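{- Let $\Phi$ be an irreducible crystallographic root system of one of the classical types $A_r$, $B_r$, $C_r$ or $D_r$, of rank $r$, with a fixed choice of simple roots $\{\alpha_1,\ldots,\alpha_r\}$, positive roots $\Phi^+$ and Coxeter number $h$. Let $\operatorname{Rvac}\colon\mathcal{A}(\Phi^+)\to\mathcal{A}(\Phi^+)$ be rowvacuation on the root poset $\Phi^+$. Then $\operatorname{Rvac}$ is an involution, and for every antichain $A\in\mathcal{A}(\Phi^+)$: (i) $\#A+\#\operatorname{Rvac}(A)=r$; (ii) the numbers of long roots and of short roots in the multiset union $A\uplus\operatorname{Rvac}(A)$ are the same as the numbers of long roots and of short roots among the simple roots $\{\alpha_1,\ldots,\alpha_r\}$; (iii) if $A=\Phi^+_i$ for some $0\le i\le h-1$, then $\operatorname{Rvac}(A)=\Phi^+_{h-1-i}$; (iv) if $A$ contains a simple root $\alpha$, then $\operatorname{Rvac}(A)=\operatorname{Rvac}_{(\Phi')^+}(A\setminus\{\alpha\})$, where $\Phi'$ is the maximal parabolic sub-root system obtained by removing $\alpha$ from the simple system; (v) if $A\subseteq(\Phi')^+$, where $\Phi'$ is the maximal parabolic sub-root system obtained by removing some simple root $\alpha$ from the simple system, then $\operatorname{Rvac}(A)=\{\alpha\}\cup\operatorname{Rvac}_{(\Phi')^+}(A)$.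
   Context: All posets are finite. A poset $P$ is ranked if there is a function $\mathrm{rk}\colon P\to\mathbb{N}$ with $\mathrm{rk}(p)=0$ for every minimal element $p$ and $\mathrm{rk}(y)=\mathrm{rk}(x)+1$ whenever $y$ covers $x$; $\mathrm{rk}(P)$ is the maximum value of $\mathrm{rk}$ and $P_i=\{p\in P:\mathrm{rk}(p)=i\}$ (empty unless $0\le i\le \mathrm{rk}(P)$). $\mathcal{A}(P)$ is the set of antichains of $P$. For $p\in P$, the toggle $\tau_p\colon\mathcal{A}(P)\to\mathcal{A}(P)$ is $\tau_p(A)=A\setminus\{p\}$ if $p\in A$, $\tau_p(A)=A\cup\{p\}$ if $p\notin A$ and $A\cup\{p\}$ is an antichain, and $\tau_p(A)=A$ otherwise. For $0\le i\le \mathrm{rk}(P)$ the rank toggle $\boldsymbol{\tau}_i$ is the composite of the (pairwise commuting) toggles $\tau_p$, $p\in P_i$. With $R=\mathrm{rk}(P)$ and composition applied right to left, rowvacuation is $\operatorname{Rvac}_P=(\boldsymbol{\tau}_R)(\boldsymbol{\tau}_R\boldsymbol{\tau}_{R-1})\cdots(\boldsymbol{\tau}_R\cdots\boldsymbol{\tau}_1)(\boldsymbol{\tau}_R\cdots\boldsymbol{\tau}_0)$. The root poset $\Phi^+$ is ordered by $\alpha\le\beta$ iff $\beta-\alpha$ is a nonnegative integer combination of simple roots; it is ranked with $\mathrm{rk}(\alpha)=\mathrm{height}(\alpha)-1$, where the height of $\sum_i a_i\alpha_i$ is $\sum_i a_i$; $\Phi^+_i$ denotes its set of elements of rank $i$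 (so $\Phi^+_0$ is the set of simple roots and $\Phi^+_{h-1}=\varnothing$). For a simple root $\alpha$, the positive roots of the maximal parabolic sub-root system $\Phi'$ obtained by removing $\alpha$ form the subposet $(\Phi')^+=\{\beta\in\Phi^+:\beta\not\ge\alpha\}$, with the restricted order and rank function, and $\operatorname{Rvac}_{(\Phi')^+}$ is rowvacuation on it. In the simply laced types $A$ and $D$ all roots are considered to have the same length (so (ii) is automatic there). -}

module Defs where

open import Data.Bool using (Bool; true; false; if_then_else_; _∧_)
open import Data.Nat using (ℕ; zero; suc; _+_; _*_; _∸_; _≤_; _≤ᵇ_; _⊔_)
import Data.Nat.Properties as ℕP
open import Data.Fin using (Fin; toℕ)
open import Data.List using (List; []; _∷_; map; concatMap; filter; upTo; foldr; sum; _++_; length)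
open import Data.List.Membership.DecPropositional (ℕP._≟_) using () renaming (_∈?_ to _∈ℕ?_)
open import Data.List.Relation.Unary.All using (All)
open import Data.List.Relation.Unary.AllPairs using (AllPairs; allPairs?)
open import Data.Vec using (Vec; tabulate)
import Data.Vec as Vec
open import Data.Vec.Properties using (≡-dec)
open import Data.Vec.Relation.Binary.Pointwise.Inductive using (Pointwise) renaming (decidable to pw-dec)
open import Data.Product using (_×_; _,_)
open import Data.Sum using (_⊎_)
open import Relation.Nullary using (¬_; Dec; yes; no; does; ¬?; _×-dec_)
open import Relation.Binary.PropositionalEquality using (_≡_)
open import Relation.Binary using (DecidableEquality)
import Data.List.Membership.Propositional as MemP

-- Positive roots of rank r are encoded by their coefficient vectors
-- (a_1,…,a_r) with respect to the simple roots α_1,…,α_r.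

Root : ℕ → Set
Root r = Vec ℕ r

_≟ᵣ_ : ∀ {r} → DecidableEquality (Root r)
_≟ᵣ_ = ≡-dec ℕP._≟_

open MemP public using (_∈_)

_∈?_ : ∀ {r} (x : Root r) (xs : List (Root r)) → Dec (x ∈ xs)
_∈?_ {r} = DM._∈?_
  where import Data.List.Membership.DecPropositional (_≟ᵣ_ {r}) as DM

_≤ᵣ_ : ∀ {r} → Root r → Root r → Set
α ≤ᵣ β = Pointwise _≤_ α β

_≤ᵣ?_ : ∀ {r} (α β : Root r) → Dec (α ≤ᵣ β)
α ≤ᵣ? β = pw-dec ℕP._≤?_ α β

height : ∀ {r} → Root r → ℕ
height v = Vec.sum v

rk : ∀ {r} → Root r → ℕ
rk v = height v ∸ 1

data ClassicalType : Set where
  A B C D : ClassicalType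

-- standard rank ranges for irreducible classical types
minRank : ClassicalType → ℕ
minRank A = 1
minRank B = 2
minRank C = 2
minRank D = 4

coxeter : ClassicalType → ℕ → ℕ
coxeter A r = suc r
coxeter B r = 2 * r
coxeter C r = 2 * r
coxeter D r = 2 * r ∸ 2

[_⋯_] : ℕ → ℕ → List ℕ
[ a ⋯ b ] = map (a +_) (upTo (suc b ∸ a))

-- ind i j : indicator of the interval of simple roots α_i,…,α_j (1-based)
ind : ∀ {r} → ℕ → ℕ → Root r
ind i j = tabulate (λ (k : Fin _) → let k′ = suc (toℕ k) in
  if (i ≤ᵇ k′) ∧ (k′ ≤ᵇ j) then 1 else 0)

_⊕_ : ∀ {r} → Root r → Root r → Root r
_⊕_ = Vec.zipWith _+_

2× : ∀ {r} → Root r → Root r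
2× = Vec.map (2 *_)

pairs : ℕ → List (ℕ × ℕ)
pairs n = concatMap (λ i → map (i ,_) [ suc i ⋯ n ]) [ 1 ⋯ n ]

-- In ε-coordinates (standard realisation):
--  A_r : α_i = ε_i - ε_{i+1};  roots ε_i - ε_j (1≤i<j≤r+1), all long.
--  B_r : α_i = ε_i - ε_{i+1} (i<r), α_r = ε_r;
--        long: ε_i ± ε_j (i<j), short: ε_i.
--  C_r : α_i = ε_i - ε_{i+1} (i<r), α_r = 2ε_r;
--        long: 2ε_i, short: ε_i ± ε_j (i<j).
--  D_r : α_i = ε_i - ε_{i+1} (i<r), α_r = ε_{r-1} + ε_r;
--        ε_i ± ε_j (i<j), all long.

-- ε_i - ε_j  (i<j), same coefficients in every type
minusRoot : ∀ {r} → ℕ × ℕ → Root r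
minusRoot (i , j) = ind i (j ∸ 1)

longRoots : ClassicalType → (r : ℕ) → List (Root r)
longRoots A r = map minusRoot (pairs (suc r))
longRoots B r =
  map minusRoot (pairs r) ++
  map (λ { (i , j) → ind i (j ∸ 1) ⊕ 2× (ind j r) }) (pairs r)          -- ε_i + ε_j
longRoots C r =
  map (λ i → 2× (ind i (r ∸ 1)) ⊕ ind r r) [ 1 ⋯ r ]                    -- 2ε_i
longRoots D r =
  map minusRoot (pairs r) ++
  map (λ { (i , j) → ind i (j ∸ 1) ⊕ (2× (ind j (r ∸ 2)) ⊕ ind (r ∸ 1) r) })
      (pairs (r ∸ 1)) ++                                                   -- ε_i + ε_j, j<r
  map (λ i → ind i (r ∸ 2) ⊕ ind r r) [ 1 ⋯ r ∸ 1 ]                      -- ε_i + ε_r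

shortRoots : ClassicalType → (r : ℕ) → List (Root r)
shortRoots A r = []
shortRoots B r = map (λ i → ind i r) [ 1 ⋯ r ]                          -- ε_i
shortRoots C r =
  map minusRoot (pairs r) ++
  map (λ { (i , j) → ind i (j ∸ 1) ⊕ (2× (ind j (r ∸ 1)) ⊕ ind r r) }) (pairs r) -- ε_i + ε_j
shortRoots D r = []

Φ⁺ : ClassicalType → (r : ℕ) → List (Root r)
Φ⁺ t r = longRoots t r ++ shortRoots t r

simpleRoots : (r : ℕ) → List (Root r)
simpleRoots r = map (λ i → ind i i) [ 1 ⋯ r ]

parabolic : ∀ {r} → Root r → List (Root r) → List (Root r)
parabolic α P = filter (λ β → ¬? (α ≤ᵣ? β)) P

-- Antichains, toggles, rowvacuation on a finite subposet P of the root
-- poset (given by the list of its elements, with the restricted order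
-- and the rank function rk).

Incomparable : ∀ {r} → Root r → Root r → Set
Incomparable x y = ¬ (x ≤ᵣ y) × ¬ (y ≤ᵣ x)

incomparable? : ∀ {r} (x y : Root r) → Dec (Incomparable x y)
incomparable? x y = ¬? (x ≤ᵣ? y) ×-dec ¬? (y ≤ᵣ? x)

IsAntichain : ∀ {r} → List (Root r) → List (Root r) → Set
IsAntichain P X = All (_∈ P) X × AllPairs Incomparable X

_≋_ : ∀ {r} → List (Root r) → List (Root r) → Set
X ≋ Y = ∀ x → (x ∈ X → x ∈ Y) × (x ∈ Y → x ∈ X)

remove : ∀ {r} → Root r → List (Root r) → List (Root r)
remove p X = filter (λ q → ¬? (q ≟ᵣ p)) X

toggle : ∀ {r} → Root r → List (Root r) → List (Root r)
toggle p X with p ∈? X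
... | yes _ = remove p X
... | no _ with allPairs? incomparable? (p ∷ X)
...   | yes _ = p ∷ X
...   | no _ = X

level : ∀ {r} → List (Root r) → ℕ → List (Root r)
level P i = filter (λ v → rk v ℕP.≟ i) P

rankToggle : ∀ {r} → List (Root r) → ℕ → List (Root r) → List (Root r)
rankToggle P i X = foldr toggle X (level P i)

rank : ∀ {r} → List (Root r) → ℕ
rank P = foldr _⊔_ 0 (map rk P)

applyRanks : ∀ {r} → List (Root r) → List ℕ → List (Root r) → List (Root r)
applyRanks P [] X = X
applyRanks P (i ∷ is) X = applyRanks P is (rankToggle P i X)

sweep : ∀ {r} → List (Root r) → ℕ → List (Root r) → List (Root r)
sweep P k = applyRanks P [ k ⋯ rank P ]

Rvac : ∀ {r} → List (Root r) → List (Root r) → List (Root r)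
Rvac P X = go [ 0 ⋯ rank P ] X
  where
  go : List ℕ → List _ → List _
  go [] X = X
  go (k ∷ ks) X = go ks (sweep P k X)

countIn : ∀ {r} → List (Root r) → List (Root r) → ℕ
countIn S X = length (filter (λ x → x ∈? S) X)

{-# OPTIONS --safe #-}

-- The classical root posets are posets of intervals (a, b]: all intervals of
-- {1, …, N} in type A, and one of each pair of mirror images in types B, C
-- and D, where in type D the intervals ending in the middle come in two
-- colours.  Let S x count the starts < x and E y the ends ≤ y of the
-- intervals of an antichain, completed by their mirror images.  The order
-- ideals through which rowvacuation runs can then be written down: (a, b]
-- belongs to the ideal at time t iff t + E (b - t) ≤ S (a + t).  At time
-- 1 + rank this is the initial condition for the pair x - E x, x - S x, whence
-- the involution, and comparing totals yields the cardinalities.  In type D,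
-- antichains not symmetric in the colours follow a twisted rule, in which the
-- colours exchange the thresholds ≤ and < over time, except when a simple root
-- is the only element ending in the middle; then (iv) and (v) reduce to type A.
-- Both of these come from running the toggles on the poset and on the parabolic
-- subposet side by side.  For (ii), the number of long (or short) roots in
-- A ⊎ Rvac A does not depend on A, and rowvacuation takes ∅ to the set of
-- simple roots.
module Submission where

-- A root of rank ρ takes part in the sweeps 0, ..., ρ only, so its final state is the one at its
-- own time t = 1 + ρ. There b - t = a and a + t = b, and t + E a ≤ S b rewrites to b - S b ≤ a - E
-- a: complementing counting functions exchanges starts and ends. In type A this is the
-- Lalanne-Kreweras involution: the first positions a + 1 of the intervals of the image are the
-- positions where no interval ends, and its last positions are those where none begins. In the
-- symmetric types N is odd, and completion doubles every interval except a central one, a + b = N.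
-- Parity then forces exactly one of A and Rvac A to contain a central interval; these are the long
-- roots of type C. Intervals ending in the middle, the short roots of type B, obey the same law.
-- The obstacle in type D is that counting functions do not see colours. For roots ending in the
-- middle the colours differ only at ties between the two sides of the inequality, and there the
-- parity of S decides which colour is in the ideal. An encoding of this kind has to be built for
-- the antichain first, by extending its outermost root ending in the middle to a central interval.

open import Defs hiding (A; B; C; D)
open import Data.Bool using (Bool; true; false; _∧_; if_then_else_; not; _xor_)
import Data.Bool.Properties as Bool
open import Data.Empty using (⊥; ⊥-elim)
open import Data.List using (List; []; _∷_; _++_; map; foldr; filter; length; concatMap)
open import Data.List.Membership.Propositional using (find; _∈_)
open import Data.List.Membership.Propositional.Properties using (∈-filter⁺; ∈-filter⁻; ∈-map⁺; ∈-map⁻; ∈-upTo⁺; ∈-upTo⁻; ∈-concatMap⁺; ∈-concatMap⁻; ∈-++⁺ˡ; ∈-++⁺ʳ; ∈-++⁻)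
open import Data.List.Properties using (filter-none; map-applyUpTo; filter-all; length-map; length-++; filter-++)
open import Data.List.Relation.Unary.All using (All; []; _∷_)
import Data.List.Relation.Unary.All as All
import Data.List.Relation.Unary.All.Properties as All
open import Data.List.Relation.Unary.AllPairs using (AllPairs; []; _∷_; allPairs?)
import Data.List.Relation.Unary.AllPairs as AllPairs
import Data.List.Relation.Unary.AllPairs.Properties as AllPairs
open import Data.List.Relation.Unary.Any using (here; there; Any)
import Data.List.Relation.Unary.Any as Any
import Data.List.Relation.Unary.Any.Properties as Any
open import Data.List.Relation.Unary.Unique.Propositional using (Unique)
import Data.List.Relation.Unary.Unique.Propositional.Properties as Unique
open import Data.Nat
open import Data.Nat.Properties
open import Data.Product using (_×_; _,_; proj₁; proj₂; map₂; ∃)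
open import Data.Sum using (_⊎_; inj₁; inj₂)
open import Data.Vec.Relation.Binary.Pointwise.Inductive using ([]; _∷_)
import Data.Vec.Relation.Binary.Pointwise.Inductive as Pw
open import Function using (_∘_; id; mk⇔)
open import Relation.Binary using (tri<; tri≈; tri>; Tri)
open import Relation.Binary.PropositionalEquality
open import Relation.Nullary using (¬_; yes; no; ¬?; Dec; contradiction; _×-dec_; does)
open import Relation.Unary using (Decidable)

-- Reflective linear arithmetic over ℕ

module Lia where

  open import Data.Bool using (T)
  open import Data.Fin using (Fin; zero; suc)
  open import Data.Bool.ListAction using (any)
  import Data.List.Relation.Unary.All as AllB
  open import Data.Maybe as Maybe using (Maybe; just; nothing)
  open import Data.Nat.Solver using (module +-*-Solver)
  open import Data.Unit using (tt)
  open import Data.Vec using (Vec; []; _∷_; lookup; allFin; replicate; _[_]≔_)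
  import Data.Vec as Vec
  open import Data.Vec.N-ary using (N-ary)
  open import Relation.Nullary.Decidable using (yes; no)

  infixl 6 _:+_
  infix 4 _:≤_ _:<_ _:≡_ _:≰_
  infixr 3 _:→_

  data Expr (n : ℕ) : Set where
    var  : Fin n → Expr n
    con  : ℕ → Expr n
    _:+_ : Expr n → Expr n → Expr n

  data Rel (n : ℕ) : Set where
    _:≤_ _:<_ _:≡_ _:≰_ : Expr n → Expr n → Rel n

  data Problem (n : ℕ) : Set where
    goal    : Rel n → Problem n
    absurd  : Problem n
    _:→_    : Rel n → Problem n → Problem n

  ⟦_⟧ : ∀ {n} → Expr n → Vec ℕ n → ℕ
  ⟦ var i ⟧ ρ = lookup ρ i
  ⟦ con k ⟧ ρ = k
  ⟦ e :+ f ⟧ ρ = ⟦ e ⟧ ρ + ⟦ f ⟧ ρ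

  ⟦_⟧ᵣ : ∀ {n} → Rel n → Vec ℕ n → Set
  ⟦ e :≤ f ⟧ᵣ ρ = ⟦ e ⟧ ρ ≤ ⟦ f ⟧ ρ
  ⟦ e :< f ⟧ᵣ ρ = ⟦ e ⟧ ρ < ⟦ f ⟧ ρ
  ⟦ e :≡ f ⟧ᵣ ρ = ⟦ e ⟧ ρ ≡ ⟦ f ⟧ ρ
  ⟦ e :≰ f ⟧ᵣ ρ = ¬ (⟦ e ⟧ ρ ≤ ⟦ f ⟧ ρ)

  ⟦_⟧ₚ : ∀ {n} → Problem n → Vec ℕ n → Set
  ⟦ goal g ⟧ₚ ρ = ⟦ g ⟧ᵣ ρ
  ⟦ absurd ⟧ₚ ρ = ⊥
  ⟦ h :→ p ⟧ₚ ρ = ⟦ h ⟧ᵣ ρ → ⟦ p ⟧ₚ ρ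

  -- A constraint l ≤ r between linear forms; the constant term comes first.
  Constraint : ℕ → Set
  Constraint n = Vec ℕ (suc n) × Vec ℕ (suc n)

  dot : ∀ {n} → Vec ℕ n → Vec ℕ n → ℕ
  dot [] [] = 0
  dot (k ∷ v) (x ∷ ρ) = k * x + dot v ρ

  Sat : ∀ {n} → Vec ℕ n → Constraint n → Set
  Sat ρ (l , r) = dot l (1 ∷ ρ) ≤ dot r (1 ∷ ρ)

  unit : ∀ {n} → Fin n → Vec ℕ n
  unit zero = 1 ∷ replicate _ 0
  unit (suc i) = 0 ∷ unit i

  linear : ∀ {n} → Expr n → Vec ℕ (suc n)
  linear (var i) = 0 ∷ unit i
  linear (con k) = k ∷ replicate _ 0
  linear (e :+ f) = Vec.zipWith _+_ (linear e) (linear f)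

  cancel : ∀ {n} → Vec ℕ n → Vec ℕ n → Vec ℕ n
  cancel = Vec.zipWith (λ x y → x ∸ (x ⊓ y))

  -- Coefficients stay in ℕ because common parts are cancelled instead of subtracted. A variable
  -- then occurs on one side at most, and the side tells an upper bound from a lower bound.
  normal : ∀ {n} → Constraint n → Constraint n
  normal (l , r) = cancel l r , cancel r l

  combine : ∀ {n} → ℕ → Constraint n → ℕ → Constraint n → Constraint n
  combine p (l , r) q (l′ , r′) =
    normal (Vec.zipWith _+_ (Vec.map (p *_) l) (Vec.map (q *_) l′) ,
            Vec.zipWith _+_ (Vec.map (p *_) r) (Vec.map (q *_) r′))

  isZero : ℕ → Bool
  isZero zero = true
  isZero (suc _) = false

  trivial : ∀ {n} → Constraint n → Bool
  trivial (l , _) = Vec.foldr′ _∧_ true (Vec.map isZero l)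

  prune : ∀ {n} → List (Constraint n) → List (Constraint n)
  prune [] = []
  prune (c ∷ cs) = if trivial c then prune cs else c ∷ prune cs

  -- Elimination uses x ≥ 0 for every variable x, so an upper bound on x
  -- also yields the constraint with x dropped.
  pairUp : ∀ {n} → Fin n → Constraint n → List (Constraint n) → List (Constraint n)
  pairUp i c [] = []
  pairUp i c@(l , r) (c′@(l′ , r′) ∷ cs) =
    if isZero (lookup r′ (suc i)) then pairUp i c cs
    else combine (lookup r′ (suc i)) c (lookup l (suc i)) c′ ∷ pairUp i c cs

  eliminate : ∀ {n} → Fin n → List (Constraint n) → List (Constraint n) → List (Constraint n)
  eliminate i all [] = []
  eliminate i all (c@(l , r) ∷ cs) =
    if isZero (lookup l (suc i))
    then (if isZero (lookup r (suc i)) then c ∷ eliminate i all cs else eliminate i all cs)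
    else (l [ suc i ]≔ 0 , r) ∷ pairUp i c all ++ eliminate i all cs

  eliminateAll : ∀ {n} → List (Fin n) → List (Constraint n) → List (Constraint n)
  eliminateAll [] cs = cs
  eliminateAll (i ∷ is) cs = eliminateAll is (prune (eliminate i cs cs))

  reverse : ∀ {n} → Constraint n → Constraint n
  reverse (l , r) = r , l

  -- Gaussian elimination with an equation whose left side contains the variable i.
  substitute : ∀ {n} → Fin n → Constraint n → Constraint n → Constraint n
  substitute i e@(l , _) c@(l′ , r′) =
    if isZero (lookup l′ (suc i))
    then (if isZero (lookup r′ (suc i)) then c
          else combine (lookup l (suc i)) c (lookup r′ (suc i)) e)
    else combine (lookup l (suc i)) c (lookup l′ (suc i)) (reverse e)

  pivot : ∀ {n} → Fin n → List (Constraint n) → Maybe (Constraint n × List (Constraint n))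
  pivot i [] = nothing
  pivot i (e@(l , r) ∷ es) =
    if isZero (lookup l (suc i))
    then (if isZero (lookup r (suc i)) then Maybe.map (map₂ (e ∷_)) (pivot i es) else just (reverse e , es))
    else just (e , es)

  gauss : ∀ {n} → List (Fin n) → List (Constraint n) → List (Constraint n) → List (Constraint n)
  gauss [] es cs = es ++ map reverse es ++ cs
  gauss (i ∷ is) es cs with pivot i es
  ... | nothing = gauss is es cs
  ... | just (e@(l , r) , es′) =
    -- After the substitution the pivot equation is kept only as the inequality without the
    -- variable, which holds since the variable is nonnegative.
    gauss is (map (substitute i e) es′) ((l [ suc i ]≔ 0 , r) ∷ map (substitute i e) cs)

  -- Variables may remain on the left, since they only make that side larger.
  false? : ∀ {n} → Constraint n → Bool
  false? (k ∷ _ , k′ ∷ r) = (k′ <ᵇ k) ∧ Vec.foldr′ _∧_ true (Vec.map isZero r)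

  System : ℕ → Set
  System n = List (Constraint n) × List (Constraint n)

  refutes : ∀ {n} → System n → Bool
  refutes {n} (es , cs) =
    any false? (eliminateAll (Vec.toList (allFin n)) (prune (gauss (Vec.toList (allFin n)) es cs)))

  bound : ∀ {n} → Expr n → Expr n → Constraint n
  bound e f = normal (linear e , linear f)

  _with≤_ : ∀ {n} → System n → Constraint n → System n
  (es , cs) with≤ c = es , c ∷ cs

  assume : ∀ {n} → Rel n → System n → System n
  assume (e :≤ f) sys = sys with≤ bound e f
  assume (e :< f) sys = sys with≤ bound (con 1 :+ e) f
  assume (e :≡ f) (es , cs) = bound e f ∷ es , cs
  assume (e :≰ f) sys = sys with≤ bound (con 1 :+ f) e

  decide : ∀ {n} → System n → Problem n → Bool
  decide sys (goal (e :≤ f)) = refutes (sys with≤ bound (con 1 :+ f) e)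
  decide sys (goal (e :< f)) = refutes (sys with≤ bound f e)
  decide sys (goal (e :≡ f)) = refutes (sys with≤ bound (con 1 :+ f) e) ∧ refutes (sys with≤ bound (con 1 :+ e) f)
  decide sys (goal (e :≰ f)) = refutes (sys with≤ bound e f)
  decide sys absurd = refutes sys
  decide sys (h :→ p) = decide (assume h sys) p

  dot-0 : ∀ {n} (ρ : Vec ℕ n) → dot (replicate n 0) ρ ≡ 0
  dot-0 [] = refl
  dot-0 (x ∷ ρ) = dot-0 ρ

  dot-unit : ∀ {n} (i : Fin n) (ρ : Vec ℕ n) → dot (unit i) ρ ≡ lookup ρ i
  dot-unit zero (x ∷ ρ) rewrite dot-0 ρ | +-identityʳ (x + 0) = +-identityʳ x
  dot-unit (suc i) (x ∷ ρ) = dot-unit i ρ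

  dot-+ : ∀ {n} (u v ρ : Vec ℕ n) → dot (Vec.zipWith _+_ u v) ρ ≡ dot u ρ + dot v ρ
  dot-+ [] [] [] = refl
  dot-+ (k ∷ u) (l ∷ v) (x ∷ ρ) rewrite dot-+ u v ρ =
    solve 5 (λ k l x a b → (k :⊕ l) :⊗ x :⊕ (a :⊕ b) := k :⊗ x :⊕ a :⊕ (l :⊗ x :⊕ b))
      refl k l x (dot u ρ) (dot v ρ)
    where open +-*-Solver renaming (_:+_ to _:⊕_; _:*_ to _:⊗_)

  dot-* : ∀ {n} p (u ρ : Vec ℕ n) → dot (Vec.map (p *_) u) ρ ≡ p * dot u ρ
  dot-* p [] [] = sym (*-zeroʳ p)
  dot-* p (k ∷ u) (x ∷ ρ) rewrite dot-* p u ρ =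
    solve 4 (λ p k x a → p :⊗ k :⊗ x :⊕ p :⊗ a := p :⊗ (k :⊗ x :⊕ a)) refl p k x (dot u ρ)
    where open +-*-Solver renaming (_:+_ to _:⊕_; _:*_ to _:⊗_)

  linear-sound : ∀ {n} (e : Expr n) ρ → dot (linear e) (1 ∷ ρ) ≡ ⟦ e ⟧ ρ
  linear-sound (var i) ρ = dot-unit i ρ
  linear-sound (con k) ρ rewrite dot-0 ρ | *-identityʳ k = +-identityʳ k
  linear-sound (e :+ f) ρ = trans (dot-+ (linear e) (linear f) (1 ∷ ρ))
                                  (cong₂ _+_ (linear-sound e ρ) (linear-sound f ρ))

  cancel-dot : ∀ {n} (l r ρ : Vec ℕ n) →
               dot (cancel l r) ρ + dot (Vec.zipWith _⊓_ l r) ρ ≡ dot l ρ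
  cancel-dot l r ρ = trans (sym (dot-+ (cancel l r) (Vec.zipWith _⊓_ l r) ρ))
                           (cong (λ v → dot v ρ) (restore l r))
    where
    restore : ∀ {n} (l r : Vec ℕ n) → Vec.zipWith _+_ (cancel l r) (Vec.zipWith _⊓_ l r) ≡ l
    restore [] [] = refl
    restore (x ∷ l) (y ∷ r) = cong₂ _∷_ (m∸n+n≡m (m⊓n≤m x y)) (restore l r)

  ⊓-swap : ∀ {n} (l r : Vec ℕ n) → Vec.zipWith _⊓_ l r ≡ Vec.zipWith _⊓_ r l
  ⊓-swap [] [] = refl
  ⊓-swap (x ∷ l) (y ∷ r) = cong₂ _∷_ (⊓-comm x y) (⊓-swap l r)

  normal-sound : ∀ {n} (ρ : Vec ℕ n) c → Sat ρ c → Sat ρ (normal c)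
  normal-sound ρ (l , r) h = +-cancelʳ-≤ (dot (Vec.zipWith _⊓_ l r) (1 ∷ ρ)) _ _
    (subst₂ _≤_ (sym (cancel-dot l r (1 ∷ ρ)))
      (sym (trans (cong (λ v → dot (cancel r l) (1 ∷ ρ) + dot v (1 ∷ ρ)) (⊓-swap l r))
                  (cancel-dot r l (1 ∷ ρ)))) h)

  combine-sound : ∀ {n} (ρ : Vec ℕ n) p c q c′ → Sat ρ c → Sat ρ c′ → Sat ρ (combine p c q c′)
  combine-sound ρ p (l , r) q (l′ , r′) h h′ = normal-sound ρ
    (Vec.zipWith _+_ (Vec.map (p *_) l) (Vec.map (q *_) l′) ,
     Vec.zipWith _+_ (Vec.map (p *_) r) (Vec.map (q *_) r′))
    (subst₂ _≤_ (sym (form l l′)) (sym (form r r′)) (+-mono-≤ (*-monoʳ-≤ p h) (*-monoʳ-≤ q h′)))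
    where
    form : ∀ u v → dot (Vec.zipWith _+_ (Vec.map (p *_) u) (Vec.map (q *_) v)) (1 ∷ ρ)
                 ≡ p * dot u (1 ∷ ρ) + q * dot v (1 ∷ ρ)
    form u v = trans (dot-+ (Vec.map (p *_) u) (Vec.map (q *_) v) (1 ∷ ρ))
                     (cong₂ _+_ (dot-* p u (1 ∷ ρ)) (dot-* q v (1 ∷ ρ)))

  prune-sound : ∀ {n} {ρ : Vec ℕ n} cs → All (Sat ρ) cs → All (Sat ρ) (prune cs)
  prune-sound [] [] = []
  prune-sound (c ∷ cs) (h ∷ hs) with trivial c
  ... | true = prune-sound cs hs
  ... | false = h ∷ prune-sound cs hs

  pairUp-sound : ∀ {n} {ρ : Vec ℕ n} i c cs → Sat ρ c → All (Sat ρ) cs → All (Sat ρ) (pairUp i c cs)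
  pairUp-sound i c [] h [] = []
  pairUp-sound {ρ = ρ} i c@(l , r) (c′@(l′ , r′) ∷ cs) h (h′ ∷ hs) with isZero (lookup r′ (suc i))
  ... | true = pairUp-sound i c cs h hs
  ... | false = combine-sound ρ (lookup r′ (suc i)) c (lookup l (suc i)) c′ h h′ ∷ pairUp-sound i c cs h hs

  dot-≔0 : ∀ {n} (l : Vec ℕ n) i ρ → dot (l [ i ]≔ 0) ρ ≤ dot l ρ
  dot-≔0 (k ∷ l) zero (x ∷ ρ) = m≤n+m (dot l ρ) (k * x)
  dot-≔0 (k ∷ l) (suc i) (x ∷ ρ) = +-monoʳ-≤ (k * x) (dot-≔0 l i ρ)

  eliminate-sound : ∀ {n} {ρ : Vec ℕ n} i all cs → All (Sat ρ) all → All (Sat ρ) cs →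
                    All (Sat ρ) (eliminate i all cs)
  eliminate-sound i all [] hs [] = []
  eliminate-sound {ρ = ρ} i all (c@(l , r) ∷ cs) hs (h ∷ hs′)
    with isZero (lookup l (suc i)) | isZero (lookup r (suc i))
  ... | true  | true  = h ∷ eliminate-sound i all cs hs hs′
  ... | true  | false = eliminate-sound i all cs hs hs′
  ... | false | _     = ≤-trans (dot-≔0 l (suc i) (1 ∷ ρ)) h
                        ∷ All.++⁺ (pairUp-sound i c all h hs) (eliminate-sound i all cs hs hs′)

  eliminateAll-sound : ∀ {n} {ρ : Vec ℕ n} is cs → All (Sat ρ) cs → All (Sat ρ) (eliminateAll is cs)
  eliminateAll-sound [] cs hs = hs
  eliminateAll-sound (i ∷ is) cs hs =
    eliminateAll-sound is _ (prune-sound _ (eliminate-sound i cs cs hs hs))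

  ∧-T : ∀ {a b} → T (a ∧ b) → T a × T b
  ∧-T {true} t = tt , t

  zero-dot : ∀ {n} (r ρ : Vec ℕ n) → T (Vec.foldr′ _∧_ true (Vec.map isZero r)) → dot r ρ ≡ 0
  zero-dot [] [] _ = refl
  zero-dot (zero ∷ r) (x ∷ ρ) t = zero-dot r ρ t

  false?-sound : ∀ {n} (ρ : Vec ℕ n) c → T (false? c) → ¬ Sat ρ c
  false?-sound ρ (k ∷ l , k′ ∷ r) t h with ∧-T {k′ <ᵇ k} t
  ... | t₁ , t₂ rewrite zero-dot r ρ t₂ | *-identityʳ k | *-identityʳ k′ | +-identityʳ k′ =
    <⇒≱ (<ᵇ⇒< k′ k t₁) (≤-trans (m≤m+n k (dot l ρ)) h)

  any-sound : ∀ {n} {ρ : Vec ℕ n} cs → T (any false? cs) → ¬ All (Sat ρ) cs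
  any-sound {ρ = ρ} (c ∷ cs) t (h ∷ hs) with false? c in eq
  ... | true = false?-sound ρ c (subst T (sym eq) tt) h
  ... | false = any-sound cs t hs

  SatEq : ∀ {n} → Vec ℕ n → Constraint n → Set
  SatEq ρ e = Sat ρ e × Sat ρ (reverse e)

  SatSystem : ∀ {n} → Vec ℕ n → System n → Set
  SatSystem ρ (es , cs) = All (SatEq ρ) es × All (Sat ρ) cs

  substitute-sound : ∀ {n} {ρ : Vec ℕ n} i e c → SatEq ρ e → Sat ρ c → Sat ρ (substitute i e c)
  substitute-sound {ρ = ρ} i e@(l , _) c@(l′ , r′) (h , h′) hc
    with isZero (lookup l′ (suc i)) | isZero (lookup r′ (suc i))
  ... | false | _ = combine-sound ρ (lookup l (suc i)) c (lookup l′ (suc i)) (reverse e) hc h′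
  ... | true | true = hc
  ... | true | false = combine-sound ρ (lookup l (suc i)) c (lookup r′ (suc i)) e hc h

  substitute-sound′ : ∀ {n} {ρ : Vec ℕ n} i e f → SatEq ρ e → SatEq ρ f → SatEq ρ (substitute i e f)
  substitute-sound′ {ρ = ρ} i e@(l , _) f@(l′ , r′) (h , h′) (hf , hf′)
    with isZero (lookup l′ (suc i)) | isZero (lookup r′ (suc i))
  ... | false | _ = combine-sound ρ (lookup l (suc i)) f (lookup l′ (suc i)) (reverse e) hf h′
                  , combine-sound ρ (lookup l (suc i)) (reverse f) (lookup l′ (suc i)) e hf′ h
  ... | true | true = hf , hf′
  ... | true | false = combine-sound ρ (lookup l (suc i)) f (lookup r′ (suc i)) e hf h
                     , combine-sound ρ (lookup l (suc i)) (reverse f) (lookup r′ (suc i)) (reverse e) hf′ h′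

  pivot-sound : ∀ {n} {ρ : Vec ℕ n} i es {e es′} → pivot i es ≡ just (e , es′) → All (SatEq ρ) es →
                SatEq ρ e × All (SatEq ρ) es′
  pivot-sound i (e@(l , r) ∷ es) eq (h ∷ hs) with isZero (lookup l (suc i)) | isZero (lookup r (suc i))
  pivot-sound i (e ∷ es) refl (h ∷ hs) | false | _ = h , hs
  pivot-sound i (e ∷ es) refl (h ∷ hs) | true | false = (proj₂ h , proj₁ h) , hs
  pivot-sound i (e ∷ es) eq (h ∷ hs) | true | true with pivot i es in eq′
  pivot-sound i (e ∷ es) refl (h ∷ hs) | true | true | just _ with pivot-sound i es eq′ hs
  ... | he , hes = he , h ∷ hes

  gauss-sound : ∀ {n} {ρ : Vec ℕ n} is es cs → All (SatEq ρ) es → All (Sat ρ) cs → All (Sat ρ) (gauss is es cs)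
  gauss-sound [] es cs hes hcs = All.++⁺ (AllB.map proj₁ hes) (All.++⁺ (All.map⁺ (AllB.map proj₂ hes)) hcs)
  gauss-sound {ρ = ρ} (i ∷ is) es cs hes hcs with pivot i es in eq
  ... | nothing = gauss-sound is es cs hes hcs
  ... | just (e@(l , r) , es′) with pivot-sound i es eq hes
  ...   | he , hes′ = gauss-sound is _ _
    (All.map⁺ (AllB.map (λ {f} → substitute-sound′ i e f he) hes′))
    (≤-trans (dot-≔0 l (suc i) (1 ∷ ρ)) (proj₁ he) ∷ All.map⁺ (AllB.map (λ {c} → substitute-sound i e c he) hcs))

  refutes-sound : ∀ {n} {ρ : Vec ℕ n} sys → T (refutes sys) → ¬ SatSystem ρ sys
  refutes-sound {n} (es , cs) t (hes , hcs) = any-sound _ t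
    (eliminateAll-sound (Vec.toList (allFin n)) _ (prune-sound _ (gauss-sound (Vec.toList (allFin n)) es cs hes hcs)))

  bound-sound : ∀ {n} {ρ : Vec ℕ n} e f → ⟦ e ⟧ ρ ≤ ⟦ f ⟧ ρ → Sat ρ (bound e f)
  bound-sound {ρ = ρ} e f h = normal-sound ρ (linear e , linear f)
    (subst₂ _≤_ (sym (linear-sound e ρ)) (sym (linear-sound f ρ)) h)

  _with≤-sound_ : ∀ {n} {ρ : Vec ℕ n} {sys c} → SatSystem ρ sys → Sat ρ c → SatSystem ρ (sys with≤ c)
  (hes , hcs) with≤-sound h = hes , h ∷ hcs

  assume-sound : ∀ {n} {ρ : Vec ℕ n} h {sys} → ⟦ h ⟧ᵣ ρ → SatSystem ρ sys → SatSystem ρ (assume h sys)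
  assume-sound (e :≤ f) h hs = hs with≤-sound bound-sound e f h
  assume-sound (e :< f) h hs = hs with≤-sound bound-sound (con 1 :+ e) f h
  assume-sound (e :≡ f) h (hes , hcs) =
    (bound-sound e f (≤-reflexive h) , bound-sound f e (≤-reflexive (sym h))) ∷ hes , hcs
  assume-sound (e :≰ f) h hs = hs with≤-sound bound-sound (con 1 :+ f) e (≰⇒> h)

  ≤-by-contradiction : ∀ {n} {ρ : Vec ℕ n} sys e f → T (refutes (sys with≤ bound (con 1 :+ f) e)) →
                       SatSystem ρ sys → ⟦ e ⟧ ρ ≤ ⟦ f ⟧ ρ
  ≤-by-contradiction {ρ = ρ} sys e f t hs with ⟦ e ⟧ ρ ≤? ⟦ f ⟧ ρ
  ... | yes p = p
  ... | no ¬p = ⊥-elim (refutes-sound _ t (hs with≤-sound bound-sound (con 1 :+ f) e (≰⇒> ¬p)))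

  decide-sound : ∀ {n} (ρ : Vec ℕ n) sys p → T (decide sys p) → SatSystem ρ sys → ⟦ p ⟧ₚ ρ
  decide-sound ρ sys (goal (e :≤ f)) t hs = ≤-by-contradiction sys e f t hs
  decide-sound ρ sys (goal (e :< f)) t hs with ⟦ f ⟧ ρ ≤? ⟦ e ⟧ ρ
  ... | yes p = ⊥-elim (refutes-sound _ t (hs with≤-sound bound-sound f e p))
  ... | no ¬p = ≰⇒> ¬p
  decide-sound ρ sys (goal (e :≡ f)) t hs with ∧-T {refutes (sys with≤ bound (con 1 :+ f) e)} t
  ... | t₁ , t₂ = ≤-antisym (≤-by-contradiction sys e f t₁ hs) (≤-by-contradiction sys f e t₂ hs)
  decide-sound ρ sys (goal (e :≰ f)) t hs p = refutes-sound _ t (hs with≤-sound bound-sound e f p)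
  decide-sound ρ sys absurd t hs = refutes-sound _ t hs
  decide-sound ρ sys (h :→ p) t hs = λ x → decide-sound ρ (assume h sys) p t (assume-sound h x hs)

  -- Problems are written as functions of their variables; this feeds such a function the variables
  -- in order.
  close : ∀ {m} {B : Set} n → (Fin n → Expr m) → N-ary n (Expr m) B → B
  close zero v f = f
  close (suc n) v f = close n (v ∘ suc) (f (v zero))

  Curried : ∀ n → (Vec ℕ n → Set) → Set
  Curried zero P = P []
  Curried (suc n) P = (x : ℕ) → Curried n (P ∘ (x ∷_))

  curried : ∀ n {P : Vec ℕ n → Set} → (∀ ρ → P ρ) → Curried n P
  curried zero f = f []
  curried (suc n) f x = curried n (f ∘ (x ∷_))

  -- Linear arithmetic over ℕ by reflection: Gauss and Fourier–Motzkin elimination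
  -- refute the negated goal, and the implicit argument is solved by evaluation.
  lia : ∀ n (p : N-ary n (Expr n) (Problem n)) {_ : T (decide ([] , []) (close n var p))} →
        Curried n ⟦ close n var p ⟧ₚ
  lia n p {t} = curried n (λ ρ → decide-sound ρ ([] , []) (close n var p) t ([] , []))

-- Toggles and rank toggles as operations on lists

module Toggle where

  open import Data.List using (foldl; applyUpTo)
  open import Data.Vec using ([]; _∷_)

  ≤ᵣ-refl : ∀ {r} {x : Root r} → x ≤ᵣ x
  ≤ᵣ-refl = Pw.refl ≤-refl

  ≤ᵣ-trans : ∀ {r} {x y z : Root r} → x ≤ᵣ y → y ≤ᵣ z → x ≤ᵣ z
  ≤ᵣ-trans = Pw.trans ≤-trans

  height-mono : ∀ {r} {x y : Root r} → x ≤ᵣ y → height x ≤ height y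
  height-mono [] = z≤n
  height-mono (p ∷ ps) = +-mono-≤ p (height-mono ps)

  height-strict : ∀ {r} {x y : Root r} → x ≤ᵣ y → x ≢ y → height x < height y
  height-strict [] x≢y = ⊥-elim (x≢y refl)
  height-strict {x = a ∷ x} {b ∷ y} (p ∷ ps) x≢y with a ≟ b
  ... | no a≢b = +-mono-<-≤ (≤∧≢⇒< p a≢b) (height-mono ps)
  ... | yes refl = +-monoʳ-< a (height-strict ps (x≢y ∘ cong (a ∷_)))

  -- A root is comparable to itself, so a free root is not in X. For an antichain X the three cases
  -- of a toggle thus merge into one criterion: p lies in `toggle p X` exactly if p is free.
  Free : ∀ {r} → Root r → List (Root r) → Set
  Free x X = All (Incomparable x) X

  free⇒∉ : ∀ {r} {x : Root r} {X} → Free x X → ¬ x ∈ X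
  free⇒∉ f x∈X = proj₁ (All.lookup f x∈X) ≤ᵣ-refl

  Antichain : ∀ {r} → List (Root r) → Set
  Antichain = AllPairs Incomparable

  incomparable-sym : ∀ {r} {x y : Root r} → Incomparable x y → Incomparable y x
  incomparable-sym (p , q) = q , p

  allPairs-lookup : ∀ {A : Set} {R : A → A → Set} → (∀ {x y} → R x y → R y x) → ∀ {xs} → AllPairs R xs →
                    ∀ {x y} → x ∈ xs → y ∈ xs → x ≡ y ⊎ R x y
  allPairs-lookup sy (p ∷ ps) (here refl) (here refl) = inj₁ refl
  allPairs-lookup sy (p ∷ ps) (here refl) (there y∈) = inj₂ (All.lookup p y∈)
  allPairs-lookup sy (p ∷ ps) (there x∈) (here refl) = inj₂ (sy (All.lookup p x∈))
  allPairs-lookup sy (p ∷ ps) (there x∈) (there y∈) = allPairs-lookup sy ps x∈ y∈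

  allPairs-∈ : ∀ {r} {X : List (Root r)} → Antichain X → ∀ {x y} → x ∈ X → y ∈ X → x ≡ y ⊎ Incomparable x y
  allPairs-∈ = allPairs-lookup incomparable-sym

  allPairs-map∈ : ∀ {A : Set} {R S : A → A → Set} {xs : List A} →
                  (∀ {x y} → x ∈ xs → y ∈ xs → R x y → S x y) → AllPairs R xs → AllPairs S xs
  allPairs-map∈ f [] = []
  allPairs-map∈ f (p ∷ ps) =
    All.tabulate (λ y∈ → f (here refl) (there y∈) (All.lookup p y∈)) ∷
    allPairs-map∈ (λ x∈ y∈ → f (there x∈) (there y∈)) ps

  toggle-antichain : ∀ {r} (p : Root r) {X} → Antichain X → Antichain (toggle p X)
  toggle-antichain p {X} a with p ∈? X
  ... | yes _ = AllPairs.filter⁺ _ a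
  ... | no _ with allPairs? incomparable? (p ∷ X)
  ...   | yes a′ = a′
  ...   | no _ = a

  toggle-self⁺ : ∀ {r} (p : Root r) {X} → Antichain X → Free p X → p ∈ toggle p X
  toggle-self⁺ p {X} a f with p ∈? X
  ... | yes p∈X = ⊥-elim (free⇒∉ f p∈X)
  ... | no _ with allPairs? incomparable? (p ∷ X)
  ...   | yes _ = here refl
  ...   | no ¬a = ⊥-elim (¬a (f ∷ a))

  toggle-self⁻ : ∀ {r} (p : Root r) {X} → p ∈ toggle p X → Free p X
  toggle-self⁻ p {X} h with p ∈? X
  ... | yes _ = ⊥-elim (proj₂ (∈-filter⁻ (λ q → ¬? (q ≟ᵣ p)) {xs = X} h) refl)
  ... | no p∉X with allPairs? incomparable? (p ∷ X)
  ...   | yes (f ∷ _) = f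
  ...   | no _ = ⊥-elim (p∉X h)

  toggle-other⁺ : ∀ {r} (p : Root r) {x X} → x ≢ p → x ∈ X → x ∈ toggle p X
  toggle-other⁺ p {X = X} x≢p x∈X with p ∈? X
  ... | yes _ = ∈-filter⁺ _ x∈X x≢p
  ... | no _ with allPairs? incomparable? (p ∷ X)
  ...   | yes _ = there x∈X
  ...   | no _ = x∈X

  toggle-other⁻ : ∀ {r} (p : Root r) {x X} → x ≢ p → x ∈ toggle p X → x ∈ X
  toggle-other⁻ p {X = X} x≢p h with p ∈? X
  ... | yes _ = proj₁ (∈-filter⁻ _ h)
  ... | no _ with allPairs? incomparable? (p ∷ X)
  ...   | no _ = h
  ...   | yes _ with h
  ...     | here x≡p = ⊥-elim (x≢p x≡p)
  ...     | there x∈X = x∈X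

  module _ {r} {X : List (Root r)} (aX : Antichain X) where

    toggles-antichain : ∀ L → Antichain (foldr toggle X L)
    toggles-antichain [] = aX
    toggles-antichain (p ∷ L) = toggle-antichain p (toggles-antichain L)

    toggles-other⁺ : ∀ L {x} → ¬ x ∈ L → x ∈ X → x ∈ foldr toggle X L
    toggles-other⁺ [] _ h = h
    toggles-other⁺ (p ∷ L) x∉ h = toggle-other⁺ p (x∉ ∘ here) (toggles-other⁺ L (x∉ ∘ there) h)

    toggles-other⁻ : ∀ L {x} → ¬ x ∈ L → x ∈ foldr toggle X L → x ∈ X
    toggles-other⁻ [] _ h = h
    toggles-other⁻ (p ∷ L) x∉ h = toggles-other⁻ L (x∉ ∘ there) (toggle-other⁻ p (x∉ ∘ here) h)

    -- Toggling elements incomparable to p alters X only where the freeness of p is unaffected.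
    -- Toggles of one rank can therefore all be judged against the original X.
    toggles-free : ∀ {p} L → All (Incomparable p) L → Free p X → Free p (foldr toggle X L)
    toggles-free L pL f = All.tabulate go
      where
      go : ∀ {y} → y ∈ foldr toggle X L → Incomparable _ y
      go {y} y∈ with y ∈? L
      ... | yes y∈L = All.lookup pL y∈L
      ... | no y∉L = All.lookup f (toggles-other⁻ L y∉L y∈)

    toggles-free⁻ : ∀ {p} L → All (Incomparable p) L → Free p (foldr toggle X L) → Free p X
    toggles-free⁻ L pL f = All.tabulate go
      where
      go : ∀ {y} → y ∈ X → Incomparable _ y
      go {y} y∈ with y ∈? L
      ... | yes y∈L = All.lookup pL y∈L
      ... | no y∉L = All.lookup f (toggles-other⁺ L y∉L y∈)

    toggles-self⁺ : ∀ L → Antichain L → ∀ {x} → x ∈ L → Free x X → x ∈ foldr toggle X L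
    toggles-self⁺ (p ∷ L) (pL ∷ aL) (here refl) f =
      toggle-self⁺ p (toggles-antichain L) (toggles-free L pL f)
    toggles-self⁺ (p ∷ L) (pL ∷ aL) (there x∈L) f =
      toggle-other⁺ p (λ { refl → free⇒∉ pL x∈L }) (toggles-self⁺ L aL x∈L f)

    toggles-self⁻ : ∀ L → Antichain L → ∀ {x} → x ∈ L → x ∈ foldr toggle X L → Free x X
    toggles-self⁻ (p ∷ L) (pL ∷ aL) (here refl) h = toggles-free⁻ L pL (toggle-self⁻ p h)
    toggles-self⁻ (p ∷ L) (pL ∷ aL) (there x∈L) h =
      toggles-self⁻ L aL x∈L (toggle-other⁻ p (λ { refl → free⇒∉ pL x∈L }) h)

  interval-cons : ∀ {a b} → a ≤ b → [ a ⋯ b ] ≡ a ∷ [ suc a ⋯ b ]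
  interval-cons {a} {b} a≤b rewrite +-∸-assoc 1 a≤b =
    cong₂ _∷_ (+-identityʳ a)
      (trans (map-applyUpTo suc (a +_) (b ∸ a))
        (trans (applyUpTo-cong (+-suc a) (b ∸ a)) (sym (map-applyUpTo id (suc a +_) (b ∸ a)))))
    where
    applyUpTo-cong : ∀ {f g : ℕ → ℕ} → (∀ x → f x ≡ g x) → ∀ n → applyUpTo f n ≡ applyUpTo g n
    applyUpTo-cong e zero = refl
    applyUpTo-cong e (suc n) = cong₂ _∷_ (e 0) (applyUpTo-cong (e ∘ suc) n)

  interval-nil : ∀ {a b} → b < a → [ a ⋯ b ] ≡ []
  interval-nil {a} {b} b<a rewrite m≤n⇒m∸n≡0 b<a = refl

  -- Positive heights make `rk`, a truncated subtraction, strictly monotone; uniqueness makes a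
  -- level an antichain as a list and not merely as a set.
  record RankedList {r} (P : List (Root r)) : Set where
    field
      unique   : Unique P
      positive : ∀ {x} → x ∈ P → 1 ≤ height x

    rk-strict : ∀ {x y} → x ∈ P → x ≤ᵣ y → x ≢ y → rk x < rk y
    rk-strict x∈ x≤y x≢y = ∸-monoˡ-< (height-strict x≤y x≢y) (positive x∈)

    rk-incomparable : ∀ {x y} → x ∈ P → y ∈ P → rk x ≡ rk y → x ≢ y → Incomparable x y
    rk-incomparable x∈ y∈ e x≢y =
      (λ x≤y → <-irrefl e (rk-strict x∈ x≤y x≢y)) ,
      (λ y≤x → <-irrefl (sym e) (rk-strict y∈ y≤x (x≢y ∘ sym)))

    level-∈⁺ : ∀ {x k} → x ∈ P → rk x ≡ k → x ∈ level P k
    level-∈⁺ = ∈-filter⁺ _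

    level-∈⁻ : ∀ {x k} → x ∈ level P k → x ∈ P × rk x ≡ k
    level-∈⁻ = ∈-filter⁻ _

    level-antichain : ∀ k → Antichain (level P k)
    level-antichain k = allPairs-map∈ inc (AllPairs.filter⁺ _ unique)
      where
      inc : ∀ {x y} → x ∈ level P k → y ∈ level P k → x ≢ y → Incomparable x y
      inc x∈ y∈ with level-∈⁻ x∈ | level-∈⁻ y∈
      ... | x∈P , rx | y∈P , ry = rk-incomparable x∈P y∈P (trans rx (sym ry))

    rankToggle-antichain : ∀ k {X} → Antichain X → Antichain (rankToggle P k X)
    rankToggle-antichain k a = toggles-antichain a (level P k)

    rankToggle-at⁺ : ∀ {x X} → Antichain X → x ∈ P → Free x X → x ∈ rankToggle P (rk x) X
    rankToggle-at⁺ {x} a x∈P = toggles-self⁺ a (level P (rk x)) (level-antichain (rk x)) (level-∈⁺ x∈P refl)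

    rankToggle-at⁻ : ∀ {x X} → Antichain X → x ∈ P → x ∈ rankToggle P (rk x) X → Free x X
    rankToggle-at⁻ {x} a x∈P = toggles-self⁻ a (level P (rk x)) (level-antichain (rk x)) (level-∈⁺ x∈P refl)

    rankToggle-off⁺ : ∀ {k x X} → Antichain X → rk x ≢ k → x ∈ X → x ∈ rankToggle P k X
    rankToggle-off⁺ {k} a rx = toggles-other⁺ a (level P k) (rx ∘ proj₂ ∘ level-∈⁻)

    rankToggle-off⁻ : ∀ {k x X} → Antichain X → rk x ≢ k → x ∈ rankToggle P k X → x ∈ X
    rankToggle-off⁻ {k} a rx = toggles-other⁻ a (level P k) (rx ∘ proj₂ ∘ level-∈⁻)

    rankToggle-⊆ : ∀ k {X} → Antichain X → All (_∈ P) X → All (_∈ P) (rankToggle P k X)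
    rankToggle-⊆ k {X} a X⊆P = All.tabulate go
      where
      go : ∀ {x} → x ∈ rankToggle P k X → x ∈ P
      go {x} x∈ with x ∈? level P k
      ... | yes x∈L = proj₁ (level-∈⁻ x∈L)
      ... | no x∉L = All.lookup X⊆P (toggles-other⁻ a (level P k) x∉L x∈)

  rk≤rank : ∀ {r} {P : List (Root r)} {x} → x ∈ P → rk x ≤ rank P
  rk≤rank (here refl) = m≤m⊔n _ _
  rk≤rank {P = y ∷ P} (there x∈) = ≤-trans (rk≤rank x∈) (m≤n⊔m (rk y) (rank P))

  -- Sweeps up to any bound R on the ranks give the same map, which allows
  -- posets of different ranks to be compared.
  sweepTo : ∀ {r} → List (Root r) → ℕ → ℕ → List (Root r) → List (Root r)
  sweepTo P R k = applyRanks P [ k ⋯ R ]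

  RvacTo : ∀ {r} → List (Root r) → ℕ → List ℕ → List (Root r) → List (Root r)
  RvacTo P R ks X = foldl (λ Y k → sweepTo P R k Y) X ks

  iterate-sweep : ∀ {r} (P : List (Root r)) (g : List ℕ → List (Root r) → List (Root r)) →
                  (∀ X → g [] X ≡ X) → (∀ k ks X → g (k ∷ ks) X ≡ g ks (sweep P k X)) →
                  ∀ ks X → g ks X ≡ RvacTo P (rank P) ks X
  iterate-sweep P g g[] g∷ [] X = g[] X
  iterate-sweep P g g[] g∷ (k ∷ ks) X = trans (g∷ k ks X) (iterate-sweep P g g[] g∷ ks (sweep P k X))

  Rvac-iterate : ∀ {r} (P : List (Root r)) X → Rvac P X ≡ RvacTo P (rank P) [ 0 ⋯ rank P ] X
  Rvac-iterate {r} P X = proof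
    where
    -- The loop of Rvac is local to its definition; unification recovers it.
    loop : List ℕ → List (Root r) → List (Root r)
    loop = _
    proof : Rvac P X ≡ RvacTo P (rank P) [ 0 ⋯ rank P ] X
    -- The first round of the loop computes. Abstracting the remaining list and state leaves the
    -- loop applied to variables, a pattern that determines `loop`.
    proof with map (0 +_) (applyUpTo suc (rank P))
    ... | ks with applyRanks P ks (rankToggle P 0 X)
    ...   | Y = iterate-sweep P loop (λ _ → refl) (λ _ _ _ → refl) ks Y

  module _ {r} {P : List (Root r)} where

    level-empty : ∀ {k} → rank P < k → level P k ≡ []
    level-empty lt = filter-none (λ v → rk v ≟ _) {P} (All.tabulate (λ x∈ e → <⇒≱ lt (subst (_≤ rank P) e (rk≤rank x∈))))

    applyRanks-above : ∀ {ks} X → All (rank P <_) ks → applyRanks P ks X ≡ X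
    applyRanks-above X [] = refl
    applyRanks-above X (lt ∷ lts) rewrite level-empty lt = applyRanks-above X lts

    interval-bound : ∀ a {b} → All (a ≤_) [ a ⋯ b ]
    interval-bound a = All.map⁺ (All.tabulate (λ {i} _ → m≤m+n a i))

    sweepTo-irrelevant : ∀ n {R} k → R ≡ n + rank P → ∀ X → sweepTo P R k X ≡ sweep P k X
    sweepTo-irrelevant n k refl = go (suc (rank P) ∸ k) k refl
      where
      go : ∀ d k → suc (rank P) ∸ k ≡ d → ∀ X → sweepTo P (n + rank P) k X ≡ sweep P k X
      go d k e X with k ≤? rank P
      ... | no k≰ rewrite interval-nil (≰⇒> k≰) =
        applyRanks-above X (All.map (<-≤-trans (≰⇒> k≰)) (interval-bound k))
      go zero k e X | yes k≤ = ⊥-elim (<⇒≱ (s≤s k≤) (m∸n≡0⇒m≤n e))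
      go (suc d) k e X | yes k≤
        rewrite interval-cons k≤ | interval-cons (≤-trans k≤ (m≤n+m (rank P) n)) =
        go d (suc k) (suc-injective (trans (sym (+-∸-assoc 1 k≤)) e)) (rankToggle P k X)

    Rvac-bound : ∀ n {R} → R ≡ n + rank P → ∀ X → Rvac P X ≡ RvacTo P R [ 0 ⋯ R ] X
    Rvac-bound n {R} eq X = trans (Rvac-iterate P X) (sym (go (suc (rank P)) 0 refl X))
      where
      above : ∀ ks X → All (rank P <_) ks → RvacTo P R ks X ≡ X
      above [] X [] = refl
      above (k ∷ ks) X (lt ∷ lts) = trans (cong (RvacTo P R ks)
        (trans (sweepTo-irrelevant n k eq X) (cong (λ is → applyRanks P is X) (interval-nil lt)))) (above ks X lts)
      go : ∀ d k → suc (rank P) ∸ k ≡ d → ∀ X → RvacTo P R [ k ⋯ R ] X ≡ RvacTo P (rank P) [ k ⋯ rank P ] X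
      go d k e X with k ≤? rank P
      ... | no k≰ rewrite interval-nil (≰⇒> k≰) =
        above [ k ⋯ R ] X (All.map (<-≤-trans (≰⇒> k≰)) (interval-bound k))
      go zero k e X | yes k≤ = ⊥-elim (<⇒≱ (s≤s k≤) (m∸n≡0⇒m≤n e))
      go (suc d) k e X | yes k≤
        rewrite interval-cons k≤ | interval-cons (≤-trans k≤ (≤-trans (m≤n+m (rank P) n) (≤-reflexive (sym eq))))
              | sweepTo-irrelevant n k eq X =
        go d (suc k) (suc-injective (trans (sym (+-∸-assoc 1 k≤)) e)) (sweep P k X)

-- Evolving order ideals and their relation to rowvacuation

module Grid where

  open Toggle
  open import Data.List.Relation.Unary.Any using (any?)

  -- One invariant rule for both nested loops: `run` is instantiated with the rank toggles of a
  -- sweep and with the sweeps of rowvacuation, and `Inv k` is what holds before round k.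
  interval-induction : ∀ {S : Set} (run : List ℕ → S → S) (step : ℕ → S → S) →
    (∀ s → run [] s ≡ s) → (∀ k ks s → run (k ∷ ks) s ≡ run ks (step k s)) →
    (Inv : ℕ → S → Set) (R : ℕ) {lo : ℕ} →
    (∀ {k s} → lo ≤ k → k ≤ R → Inv k s → Inv (suc k) (step k s)) →
    ∀ d {k s} → lo ≤ k → d + k ≡ suc R → Inv k s → Inv (suc R) (run [ k ⋯ R ] s)
  interval-induction run step run[] run∷ Inv R ih zero lo≤k refl h
    rewrite interval-nil (n<1+n R) = subst (Inv (suc R)) (sym (run[] _)) h
  interval-induction run step run[] run∷ Inv R ih (suc d) {k} {s} lo≤k eq h
    rewrite interval-cons {k} {R} (≤-trans (m≤n+m k d) (≤-reflexive (suc-injective eq)))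
          | run∷ k [ suc k ⋯ R ] s =
    interval-induction run step run[] run∷ Inv R ih d (m≤n⇒m≤1+n lo≤k) (trans (+-suc d k) eq)
      (ih lo≤k (≤-trans (m≤n+m k d) (≤-reflexive (suc-injective eq))) h)

  Rvac-valid : ∀ {r} {P X : List (Root r)} → RankedList P → Antichain X → All (_∈ P) X →
               Antichain (Rvac P X) × All (_∈ P) (Rvac P X)
  Rvac-valid {P = P} {X} ranked a X⊆P rewrite Rvac-iterate P X =
    interval-induction (RvacTo P (rank P)) (sweepTo P (rank P)) (λ _ → refl) (λ _ _ _ → refl) (λ _ → Valid) (rank P)
      (λ {k} _ k≤ v → interval-induction (applyRanks P) (rankToggle P) (λ _ → refl) (λ _ _ _ → refl) (λ _ → Valid) (rank P)
        {0} (λ {j} _ _ (a , s) → rankToggle-antichain j a , rankToggle-⊆ j a s)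
        (suc (rank P) ∸ k) {k} z≤n (m∸n+n≡m (m≤n⇒m≤1+n k≤)) v)
      (suc (rank P)) {0} z≤n (+-identityʳ _) (a , X⊆P)
    where
    open RankedList ranked
    Valid : List (Root _) → Set
    Valid X = Antichain X × All (_∈ P) X

  Below : ∀ {r} → List (Root r) → Root r → Set
  Below X y = Any (_≤ᵣ y) X

  below? : ∀ {r} (X : List (Root r)) y → Dec (Below X y)
  below? X y = any? (_≤ᵣ? y) X

  ∈⇒below : ∀ {r} {X : List (Root r)} {x y} → x ∈ X → x ≤ᵣ y → Below X y
  ∈⇒below x∈ x≤y = Any.map (λ { refl → x≤y }) x∈

  -- Several indices may name one root, such as the two colours of an interval that does not end in
  -- the middle; hence conditions like `root i ≢ root j` in place of `i ≢ j`. The relation `⋖` only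
  -- has to supply enough covers for `saturated`.
  record Model {r} (P : List (Root r)) : Set₁ where
    infix 4 _⋖_
    field
      ranked    : RankedList P
      Ix        : Set
      root      : Ix → Root r
      root∈     : ∀ i → root i ∈ P
      index     : ∀ {x} → x ∈ P → ∃ λ i → root i ≡ x
      _⋖_       : Ix → Ix → Set
      ⋖⇒≤       : ∀ {i j} → i ⋖ j → root i ≤ᵣ root j
      ⋖-rk      : ∀ {i j} → i ⋖ j → rk (root j) ≡ suc (rk (root i))
      saturated : ∀ {i j} → root i ≤ᵣ root j → root i ≢ root j → ∃ λ k → k ⋖ j × root i ≤ᵣ root k
    open RankedList ranked public

    ρ : Ix → ℕ
    ρ i = rk (root i)

    ⋖-ρ≤ : ∀ {i j t} → i ⋖ j → t ≤ ρ i → t ≤ ρ j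
    ⋖-ρ≤ i⋖j t≤ = ≤-trans t≤ (≤-trans (n≤1+n _) (≤-reflexive (sym (⋖-rk i⋖j))))

    ⋖-ρ< : ∀ {i j} → i ⋖ j → ρ i < ρ j
    ⋖-ρ< i⋖j = ≤-reflexive (sym (⋖-rk i⋖j))

    -- X i t records whether root i lies in the order ideal at time t, where
    -- time t is only relevant for t ≤ 1 + ρ i.  The laws say that the ideal
    -- at time 1 + t is generated by the minimal elements outside the ideal at
    -- time t.
    record Evolution (X : Ix → ℕ → Set) : Set where
      field
        X?        : ∀ i t → Dec (X i t)
        invariant : ∀ {i j t} → root i ≡ root j → X i t → X j t
        mono      : ∀ {i j t} → j ⋖ i → t ≤ ρ i → X i t → X j t
        grow      : ∀ {i t} → t ≤ ρ i → ¬ X i t → (∀ {j} → j ⋖ i → X j t) → X i (suc t)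
        trace     : ∀ {i t} → t ≤ ρ i → X i (suc t) →
                    (∃ λ j → i ⋖ j × X j (suc t)) ⊎ (¬ X i t × (∀ {j} → j ⋖ i → X j t))

      -- Sweep k toggles the ranks from k on, so a root of rank ρ is last toggled in sweep ρ and its
      -- state is frozen from time 1 + ρ onwards.
      Y : ℕ → Ix → Set
      Y k i = X i (k ⊓ suc (ρ i))

      Y? : ∀ k i → Dec (Y k i)
      Y? k i = X? i (k ⊓ suc (ρ i))

      M : ℕ → Ix → Set
      M k i = ¬ Y k i × (∀ {j} → j ⋖ i → Y k j)

      early : ∀ {k i} → k ≤ suc (ρ i) → Y k i ≡ X i k
      early {i = i} k≤ = cong (X i) (m≤n⇒m⊓n≡m k≤)

      late : ∀ {k i} → suc (ρ i) ≤ k → Y k i ≡ X i (suc (ρ i))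
      late {i = i} k≥ = cong (X i) (m≥n⇒m⊓n≡n k≥)

      -- Following `trace` upwards must stop, since ranks are bounded, and it stops at a generator
      -- of the new ideal: a minimal element outside the old one. The fuel d makes the recursion
      -- structural.
      climb : ∀ d {i t} → rank P < d + ρ i → t ≤ ρ i → X i (suc t) →
              ∃ λ z → root i ≤ᵣ root z × t ≤ ρ z × ¬ X z t × (∀ {j} → j ⋖ z → X j t)
      climb zero {i} lt t≤ x = contradiction (rk≤rank (root∈ i)) (<⇒≱ lt)
      climb (suc d) {i} lt t≤ x with trace t≤ x
      ... | inj₂ (¬x , low) = i , ≤ᵣ-refl , t≤ , ¬x , low
      ... | inj₁ (j , i⋖j , x′)
        with climb d (subst (rank P <_) (trans (sym (+-suc d (ρ i))) (cong (d +_) (sym (⋖-rk i⋖j)))) lt)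
                   (⋖-ρ≤ i⋖j t≤) x′
      ...   | z , j≤z , t≤z , ¬x , low = z , ≤ᵣ-trans (⋖⇒≤ i⋖j) j≤z , t≤z , ¬x , low

      -- The lower neighbours of a generator are in the old ideal by `trace`, and anything else in
      -- the new ideal has a new element above it, to which the induction applies before `mono`
      -- descends again.
      old-below : ∀ d {i j t} → rank P < d + ρ i → t ≤ ρ i → X i (suc t) → j ⋖ i → X j t
      old-below zero {i} lt t≤ x j⋖i = contradiction (rk≤rank (root∈ i)) (<⇒≱ lt)
      old-below (suc d) {i} lt t≤ x j⋖i with trace t≤ x
      ... | inj₂ (¬x , low) = low j⋖i
      ... | inj₁ (z , i⋖z , x′) = mono j⋖i t≤
        (old-below d (subst (rank P <_) (trans (sym (+-suc d (ρ i))) (cong (d +_) (sym (⋖-rk i⋖z)))) lt)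
                   (⋖-ρ≤ i⋖z t≤) x′ i⋖z)

      enough : ∀ i → rank P < suc (rank P) + ρ i
      enough i = m≤m+n (suc (rank P)) (ρ i)

      Y-mono-cover : ∀ k {i j} → j ⋖ i → Y k i → Y k j
      Y-mono-cover k {i} {j} j⋖i y with k ≤? ρ i
      ... | yes k≤ = subst id (sym (early (subst (k ≤_) (⋖-rk j⋖i) k≤)))
                       (mono j⋖i k≤ (subst id (early (m≤n⇒m≤1+n k≤)) y))
      -- The two roots are frozen at different times, j one step before i; `old-below` bridges that
      -- step.
      ... | no k≰ = subst id (sym (trans (late {k} {j} (<⇒≤ (subst (_< k) (⋖-rk j⋖i) (≰⇒> k≰))))
                                         (cong (X j) (sym (⋖-rk j⋖i)))))
                      (old-below _ (enough i) ≤-refl (subst id (late (≰⇒> k≰)) y) j⋖i)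

      Y-mono : ∀ k n {i j} → ρ i ≤ n → root j ≤ᵣ root i → Y k i → Y k j
      Y-mono k n {i} {j} ρ≤ j≤i y with root j ≟ᵣ root i
      ... | yes e = subst (λ s → X j (k ⊓ suc s)) (cong rk (sym e)) (invariant (sym e) y)
      ... | no ¬e with saturated j≤i ¬e
      Y-mono k zero ρ≤ j≤i y | no ¬e | z , z⋖i , j≤z = contradiction (⋖-ρ< z⋖i) (≤⇒≯ (≤-trans ρ≤ z≤n))
      Y-mono k (suc n) ρ≤ j≤i y | no ¬e | z , z⋖i , j≤z =
        Y-mono k n (s≤s⁻¹ (subst (_≤ suc n) (⋖-rk z⋖i) ρ≤)) j≤z (Y-mono-cover k z⋖i y)

      M-strict : ∀ {k i j} → M k i → root j ≤ᵣ root i → root j ≢ root i → Y k j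
      M-strict {k} (_ , low) j≤i j≢i with saturated j≤i j≢i
      ... | z , z⋖i , j≤z = Y-mono k _ ≤-refl j≤z (low z⋖i)

      M-final : ∀ {k i} → ρ i < k → (M k i → M (suc k) i) × (M (suc k) i → M k i)
      M-final {k} {i} lt =
        (λ (¬y , low) → ¬y ∘ subst id (sym (e lt)) , λ j⋖i → subst id (e (<-trans (⋖-ρ< j⋖i) lt)) (low j⋖i)) ,
        (λ (¬y , low) → ¬y ∘ subst id (e lt) , λ j⋖i → subst id (sym (e (<-trans (⋖-ρ< j⋖i) lt))) (low j⋖i))
        where
        e : ∀ {j} → ρ j < k → Y k j ≡ Y (suc k) j
        e {j} l = trans (late l) (sym (late (m≤n⇒m≤1+n l)))

      record At (k : ℕ) (B : List (Root r)) : Set where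
        field
          antichain : Antichain B
          ⊆P        : All (_∈ P) B
          ∈⇒M       : ∀ i → root i ∈ B → M k i
          M⇒∈       : ∀ i → M k i → root i ∈ B

      -- In the middle of sweep k the list is spliced at rank j from the generators of two
      -- consecutive ideals.
      record During (k j : ℕ) (B : List (Root r)) : Set where
        field
          antichain : Antichain B
          ⊆P        : All (_∈ P) B
          done⇒     : ∀ i → ρ i < j → root i ∈ B → M (suc k) i
          done⇐     : ∀ i → ρ i < j → M (suc k) i → root i ∈ B
          todo⇒     : ∀ i → j ≤ ρ i → root i ∈ B → M k i
          todo⇐     : ∀ i → j ≤ ρ i → M k i → root i ∈ B

      M-next : ∀ {k i} → k ≤ ρ i → M k i → Y (suc k) i
      M-next {k} {i} k≤ (¬y , low) = subst id (sym (early (s≤s k≤)))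
        (grow k≤ (¬y ∘ subst id (sym (early (m≤n⇒m≤1+n k≤))))
              (λ {j} j⋖i → subst id (early (subst (k ≤_) (⋖-rk j⋖i) k≤)) (low j⋖i)))

      module _ {k j : ℕ} {B : List (Root r)} (k≤j : k ≤ j) (D : During k j B) where
        open During D

        -- Induction on the rank of c: if c were missing from the new ideal while everything below
        -- it is present, then c would be minimal outside, hence already placed in B, and root i
        -- would not be free.
        free⇒below : ∀ i → ρ i ≡ j → Free (root i) B →
                     ∀ n c → ρ c ≤ n → root c ≤ᵣ root i → root c ≢ root i → Y (suc k) c
        free⇒below i ρi f n c ρ≤ c≤i c≢i with Y? (suc k) c
        ... | yes y = y
        ... | no ¬y = contradiction c≤i (proj₂ (All.lookup f (done⇐ c lt (¬y , lower n ρ≤))))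
          where
          lt : ρ c < j
          lt = subst (ρ c <_) ρi (rk-strict (root∈ c) c≤i c≢i)
          lower : ∀ n → ρ c ≤ n → ∀ {d} → d ⋖ c → Y (suc k) d
          lower zero ρ≤ d⋖c = contradiction (⋖-ρ< d⋖c) (≤⇒≯ (≤-trans ρ≤ z≤n))
          lower (suc n) ρ≤ {d} d⋖c = free⇒below i ρi f n d (s≤s⁻¹ (subst (_≤ suc n) (⋖-rk d⋖c) ρ≤))
            (≤ᵣ-trans (⋖⇒≤ d⋖c) c≤i)
            (λ e → <⇒≢ (<-trans (⋖-ρ< d⋖c) (rk-strict (root∈ c) c≤i c≢i)) (cong rk e))

        free⇒M : ∀ i → ρ i ≡ j → Free (root i) B → M (suc k) i
        free⇒M i ρi f = ¬y , λ {c} c⋖i →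
          free⇒below i ρi f _ c ≤-refl (⋖⇒≤ c⋖i) (λ e → <⇒≢ (⋖-ρ< c⋖i) (cong rk e))
          where
          k≤i : k ≤ ρ i
          k≤i = subst (k ≤_) (sym ρi) k≤j
          ¬y : ¬ Y (suc k) i
          -- If i were in the new ideal, a generator of that ideal would lie above i, at a rank not
          -- yet toggled, and so would still be in B.
          ¬y y with climb _ (enough i) k≤i (subst id (early (s≤s k≤i)) y)
          ... | z , i≤z , k≤z , ¬x , low = contradiction i≤z (proj₁ (All.lookup f z∈))
            where
            z∈ : root z ∈ B
            z∈ = todo⇐ z (subst (_≤ ρ z) ρi (∸-monoˡ-≤ 1 (height-mono i≤z)))
              (¬x ∘ subst id (early (m≤n⇒m≤1+n k≤z)) ,
               λ {c} c⋖z → subst id (sym (early (subst (k ≤_) (⋖-rk c⋖z) k≤z))) (low c⋖z))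

        -- An element of B above i is not yet toggled and enters the new ideal by `M-next`, which
        -- would pull i in. An element of B strictly below i is outside the new ideal, although
        -- everything below i is inside.
        M⇒free : ∀ i → ρ i ≡ j → M (suc k) i → Free (root i) B
        M⇒free i ρi m = All.tabulate inc
          where
          inc : ∀ {b} → b ∈ B → Incomparable (root i) b
          inc {b} b∈ with index (All.lookup ⊆P b∈)
          ... | c , refl = i≰c , c≰i
            where
            i≰c : ¬ root i ≤ᵣ root c
            i≰c i≤c = proj₁ m (Y-mono (suc k) _ ≤-refl i≤c (M-next (≤-trans k≤j j≤c) (todo⇒ c j≤c b∈)))
              where
              j≤c : j ≤ ρ c
              j≤c = subst (_≤ ρ c) ρi (∸-monoˡ-≤ 1 (height-mono i≤c))
            c≰i : ¬ root c ≤ᵣ root i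
            c≰i c≤i with root c ≟ᵣ root i
            ... | yes e = i≰c (subst (root i ≤ᵣ_) (sym e) ≤ᵣ-refl)
            ... | no c≢i = proj₁ (done⇒ c (subst (ρ c <_) ρi (rk-strict (root∈ c) c≤i c≢i)) b∈)
                                 (M-strict m c≤i c≢i)

        during-step : During k (suc j) (rankToggle P j B)
        during-step = record
          { antichain = rankToggle-antichain j antichain
          ; ⊆P = rankToggle-⊆ j antichain ⊆P
          ; done⇒ = d⇒
          ; done⇐ = d⇐
          ; todo⇒ = λ i lt h → todo⇒ i (<⇒≤ lt) (rankToggle-off⁻ antichain (>⇒≢ lt) h)
          ; todo⇐ = λ i lt m → rankToggle-off⁺ antichain (>⇒≢ lt) (todo⇐ i (<⇒≤ lt) m)
          }
          where
          d⇒ : ∀ i → ρ i < suc j → root i ∈ rankToggle P j B → M (suc k) i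
          d⇒ i lt h with ρ i ≟ j
          ... | yes refl = free⇒M i refl (rankToggle-at⁻ antichain (root∈ i) h)
          ... | no ρ≢ = done⇒ i (≤∧≢⇒< (s≤s⁻¹ lt) ρ≢) (rankToggle-off⁻ antichain ρ≢ h)
          d⇐ : ∀ i → ρ i < suc j → M (suc k) i → root i ∈ rankToggle P j B
          d⇐ i lt m with ρ i ≟ j
          ... | yes refl = rankToggle-at⁺ antichain (root∈ i) (M⇒free i refl m)
          ... | no ρ≢ = rankToggle-off⁺ antichain ρ≢ (done⇐ i (≤∧≢⇒< (s≤s⁻¹ lt) ρ≢) m)

      sweep-step : ∀ {k B} → k ≤ rank P → At k B → At (suc k) (sweepTo P (rank P) k B)
      sweep-step {k} {B} k≤ at = record
        { antichain = During.antichain end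
        ; ⊆P = During.⊆P end
        ; ∈⇒M = λ i → During.done⇒ end i (s≤s (rk≤rank (root∈ i)))
        ; M⇒∈ = λ i → During.done⇐ end i (s≤s (rk≤rank (root∈ i)))
        }
        where
        open At at
        start : During k k B
        start = record
          { antichain = antichain
          ; ⊆P = ⊆P
          ; done⇒ = λ i lt h → proj₁ (M-final lt) (∈⇒M i h)
          ; done⇐ = λ i lt m → M⇒∈ i (proj₂ (M-final lt) m)
          ; todo⇒ = λ i _ → ∈⇒M i
          ; todo⇐ = λ i _ → M⇒∈ i
          }
        end : During k (suc (rank P)) (sweepTo P (rank P) k B)
        end = interval-induction (applyRanks P) (rankToggle P) (λ _ → refl) (λ _ _ _ → refl) (During k) (rank P)
          (λ k≤j _ → during-step k≤j) (suc (rank P) ∸ k) ≤-refl (m∸n+n≡m (m≤n⇒m≤1+n k≤)) start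

      Y⇒¬below : ∀ {k B} → At k B → ∀ i → Y k i → ¬ Below B (root i)
      Y⇒¬below {k} at i y b with find b
      ... | x , x∈B , x≤i with index (All.lookup (At.⊆P at) x∈B)
      ...   | c , refl = proj₁ (At.∈⇒M at c x∈B) (Y-mono k _ ≤-refl x≤i y)

      ¬below⇒Y : ∀ {k B} → At k B → ∀ n i → ρ i ≤ n → ¬ Below B (root i) → Y k i
      ¬below⇒Y {k} at n i ρ≤ ¬b with Y? k i
      ... | yes y = y
      ... | no ¬y = contradiction (∈⇒below (At.M⇒∈ at i (¬y , lower n ρ≤)) ≤ᵣ-refl) ¬b
        where
        lower : ∀ n → ρ i ≤ n → ∀ {d} → d ⋖ i → Y k d
        lower zero ρ≤ d⋖i = contradiction (⋖-ρ< d⋖i) (≤⇒≯ (≤-trans ρ≤ z≤n))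
        lower (suc n) ρ≤ {d} d⋖i = ¬below⇒Y at n d (s≤s⁻¹ (subst (_≤ suc n) (⋖-rk d⋖i) ρ≤))
          (¬b ∘ Any.map (λ x≤d → ≤ᵣ-trans x≤d (⋖⇒≤ d⋖i)))

      module _ {A : List (Root r)} (anti : Antichain A) (A⊆P : All (_∈ P) A)
               (X⇒ : ∀ i → X i 0 → ¬ Below A (root i)) (X⇐ : ∀ i → ¬ Below A (root i) → X i 0) where

        initially : At 0 A
        initially = record { antichain = anti ; ⊆P = A⊆P ; ∈⇒M = to ; M⇒∈ = from }
          where
          to : ∀ i → root i ∈ A → M 0 i
          to i i∈ = (λ x → X⇒ i x (∈⇒below i∈ ≤ᵣ-refl)) , λ {j} j⋖i → X⇐ j (no-below j⋖i)
            where
            no-below : ∀ {j} → j ⋖ i → ¬ Below A (root j)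
            no-below j⋖i b with find b
            ... | x , x∈ , x≤j with allPairs-∈ anti x∈ i∈
            ...   | inj₁ refl = contradiction (∸-monoˡ-≤ 1 (height-mono x≤j)) (<⇒≱ (⋖-ρ< j⋖i))
            ...   | inj₂ (x≰i , _) = x≰i (≤ᵣ-trans x≤j (⋖⇒≤ j⋖i))
          from : ∀ i → M 0 i → root i ∈ A
          from i (¬x , low) with below? A (root i)
          ... | no ¬b = contradiction (X⇐ i ¬b) ¬x
          ... | yes b with find b
          ...   | x , x∈ , x≤i with x ≟ᵣ root i
          ...     | yes refl = x∈
          ...     | no x≢i with index (All.lookup A⊆P x∈)
          ...       | c , refl with saturated x≤i x≢i
          ...         | z , z⋖i , c≤z = contradiction (∈⇒below x∈ c≤z) (X⇒ z (low z⋖i))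

        finally : At (suc (rank P)) (Rvac P A)
        finally rewrite Rvac-iterate P A =
          interval-induction (RvacTo P (rank P)) (sweepTo P (rank P)) (λ _ → refl) (λ _ _ _ → refl) At (rank P)
            (λ _ → sweep-step) (suc (rank P)) {0} z≤n (+-identityʳ _) initially

        final-eq : ∀ i → Y (suc (rank P)) i ≡ X i (suc (ρ i))
        final-eq i = late (s≤s (rk≤rank (root∈ i)))

        Rvac-antichain : Antichain (Rvac P A)
        Rvac-antichain = At.antichain finally

        Rvac-⊆ : All (_∈ P) (Rvac P A)
        Rvac-⊆ = At.⊆P finally

        final⇒ : ∀ i → X i (suc (ρ i)) → ¬ Below (Rvac P A) (root i)
        final⇒ i x = Y⇒¬below finally i (subst id (sym (final-eq i)) x)

        final⇐ : ∀ i → ¬ Below (Rvac P A) (root i) → X i (suc (ρ i))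
        final⇐ i ¬b = subst id (final-eq i) (¬below⇒Y finally _ i ≤-refl ¬b)

  -- Each antichain consists of the minimal elements of the filter that it generates, and the two
  -- filters agree.
  antichain-≋ : ∀ {r} {X Y : List (Root r)} → Antichain X → Antichain Y →
                (∀ {x} → x ∈ X → Below Y x) → (∀ {y} → y ∈ Y → Below X y) → X ≋ Y
  antichain-≋ aX aY X⇒Y Y⇒X x = go aX X⇒Y Y⇒X , go aY Y⇒X X⇒Y
    where
    go : ∀ {X Y} → Antichain X → (∀ {x} → x ∈ X → Below Y x) → (∀ {y} → y ∈ Y → Below X y) → ∀ {x} → x ∈ X → x ∈ Y
    go aX X⇒Y Y⇒X x∈ with find (X⇒Y x∈)
    ... | y , y∈ , y≤x with find (Y⇒X y∈)
    ...   | z , z∈ , z≤y with allPairs-∈ aX z∈ x∈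
    ...     | inj₂ (z≰x , _) = contradiction (≤ᵣ-trans z≤y y≤x) z≰x
    ...     | inj₁ refl with y ≟ᵣ z
    ...       | yes refl = y∈
    ...       | no y≢z = contradiction (<-≤-trans (height-strict y≤x y≢z) (height-mono z≤y)) (n≮n _)

  module _ {r} {P : List (Root r)} (model : Model P) where
    open Model model

    record Encodes (X : Ix → ℕ → Set) (A : List (Root r)) : Set where
      constructor encode
      field laws : ∀ i → (X i 0 → ¬ Below A (root i)) × (¬ Below A (root i) → X i 0)
    open Encodes

    -- Each root is read at the time 1 + ρ when it freezes, so X′ begins with the ideal in which X
    -- ends.
    record Dual (X X′ : Ix → ℕ → Set) : Set where
      constructor dually
      field exchange : ∀ i → (X i (suc (ρ i)) → X′ i 0) × (X′ i 0 → X i (suc (ρ i)))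
    open Dual

    record IsAntichainIn (A : List (Root r)) : Set where
      field
        antichain : Antichain A
        ⊆P        : All (_∈ P) A
    open IsAntichainIn

    encodes-≋ : ∀ {X A B} → IsAntichainIn A → IsAntichainIn B → Encodes X A → Encodes X B → A ≋ B
    encodes-≋ {X} aA aB eA eB = antichain-≋ (antichain aA) (antichain aB) (below aA eA eB) (below aB eB eA)
      where
      below : ∀ {A B} → IsAntichainIn A → Encodes X A → Encodes X B → ∀ {x} → x ∈ A → Below B x
      below {A} {B} aA eA eB {x} x∈ with below? B x
      ... | yes b = b
      ... | no ¬b with index (All.lookup (⊆P aA) x∈)
      ...   | i , refl = contradiction (∈⇒below x∈ ≤ᵣ-refl) (proj₁ (laws eA i) (proj₂ (laws eB i) ¬b))

    module _ {X X′ : Ix → ℕ → Set} (evolution : Evolution X) (dual : Dual X X′)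
             {A : List (Root r)} (aA : IsAntichainIn A) (eA : Encodes X A) where
      open Evolution evolution

      Rvac-in : IsAntichainIn (Rvac P A)
      Rvac-in = record
        { antichain = Rvac-antichain (antichain aA) (⊆P aA) (proj₁ ∘ laws eA) (proj₂ ∘ laws eA)
        ; ⊆P = Rvac-⊆ (antichain aA) (⊆P aA) (proj₁ ∘ laws eA) (proj₂ ∘ laws eA)
        }

      Rvac-encodes : Encodes X′ (Rvac P A)
      Rvac-encodes = encode λ i →
        final⇒ (antichain aA) (⊆P aA) (proj₁ ∘ laws eA) (proj₂ ∘ laws eA) i ∘ proj₂ (exchange dual i) ,
        proj₁ (exchange dual i) ∘ final⇐ (antichain aA) (⊆P aA) (proj₁ ∘ laws eA) (proj₂ ∘ laws eA) i

    -- Duality in both directions leads back to the encoding by X, and an antichain is determined by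
    -- what encodes it.
    Rvac-involutive : ∀ {X X′} → Evolution X → Evolution X′ → Dual X X′ → Dual X′ X →
                      ∀ {A} → IsAntichainIn A → Encodes X A → Rvac P (Rvac P A) ≋ A
    Rvac-involutive ev ev′ d d′ aA eA = encodes-≋ (Rvac-in ev′ d′ aB eB) aA (Rvac-encodes ev′ d′ aB eB) eA
      where
      aB = Rvac-in ev d aA eA
      eB = Rvac-encodes ev d aA eA

    indices : ∀ {A} → All (_∈ P) A → ∃ λ Q → map root Q ≡ A
    indices [] = [] , refl
    indices (x∈ ∷ A⊆P) with index x∈ | indices A⊆P
    ... | i , refl | Q , refl = i ∷ Q , refl

-- Maximal parabolic subposets: parts (iv) and (v)

module Parabolic where

  open Toggle
  open Grid

  rank-≤ : ∀ {r} {P : List (Root r)} {b} → (∀ {x} → x ∈ P → rk x ≤ b) → rank P ≤ b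
  rank-≤ {P = []} _ = z≤n
  rank-≤ {P = x ∷ P} h = ⊔-lub (h (here refl)) (rank-≤ (h ∘ there))

  module _ {r} {P : List (Root r)} (ranked : RankedList P) {α : Root r} (α∈P : α ∈ P) (rk-α : rk α ≡ 0) where
    open RankedList ranked

    P′ : List (Root r)
    P′ = parabolic α P

    P′⁺ : ∀ {x} → x ∈ P → ¬ α ≤ᵣ x → x ∈ P′
    P′⁺ = ∈-filter⁺ _

    P′⁻ : ∀ {x} → x ∈ P′ → x ∈ P × ¬ α ≤ᵣ x
    P′⁻ = ∈-filter⁻ _

    ranked′ : RankedList P′
    ranked′ = record
      { unique = AllPairs.filter⁺ _ unique
      ; positive = positive ∘ proj₁ ∘ P′⁻
      }
    module R′ = RankedList ranked′

    ≤α⇒≡ : ∀ {x} → x ∈ P → x ≤ᵣ α → x ≡ α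
    ≤α⇒≡ {x} x∈ x≤α with x ≟ᵣ α
    ... | yes e = e
    ... | no x≢α = contradiction (rk-strict x∈ x≤α x≢α) (subst (λ k → ¬ rk x < k) (sym rk-α) n≮0)

    ≰α : ∀ {x} → x ∈ P′ → ¬ x ≤ᵣ α
    ≰α x∈ x≤α with P′⁻ x∈
    ... | x∈P , α≰x = α≰x (subst (_≤ᵣ _) (≤α⇒≡ x∈P x≤α) ≤ᵣ-refl)

    rank′≤ : rank P′ ≤ rank P
    rank′≤ = rank-≤ (rk≤rank ∘ proj₁ ∘ P′⁻)

    Rvac′ : ∀ X → Rvac P′ X ≡ RvacTo P′ (rank P) [ 0 ⋯ rank P ] X
    Rvac′ X = Rvac-bound (rank P ∸ rank P′) (sym (m∸n+n≡m rank′≤)) X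

    States : Set
    States = List (Root r) × List (Root r)

    sweep₂ : List ℕ → States → States
    sweep₂ ks (X , Y) = applyRanks P ks X , applyRanks P′ ks Y

    toggle₂ : ℕ → States → States
    toggle₂ k (X , Y) = rankToggle P k X , rankToggle P′ k Y

    Rvac₂ : List ℕ → States → States
    Rvac₂ ks (X , Y) = RvacTo P (rank P) ks X , RvacTo P′ (rank P) ks Y

    record Valid (s : States) : Set where
      field
        antichainX : Antichain (proj₁ s)
        antichainY : Antichain (proj₂ s)
        X⊆P        : All (_∈ P) (proj₁ s)
        Y⊆P′       : All (_∈ P′) (proj₂ s)

    valid-step : ∀ k {s} → Valid s → Valid (toggle₂ k s)
    valid-step k v = record
      { antichainX = rankToggle-antichain k antichainX
      ; antichainY = R′.rankToggle-antichain k antichainY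
      ; X⊆P = rankToggle-⊆ k antichainX X⊆P
      ; Y⊆P′ = R′.rankToggle-⊆ k antichainY Y⊆P′
      }
      where open Valid v

    module Avoiding where

      record Equal (s : States) : Set where
        field
          valid : Valid s
          X⊆Y   : ∀ {x} → x ∈ proj₁ s → x ∈ proj₂ s
          Y⊆X   : ∀ {x} → x ∈ proj₂ s → x ∈ proj₁ s

      record Extended (s : States) : Set where
        field
          valid : Valid s
          α∈X   : α ∈ proj₁ s
          X⊆Y   : ∀ {x} → x ∈ proj₁ s → x ≢ α → x ∈ proj₂ s
          Y⊆X   : ∀ {x} → x ∈ proj₂ s → x ∈ proj₁ s

      -- All of X lies in P′ and is thus incomparable to α, so the toggle of rank 0 inserts α. Later
      -- toggles never reach rank 0, and the presence of α keeps everything above it out, which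
      -- leaves exactly the toggles of P′.
      first : ∀ {s} → Equal s → Extended (toggle₂ 0 s)
      first {X , Y} e = record { valid = valid-step 0 valid ; α∈X = α∈ ; X⊆Y = to ; Y⊆X = from }
        where
        open Equal e
        open Valid valid
        α∈ : α ∈ rankToggle P 0 X
        α∈ = subst (λ k → α ∈ rankToggle P k X) rk-α (rankToggle-at⁺ antichainX α∈P
          (All.tabulate (λ x∈ → let x∈′ = All.lookup Y⊆P′ (X⊆Y x∈) in proj₂ (P′⁻ x∈′) , ≰α x∈′)))
        to : ∀ {x} → x ∈ rankToggle P 0 X → x ≢ α → x ∈ rankToggle P′ 0 Y
        to {x} x∈ x≢α with rk x ≟ 0
        ... | no ρ≢ = R′.rankToggle-off⁺ antichainY ρ≢ (X⊆Y (rankToggle-off⁻ antichainX ρ≢ x∈))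
        ... | yes ρ0 = subst (λ k → x ∈ rankToggle P′ k Y) ρ0 (R′.rankToggle-at⁺ antichainY x∈P′
            (All.tabulate (λ y∈ → All.lookup free (Y⊆X y∈))))
          where
          x∈P : x ∈ P
          x∈P = All.lookup (rankToggle-⊆ 0 antichainX X⊆P) x∈
          free : Free x X
          free = rankToggle-at⁻ antichainX x∈P (subst (λ k → x ∈ rankToggle P k X) (sym ρ0) x∈)
          x∈P′ : x ∈ P′
          x∈P′ = P′⁺ x∈P (λ α≤x → <-irrefl (trans rk-α (sym ρ0)) (rk-strict α∈P α≤x (x≢α ∘ sym)))
        from : ∀ {x} → x ∈ rankToggle P′ 0 Y → x ∈ rankToggle P 0 X
        from {x} x∈ with rk x ≟ 0
        ... | no ρ≢ = rankToggle-off⁺ antichainX ρ≢ (Y⊆X (R′.rankToggle-off⁻ antichainY ρ≢ x∈))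
        ... | yes ρ0 = subst (λ k → x ∈ rankToggle P k X) ρ0 (rankToggle-at⁺ antichainX (proj₁ (P′⁻ x∈P′))
            (All.tabulate (λ y∈ → All.lookup free (X⊆Y y∈))))
          where
          x∈P′ : x ∈ P′
          x∈P′ = All.lookup (R′.rankToggle-⊆ 0 antichainY Y⊆P′) x∈
          free : Free x Y
          free = R′.rankToggle-at⁻ antichainY x∈P′ (subst (λ k → x ∈ rankToggle P′ k Y) (sym ρ0) x∈)

      next : ∀ {k s} → 1 ≤ k → Extended s → Extended (toggle₂ k s)
      next {k} {X , Y} k≥1 e = record
        { valid = valid-step k valid
        ; α∈X = rankToggle-off⁺ antichainX (λ e → <-irrefl (trans (sym rk-α) e) k≥1) α∈X
        ; X⊆Y = to
        ; Y⊆X = from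
        }
        where
        open Extended e
        open Valid valid
        to : ∀ {x} → x ∈ rankToggle P k X → x ≢ α → x ∈ rankToggle P′ k Y
        to {x} x∈ x≢α with rk x ≟ k
        ... | no ρ≢ = R′.rankToggle-off⁺ antichainY ρ≢ (X⊆Y (rankToggle-off⁻ antichainX ρ≢ x∈) x≢α)
        ... | yes refl = R′.rankToggle-at⁺ antichainY (P′⁺ x∈P (proj₂ (All.lookup free α∈X)))
            (All.tabulate (λ y∈ → All.lookup free (Y⊆X y∈)))
          where
          x∈P : x ∈ P
          x∈P = All.lookup (rankToggle-⊆ k antichainX X⊆P) x∈
          free : Free x X
          free = rankToggle-at⁻ antichainX x∈P x∈
        from : ∀ {x} → x ∈ rankToggle P′ k Y → x ∈ rankToggle P k X
        from {x} x∈ with rk x ≟ k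
        ... | no ρ≢ = rankToggle-off⁺ antichainX ρ≢ (Y⊆X (R′.rankToggle-off⁻ antichainY ρ≢ x∈))
        ... | yes refl = rankToggle-at⁺ antichainX (proj₁ (P′⁻ x∈P′)) (All.tabulate inc)
          where
          x∈P′ : x ∈ P′
          x∈P′ = All.lookup (R′.rankToggle-⊆ k antichainY Y⊆P′) x∈
          inc : ∀ {y} → y ∈ X → Incomparable x y
          inc {y} y∈ with y ≟ᵣ α
          ... | yes refl = ≰α x∈P′ , proj₂ (P′⁻ x∈P′)
          ... | no y≢α = All.lookup (R′.rankToggle-at⁻ antichainY x∈P′ x∈) (X⊆Y y∈ y≢α)

      sweep-next : ∀ {k s} → 1 ≤ k → k ≤ suc (rank P) → Extended s → Extended (sweep₂ [ k ⋯ rank P ] s)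
      sweep-next {k} k≥1 k≤ =
        interval-induction sweep₂ toggle₂ (λ _ → refl) (λ _ _ _ → refl) (λ _ → Extended) (rank P)
          (λ 1≤k _ → next 1≤k) (suc (rank P) ∸ k) {k} k≥1 (m∸n+n≡m k≤)

      end : ∀ {X} → Antichain X → All (_∈ P′) X → Extended (Rvac₂ [ 0 ⋯ rank P ] (X , X))
      -- Rank 0 is toggled only once, at the very beginning of the first sweep; both loops are
      -- unrolled by one round to expose that toggle.
      end {X} a X⊆P′ = subst (λ ks → Extended (Rvac₂ ks (X , X))) (sym (interval-cons {0} {rank P} z≤n))
        (interval-induction Rvac₂ (λ k → sweep₂ [ k ⋯ rank P ]) (λ _ → refl) (λ _ _ _ → refl)
          (λ _ → Extended) (rank P) (λ 1≤k k≤ → sweep-next 1≤k (m≤n⇒m≤1+n k≤)) (rank P) (s≤s z≤n)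
          (+-comm (rank P) 1) start)
        where
        start : Extended (sweep₂ [ 0 ⋯ rank P ] (X , X))
        start = subst (λ ks → Extended (sweep₂ ks (X , X))) (sym (interval-cons {0} {rank P} z≤n)) (sweep-next (s≤s z≤n) (s≤s z≤n) (first record
          { valid = record { antichainX = a ; antichainY = a ; X⊆P = All.map (proj₁ ∘ P′⁻) X⊆P′ ; Y⊆P′ = X⊆P′ }
          ; X⊆Y = id
          ; Y⊆X = id }))

    Rvac-avoiding : ∀ {X} → Antichain X → All (_∈ P′) X → Rvac P X ≋ (α ∷ Rvac P′ X)
    Rvac-avoiding {X} a X⊆P′ x rewrite Rvac-iterate P X | Rvac′ X = to , from
      where
      open Avoiding.Extended (Avoiding.end a X⊆P′)
      to : x ∈ RvacTo P (rank P) [ 0 ⋯ rank P ] X → x ∈ (α ∷ RvacTo P′ (rank P) [ 0 ⋯ rank P ] X)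
      to x∈ with x ≟ᵣ α
      ... | yes e = here e
      ... | no x≢α = there (X⊆Y x∈ x≢α)
      from : x ∈ (α ∷ RvacTo P′ (rank P) [ 0 ⋯ rank P ] X) → x ∈ RvacTo P (rank P) [ 0 ⋯ rank P ] X
      from (here refl) = α∈X
      from (there x∈) = Y⊆X x∈

    module Containing (model : Model P) where

      between : ∀ d {x k} → x ∈ P → α ≤ᵣ x → rk x ≡ d + k → ∃ λ z → z ∈ P × α ≤ᵣ z × z ≤ᵣ x × rk z ≡ k
      between zero {x} x∈ α≤x e = x , x∈ , α≤x , ≤ᵣ-refl , e
      between (suc d) {x} {k} x∈ α≤x e with Model.index model x∈ | Model.index model α∈P
      ... | i , refl | a , refl with Model.saturated model α≤x (λ α≡x → 1+n≢0 (trans (sym e) (trans (sym (cong rk α≡x)) rk-α)))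
      ...   | j , j⋖i , α≤j with between d (Model.root∈ model j) α≤j (suc-injective (trans (sym (Model.⋖-rk model j⋖i)) e))
      ...     | z , z∈ , α≤z , z≤j , rz = z , z∈ , α≤z , ≤ᵣ-trans z≤j (Model.⋖⇒≤ model j⋖i) , rz

      -- The elements of X above α form a front at rank k: `above` puts them all there, and `cover`
      -- says that nothing at this rank above α slips past X. Each sweep moves the front up by one
      -- rank, while the rest of X evolves as in P′.
      record Between (k : ℕ) (s : States) : Set where
        field
          valid : Valid s
          X⊆Y   : ∀ {x} → x ∈ proj₁ s → ¬ α ≤ᵣ x → x ∈ proj₂ s
          Y⊆X   : ∀ {x} → x ∈ proj₂ s → x ∈ proj₁ s
          above : ∀ {x} → x ∈ proj₁ s → α ≤ᵣ x → rk x ≡ k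
          cover : ∀ {x} → x ∈ P → α ≤ᵣ x → rk x ≡ k → Below (proj₁ s) x

      record During (k j : ℕ) (s : States) : Set where
        field
          valid : Valid s
          X⊆Y   : ∀ {x} → x ∈ proj₁ s → ¬ α ≤ᵣ x → x ∈ proj₂ s
          Y⊆X   : ∀ {x} → x ∈ proj₂ s → x ∈ proj₁ s
          above : ∀ {x} → x ∈ proj₁ s → α ≤ᵣ x → rk x ≡ suc k × suc k < j
          cover : ∀ {x} → suc k < j → x ∈ P → α ≤ᵣ x → rk x ≡ suc k → Below (proj₁ s) x

      -- Toggling agrees on P′ as soon as the elements of X above α are
      -- incomparable to the elements of P′ being toggled.
      module _ {X Y : List (Root r)} (valid : Valid (X , Y))
               (X⊆Y : ∀ {x} → x ∈ X → ¬ α ≤ᵣ x → x ∈ Y) (Y⊆X : ∀ {x} → x ∈ Y → x ∈ X) (k : ℕ)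
               (inc : ∀ {x y} → x ∈ P′ → rk x ≡ k → y ∈ X → α ≤ᵣ y → Incomparable x y) where
        open Valid valid

        to : ∀ {x} → x ∈ rankToggle P k X → ¬ α ≤ᵣ x → x ∈ rankToggle P′ k Y
        to {x} x∈ α≰x with rk x ≟ k
        ... | no ρ≢ = R′.rankToggle-off⁺ antichainY ρ≢ (X⊆Y (rankToggle-off⁻ antichainX ρ≢ x∈) α≰x)
        ... | yes refl = R′.rankToggle-at⁺ antichainY (P′⁺ x∈P α≰x)
            (All.tabulate (λ y∈ → All.lookup (rankToggle-at⁻ antichainX x∈P x∈) (Y⊆X y∈)))
          where
          x∈P : x ∈ P
          x∈P = All.lookup (rankToggle-⊆ k antichainX X⊆P) x∈
        from : ∀ {x} → x ∈ rankToggle P′ k Y → x ∈ rankToggle P k X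
        from {x} x∈ with rk x ≟ k
        ... | no ρ≢ = rankToggle-off⁺ antichainX ρ≢ (Y⊆X (R′.rankToggle-off⁻ antichainY ρ≢ x∈))
        ... | yes refl = rankToggle-at⁺ antichainX (proj₁ (P′⁻ x∈P′)) (All.tabulate inc′)
          where
          x∈P′ : x ∈ P′
          x∈P′ = All.lookup (R′.rankToggle-⊆ k antichainY Y⊆P′) x∈
          inc′ : ∀ {y} → y ∈ X → Incomparable x y
          inc′ {y} y∈ with α ≤ᵣ? y
          ... | yes α≤y = inc x∈P′ refl y∈ α≤y
          ... | no α≰y = All.lookup (R′.rankToggle-at⁻ antichainY x∈P′ x∈) (X⊆Y y∈ α≰y)

      below-free : ∀ {x : Root r} {X} → Below X x → ¬ Free x X
      below-free b f with find b
      ... | y , y∈ , y≤x = proj₂ (All.lookup f y∈) y≤x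

      -- The toggle of rank k dissolves the front: by `cover`, no element of that rank above α is
      -- free, whether it is in X or merely above an element of X.
      first : ∀ {k s} → Between k s → During k (suc k) (toggle₂ k s)
      first {k} {X , Y} b = record
        { valid = valid-step k valid
        ; X⊆Y = to valid X⊆Y Y⊆X k inc
        ; Y⊆X = from valid X⊆Y Y⊆X k inc
        ; above = λ x∈ α≤x → ⊥-elim (none x∈ α≤x)
        ; cover = λ lt → contradiction lt (n≮n _)
        }
        where
        open Between b
        open Valid valid
        inc : ∀ {x y} → x ∈ P′ → rk x ≡ k → y ∈ X → α ≤ᵣ y → Incomparable x y
        inc x∈ rx y∈ α≤y = rk-incomparable (proj₁ (P′⁻ x∈)) (All.lookup X⊆P y∈) (trans rx (sym (above y∈ α≤y)))
          (λ { refl → proj₂ (P′⁻ x∈) α≤y })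
        none : ∀ {x} → x ∈ rankToggle P k X → ¬ α ≤ᵣ x
        none {x} x∈ α≤x with rk x ≟ k
        ... | no ρ≢ = ρ≢ (above (rankToggle-off⁻ antichainX ρ≢ x∈) α≤x)
        ... | yes refl = below-free (cover x∈P α≤x refl) (rankToggle-at⁻ antichainX x∈P x∈)
          where
          x∈P : x ∈ P
          x∈P = All.lookup (rankToggle-⊆ k antichainX X⊆P) x∈

      next : ∀ {k j s} → suc k ≤ j → During k j s → During k (suc j) (toggle₂ j s)
      next {k} {j} {X , Y} k<j d = record
        { valid = valid-step j valid
        ; X⊆Y = to valid X⊆Y Y⊆X j inc
        ; Y⊆X = from valid X⊆Y Y⊆X j inc
        ; above = above′
        ; cover = λ _ → cover′
        }
        where
        open During d
        open Valid valid
        inc : ∀ {x y} → x ∈ P′ → rk x ≡ j → y ∈ X → α ≤ᵣ y → Incomparable x y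
        inc x∈ refl y∈ α≤y =
          (λ x≤y → <⇒≱ (subst (_< j) (sym (proj₁ (above y∈ α≤y))) (proj₂ (above y∈ α≤y))) (∸-monoˡ-≤ 1 (height-mono x≤y))) ,
          (λ y≤x → proj₂ (P′⁻ x∈) (≤ᵣ-trans α≤y y≤x))
        above′ : ∀ {x} → x ∈ rankToggle P j X → α ≤ᵣ x → rk x ≡ suc k × suc k < suc j
        above′ {x} x∈ α≤x with rk x ≟ j
        ... | no ρ≢ with above (rankToggle-off⁻ antichainX ρ≢ x∈) α≤x
        ...   | e , lt = e , m≤n⇒m≤1+n lt
        above′ {x} x∈ α≤x | yes refl with m≤n⇒m<n∨m≡n k<j
        ... | inj₂ e = sym e , s≤s k<j
        -- Above the new front: an element z of rank 1 + k between α and x has something of X below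
        -- it, so x is not free.
        ... | inj₁ lt with between (rk x ∸ suc k) x∈P α≤x (sym (m∸n+n≡m k<j))
          where
          x∈P : x ∈ P
          x∈P = All.lookup (rankToggle-⊆ j antichainX X⊆P) x∈
        ...   | z , z∈ , α≤z , z≤x , rz with find (cover lt z∈ α≤z rz)
        ...     | y , y∈ , y≤z = ⊥-elim (below-free (∈⇒below y∈ (≤ᵣ-trans y≤z z≤x))
                  (rankToggle-at⁻ antichainX (All.lookup (rankToggle-⊆ j antichainX X⊆P) x∈) x∈))
        cover′ : ∀ {x} → x ∈ P → α ≤ᵣ x → rk x ≡ suc k → Below (rankToggle P j X) x
        cover′ {x} x∈P α≤x rx with m≤n⇒m<n∨m≡n k<j
        ... | inj₁ lt with find (cover lt x∈P α≤x rx)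
        ...   | y , y∈ , y≤x = ∈⇒below (rankToggle-off⁺ antichainX
                  (<⇒≢ (≤-<-trans (∸-monoˡ-≤ 1 (height-mono y≤x)) (subst (_< j) (sym rx) lt))) y∈) y≤x
        -- The new front forms here. At this moment nothing of X lies above α, so x can only be
        -- blocked by an element below it, which then survives this toggle and serves as the cover.
        cover′ {x} x∈P α≤x rx | inj₂ refl with below? X x
        ... | no ¬b = ∈⇒below (subst (λ i → x ∈ rankToggle P i X) rx (rankToggle-at⁺ antichainX x∈P
                (All.tabulate (λ y∈ → (λ x≤y → n≮n _ (proj₂ (above y∈ (≤ᵣ-trans α≤x x≤y)))) ,
                                      (λ y≤x → ¬b (∈⇒below y∈ y≤x)))))) ≤ᵣ-refl
        ... | yes b with find b
        ...   | y , y∈ , y≤x with y ≟ᵣ x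
        ...     | yes refl = contradiction (proj₂ (above y∈ α≤x)) (n≮n _)
        ...     | no y≢x = ∈⇒below (rankToggle-off⁺ antichainX
                  (<⇒≢ (subst (rk y <_) rx (rk-strict (All.lookup X⊆P y∈) y≤x y≢x))) y∈) y≤x

      sweep-step : ∀ {k s} → k ≤ rank P → Between k s → Between (suc k) (sweep₂ [ k ⋯ rank P ] s)
      sweep-step {k} {s} k≤ b rewrite interval-cons k≤ = record
        { valid = valid
        ; X⊆Y = X⊆Y
        ; Y⊆X = Y⊆X
        ; above = λ x∈ α≤x → proj₁ (above x∈ α≤x)
        ; cover = λ x∈ α≤x rx → cover (s≤s (subst (_≤ rank P) rx (rk≤rank x∈))) x∈ α≤x rx
        }
        where
        open During (interval-induction sweep₂ toggle₂ (λ _ → refl) (λ _ _ _ → refl) (During k) (rank P)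
          {suc k} (λ k<j _ → next k<j) (rank P ∸ k) ≤-refl
          (trans (+-suc (rank P ∸ k) k) (cong suc (m∸n+n≡m k≤))) (first b))

      end : ∀ {X} → Antichain X → All (_∈ P) X → α ∈ X → Between (suc (rank P)) (Rvac₂ [ 0 ⋯ rank P ] (X , remove α X))
      end {X} a X⊆P α∈X = interval-induction Rvac₂ (λ k → sweep₂ [ k ⋯ rank P ]) (λ _ → refl) (λ _ _ _ → refl)
          Between (rank P) (λ _ → sweep-step) (suc (rank P)) {0} z≤n (+-identityʳ _) start
        where
        only : ∀ {x} → x ∈ X → α ≤ᵣ x → x ≡ α
        only x∈ α≤x with allPairs-∈ a x∈ α∈X
        ... | inj₁ e = e
        ... | inj₂ (_ , α≰x) = contradiction α≤x α≰x
        remove⁻ : ∀ {x} → x ∈ remove α X → x ∈ X × x ≢ α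
        remove⁻ = ∈-filter⁻ (λ q → ¬? (q ≟ᵣ α))
        start : Between 0 (X , remove α X)
        start = record
          { valid = record
            { antichainX = a
            ; antichainY = AllPairs.filter⁺ _ a
            ; X⊆P = X⊆P
            ; Y⊆P′ = All.tabulate (λ y∈ → let y∈X , y≢α = remove⁻ y∈ in
                       P′⁺ (All.lookup X⊆P y∈X) (y≢α ∘ only y∈X))
            }
          ; X⊆Y = λ x∈ α≰x → ∈-filter⁺ (λ q → ¬? (q ≟ᵣ α)) x∈ (λ { refl → α≰x ≤ᵣ-refl })
          ; Y⊆X = proj₁ ∘ remove⁻
          ; above = λ x∈ α≤x → trans (cong rk (only x∈ α≤x)) rk-α
          ; cover = λ _ α≤x _ → ∈⇒below α∈X α≤x
          }

    -- After the last sweep the front would stand at rank 1 + rank P, where there are no elements;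
    -- hence nothing above α remains.
    Rvac-containing : Model P → ∀ {X} → Antichain X → All (_∈ P) X → α ∈ X → Rvac P X ≋ Rvac P′ (remove α X)
    Rvac-containing model {X} a X⊆P α∈X x rewrite Rvac-iterate P X | Rvac′ (remove α X) =
      (λ x∈ → X⊆Y x∈ (λ α≤x → 1+n≰n {rank P} (subst (_≤ rank P) (above x∈ α≤x)
        (rk≤rank (All.lookup (Valid.X⊆P valid) x∈))))) , Y⊆X
      where open Containing.Between (Containing.end model a X⊆P α∈X)

-- Levels: part (iii)

module Levels where

  open Toggle
  open Grid
  open Lia using (lia; con; goal; _:+_; _:≤_; _:<_; _:≡_; _:≰_; _:→_)

  module _ {r} {P : List (Root r)} (model : Model P)
           (lower : ∀ i → 1 ≤ Model.ρ model i → ∃ λ j → Model._⋖_ model j i)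
           (upper : ∀ i → Model.ρ model i < rank P → ∃ λ j → Model._⋖_ model i j) where
    open Model model

    descend : ∀ d i {k} → ρ i ≡ d + k → ∃ λ j → root j ≤ᵣ root i × ρ j ≡ k
    descend zero i e = i , ≤ᵣ-refl , e
    descend (suc d) i e with lower i (subst (1 ≤_) (sym e) (s≤s z≤n))
    ... | j , j⋖i with descend d j (suc-injective (trans (sym (⋖-rk j⋖i)) e))
    ...   | z , z≤j , ez = z , ≤ᵣ-trans z≤j (⋖⇒≤ j⋖i) , ez

    -- The ideals run through the unions of the lowest levels; from the whole
    -- poset the orbit passes to the empty ideal, where only times beyond the
    -- rank of an element remain.
    module _ (c : ℕ) (c≤ : c ≤ suc (rank P)) where

      X : Ix → ℕ → Set
      X i t = ρ i < c + t × c + t ≤ suc (rank P)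

      level-grid : Evolution X
      level-grid = record
        { X? = λ i t → (ρ i <? c + t) ×-dec (c + t ≤? suc (rank P))
        ; invariant = λ {i} {j} {t} e (p , q) → subst (_< c + t) (cong rk e) p , q
        ; mono = λ j⋖i _ (p , q) → <-trans (⋖-ρ< j⋖i) p , q
        ; grow = grow
        ; trace = trace
        }
        where
        grow : ∀ {i t} → t ≤ ρ i → ¬ X i t → (∀ {j} → j ⋖ i → X j t) → X i (suc t)
        grow {i} {t} t≤ ¬x low with ρ i <? c + t | ρ i ≟ 0
        ... | yes lt | yes e = contradiction
          (lt , lia 4 (λ t ρ c R → t :≤ ρ :→ ρ :≡ con 0 :→ c :≤ con 1 :+ R :→ goal (c :+ t :≤ con 1 :+ R))
                  t (ρ i) c (rank P) t≤ e c≤) ¬x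
        ... | no ¬lt | yes e =
          lia 3 (λ t ρ c → ρ :≡ con 0 :→ goal (ρ :< c :+ (con 1 :+ t))) t (ρ i) c e ,
          lia 4 (λ t ρ c R → t :≤ ρ :→ ρ :≡ con 0 :→ con 1 :+ ρ :≰ c :+ t :→ goal (c :+ (con 1 :+ t) :≤ con 1 :+ R))
            t (ρ i) c (rank P) t≤ e ¬lt
        ... | lt? | no ρ≢0 with lower i (n≢0⇒n>0 ρ≢0)
        ...   | j , j⋖i with low j⋖i
        ...     | p , q with lt?
        ...       | yes lt = contradiction (lt , q) ¬x
        ...       | no ¬lt =
          lia 4 (λ t ρ ρ′ c → ρ′ :< c :+ t :→ ρ :≡ con 1 :+ ρ′ :→ goal (ρ :< c :+ (con 1 :+ t)))
            t (ρ i) (ρ j) c p (⋖-rk j⋖i) ,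
          lia 5 (λ t ρ ρ′ c R → con 1 :+ ρ :≰ c :+ t :→ ρ :≤ R :→ goal (c :+ (con 1 :+ t) :≤ con 1 :+ R))
            t (ρ i) (ρ j) c (rank P) ¬lt (rk≤rank (root∈ i))
        trace : ∀ {i t} → t ≤ ρ i → X i (suc t) →
                (∃ λ j → i ⋖ j × X j (suc t)) ⊎ (¬ X i t × (∀ {j} → j ⋖ i → X j t))
        trace {i} {t} t≤ (p , q) with ρ i <? c + t
        ... | yes lt with upper i (lia 4 (λ ρ c t R → ρ :< c :+ t :→ c :+ (con 1 :+ t) :≤ con 1 :+ R :→ goal (ρ :< R))
                                     (ρ i) c t (rank P) lt q)
        ...   | j , i⋖j = inj₁ (j , i⋖j ,
          lia 4 (λ ρ ρ′ c t → ρ :< c :+ t :→ ρ′ :≡ con 1 :+ ρ :→ goal (ρ′ :< c :+ (con 1 :+ t)))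
            (ρ i) (ρ j) c t lt (⋖-rk i⋖j) , q)
        trace {i} {t} t≤ (p , q) | no ¬lt = inj₂ (¬lt ∘ proj₁ , λ {j} j⋖i →
          lia 4 (λ ρ ρ′ c t → ρ :< c :+ (con 1 :+ t) :→ ρ :≡ con 1 :+ ρ′ :→ goal (ρ′ :< c :+ t))
            (ρ i) (ρ j) c t p (⋖-rk j⋖i) ,
          ≤-trans (+-monoʳ-≤ c (n≤1+n t)) q)

      -- At the freezing time 1 + ρ the condition of `X` becomes ρ < 1 + rank P - c, so the
      -- generators of the final filter are those of rank 1 + rank P - c. The value c = 1 + rank P
      -- is included and stands for the empty antichain.
      Rvac-level : ∀ {A} → Antichain A → All (_∈ P) A → A ≋ level P c → Rvac P A ≋ level P (suc (rank P) ∸ c)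
      Rvac-level {A} anti A⊆P A≋ = antichain-≋ (Rvac-antichain anti A⊆P X⇒ X⇐) (level-antichain _) to from
        where
        open Evolution level-grid
        reach : ∀ i k → k ≤ ρ i → Below (level P k) (root i)
        reach i k k≤ with descend (ρ i ∸ k) i (sym (m∸n+n≡m k≤))
        ... | j , j≤i , e = ∈⇒below (level-∈⁺ (root∈ j) e) j≤i
        X⇒ : ∀ i → X i 0 → ¬ Below A (root i)
        X⇒ i (p , _) b with find b
        ... | x , x∈ , x≤i = <⇒≱ (subst (ρ i <_) (+-identityʳ c) p)
          (subst (_≤ ρ i) (proj₂ (level-∈⁻ (proj₁ (A≋ x) x∈))) (∸-monoˡ-≤ 1 (height-mono x≤i)))
        X⇐ : ∀ i → ¬ Below A (root i) → X i 0
        X⇐ i ¬b with c ≤? ρ i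
        ... | no c≰ = subst (ρ i <_) (sym (+-identityʳ c)) (≰⇒> c≰) , subst (_≤ suc (rank P)) (sym (+-identityʳ c)) c≤
        ... | yes c≤ρ with find (reach i c c≤ρ)
        ...   | x , x∈ , x≤i = contradiction (∈⇒below (proj₂ (A≋ x) x∈) x≤i) ¬b
        to : ∀ {x} → x ∈ Rvac P A → Below (level P (suc (rank P) ∸ c)) x
        to x∈ with index (All.lookup (Rvac-⊆ anti A⊆P X⇒ X⇐) x∈)
        ... | i , refl with suc (rank P) ∸ c ≤? ρ i
        ...   | yes le = reach i _ le
        ...   | no ≰ = contradiction (∈⇒below x∈ ≤ᵣ-refl) (final⇒ anti A⊆P X⇒ X⇐ i
          (lia 2 (λ ρ c → goal (ρ :< c :+ (con 1 :+ ρ))) (ρ i) c ,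
           lia 4 (λ ρ c R d → d :≰ ρ :→ d :+ c :≡ con 1 :+ R :→ goal (c :+ (con 1 :+ ρ) :≤ con 1 :+ R))
             (ρ i) c (rank P) (suc (rank P) ∸ c) ≰ (m∸n+n≡m c≤)))
        from : ∀ {y} → y ∈ level P (suc (rank P) ∸ c) → Below (Rvac P A) y
        from {y} y∈ with level-∈⁻ y∈ | below? (Rvac P A) y
        ... | y∈P , e | yes b = b
        ... | y∈P , e | no ¬b with index y∈P
        ...   | i , refl = contradiction (proj₂ (final⇐ anti A⊆P X⇒ X⇐ i ¬b))
          (lia 4 (λ ρ c R d → ρ :≡ d :→ d :+ c :≡ con 1 :+ R :→ goal (c :+ (con 1 :+ ρ) :≰ con 1 :+ R))
            (ρ i) c (rank P) (suc (rank P) ∸ c) e (m∸n+n≡m c≤))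

-- Counting functions and the local inequalities at an interval

module Steps where

  open Lia using (lia; con; goal; absurd; _:+_; _:≤_; _:<_; _:≡_; _:≰_; _:→_)

  -- Intervals of an antichain have distinct starts and distinct ends, so the counts rise by at most
  -- one at each position.
  record Step (F : ℕ → ℕ) : Set where
    field
      zero≡ : F 0 ≡ 0
      up    : ∀ x → F x ≤ F (suc x)
      slow  : ∀ x → F (suc x) ≤ suc (F x)

    bounded : ∀ x → F x ≤ x
    bounded zero = ≤-reflexive zero≡
    bounded (suc x) = ≤-trans (slow x) (s≤s (bounded x))

    increasing : ∀ {x y} → x ≤ y → F x ≤ F y
    increasing {y = zero} z≤n = ≤-refl
    increasing {x} {suc y} x≤ with m≤n⇒m<n∨m≡n x≤
    ... | inj₁ (s≤s x≤y) = ≤-trans (increasing x≤y) (up y)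
    ... | inj₂ refl = ≤-refl

    lipschitz : ∀ x t → F (t + x) ≤ t + F x
    lipschitz x zero = ≤-refl
    lipschitz x (suc t) = ≤-trans (slow (t + x)) (s≤s (lipschitz x t))

    dual : Step (λ x → x ∸ F x)
    dual = record
      { zero≡ = 0∸n≡0 (F 0)
      ; up = λ x → ≤-trans (∸-monoʳ-≤ (suc x) (slow x)) ≤-refl
      ; slow = λ x → ≤-trans (∸-monoʳ-≤ (suc x) (up x)) (m≤n+o⇒m∸n≤o (suc x) (F x) (≤-trans (≤-reflexive (sym
          (trans (+-suc (F x) (x ∸ F x)) (cong suc (m+[n∸m]≡n (bounded x)))))) ≤-refl))
      }

    -- F takes every value up to F n, at an argument as large as wanted
    -- as long as F has not exceeded the value there.
    attains : ∀ d {a n k} → d + a ≡ n → F a ≤ k → k ≤ F n → ∃ λ b → a ≤ b × b ≤ n × F b ≡ k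
    attains zero refl l u = _ , ≤-refl , ≤-refl , ≤-antisym l u
    attains (suc d) {a} {n} {k} e l u with F a ≟ k
    ... | yes q = a , ≤-refl , ≤-trans (m≤n+m a (suc d)) (≤-reflexive e) , q
    ... | no q with attains d {suc a} (trans (+-suc d a) e) (≤-trans (slow a) (≤∧≢⇒< l q)) u
    ...   | b , a<b , b≤n , v = b , <⇒≤ a<b , b≤n , v

  -- S x counts the interval starts below x, E y the interval ends up to y.
  record Balanced (N : ℕ) (S E : ℕ → ℕ) : Set where
    field
      S-step : Step S
      E-step : Step E
      E≤S    : ∀ z → E z ≤ S z
      total  : S N ≡ E N
    module S = Step S-step
    module E = Step E-step

  -- The mirror (a, b] ↦ (N - b, N - a] turns ends up to y into starts from N - y on; together with
  -- the starts before N - y these are all the starts.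
  Symmetric : ℕ → (S E : ℕ → ℕ) → Set
  Symmetric N S E = ∀ x y → x + y ≡ N → E y + S x ≡ S N

  -- If F counts a set of positions, this counts the complementary set.
  co : (ℕ → ℕ) → ℕ → ℕ
  co F x = x ∸ F x

  module _ {N : ℕ} {S E : ℕ → ℕ} (bal : Balanced N S E) where
    open Balanced bal

    co-balanced : Balanced N (co E) (co S)
    co-balanced = record
      { S-step = E.dual
      ; E-step = S.dual
      ; E≤S = λ z → ∸-monoʳ-≤ z (E≤S z)
      ; total = cong (N ∸_) (sym total)
      }

    co-symmetric : Symmetric N S E → Symmetric N (co E) (co S)
    co-symmetric sy x y e =
      lia 10 (λ N K EN x y Sx Ex Sy cEx cSy → cEx :+ Ex :≡ x :→ cSy :+ Sy :≡ y :→ x :+ y :≡ N :→ Ex :+ Sy :≡ K :→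
               EN :+ K :≡ N :→ goal (cSy :+ cEx :≡ EN))
        N (S N) (N ∸ E N) x y (S x) (E x) (S y) (x ∸ E x) (y ∸ S y)
        (m∸n+n≡m (E.bounded x)) (m∸n+n≡m (S.bounded y)) e
        (sy y x (trans (+-comm y x) e)) (trans (cong (_ +_) total) (m∸n+n≡m (E.bounded N)))

    module _ {a b t : ℕ} (t+a<b : t + a < b) where
      private
        -- The values that matter for (a, b]. At time t, the root itself is t + e1 ≤ s0 and its
        -- lower neighbours (a + 1, b] and (a, b - 1] are t + e1 ≤ s1 and t + e0 ≤ s0. At time 1 +
        -- t, the root is t + e0 < s1 and its upper neighbours (a - 1, b] and (a, b + 1] are t + e0
        -- < s0 and t + e1 < s1.
        e0 e1 s0 s1 : ℕ
        e0 = E (b ∸ suc t)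
        e1 = E (b ∸ t)
        s0 = S (a + t)
        s1 = S (a + suc t)

      pred-end : b ∸ t ≡ suc (b ∸ suc t)
      pred-end = +-∸-assoc 1 {b} {suc t} (≤-trans (s≤s (m≤m+n t a)) t+a<b)

      E-up : e0 ≤ e1
      E-up rewrite pred-end = E.up (b ∸ suc t)

      E-slow : e1 ≤ suc e0
      E-slow rewrite pred-end = E.slow (b ∸ suc t)

      S-up : s0 ≤ s1
      S-up rewrite +-suc a t = S.up (a + t)

      S-slow : s1 ≤ suc s0
      S-slow rewrite +-suc a t = S.slow (a + t)

      length-one : b ≡ suc a → t ≡ 0
      length-one e = lia 3 (λ a b t → t :+ a :< b :→ b :≡ con 1 :+ a :→ goal (t :≡ con 0)) a b t t+a<b e

      -- For an interval of length one the laws are those of a longer interval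
      -- whose two lower neighbours are empty intervals, where E ≤ S.
      short : b ≡ suc a → t + e1 ≤ s1 × t + e0 ≤ s0
      short e = subst (λ t → t + E (b ∸ t) ≤ S (a + suc t) × t + E (b ∸ suc t) ≤ S (a + t)) (sym (length-one e)) base
        where
        base : E b ≤ S (a + 1) × E (b ∸ 1) ≤ S (a + 0)
        base rewrite e | +-identityʳ a | +-comm a 1 = E≤S (suc a) , E≤S a

      -- Rules out the upper neighbour (a - 1, b] at the border a = 0, where s0 = S t is at most t.
      -- At the other border, b = N, the argument uses that E rises by at most t from N - t to N.
      no-left : ∀ {k} → t ≤ k → a ≡ 0 → ¬ (k + e0 < s0)
      no-left {k} t≤k refl h = lia 4 (λ e t s k → s :≤ t :→ t :≤ k :→ k :+ e :< s :→ absurd) e0 t s0 k (S.bounded t) t≤k h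

      no-right : ∀ {k} → t ≤ k → b ≡ N → ¬ (k + e1 < s1)
      no-right {k} t≤k refl h = lia 5 (λ e t s K k → K :≤ t :+ e :→ t :≤ k :→ k :+ e :< s :→ s :≤ K :→ absurd)
        e1 t s1 (S N) k
        (≤-trans (≤-reflexive (trans total (cong E (sym (m+[n∸m]≡n (<⇒≤ (≤-trans (s≤s (m≤m+n t a)) t+a<b)))))))
                 (E.lipschitz (b ∸ t) t)) t≤k h
        (S.increasing (subst (_≤ b) (trans (cong suc (+-comm t a)) (sym (+-suc a t))) t+a<b))

      -- With k = t this is the law for the threshold ≤; k = 1 + t gives the law for <, which the
      -- twisted rule needs beyond the middle.
      grow-core : ∀ k → ¬ (k + e1 ≤ s0) → k + e1 ≤ s1 → k + e0 ≤ s0 → k + e0 < s1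
      grow-core k = lia 5 (λ k e0 e1 s0 s1 → s1 :≤ con 1 :+ s0 :→ s0 :≤ s1 :→ k :+ e1 :≰ s0 :→ k :+ e1 :≤ s1 :→ k :+ e0 :≤ s0 :→
                          goal (k :+ e0 :< s1)) k e0 e1 s0 s1 S-slow S-up

      trace-core : ∀ k → k + e0 < s1 →
                   k + e0 < s0 ⊎ k + e1 < s1 ⊎ (¬ (k + e1 ≤ s0) × k + e1 ≤ s1 × k + e0 ≤ s0)
      trace-core k h with k + e0 <? s0 | k + e1 <? s1
      ... | yes p | _ = inj₁ p
      ... | no _ | yes q = inj₂ (inj₁ q)
      ... | no p | no q = inj₂ (inj₂
        ( lia 5 (λ k e0 e1 s0 s1 → s1 :≤ con 1 :+ s0 :→ k :+ e0 :< s1 :→ con 1 :+ (k :+ e0) :≰ s0 :→ con 1 :+ (k :+ e1) :≰ s1 :→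
              goal (k :+ e1 :≰ s0)) k e0 e1 s0 s1 S-slow h p q
        , lia 5 (λ k e0 e1 s0 s1 → e1 :≤ con 1 :+ e0 :→ k :+ e0 :< s1 :→ goal (k :+ e1 :≤ s1)) k e0 e1 s0 s1 E-slow h
        , lia 4 (λ k e0 s0 s1 → s1 :≤ con 1 :+ s0 :→ k :+ e0 :< s1 :→ goal (k :+ e0 :≤ s0)) k e0 s0 s1 S-slow h))

      -- For a central interval the lower neighbours (a + 1, b] and (a, b - 1] are mirror images of
      -- each other, and so are the two upper neighbours; the equation makes their conditions
      -- equivalent.
      mirror : Symmetric N S E → a + b ≡ N → e1 + s0 ≡ e0 + s1
      mirror sy refl = trans (sy (a + t) (b ∸ t) (trans (+-assoc a t (b ∸ t)) (cong (a +_) (m+[n∸m]≡n t≤b))))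
          (sym (sy (a + suc t) (b ∸ suc t) (trans (+-assoc a (suc t) (b ∸ suc t)) (cong (a +_) (m+[n∸m]≡n t<b)))))
        where
        t<b : t < b
        t<b = ≤-trans (s≤s (m≤m+n t a)) t+a<b
        t≤b : t ≤ b
        t≤b = <⇒≤ t<b

-- Root posets as posets of intervals

module Models where

  open Toggle
  open Grid
  open Lia using (lia; con; goal; _:+_; _:≤_; _:<_; _:≡_; _:→_)
  open Steps

  -- The interval (start, end].
  record FullIx (N : ℕ) : Set where
    constructor full
    field
      {start end} : ℕ
      start<end   : start < end
      end≤N       : end ≤ N

  record FullRoots {r} (P : List (Root r)) (N : ℕ) : Set where
    field
      ranked  : RankedList P
      vec     : ℕ → ℕ → Root r
      vec∈    : ∀ {a b} → a < b → b ≤ N → vec a b ∈ P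
      vec∈⁻   : ∀ {x} → x ∈ P → ∃ λ (i : FullIx N) → vec (FullIx.start i) (FullIx.end i) ≡ x
      reflect : ∀ {a b c d} → a < b → b ≤ N → c < d → d ≤ N → vec a b ≤ᵣ vec c d → c ≤ a × b ≤ d
      embed   : ∀ {a b c d} → c ≤ a → b ≤ d → vec a b ≤ᵣ vec c d
      rk-vec  : ∀ {a b} → a < b → b ≤ N → suc (rk (vec a b) + a) ≡ b

  -- One of each pair of mirror intervals (a, b] and (N - b, N - a] in {1..N};
  -- the colour is relevant only for those ending in the middle m.
  record HalfIx (N : ℕ) : Set where
    constructor half
    field
      {start end} : ℕ
      start<end   : start < end
      sum≤N       : start + end ≤ N
      colour      : Bool

  -- Types B and C have N = 2r - 1 and m = r, and their colours make no difference. Type D has N =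
  -- 2r - 3 and m = r - 1; there the colours tell which of the two simple roots of the fork a root
  -- ending in m contains.
  record HalfRoots {r} (P : List (Root r)) (N m : ℕ) : Set where
    field
      middle  : suc N ≡ m + m
      ranked  : RankedList P
      vec     : ℕ → ℕ → Bool → Root r
      vec∈    : ∀ {a b} ε → a < b → a + b ≤ N → vec a b ε ∈ P
      vec∈⁻   : ∀ {x} → x ∈ P → ∃ λ (i : HalfIx N) → vec (HalfIx.start i) (HalfIx.end i) (HalfIx.colour i) ≡ x
      reflect : ∀ {a b ε c d δ} → a < b → a + b ≤ N → c < d → c + d ≤ N → vec a b ε ≤ᵣ vec c d δ → c ≤ a × b ≤ d
      embed   : ∀ {a b c d} ε → c ≤ a → b ≤ d → vec a b ε ≤ᵣ vec c d ε
      plain   : ∀ {a b ε δ} → b ≢ m → vec a b ε ≡ vec a b δ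
      rk-vec  : ∀ {a b} ε → a < b → a + b ≤ N → suc (rk (vec a b ε) + a) ≡ b
      colours : (∀ {a c ε δ} → a < m → c < m → vec a m ε ≤ᵣ vec c m δ → ε ≡ δ) ⊎ (∀ {a b ε δ} → vec a b ε ≡ vec a b δ)

  rank-bound : ∀ {ρ a b t} → suc (ρ + a) ≡ b → t ≤ ρ → t + a < b
  rank-bound {ρ} {a} {b} {t} e t≤ = lia 4 (λ ρ a b t → con 1 :+ (ρ :+ a) :≡ b :→ t :≤ ρ :→ goal (t :+ a :< b)) ρ a b t e t≤

  module Full {r} {P : List (Root r)} {N} (roots : FullRoots P N) where
    open FullRoots roots
    open FullIx

    root : FullIx N → Root r
    root i = vec (start i) (end i)

    infix 4 _⋖_
    _⋖_ : FullIx N → FullIx N → Set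
    i ⋖ j = (start i ≡ suc (start j) × end i ≡ end j) ⊎ (start i ≡ start j × suc (end i) ≡ end j)

    model : Model P
    model = record
      { ranked = ranked
      ; Ix = FullIx N
      ; root = root
      ; root∈ = λ i → vec∈ (start<end i) (end≤N i)
      ; index = vec∈⁻
      ; _⋖_ = _⋖_
      ; ⋖⇒≤ = λ { (inj₁ (refl , refl)) → embed (n≤1+n _) ≤-refl ; (inj₂ (refl , refl)) → embed ≤-refl (n≤1+n _) }
      ; ⋖-rk = λ {i} {j} → ⋖-rk {i} {j}
      ; saturated = λ {i} {j} → saturated {i} {j}
      }
      where
      ⋖-rk : ∀ {i j} → i ⋖ j → rk (root j) ≡ suc (rk (root i))
      ⋖-rk {i} {j} (inj₁ (refl , refl)) =
        lia 4 (λ ρ σ a b → con 1 :+ (ρ :+ (con 1 :+ a)) :≡ b :→ con 1 :+ (σ :+ a) :≡ b :→ goal (σ :≡ con 1 :+ ρ))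
          (rk (root i)) (rk (root j)) (start j) (end i) (rk-vec (start<end i) (end≤N i)) (rk-vec (start<end j) (end≤N j))
      ⋖-rk {i} {j} (inj₂ (refl , refl)) =
        lia 4 (λ ρ σ a b → con 1 :+ (ρ :+ a) :≡ b :→ con 1 :+ (σ :+ a) :≡ con 1 :+ b :→ goal (σ :≡ con 1 :+ ρ))
          (rk (root i)) (rk (root j)) (start j) (end i) (rk-vec (start<end i) (end≤N i)) (rk-vec (start<end j) (end≤N j))
      saturated : ∀ {i j} → root i ≤ᵣ root j → root i ≢ root j → ∃ λ k → k ⋖ j × root i ≤ᵣ root k
      saturated {i} {full c<d d≤N} i≤j i≢j with reflect (start<end i) (end≤N i) c<d d≤N i≤j
      ... | c≤a , b≤d with m≤n⇒m<n∨m≡n c≤a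
      ...   | inj₁ c<a = (full (<-≤-trans (≤-<-trans c<a (start<end i)) b≤d) d≤N) , inj₁ (refl , refl) , embed c<a b≤d
      ...   | inj₂ refl with m≤n⇒m<n∨m≡n b≤d
      ...     | inj₂ refl = contradiction refl i≢j
      ...     | inj₁ (s≤s b≤d′) = (full (<-≤-trans (start<end i) b≤d′) (<⇒≤ d≤N)) , inj₂ (refl , refl) , embed ≤-refl b≤d′

    open Model model using (ρ; Evolution)

    rank-at : ∀ i → suc (ρ i + start i) ≡ end i
    rank-at i = rk-vec (start<end i) (end≤N i)

    lower : ∀ i → 1 ≤ ρ i → ∃ λ j → j ⋖ i
    lower i h = (full (rank-bound (rank-at i) h) (end≤N i)) , inj₁ (refl , refl)

    upper : ∀ i → suc (ρ i) < N → ∃ λ j → i ⋖ j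
    upper i@(full {suc a} a<b b≤N) h = (full (<-trans (n<1+n a) a<b) b≤N) , inj₁ (refl , refl)
    upper i@(full {zero} {b} a<b b≤N) h = (full (m≤n⇒m≤1+n a<b) lt) , inj₂ (refl , refl)
      where
      lt : b < N
      lt = lia 3 (λ ρ b N → con 1 :+ (ρ :+ con 0) :≡ b :→ con 1 :+ ρ :< N :→ goal (b :< N)) (ρ i) b N (rank-at i) h

    module _ {S E : ℕ → ℕ} (bal : Balanced N S E) where
      open Balanced bal

      Ideal : FullIx N → ℕ → Set
      Ideal i t = t + E (end i ∸ t) ≤ S (start i + t)

      evolution : Evolution Ideal
      evolution = record
        { X? = λ i t → t + E (end i ∸ t) ≤? S (start i + t)
        ; invariant = λ {i} {j} → respects {i} {j}
        ; mono = λ {i} {j} → mono {i} {j}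
        ; grow = λ {i} → grow {i}
        ; trace = λ {i} → trace {i}
        }
        where
        respects : ∀ {i j t} → root i ≡ root j → Ideal i t → Ideal j t
        respects {i} {j} {t} e x
          with reflect (start<end i) (end≤N i) (start<end j) (end≤N j) (subst (root i ≤ᵣ_) e ≤ᵣ-refl)
             | reflect (start<end j) (end≤N j) (start<end i) (end≤N i) (subst (_≤ᵣ root i) e ≤ᵣ-refl)
        ... | c≤a , b≤d | a≤c , d≤b =
          subst₂ (λ a b → t + E (b ∸ t) ≤ S (a + t)) (≤-antisym a≤c c≤a) (≤-antisym b≤d d≤b) x
        mono : ∀ {i j t} → j ⋖ i → t ≤ ρ i → Ideal i t → Ideal j t
        mono {i} {j} {t} (inj₁ (refl , refl)) _ x = ≤-trans x (S.up _)
        mono {i} {j} {t} (inj₂ (refl , refl)) _ x = ≤-trans (+-monoʳ-≤ t (E.increasing (∸-monoˡ-≤ t (n≤1+n (end j))))) x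
        grow : ∀ {i t} → t ≤ ρ i → ¬ Ideal i t → (∀ {j} → j ⋖ i → Ideal j t) → Ideal i (suc t)
        grow {i@(full {a} {suc b} a<b b≤N)} {t} t≤ ¬x low with end i ≟ suc a
        ... | yes refl = grow-core bal (rank-bound (rank-at i) t≤) t ¬x
                           (proj₁ (short bal (rank-bound (rank-at i) t≤) refl)) (proj₂ (short bal (rank-bound (rank-at i) t≤) refl))
        grow {i@(full {a} {suc b} a<b b≤N)} {t} t≤ ¬x low | no b≢ =
          grow-core bal (rank-bound (rank-at i) t≤) t ¬x
            (subst (λ s → t + E (suc b ∸ t) ≤ S s) (sym (+-suc a t)) (low {full a<b′ b≤N} (inj₁ (refl , refl))))
            (low {full (s≤s⁻¹ a<b′) (<⇒≤ b≤N)} (inj₂ (refl , refl)))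
          where
          a<b′ : suc a < suc b
          a<b′ = ≤∧≢⇒< a<b (b≢ ∘ sym)
        trace : ∀ {i t} → t ≤ ρ i → Ideal i (suc t) →
                (∃ λ j → i ⋖ j × Ideal j (suc t)) ⊎ (¬ Ideal i t × (∀ {j} → j ⋖ i → Ideal j t))
        trace {i} {t} t≤ x with trace-core bal (rank-bound (rank-at i) t≤) t x
        trace {i@(full {zero} a<b b≤N)} t≤ x | inj₁ p = contradiction p (no-left bal (rank-bound (rank-at i) t≤) ≤-refl refl)
        trace {full {suc a} {b} a<b b≤N} {t} t≤ x | inj₁ p = inj₁ ((full (<-trans (n<1+n a) a<b) b≤N) , inj₁ (refl , refl) ,
          subst (λ s → suc t + E (b ∸ suc t) ≤ S s) (sym (+-suc a t)) p)
        trace {i} {t} t≤ x | inj₂ (inj₁ p) with end i ≟ N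
        ... | yes e = contradiction p (no-right bal (rank-bound (rank-at i) t≤) ≤-refl e)
        ... | no ≢N = inj₁ ((full (m≤n⇒m≤1+n (start<end i)) (≤∧≢⇒< (end≤N i) ≢N)) , inj₂ (refl , refl) , p)
        trace {i} {t} t≤ x | inj₂ (inj₂ (¬x , r , l)) = inj₂ (¬x , λ where
          (inj₁ (refl , refl)) → subst (λ s → t + E (end i ∸ t) ≤ S s) (+-suc (start i) t) r
          {j} (inj₂ (refl , e)) → subst (λ s → t + E s ≤ S (start i + t)) (cong (_∸ suc t) (sym e)) l)

  odd : ℕ → Bool
  odd zero = false
  odd (suc n) = not (odd n)

  xor-not : ∀ b x → b xor not x ≡ not (b xor x)
  xor-not true x = refl
  xor-not false x = refl

  ≢⇒≡not : ∀ {x y : Bool} → x ≢ y → x ≡ not y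
  ≢⇒≡not {true} {true} p = contradiction refl p
  ≢⇒≡not {true} {false} p = refl
  ≢⇒≡not {false} {true} p = refl
  ≢⇒≡not {false} {false} p = contradiction refl p

  not≢ : ∀ {x : Bool} → not x ≢ x
  not≢ {true} ()
  not≢ {false} ()

  module Half {r} {P : List (Root r)} {N m} (roots : HalfRoots P N m) where
    open HalfRoots roots
    open HalfIx

    root : HalfIx N → Root r
    root i = vec (start i) (end i) (colour i)

    infix 4 _⋖_
    _⋖_ : HalfIx N → HalfIx N → Set
    i ⋖ j = (start i ≡ suc (start j) × end i ≡ end j × (end i ≡ m → colour i ≡ colour j))
          ⊎ (start i ≡ start j × suc (end i) ≡ end j)

    -- Colours need to agree only if both intervals end in m; otherwise `plain` recolours one of the
    -- two roots.
    embed′ : ∀ {a b c d ε δ} → c ≤ a → b ≤ d → (b ≡ m → d ≡ m → ε ≡ δ) → vec a b ε ≤ᵣ vec c d δ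
    embed′ {a} {b} {c} {d} {ε} {δ} c≤a b≤d eq with b ≟ m
    ... | no b≢m = subst (_≤ᵣ vec c d δ) (plain b≢m) (embed δ c≤a b≤d)
    ... | yes b≡m with d ≟ m
    ...   | yes d≡m = subst (λ δ → vec a b ε ≤ᵣ vec c d δ) (eq b≡m d≡m) (embed ε c≤a b≤d)
    ...   | no d≢m = subst (vec a b ε ≤ᵣ_) (plain d≢m) (embed ε c≤a b≤d)

    middle-start : ∀ {a} → a + m ≤ N → a < m
    middle-start {a} h = lia 3 (λ a m N → a :+ m :≤ N :→ con 1 :+ N :≡ m :+ m :→ goal (a :< m)) a m N h middle

    rank-at : ∀ i → suc (rk (root i) + start i) ≡ end i
    rank-at i = rk-vec (colour i) (start<end i) (sum≤N i)

    model : Model P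
    model = record
      { ranked = ranked
      ; Ix = HalfIx N
      ; root = root
      ; root∈ = λ i → vec∈ (colour i) (start<end i) (sum≤N i)
      ; index = vec∈⁻
      ; _⋖_ = _⋖_
      ; ⋖⇒≤ = λ { (inj₁ (refl , refl , e)) → embed′ (n≤1+n _) ≤-refl (λ p _ → e p)
                ; (inj₂ (refl , refl)) → embed′ ≤-refl (n≤1+n _) (λ p q → contradiction (trans q (sym p)) 1+n≢n) }
      ; ⋖-rk = λ {i} {j} → ⋖-rk {i} {j}
      ; saturated = λ {i} {j} → saturated {i} {j}
      }
      where
      ⋖-rk : ∀ {i j} → i ⋖ j → rk (root j) ≡ suc (rk (root i))
      ⋖-rk {i} {j} (inj₁ (refl , refl , _)) =
        lia 4 (λ ρ σ a b → con 1 :+ (ρ :+ (con 1 :+ a)) :≡ b :→ con 1 :+ (σ :+ a) :≡ b :→ goal (σ :≡ con 1 :+ ρ))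
          (rk (root i)) (rk (root j)) (start j) (end i) (rank-at i) (rank-at j)
      ⋖-rk {i} {j} (inj₂ (refl , refl)) =
        lia 4 (λ ρ σ a b → con 1 :+ (ρ :+ a) :≡ b :→ con 1 :+ (σ :+ a) :≡ con 1 :+ b :→ goal (σ :≡ con 1 :+ ρ))
          (rk (root i)) (rk (root j)) (start j) (end i) (rank-at i) (rank-at j)
      saturated : ∀ {i j} → root i ≤ᵣ root j → root i ≢ root j → ∃ λ k → k ⋖ j × root i ≤ᵣ root k
      saturated {i@(half {a} {b} a<b a+b≤ ε)} {half {c} {suc d} c<d c+d≤ δ} i≤j i≢j
        with reflect a<b a+b≤ c<d c+d≤ i≤j
      ... | c≤a , b≤d with b ≟ suc d
      ...   | no b≢d = (half (<-≤-trans (≤-<-trans c≤a a<b) b≤d′) (≤-trans (+-monoʳ-≤ c (n≤1+n d)) c+d≤) ε) ,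
                       inj₂ (refl , refl) , embed ε c≤a b≤d′
        where
        b≤d′ : b ≤ d
        b≤d′ = s≤s⁻¹ (≤∧≢⇒< b≤d b≢d)
      ...   | yes refl with m≤n⇒m<n∨m≡n c≤a
      ...     | inj₁ c<a = (half (≤-<-trans c<a a<b) (≤-trans (+-monoˡ-≤ (suc d) c<a) a+b≤) δ) ,
                           inj₁ (refl , refl , λ _ → refl) , below
        where
        below : vec a (suc d) ε ≤ᵣ vec (suc c) (suc d) δ
        below with colours
        ... | inj₂ colourless = subst (_≤ᵣ vec (suc c) (suc d) δ) colourless (embed δ c<a ≤-refl)
        ... | inj₁ coloured = embed′ c<a ≤-refl (λ { refl _ → coloured a<b (middle-start c+d≤) i≤j })
      ...     | inj₂ refl = contradiction same i≢j
        where
        same : vec a (suc d) ε ≡ vec a (suc d) δ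
        same with colours
        ... | inj₂ colourless = colourless
        ... | inj₁ coloured with suc d ≟ m
        ...   | no ≢m = plain ≢m
        ...   | yes refl = cong (vec a (suc d)) (coloured a<b a<b i≤j)

    open Model model using (ρ; Evolution)

    root≡⇒ends : ∀ i j → root i ≡ root j → start i ≡ start j × end i ≡ end j
    root≡⇒ends i j e
      with reflect (start<end i) (sum≤N i) (start<end j) (sum≤N j) (subst (root i ≤ᵣ_) e ≤ᵣ-refl)
         | reflect (start<end j) (sum≤N j) (start<end i) (sum≤N i) (subst (_≤ᵣ root i) e ≤ᵣ-refl)
    ... | c≤a , b≤d | a≤c , d≤b = ≤-antisym a≤c c≤a , ≤-antisym b≤d d≤b

    lower : ∀ i → 1 ≤ ρ i → ∃ λ j → j ⋖ i
    lower i@(half {a} {suc b} a<b s≤ ε) h =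
      (half (s≤s⁻¹ (rank-bound (rank-at i) h)) (≤-trans (+-monoʳ-≤ a (n≤1+n b)) s≤) ε) , inj₂ (refl , refl)

    upper : ∀ i → suc (ρ i) < N → ∃ λ j → i ⋖ j
    upper i@(half {suc a} {b} a<b s≤ ε) h =
      (half (<-trans (n<1+n a) a<b) (<⇒≤ s≤) ε) , inj₁ (refl , refl , λ _ → refl)
    upper i@(half {zero} {b} a<b s≤ ε) h = (half (m≤n⇒m≤1+n a<b) lt ε) , inj₂ (refl , refl)
      where
      lt : b < N
      lt = lia 3 (λ ρ b N → con 1 :+ (ρ :+ con 0) :≡ b :→ con 1 :+ ρ :< N :→ goal (b :< N)) (ρ i) b N (rank-at i) h

    module _ {S E : ℕ → ℕ} (bal : Balanced N S E) (sy : Symmetric N S E) where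
      open Balanced bal

      Ideal : HalfIx N → ℕ → Set
      Ideal i t = t + E (end i ∸ t) ≤ S (start i + t)

      mirror-≤ : ∀ {k e0 e1 s0 s1} → e1 + s0 ≡ e0 + s1 → k + e0 ≤ s0 → k + e1 ≤ s1
      mirror-≤ {k} {e0} {e1} {s0} {s1} = lia 5 (λ k e0 e1 s0 s1 → e1 :+ s0 :≡ e0 :+ s1 :→ k :+ e0 :≤ s0 :→ goal (k :+ e1 :≤ s1)) k e0 e1 s0 s1

      evolution : Evolution Ideal
      evolution = record
        { X? = λ i t → t + E (end i ∸ t) ≤? S (start i + t)
        ; invariant = λ {i} {j} → respects {i} {j}
        ; mono = λ {i} {j} → mono {i} {j}
        ; grow = λ {i} → grow {i}
        ; trace = λ {i} → trace {i}
        }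
        where
        respects : ∀ {i j t} → root i ≡ root j → Ideal i t → Ideal j t
        respects {i} {j} {t} e x with root≡⇒ends i j e
        ... | e₁ , e₂ = subst₂ (λ a b → t + E (b ∸ t) ≤ S (a + t)) e₁ e₂ x
        mono : ∀ {i j t} → j ⋖ i → t ≤ ρ i → Ideal i t → Ideal j t
        mono {i} {j} {t} (inj₁ (refl , refl , _)) _ x = ≤-trans x (S.up _)
        mono {i} {j} {t} (inj₂ (refl , refl)) _ x = ≤-trans (+-monoʳ-≤ t (E.increasing (∸-monoˡ-≤ t (n≤1+n (end j))))) x
        grow : ∀ {i t} → t ≤ ρ i → ¬ Ideal i t → (∀ {j} → j ⋖ i → Ideal j t) → Ideal i (suc t)
        grow {i@(half {a} {suc b} a<b s≤ ε)} {t} t≤ ¬x low with suc b ≟ suc a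
        ... | yes refl = grow-core bal (rank-bound (rank-at i) t≤) t ¬x
                           (proj₁ (short bal (rank-bound (rank-at i) t≤) refl)) (proj₂ (short bal (rank-bound (rank-at i) t≤) refl))
        ... | no b≢ = grow-core bal (rank-bound (rank-at i) t≤) t ¬x left right
          where
          a<b′ : suc a < suc b
          a<b′ = ≤∧≢⇒< a<b (b≢ ∘ sym)
          right : t + E (b ∸ t) ≤ S (a + t)
          right = low {half (s≤s⁻¹ a<b′) (≤-trans (+-monoʳ-≤ a (n≤1+n b)) s≤) ε} (inj₂ (refl , refl))
          left : t + E (suc b ∸ t) ≤ S (a + suc t)
          left with a + suc b ≟ N
          -- (a + 1, b] has left the half; its mirror image (a, b - 1] stands in for it.
          ... | yes e = mirror-≤ {t} (mirror bal (rank-bound (rank-at i) t≤) sy e) right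
          ... | no ≢N = subst (λ s → t + E (suc b ∸ t) ≤ S s) (sym (+-suc a t))
                          (low {half a<b′ (≤∧≢⇒< s≤ ≢N) ε} (inj₁ (refl , refl , λ _ → refl)))
        trace : ∀ {i t} → t ≤ ρ i → Ideal i (suc t) →
                (∃ λ j → i ⋖ j × Ideal j (suc t)) ⊎ (¬ Ideal i t × (∀ {j} → j ⋖ i → Ideal j t))
        trace-left : ∀ {i t} → t ≤ ρ i → t + E (end i ∸ suc t) < S (start i + t) → ∃ λ j → i ⋖ j × Ideal j (suc t)
        trace-left {i@(half {zero} a<b s≤ ε)} t≤ p = contradiction p (no-left bal (rank-bound (rank-at i) t≤) ≤-refl refl)
        trace-left {half {suc a} {b} a<b s≤ ε} {t} t≤ p =
          (half (<-trans (n<1+n a) a<b) (<⇒≤ s≤) ε) , inj₁ (refl , refl , λ _ → refl) ,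
          subst (λ s → suc t + E (b ∸ suc t) ≤ S s) (sym (+-suc a t)) p
        trace {i} {t} t≤ x with trace-core bal (rank-bound (rank-at i) t≤) t x
        trace {i} t≤ x | inj₁ p = inj₁ (trace-left {i} t≤ p)
        trace {i} {t} t≤ x | inj₂ (inj₁ p) with start i + end i ≟ N
        -- (a, b + 1] is outside the half, so the upper neighbour is taken to be its mirror image (a
        -- - 1, b].
        ... | yes e = inj₁ (trace-left {i} t≤ (mirror-≤ {suc t} (sym (mirror bal (rank-bound (rank-at i) t≤) sy e)) p))
        ... | no ≢N = inj₁ ((half (m≤n⇒m≤1+n (start<end i)) (subst (_≤ N) (sym (+-suc (start i) (end i))) (≤∧≢⇒< (sum≤N i) ≢N)) (colour i)) ,
                            inj₂ (refl , refl) , p)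
        trace {i} {t} t≤ x | inj₂ (inj₂ (¬x , r , l)) = inj₂ (¬x , λ where
          (inj₁ (refl , refl , _)) → subst (λ s → t + E (end i ∸ t) ≤ S s) (+-suc (start i) t) r
          {j} (inj₂ (refl , e)) → subst (λ s → t + E s ≤ S (start i + t)) (cong (_∸ suc t) (sym e)) l)

-- Type D: evolution under the twisted rule

module Twisted where

  open Toggle
  open Grid
  open Lia using (lia; con; goal; absurd; _:+_; _:≤_; _:<_; _:≡_; _:≰_; _:→_)
  open Steps
  open Models

  -- In type D the two roots ending in the middle m evolve with different
  -- thresholds, v ≤ s and v < s, which they exchange over time.
  data Twisted (m : ℕ) (c : Bool) (b v s : ℕ) (ε : Bool) : Set where
    strict : v < s → Twisted m c b v s ε
    left   : b < m → v ≡ s → Twisted m c b v s ε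
    mid    : b ≡ m → v ≡ s → ε ≡ c xor odd s → Twisted m c b v s ε

  module _ {m : ℕ} {c : Bool} where

    twisted? : ∀ b v s ε → Dec (Twisted m c b v s ε)
    twisted? b v s ε with v <? s | v ≟ s | <-cmp b m | ε Bool.≟ (c xor odd s)
    ... | yes p | _ | _ | _ = yes (strict p)
    ... | no p | no q | _ | _ = no λ { (strict x) → p x ; (left _ e) → q e ; (mid _ e _) → q e }
    ... | no p | yes q | tri< l _ _ | _ = yes (left l q)
    ... | no p | yes q | tri≈ _ e _ | yes f = yes (mid e q f)
    ... | no p | yes q | tri≈ n e _ | no f = no λ { (strict x) → p x ; (left x _) → n x ; (mid _ _ x) → f x }
    ... | no p | yes q | tri> n e _ | _ = no λ { (strict x) → p x ; (left x _) → n x ; (mid x _ _) → e x }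

    twisted⇒≤ : ∀ {b v s ε} → Twisted m c b v s ε → v ≤ s
    twisted⇒≤ (strict p) = <⇒≤ p
    twisted⇒≤ (left _ e) = ≤-reflexive e
    twisted⇒≤ (mid _ e _) = ≤-reflexive e

    left⁺ : ∀ {b v s ε} → b < m → v ≤ s → Twisted m c b v s ε
    left⁺ b<m v≤s with m≤n⇒m<n∨m≡n v≤s
    ... | inj₁ p = strict p
    ... | inj₂ e = left b<m e

    right⁻ : ∀ {b v s ε} → m < b → Twisted m c b v s ε → v < s
    right⁻ m<b (strict p) = p
    right⁻ m<b (left b<m _) = contradiction b<m (<⇒≯ m<b)
    right⁻ m<b (mid refl _ _) = contradiction m<b (n≮n _)

    -- A tie in the middle admits only one colour. Since (a, m + 1] lies above both colours of (a,
    -- m], this is where the threshold < beyond the middle originates.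
    both⁻ : ∀ {b v s} → m ≤ b → (∀ ε → Twisted m c b v s ε) → v < s
    both⁻ {b} {v} {s} m≤b h with h (not (c xor odd s))
    ... | strict p = p
    ... | left b<m _ = contradiction b<m (≤⇒≯ m≤b)
    ... | mid _ _ e = contradiction e not≢

    somewhere : ∀ {b v s} → b ≤ m → v ≤ s → ∃ λ ε → Twisted m c b v s ε
    somewhere {b} {v} {s} b≤m v≤s with m≤n⇒m<n∨m≡n v≤s | m≤n⇒m<n∨m≡n b≤m
    ... | inj₁ p | _ = true , strict p
    ... | inj₂ e | inj₁ b<m = true , left b<m e
    ... | inj₂ e | inj₂ b≡m = c xor odd s , mid b≡m e refl

    Mid : ℕ → ℕ → Bool → Set
    Mid v s ε = Twisted m c m v s ε

    flip-odd : ∀ {s ε} → ε ≢ c xor odd s → ε ≡ c xor odd (suc s)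
    flip-odd {s} p = trans (≢⇒≡not p) (sym (xor-not c (odd s)))

    flip-odd⁻ : ∀ {s ε} → ε ≡ c xor odd (suc s) → ε ≢ c xor odd s
    flip-odd⁻ {s} p q = not≢ (trans (sym (xor-not c (odd s))) (trans (sym p) q))

    mid-grow : ∀ {s₀ s₁ v₀ v₁ ε} → s₁ ≡ s₀ ⊎ s₁ ≡ suc s₀ →
               ¬ Mid v₁ s₀ ε → Mid v₁ s₁ ε → v₀ ≤ s₀ → Mid (suc v₀) s₁ ε
    mid-grow (inj₁ refl) ¬x x _ = contradiction x ¬x
    mid-grow {s₀} {v₀ = v₀} {v₁} {ε} (inj₂ refl) ¬x x v₀≤ with m≤n⇒m<n∨m≡n (s≤s v₀≤)
    ... | inj₁ p = strict p
    ... | inj₂ e = mid refl e (colour x)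
      where
      colour : Mid v₁ (suc s₀) ε → ε ≡ c xor odd (suc s₀)
      colour (mid _ _ e) = e
      colour (left p _) = contradiction p (n≮n _)
      colour (strict p) with m≤n⇒m<n∨m≡n (s≤s⁻¹ p)
      ... | inj₁ q = contradiction (strict q) ¬x
      ... | inj₂ q = flip-odd {s₀} (λ e → ¬x (mid refl q e))

    -- The upper neighbour beyond the middle has the threshold <. The two equations accompany that
    -- case because a simple root of the fork has no such neighbour, and there they contradict the
    -- mirror symmetry.
    mid-trace : ∀ {s₀ s₁ v₀ v₁ ε} → s₁ ≡ s₀ ⊎ s₁ ≡ suc s₀ → v₁ ≡ v₀ ⊎ v₁ ≡ suc v₀ → Mid (suc v₀) s₁ ε →
                Mid (suc v₀) s₀ ε ⊎ (suc v₁ < s₁ × v₁ ≡ v₀ × s₁ ≡ suc s₀) ⊎ (¬ Mid v₁ s₀ ε × Mid v₁ s₁ ε × v₀ ≤ s₀)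
    mid-trace (inj₁ refl) _ x = inj₁ x
    mid-trace (inj₂ refl) _ (left p _) = contradiction p (n≮n _)
    mid-trace {s₀} {ε = ε} (inj₂ refl) v₁≡ (strict p) with m≤n⇒m<n∨m≡n (s≤s⁻¹ p)
    ... | inj₁ q = inj₁ (strict q)
    ... | inj₂ q with ε Bool.≟ (c xor odd s₀)
    ...   | yes e = inj₁ (mid refl q e)
    ...   | no e with v₁≡
    ...     | inj₁ refl = inj₂ (inj₁ (s≤s (≤-reflexive q) , refl , refl))
    ...     | inj₂ refl = inj₂ (inj₂ ((λ { (strict l) → contradiction l (≤⇒≯ (≤-reflexive (sym q))) ; (left l _) → n≮n _ l ; (mid _ _ f) → e f })
                                    , strict p , ≤-trans (n≤1+n _) (≤-reflexive q)))
    mid-trace {s₀} (inj₂ refl) (inj₁ refl) (mid _ e f) = inj₂ (inj₂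
      ((λ { (strict l) → contradiction l (≤⇒≯ (≤-reflexive (sym (suc-injective e)))) ; (left l _) → n≮n _ l ; (mid _ _ g) → flip-odd⁻ {s₀} f g })
      , strict (s≤s (≤-reflexive (suc-injective e))) , ≤-reflexive (suc-injective e)))
    mid-trace {s₀} (inj₂ refl) (inj₂ refl) (mid _ e f) = inj₂ (inj₂
      ((λ y → contradiction (twisted⇒≤ y) (<⇒≱ (≤-reflexive (sym e))))
      , mid refl e f , ≤-reflexive (suc-injective e)))

  near : ∀ {x y} → x ≤ y → y ≤ suc x → y ≡ x ⊎ y ≡ suc x
  near {x} x≤y y≤ with m≤n⇒m<n∨m≡n x≤y
  ... | inj₁ x<y = inj₂ (≤-antisym y≤ x<y)
  ... | inj₂ e = inj₁ (sym e)

  -- Stands in for E ≤ S at the simple roots (m - 1, m] of the fork, which have no lower neighbours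
  -- from which the twisted rule could be deduced. The pair built from a mixed antichain satisfies
  -- it because its special interval starts before m - 1.
  record Straddling (m : ℕ) (S E : ℕ → ℕ) : Set where
    field
      E≤S⁻ : E m ≤ S (m ∸ 1)
      E⁻<S : E (m ∸ 1) < S m

  module _ {r} {P : List (Root r)} {N m} (roots : HalfRoots P N m) {S E : ℕ → ℕ} (bal : Balanced N S E)
           (sy : Symmetric N S E) (straddling : Straddling m S E) (c : Bool)
           (coloured : ∀ {a d ε δ} → a < m → d < m → HalfRoots.vec roots a m ε ≤ᵣ HalfRoots.vec roots d m δ → ε ≡ δ) where
    open HalfRoots roots using (middle)
    open HalfIx
    open Half roots
    open Model model using (ρ; Evolution)
    open Balanced bal
    open Straddling straddling

    TwistedIdeal : HalfIx N → ℕ → Set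
    TwistedIdeal i t = Twisted m c (end i) (t + E (end i ∸ t)) (S (start i + t)) (colour i)

    private
      beyond-sum : ∀ {a b} → m < b → a + b ≤ N → suc a < m
      beyond-sum {a} {b} m<b h = lia 4 (λ a b m N → m :< b :→ a :+ b :≤ N :→ con 1 :+ N :≡ m :+ m :→ goal (con 1 :+ a :< m))
        a b m N m<b h middle

      before-sum : ∀ {a b} → a < b → b < m → suc a + b ≤ N
      before-sum {a} {b} a<b b<m = lia 4 (λ a b m N → a :< b :→ b :< m :→ con 1 :+ N :≡ m :+ m :→ goal (con 1 :+ a :+ b :≤ N))
        a b m N a<b b<m middle

      mid-sum : ∀ {a} → suc a < m → suc a + m ≤ N
      mid-sum {a} h = lia 3 (λ a m N → con 1 :+ a :< m :→ con 1 :+ N :≡ m :+ m :→ goal (con 1 :+ a :+ m :≤ N))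
        a m N h middle

      last-sum : ∀ {a} → m ≡ suc a → a + m ≡ N
      last-sum {a} h = lia 3 (λ a m N → m :≡ con 1 :+ a :→ con 1 :+ N :≡ m :+ m :→ goal (a :+ m :≡ N)) a m N h middle

    twisted-evolution : Evolution TwistedIdeal
    twisted-evolution = record
      { X? = λ i t → twisted? (end i) (t + E (end i ∸ t)) (S (start i + t)) (colour i)
      ; invariant = λ {i} {j} → respects {i} {j}
      ; mono = λ {i} {j} → mono {i} {j}
      ; grow = λ {i} → grow {i}
      ; trace = λ {i} → trace {i}
      }
      where
      respects : ∀ {i j t} → root i ≡ root j → TwistedIdeal i t → TwistedIdeal j t
      respects {i@(half {a} {b} a<b s≤ ε)} {j@(half s<e s≤′ δ)} {t} e x with root≡⇒ends i j e
      ... | refl , refl with x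
      ...   | strict p = strict p
      ...   | left p q = left p q
      ...   | mid refl q f = mid refl q (trans (sym (coloured a<b a<b (subst (root i ≤ᵣ_) e ≤ᵣ-refl))) f)

      mono : ∀ {i j t} → j ⋖ i → t ≤ ρ i → TwistedIdeal i t → TwistedIdeal j t
      mono {i} {j} {t} (inj₁ (refl , refl , e)) _ (strict p) = strict (<-≤-trans p (S.up _))
      mono {i} {j} {t} (inj₁ (refl , refl , e)) _ (left p q) = left⁺ p (≤-trans (≤-reflexive q) (S.up _))
      mono {i} {j} {t} (inj₁ (refl , refl , e)) _ (mid p q f) with near (S.up (start i + t)) (S.slow (start i + t))
      ... | inj₁ s≡ = mid p (trans q (sym s≡)) (trans (e p) (trans f (cong (λ s → c xor odd s) (sym s≡))))
      ... | inj₂ s≡ = strict (≤-reflexive (trans (cong suc q) (sym s≡)))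
      mono {i} {j} {t} (inj₂ (refl , refl)) _ x with <-cmp (end j) m
      ... | tri< l _ _ = left⁺ l (≤-trans (+-monoʳ-≤ t (E.increasing (∸-monoˡ-≤ t (n≤1+n (end j))))) (twisted⇒≤ x))
      ... | tri≈ _ refl _ = strict (≤-<-trans (+-monoʳ-≤ t (E.increasing (∸-monoˡ-≤ t (n≤1+n (end j))))) (right⁻ ≤-refl x))
      ... | tri> _ _ g = strict (≤-<-trans (+-monoʳ-≤ t (E.increasing (∸-monoˡ-≤ t (n≤1+n (end j))))) (right⁻ (m≤n⇒m≤1+n g) x))

      grow : ∀ {i t} → t ≤ ρ i → ¬ TwistedIdeal i t → (∀ {j} → j ⋖ i → TwistedIdeal j t) → TwistedIdeal i (suc t)
      grow {i@(half {a} {suc b} a<b s≤ ε)} {t} t≤ ¬x low with suc b ≟ suc a | <-cmp (suc b) m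
      ... | yes refl | tri< l _ _ = left⁺ l (grow-core bal (rank-bound (rank-at i) t≤) t (¬x ∘ left⁺ l)
              (proj₁ (short bal (rank-bound (rank-at i) t≤) refl)) (proj₂ (short bal (rank-bound (rank-at i) t≤) refl)))
      ... | yes refl | tri> _ _ g = contradiction (beyond-sum g s≤) (<⇒≯ g)
      -- At a simple root of the fork t = 0, and the interval is central, so e1 + s0 = e0 + s1. If s
      -- does not rise, then e does not either, and E (m - 1) < S m contradicts `¬x`; if s rises,
      -- then so does e, and E m ≤ S (m - 1) leaves room for the strict inequality.
      ... | yes refl | tri≈ _ refl _ = strict (suc-e0<s1 (near (S-up bal rb) (S-slow bal rb)))
        where
        rb : t + a < suc a
        rb = rank-bound (rank-at i) t≤
        t≡0 : t ≡ 0
        t≡0 = length-one bal rb refl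
        e1≤s0 : t + E (suc a ∸ t) ≤ S (a + t)
        e1≤s0 rewrite t≡0 | +-identityʳ a = E≤S⁻
        e0<s1 : t + E (suc a ∸ suc t) < S (a + suc t)
        e0<s1 rewrite t≡0 | +-comm a 1 = E⁻<S
        suc-e0<s1 : S (a + suc t) ≡ S (a + t) ⊎ S (a + suc t) ≡ suc (S (a + t)) → suc t + E (suc a ∸ suc t) < S (a + suc t)
        suc-e0<s1 (inj₁ e) =
          lia 5 (λ t e0 e1 s0 s1 → e1 :+ s0 :≡ e0 :+ s1 :→ t :+ e1 :≰ s0 :→ t :+ e1 :≤ s0 :→ goal (con 1 :+ t :+ e0 :< s1))
            t (E (suc a ∸ suc t)) (E (suc a ∸ t)) (S (a + t)) (S (a + suc t))
            (mirror bal rb sy (last-sum refl)) (contradiction′ e) e1≤s0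
          where
          contradiction′ : S (a + suc t) ≡ S (a + t) → ¬ (t + E (suc a ∸ t) ≤ S (a + t))
          contradiction′ e h = lia 5 (λ t e0 e1 s0 s1 → e1 :+ s0 :≡ e0 :+ s1 :→ s1 :≡ s0 :→ t :+ e0 :< s1 :→ s0 :≤ t :+ e1 :→ absurd)
            t (E (suc a ∸ suc t)) (E (suc a ∸ t)) (S (a + t)) (S (a + suc t))
            (mirror bal rb sy (last-sum refl)) e e0<s1 (≮⇒≥ (¬x ∘ strict))
        suc-e0<s1 (inj₂ e) =
          lia 5 (λ t e0 e1 s0 s1 → e1 :+ s0 :≡ e0 :+ s1 :→ s1 :≡ con 1 :+ s0 :→ t :+ e1 :≤ s0 :→ goal (con 1 :+ t :+ e0 :< s1))
            t (E (suc a ∸ suc t)) (E (suc a ∸ t)) (S (a + t)) (S (a + suc t))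
            (mirror bal rb sy (last-sum refl)) e e1≤s0
      ... | no b≢ | tri< l _ _ = left⁺ l (grow-core bal (rank-bound (rank-at i) t≤) t (¬x ∘ left⁺ l)
            (subst (λ s → t + E (suc b ∸ t) ≤ S s) (sym (+-suc a t))
              (twisted⇒≤ (low {half a<b′ (before-sum a<b l) ε} (inj₁ (refl , refl , λ _ → refl)))))
            (twisted⇒≤ (low {half (s≤s⁻¹ a<b′) (≤-trans (+-monoʳ-≤ a (n≤1+n b)) s≤) ε} (inj₂ (refl , refl)))))
        where
        a<b′ : suc a < suc b
        a<b′ = ≤∧≢⇒< a<b (b≢ ∘ sym)
      ... | no b≢ | tri≈ _ refl _ = mid-grow (near (S-up bal rb) (S-slow bal rb)) ¬x
            (subst (λ s → Mid {m} {c} (t + E (suc b ∸ t)) (S s) ε) (sym (+-suc a t))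
              (low {half a<b′ (mid-sum a<b′) ε} (inj₁ (refl , refl , λ _ → refl))))
            (twisted⇒≤ (low {half (s≤s⁻¹ a<b′) (≤-trans (+-monoʳ-≤ a (n≤1+n b)) s≤) ε} (inj₂ (refl , refl))))
        where
        a<b′ : suc a < suc b
        a<b′ = ≤∧≢⇒< a<b (b≢ ∘ sym)
        rb : t + a < suc b
        rb = rank-bound (rank-at i) t≤
      ... | no b≢ | tri> _ _ g = strict (grow-core bal rb (suc t) (¬x ∘ strict) left-lower right-lower)
        where
        a<b′ : suc a < suc b
        a<b′ = ≤∧≢⇒< a<b (b≢ ∘ sym)
        rb : t + a < suc b
        rb = rank-bound (rank-at i) t≤
        right-lower : t + E (b ∸ t) < S (a + t)
        right-lower = both⁻ (s≤s⁻¹ g) (λ δ →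
          low {half (s≤s⁻¹ a<b′) (≤-trans (+-monoʳ-≤ a (n≤1+n b)) s≤) δ} (inj₂ (refl , refl)))
        left-lower : t + E (suc b ∸ t) < S (a + suc t)
        left-lower with a + suc b ≟ N
        ... | yes e = mirror-≤ bal sy {suc t} (mirror bal rb sy e) right-lower
        ... | no ≢N = subst (λ s → t + E (suc b ∸ t) < S s) (sym (+-suc a t))
                        (right⁻ g (low {half a<b′ (≤∧≢⇒< s≤ ≢N) ε} (inj₁ (refl , refl , λ _ → refl))))

      Above : HalfIx N → ℕ → Set
      Above i t = ∃ λ j → i ⋖ j × TwistedIdeal j (suc t)

      left-above : ∀ {i t} → t ≤ ρ i → Twisted m c (end i) (suc t + E (end i ∸ suc t)) (S (start i + t)) (colour i) → Above i t
      left-above {i@(half {zero} a<b s≤ ε)} t≤ x =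
        contradiction (twisted⇒≤ x) (no-left bal (rank-bound (rank-at i) t≤) ≤-refl refl)
      left-above {half {suc a} {b} a<b s≤ ε} {t} t≤ x =
        half (<-trans (n<1+n a) a<b) (<⇒≤ s≤) ε , inj₁ (refl , refl , λ _ → refl) ,
        subst (λ s → Twisted m c b (suc t + E (b ∸ suc t)) (S s) ε) (sym (+-suc a t)) x

      trace : ∀ {i t} → t ≤ ρ i → TwistedIdeal i (suc t) →
              Above i t ⊎ (¬ TwistedIdeal i t × (∀ {j} → j ⋖ i → TwistedIdeal j t))
      trace {i@(half {a} {b} a<b s≤ ε)} {t} t≤ x with <-cmp b m
      ... | tri< l _ _ with trace-core bal (rank-bound (rank-at i) t≤) t (twisted⇒≤ x)
      ...   | inj₁ p = inj₁ (left-above {i} t≤ (left⁺ l p))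
      ...   | inj₂ (inj₁ p) with somewhere {m} {c} {suc b} l p
      ...     | δ , y = inj₁ (half (m≤n⇒m≤1+n a<b) (subst (_≤ N) (sym (+-suc a b)) (before-sum a<b l)) δ , inj₂ (refl , refl) , y)
      trace {i@(half {a} {b} a<b s≤ ε)} {t} t≤ x | tri< l _ _ | inj₂ (inj₂ (¬x , lower-left , lower-right)) = inj₂ (¬x ∘ twisted⇒≤ , λ where
        (inj₁ (refl , refl , _)) → left⁺ l (subst (λ s → t + E (b ∸ t) ≤ S s) (+-suc a t) lower-left)
        {j} (inj₂ (refl , refl)) → left⁺ (<-trans (n<1+n _) l) lower-right)
      trace {i@(half {a} {b} a<b s≤ ε)} {t} t≤ x | tri> _ _ g with trace-core bal (rank-bound (rank-at i) t≤) (suc t) (right⁻ g x)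
      ... | inj₁ p = inj₁ (left-above {i} t≤ (strict p))
      ... | inj₂ (inj₁ p) with a + b ≟ N
      ...   | yes e = inj₁ (left-above {i} t≤ (strict (mirror-≤ bal sy {suc (suc t)} (sym (mirror bal (rank-bound (rank-at i) t≤) sy e)) p)))
      ...   | no ≢N = inj₁ (half (m≤n⇒m≤1+n a<b) (subst (_≤ N) (sym (+-suc a b)) (≤∧≢⇒< s≤ ≢N)) ε , inj₂ (refl , refl) , strict p)
      trace {i@(half {a} {b} a<b s≤ ε)} {t} t≤ x | tri> _ _ g | inj₂ (inj₂ (¬x , lower-left , lower-right)) = inj₂ (¬x ∘ right⁻ g , λ where
        (inj₁ (refl , refl , _)) → strict (subst (λ s → t + E (b ∸ t) < S s) (+-suc a t) lower-left)
        {j} (inj₂ (refl , refl)) → strict lower-right)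
      trace {i@(half {a} {b} a<b s≤ ε)} {t} t≤ x | tri≈ _ refl _
        with mid-trace (near (S-up bal rb) (S-slow bal rb)) (near′ (near (E-up bal rb) (E-slow bal rb))) x
        where
        rb : t + a < b
        rb = rank-bound (rank-at i) t≤
        near′ : E (b ∸ t) ≡ E (b ∸ suc t) ⊎ E (b ∸ t) ≡ suc (E (b ∸ suc t)) →
                t + E (b ∸ t) ≡ t + E (b ∸ suc t) ⊎ t + E (b ∸ t) ≡ suc (t + E (b ∸ suc t))
        near′ (inj₁ e) = inj₁ (cong (t +_) e)
        near′ (inj₂ e) = inj₂ (trans (cong (t +_) e) (+-suc t _))
      ... | inj₁ p = inj₁ (left-above {i} t≤ p)
      ... | inj₂ (inj₂ (¬x , lower-left , lower-right)) = inj₂ (¬x , λ where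
              (inj₁ (refl , refl , e)) → subst₂ (λ s δ → Mid {m} {c} (t + E (b ∸ t)) (S s) δ) (+-suc a t) (sym (e refl)) lower-left
              {j} (inj₂ (refl , refl)) → left⁺ (n<1+n _) lower-right)
      ... | inj₂ (inj₁ (p , e≡ , s≡)) with b ≟ suc a
      ...   | no b≢ = inj₁ (half (m≤n⇒m≤1+n a<b) (subst (_≤ N) (sym (+-suc a b)) (mid-sum (≤∧≢⇒< a<b (b≢ ∘ sym)))) ε ,
                      inj₂ (refl , refl) , strict p)
      -- (m - 1, m + 1] is outside the half, but by symmetry e and s rise together here, while the
      -- case at hand has only s rising.
      ...   | yes b≡ = ⊥-elim (lia 5 (λ t e0 e1 s0 s1 → e1 :+ s0 :≡ e0 :+ s1 :→ s1 :≡ con 1 :+ s0 :→ t :+ e1 :≡ t :+ e0 :→ absurd)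
                         t (E (b ∸ suc t)) (E (b ∸ t)) (S (a + t)) (S (a + suc t))
                         (mirror bal (rank-bound (rank-at i) t≤) sy (last-sum b≡)) s≡ e≡)

-- Counting starts and ends, and completion by mirror images

module Count where

  open Lia using (lia; con; goal; _:+_; _:≤_; _:<_; _:≡_; _:≰_; _:→_)
  open Steps
  open Toggle using (allPairs-lookup)
  open import Data.Sum using (swap)

  𝟙 : ∀ {P : Set} → Dec P → ℕ
  𝟙 d = if does d then 1 else 0

  𝟙-yes : ∀ {P : Set} (d : Dec P) → P → 𝟙 d ≡ 1
  𝟙-yes (yes _) _ = refl
  𝟙-yes (no ¬p) p = contradiction p ¬p

  𝟙-no : ∀ {P : Set} (d : Dec P) → ¬ P → 𝟙 d ≡ 0
  𝟙-no (yes p) ¬p = contradiction p ¬p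
  𝟙-no (no _) _ = refl

  𝟙-mono : ∀ {P Q : Set} (p : Dec P) (q : Dec Q) → (P → Q) → 𝟙 p ≤ 𝟙 q
  𝟙-mono (yes p) q f = ≤-reflexive (sym (𝟙-yes q (f p)))
  𝟙-mono (no _) q f = z≤n

  𝟙-≤1 : ∀ {P : Set} (p : Dec P) → 𝟙 p ≤ 1
  𝟙-≤1 (yes _) = ≤-refl
  𝟙-≤1 (no _) = z≤n

  module _ {A : Set} where

    count : ∀ {P : A → Set} → Decidable P → List A → ℕ
    count P? xs = length (filter P? xs)

    count-∷ : ∀ {P : A → Set} (P? : Decidable P) x xs → count P? (x ∷ xs) ≡ 𝟙 (P? x) + count P? xs
    count-∷ P? x xs with P? x
    ... | yes _ = refl
    ... | no _ = refl

    module _ {P Q : A → Set} (P? : Decidable P) (Q? : Decidable Q) where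

      count-mono : ∀ {xs} → All (λ x → P x → Q x) xs → count P? xs ≤ count Q? xs
      count-mono [] = z≤n
      count-mono {x ∷ xs} (f ∷ fs) rewrite count-∷ P? x xs | count-∷ Q? x xs =
        +-mono-≤ (𝟙-mono (P? x) (Q? x) f) (count-mono fs)

      count-strict : ∀ {xs} → All (λ x → P x → Q x) xs → Any (λ x → ¬ P x × Q x) xs → count P? xs < count Q? xs
      count-strict {x ∷ xs} (f ∷ fs) (here (¬p , q)) rewrite count-∷ P? x xs | count-∷ Q? x xs
        | 𝟙-no (P? x) ¬p | 𝟙-yes (Q? x) q = s≤s (count-mono fs)
      count-strict {x ∷ xs} (f ∷ fs) (there a) rewrite count-∷ P? x xs | count-∷ Q? x xs =
        +-mono-≤-< (𝟙-mono (P? x) (Q? x) f) (count-strict fs a)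

    count-all : ∀ {P : A → Set} (P? : Decidable P) {xs} → All P xs → count P? xs ≡ length xs
    count-all P? ps = cong length (filter-all P? ps)

    count-none : ∀ {P : A → Set} (P? : Decidable P) {xs} → All (¬_ ∘ P) xs → count P? xs ≡ 0
    count-none P? ps = cong length (filter-none P? ps)

    count≤1 : ∀ {P : A → Set} (P? : Decidable P) {xs} → AllPairs (λ x y → ¬ (P x × P y)) xs → count P? xs ≤ 1
    count≤1 P? [] = z≤n
    count≤1 P? {x ∷ xs} (n ∷ ns) with P? x
    ... | no _ = count≤1 P? ns
    ... | yes p = s≤s (≤-reflexive (count-none P? (All.map (λ f q → f (p , q)) n)))

    count-below : ∀ (f : A → ℕ) {xs} → AllPairs (λ x y → f x ≢ f y) xs → ∀ k →
                  count (λ x → f x <? suc k) xs ≤ suc (count (λ x → f x <? k) xs)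
    count-below f [] k = z≤n
    count-below f {x ∷ xs} (n ∷ ns) k rewrite count-∷ (λ x → f x <? suc k) x xs | count-∷ (λ x → f x <? k) x xs
      with f x ≟ k
    ... | yes refl = ≤-trans (+-mono-≤ (𝟙-≤1 (f x <? suc (f x)))
            (count-mono (λ y → f y <? suc (f x)) (λ y → f y <? f x) (All.map (λ ≢y l → ≤∧≢⇒< (s≤s⁻¹ l) (≢y ∘ sym)) n)))
            (s≤s (m≤n+m _ (𝟙 (f x <? f x))))
    ... | no ≢k = ≤-trans (+-mono-≤ (𝟙-mono (f x <? suc k) (f x <? k) (λ l → ≤∧≢⇒< (s≤s⁻¹ l) ≢k)) (count-below f ns k))
            (≤-reflexive (+-suc (𝟙 (f x <? k)) _))

  Interval : Set
  Interval = ℕ × ℕ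

  Shifted : Interval → Interval → Set
  Shifted (a , b) (c , d) = (a < c × b < d) ⊎ (c < a × d < b)

  Inside : ℕ → ℕ → Interval → Set
  Inside a b (i , j) = a ≤ i × j ≤ b

  Proper : ℕ → Interval → Set
  Proper N (a , b) = a < b × b ≤ N

  starts ends : List Interval → ℕ → ℕ
  starts L x = count (λ q → proj₁ q <? x) L
  ends L y = count (λ q → proj₂ q <? suc y) L

  module _ {N : ℕ} {L : List Interval} (starts≢ : AllPairs (λ x y → proj₁ x ≢ proj₁ y) L)
           (ends≢ : AllPairs (λ x y → proj₂ x ≢ proj₂ y) L) (proper : All (Proper N) L) where

    starts-total : starts L N ≡ length L
    starts-total = count-all _ (All.map (λ (l , u) → <-≤-trans l u) proper)

    balanced : Balanced N (starts L) (ends L)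
    balanced = record
      { S-step = record
        { zero≡ = count-none _ (All.map (λ _ ()) proper)
        ; up = λ x → count-mono _ _ (All.map (λ _ → m≤n⇒m≤1+n) proper)
        ; slow = count-below proj₁ starts≢
        }
      ; E-step = record
        { zero≡ = count-none _ (All.map (λ (l , _) q → n≮0 (<-≤-trans l (s≤s⁻¹ q))) proper)
        ; up = λ x → count-mono _ _ (All.map (λ _ → m≤n⇒m≤1+n) proper)
        ; slow = λ x → count-below proj₂ ends≢ (suc x)
        }
      ; E≤S = λ z → count-mono _ _ (All.map (λ (l , _) q → <-≤-trans l (s≤s⁻¹ q)) proper)
      ; total = trans starts-total (sym (count-all _ (All.map (λ (_ , u) → s≤s u) proper)))
      }

  module _ {L : List Interval} (shifted : AllPairs Shifted L) where

    shifted-starts≢ : AllPairs (λ x y → proj₁ x ≢ proj₁ y) L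
    shifted-starts≢ = AllPairs.map (λ { (inj₁ (l , _)) → <⇒≢ l ; (inj₂ (l , _)) → >⇒≢ l }) shifted

    shifted-ends≢ : AllPairs (λ x y → proj₂ x ≢ proj₂ y) L
    shifted-ends≢ = AllPairs.map (λ { (inj₁ (_ , l)) → <⇒≢ l ; (inj₂ (_ , l)) → >⇒≢ l }) shifted

    -- Let z lie inside (a, b]. An interval starting before a also ends before z, hence by b; and z
    -- ends by b without starting before a. So ends up to b outnumber starts before a.
    empty⇒ : ∀ {a b} → ends L b ≤ starts L a → ¬ Any (Inside a b) L
    empty⇒ {a} {b} le any with find any
    ... | z@(i , j) , z∈ , a≤i , j≤b = <⇒≱
      (count-strict _ _ (All.tabulate before) (Any.map (λ (p , q) → ≤⇒≯ p , s≤s q) any)) le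
      where
      before : ∀ {q} → q ∈ L → proj₁ q < a → proj₂ q < suc b
      before q∈ l with allPairs-lookup swap′ shifted q∈ z∈
        where
        swap′ : ∀ {x y} → Shifted x y → Shifted y x
        swap′ = swap
      ... | inj₁ refl = contradiction a≤i (<⇒≱ l)
      ... | inj₂ (inj₁ (_ , l′)) = s≤s (≤-trans (<⇒≤ l′) j≤b)
      ... | inj₂ (inj₂ (l′ , _)) = contradiction (≤-trans a≤i (<⇒≤ l′)) (<⇒≱ l)

    empty⇐ : ∀ {a b} → ¬ Any (Inside a b) L → ends L b ≤ starts L a
    empty⇐ {a} {b} ¬any = count-mono _ _ (All.tabulate outside)
      where
      outside : ∀ {q} → q ∈ L → proj₂ q < suc b → proj₁ q < a
      outside {q} q∈ l with proj₁ q <? a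
      ... | yes p = p
      ... | no ¬p = contradiction (Any.map (λ { refl → ≮⇒≥ ¬p , s≤s⁻¹ l }) q∈) ¬any

  -- Intervals of a half poset are completed by their mirror images.
  module _ (N : ℕ) where

    HalfProper : Interval → Set
    HalfProper (a , b) = a < b × a + b ≤ N

    central? : Decidable (λ ((a , b) : Interval) → a + b ≡ N)
    central? (a , b) = a + b ≟ N

    closure : List Interval → List Interval
    closure [] = []
    closure ((a , b) ∷ L) with central? (a , b)
    ... | yes _ = (a , b) ∷ closure L
    ... | no _ = (a , b) ∷ (N ∸ b , N ∸ a) ∷ closure L

    -- A central interval is its own mirror image and occurs once. The mirror (a′, b′] of any other
    -- is characterised by equations, which keeps truncated subtraction out of the later arithmetic.
    closure-induction : (R : List Interval → List Interval → Set) → R [] [] →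
      (∀ {a b L L′} → HalfProper (a , b) → a + b ≡ N → R L L′ → R ((a , b) ∷ L) ((a , b) ∷ L′)) →
      (∀ {a b L L′} a′ b′ → HalfProper (a , b) → b + a′ ≡ N → a + b′ ≡ N → a + b ≢ N → R L L′ →
         R ((a , b) ∷ L) ((a , b) ∷ (a′ , b′) ∷ L′)) →
      ∀ {L} → All HalfProper L → R L (closure L)
    closure-induction R nil one two [] = nil
    closure-induction R nil one two {(a , b) ∷ L} (h ∷ hs) with central? (a , b)
    ... | yes e = one h e (closure-induction R nil one two hs)
    ... | no n = two (N ∸ b) (N ∸ a) h (m+[n∸m]≡n (≤-trans (m≤n+m b a) (proj₂ h))) (m+[n∸m]≡n (≤-trans (m≤m+n a b) (proj₂ h)))
                   n (closure-induction R nil one two hs)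

    closure-length : ∀ {L} → All HalfProper L → length (closure L) + count central? L ≡ length L + length L
    closure-length = closure-induction (λ L L′ → length L′ + count central? L ≡ length L + length L) refl
      (λ {a} {b} {L} {L′} _ e ih → trans (cong (suc (length L′) +_) (trans (count-∷ central? (a , b) L) (cong (_+ count central? L) (𝟙-yes (central? (a , b)) e))))
        (lia 3 (λ l c k → l :+ c :≡ k :+ k :→ goal (con 1 :+ l :+ (con 1 :+ c) :≡ con 1 :+ k :+ (con 1 :+ k))) (length L′) (count central? L) (length L) ih))
      (λ {a} {b} {L} {L′} _ _ _ _ _ n ih → trans (cong (suc (suc (length L′)) +_) (trans (count-∷ central? (a , b) L) (cong (_+ count central? L) (𝟙-no (central? (a , b)) n))))
        (lia 3 (λ l c k → l :+ c :≡ k :+ k :→ goal (con 1 :+ (con 1 :+ l) :+ c :≡ con 1 :+ k :+ (con 1 :+ k))) (length L′) (count central? L) (length L) ih))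

    all-closure : ∀ {Q R : Interval → Set} →
      (∀ {a b a′ b′} → HalfProper (a , b) → b + a′ ≡ N → a + b′ ≡ N → Q (a , b) → R (a , b) × R (a′ , b′)) →
      ∀ {L} → All HalfProper L → All Q L → All R (closure L)
    all-closure {Q} {R} f = closure-induction (λ L L′ → All Q L → All R L′) (λ _ → [])
      (λ { {a} {b} h e ih (q ∷ qs) → proj₁ (f h (trans (+-comm b a) e) e q) ∷ ih qs })
      (λ { a′ b′ h e₁ e₂ _ ih (q ∷ qs) → proj₁ (f h e₁ e₂ q) ∷ proj₂ (f h e₁ e₂ q) ∷ ih qs })

    -- Reflection moves an interval of the half to the far side of the axis: whichever of (a, b] and
    -- (c, d] comes first, (a, b] comes before the mirror image of (c, d].
    mirror-shifted : ∀ {a b c d c′ d′} → HalfProper (a , b) → HalfProper (c , d) → d + c′ ≡ N → c + d′ ≡ N →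
                     Shifted (a , b) (c , d) → Shifted (a , b) (c′ , d′)
    mirror-shifted {a} {b} {c} {d} {c′} {d′} (_ , h) (_ , k) e₁ e₂ (inj₁ (p , q)) = inj₁
      ( lia 5 (λ N a c d c′ → c :+ d :≤ N :→ d :+ c′ :≡ N :→ a :< c :→ goal (a :< c′)) N a c d c′ k e₁ p
      , lia 5 (λ N b c d d′ → c :+ d :≤ N :→ c :+ d′ :≡ N :→ b :< d :→ goal (b :< d′)) N b c d d′ k e₂ q)
    mirror-shifted {a} {b} {c} {d} {c′} {d′} (_ , h) (_ , k) e₁ e₂ (inj₂ (p , q)) = inj₁
      ( lia 5 (λ N a b d c′ → a :+ b :≤ N :→ d :+ c′ :≡ N :→ d :< b :→ goal (a :< c′)) N a b d c′ h e₁ q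
      , lia 5 (λ N a b c d′ → a :+ b :≤ N :→ c :+ d′ :≡ N :→ c :< a :→ goal (b :< d′)) N a b c d′ h e₂ p)

    mirrors-shifted : ∀ {a b c d a′ b′ c′ d′} → b + a′ ≡ N → a + b′ ≡ N → d + c′ ≡ N → c + d′ ≡ N →
                      Shifted (a , b) (c , d) → Shifted (a′ , b′) (c′ , d′)
    mirrors-shifted {a} {b} {c} {d} {a′} {b′} {c′} {d′} e₁ e₂ e₃ e₄ s = swap (reverse s)
      where
      anti : ∀ {x x′ y y′} → x + x′ ≡ N → y + y′ ≡ N → x < y → y′ < x′
      anti {x} {x′} {y} {y′} = lia 5 (λ N x x′ y y′ → x :+ x′ :≡ N :→ y :+ y′ :≡ N :→ x :< y :→ goal (y′ :< x′)) N x x′ y y′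
      reverse : Shifted (a , b) (c , d) → Shifted (c′ , d′) (a′ , b′)
      reverse (inj₁ (p , q)) = inj₁ (anti e₁ e₃ q , anti e₂ e₄ p)
      reverse (inj₂ (p , q)) = inj₂ (anti e₃ e₁ q , anti e₄ e₂ p)

    closure-shifted : ∀ {L} → All HalfProper L → AllPairs Shifted L → AllPairs Shifted (closure L)
    closure-shifted [] [] = []
    closure-shifted {(a , b) ∷ L} (h ∷ hs) (s ∷ ss) with central? (a , b)
    ... | yes e = all-closure (λ k e₁ e₂ (k′ , t) → t , mirror-shifted h k e₁ e₂ t) hs (All.zip (hs , s)) ∷ closure-shifted hs ss
    ... | no n = (own ∷ all-closure (λ k e₁ e₂ (k′ , t) → t , mirror-shifted h k e₁ e₂ t) hs (All.zip (hs , s)))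
               ∷ all-closure (λ k e₁ e₂ t → swap (mirror-shifted k h a′≡ b′≡ (swap t)) , mirrors-shifted a′≡ b′≡ e₁ e₂ t) hs s
               ∷ closure-shifted hs ss
      where
      a′≡ : b + (N ∸ b) ≡ N
      a′≡ = m+[n∸m]≡n (≤-trans (m≤n+m b a) (proj₂ h))
      b′≡ : a + (N ∸ a) ≡ N
      b′≡ = m+[n∸m]≡n (≤-trans (m≤m+n a b) (proj₂ h))
      own : Shifted (a , b) (N ∸ b , N ∸ a)
      own = inj₁ ( lia 4 (λ N a b a′ → b :+ a′ :≡ N :→ a :+ b :< N :→ goal (a :< a′)) N a b (N ∸ b) a′≡ (≤∧≢⇒< (proj₂ h) n)
                 , lia 4 (λ N a b b′ → a :+ b′ :≡ N :→ a :+ b :< N :→ goal (b :< b′)) N a b (N ∸ a) b′≡ (≤∧≢⇒< (proj₂ h) n))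

    closure-proper : ∀ {L} → All HalfProper L → All (Proper N) (closure L)
    closure-proper hs = all-closure (λ {a} {b} {a′} {b′} (l , u) e₁ e₂ _ →
      (l , ≤-trans (m≤n+m b a) u) ,
      (lia 5 (λ N a b a′ b′ → a :< b :→ b :+ a′ :≡ N :→ a :+ b′ :≡ N :→ goal (a′ :< b′)) N a b a′ b′ l e₁ e₂ ,
       ≤-trans (m≤n+m b′ a) (≤-reflexive e₂))) hs hs

    𝟙-mirror : ∀ x y a b′ → x + y ≡ N → a + b′ ≡ N → 𝟙 (b′ <? suc y) + 𝟙 (a <? x) ≡ 1
    𝟙-mirror x y a b′ e₁ e₂ with a <? x
    ... | yes p = cong₂ _+_ (𝟙-no (b′ <? suc y) (lia 5 (λ N x y a b → x :+ y :≡ N :→ a :+ b :≡ N :→ a :< x :→ goal (con 1 :+ b :≰ con 1 :+ y)) N x y a b′ e₁ e₂ p)) (𝟙-yes (a <? x) p)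
    ... | no p = cong₂ _+_ (𝟙-yes (b′ <? suc y) (lia 5 (λ N x y a b → x :+ y :≡ N :→ a :+ b :≡ N :→ con 1 :+ a :≰ x :→ goal (b :< con 1 :+ y)) N x y a b′ e₁ e₂ p)) (𝟙-no (a <? x) p)

    closure-symmetric : ∀ {L} → All HalfProper L → ∀ x y → x + y ≡ N →
                        ends (closure L) y + starts (closure L) x ≡ length (closure L)
    closure-symmetric hs x y xy = closure-induction
      (λ _ L′ → ends L′ y + starts L′ x ≡ length L′) refl
      (λ {_} {_} {_} {L′} → one {L′ = L′}) (λ {_} {_} {_} {L′} → two {L′ = L′}) hs
      where
      one : ∀ {a b} {L′ : List Interval} → HalfProper (a , b) → a + b ≡ N → ends L′ y + starts L′ x ≡ length L′ →
            ends ((a , b) ∷ L′) y + starts ((a , b) ∷ L′) x ≡ suc (length L′)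
      one {a} {b} {L′} _ e ih rewrite count-∷ (λ q → proj₂ q <? suc y) (a , b) L′ | count-∷ (λ q → proj₁ q <? x) (a , b) L′ =
        lia 5 (λ p q E S l → q :+ p :≡ con 1 :→ E :+ S :≡ l :→ goal (q :+ E :+ (p :+ S) :≡ con 1 :+ l))
          (𝟙 (a <? x)) (𝟙 (b <? suc y)) (ends L′ y) (starts L′ x) (length L′) (𝟙-mirror x y a b xy e) ih
      two : ∀ {a b} {L′ : List Interval} a′ b′ → HalfProper (a , b) → b + a′ ≡ N → a + b′ ≡ N → a + b ≢ N →
            ends L′ y + starts L′ x ≡ length L′ →
            ends ((a , b) ∷ (a′ , b′) ∷ L′) y + starts ((a , b) ∷ (a′ , b′) ∷ L′) x ≡ suc (suc (length L′))
      two {a} {b} {L′} a′ b′ _ e₁ e₂ _ ih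
        rewrite count-∷ (λ q → proj₂ q <? suc y) (a , b) ((a′ , b′) ∷ L′) | count-∷ (λ q → proj₂ q <? suc y) (a′ , b′) L′
              | count-∷ (λ q → proj₁ q <? x) (a , b) ((a′ , b′) ∷ L′) | count-∷ (λ q → proj₁ q <? x) (a′ , b′) L′ =
        lia 7 (λ p q p′ q′ E S l → q :+ p′ :≡ con 1 :→ q′ :+ p :≡ con 1 :→ E :+ S :≡ l :→
                goal (q :+ (q′ :+ E) :+ (p :+ (p′ :+ S)) :≡ con 1 :+ (con 1 :+ l)))
          (𝟙 (a <? x)) (𝟙 (b <? suc y)) (𝟙 (a′ <? x)) (𝟙 (b′ <? suc y)) (ends L′ y) (starts L′ x) (length L′)
          (𝟙-mirror x y a′ b xy (trans (+-comm a′ b) e₁)) (𝟙-mirror x y a b′ xy e₂) ih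

    inside-closure⁺ : ∀ {L a b} → Any (Inside a b) L → Any (Inside a b) (closure L)
    inside-closure⁺ {(c , d) ∷ L} any with central? (c , d)
    inside-closure⁺ {(c , d) ∷ L} (here p) | yes _ = here p
    inside-closure⁺ {(c , d) ∷ L} (there p) | yes _ = there (inside-closure⁺ p)
    inside-closure⁺ {(c , d) ∷ L} (here p) | no _ = here p
    inside-closure⁺ {(c , d) ∷ L} (there p) | no _ = there (there (inside-closure⁺ p))

    -- If a mirror image fits into an interval of the half, then so does the original: it starts
    -- late enough because a + b ≤ N, and ends no later than its image.
    inside-closure⁻ : ∀ {L a b} → All HalfProper L → a + b ≤ N → Any (Inside a b) (closure L) → Any (Inside a b) L
    inside-closure⁻ {a = a} {b} hs ab = closure-induction (λ L L′ → Any (Inside a b) L′ → Any (Inside a b) L) (λ ())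
      (λ { _ _ ih (here p) → here p ; _ _ ih (there p) → there (ih p) })
      (λ { _ _ _ _ _ _ ih (here p) → here p
         ; {c} {d} c′ d′ (_ , h) e₁ e₂ _ ih (there (here (p , q))) → here
             ( lia 5 (λ N a b c d′ → a :+ b :≤ N :→ c :+ d′ :≡ N :→ d′ :≤ b :→ goal (a :≤ c)) N a b c d′ ab e₂ q
             , lia 5 (λ N b c d d′ → c :+ d :≤ N :→ c :+ d′ :≡ N :→ d′ :≤ b :→ goal (d :≤ b)) N b c d d′ h e₂ q)
         ; _ _ _ _ _ _ ih (there (there p)) → there (ih p) }) hs

    central≤1 : ∀ {L} → AllPairs Shifted L → count central? L ≤ 1
    central≤1 ss = count≤1 central? (AllPairs.map (λ { {a , b} {c , d} (inj₁ (p , q)) (e , f) → ne p q e f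
                                                     ; {a , b} {c , d} (inj₂ (p , q)) (e , f) → ne p q f e }) ss)
      where
      ne : ∀ {a b c d} → a < c → b < d → a + b ≡ N → ¬ c + d ≡ N
      ne p q e f = <⇒≢ (+-mono-< p q) (trans e (sym f))

  module _ {N m : ℕ} (middle : suc N ≡ m + m) where

    middle? : Decidable (λ ((a , b) : Interval) → b ≡ m)
    middle? (a , b) = b ≟ m

    𝟙-at : ∀ b m → 𝟙 (b <? suc m) ≡ 𝟙 (b <? m) + 𝟙 (b ≟ m)
    𝟙-at b m with b ≟ m
    ... | yes refl = trans (𝟙-yes (b <? suc b) ≤-refl) (sym (cong₂ _+_ (𝟙-no (b <? b) (n≮n b)) (𝟙-yes (b ≟ b) refl)))
    ... | no b≢m = trans (≤-antisym (𝟙-mono (b <? suc m) (b <? m) (λ l → ≤∧≢⇒< (s≤s⁻¹ l) b≢m))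
                                    (𝟙-mono (b <? m) (b <? suc m) m≤n⇒m≤1+n))
                         (sym (trans (cong (𝟙 (b <? m) +_) (𝟙-no (b ≟ m) b≢m)) (+-identityʳ _)))

    -- The mirror image of a noncentral interval of the half ends after m, so every end at m comes
    -- from L itself.
    ends-middle : ∀ {L} → All (HalfProper N) L →
                  ends (closure N L) m ≡ count (λ q → proj₂ q <? m) (closure N L) + count middle? L
    ends-middle = closure-induction N (λ L L′ → ends L′ m ≡ count (λ q → proj₂ q <? m) L′ + count middle? L) refl
      (λ {a} {b} {L} {L′} _ _ ih → cons a b L L′ ih)
      (λ {a} {b} {L} {L′} a′ b′ (l , h) e₁ e₂ n ih → trans (cons′ a b a′ b′ L L′ (trans (𝟙-at b′ m)
          (trans (cong (𝟙 (b′ <? m) +_) (𝟙-no (b′ ≟ m) (λ e → n (on-axis a b b′ l h e₂ e)))) (+-identityʳ _))) ih) refl)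
      where
      on-axis : ∀ a b b′ → a < b → a + b ≤ N → a + b′ ≡ N → b′ ≡ m → a + b ≡ N
      on-axis a b b′ = lia 5 (λ N m a b b′ → con 1 :+ N :≡ m :+ m :→ a :< b :→ a :+ b :≤ N :→ a :+ b′ :≡ N :→ b′ :≡ m :→ goal (a :+ b :≡ N))
        N m a b b′ middle
      cons : ∀ a b L L′ → ends L′ m ≡ count (λ q → proj₂ q <? m) L′ + count middle? L →
             ends ((a , b) ∷ L′) m ≡ count (λ q → proj₂ q <? m) ((a , b) ∷ L′) + count middle? ((a , b) ∷ L)
      cons a b L L′ ih rewrite count-∷ (λ q → proj₂ q <? suc m) (a , b) L′ | count-∷ (λ q → proj₂ q <? m) (a , b) L′
                             | count-∷ middle? (a , b) L =
        lia 6 (λ p q r E F M → p :≡ q :+ r :→ E :≡ F :+ M :→ goal (p :+ E :≡ q :+ F :+ (r :+ M)))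
          (𝟙 (b <? suc m)) (𝟙 (b <? m)) (𝟙 (b ≟ m)) (ends L′ m) (count (λ q → proj₂ q <? m) L′) (count middle? L) (𝟙-at b m) ih
      cons′ : ∀ a b a′ b′ L L′ → 𝟙 (b′ <? suc m) ≡ 𝟙 (b′ <? m) → ends L′ m ≡ count (λ q → proj₂ q <? m) L′ + count middle? L →
              ends ((a , b) ∷ (a′ , b′) ∷ L′) m ≡ count (λ q → proj₂ q <? m) ((a , b) ∷ (a′ , b′) ∷ L′) + count middle? ((a , b) ∷ L)
      cons′ a b a′ b′ L L′ e ih
        rewrite count-∷ (λ q → proj₂ q <? suc m) (a , b) ((a′ , b′) ∷ L′) | count-∷ (λ q → proj₂ q <? suc m) (a′ , b′) L′
              | count-∷ (λ q → proj₂ q <? m) (a , b) ((a′ , b′) ∷ L′) | count-∷ (λ q → proj₂ q <? m) (a′ , b′) L′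
              | count-∷ middle? (a , b) L =
        lia 8 (λ p q r s t E F M → p :≡ q :+ r :→ s :≡ t :→ E :≡ F :+ M :→ goal (p :+ (s :+ E) :≡ q :+ (t :+ F) :+ (r :+ M)))
          (𝟙 (b <? suc m)) (𝟙 (b <? m)) (𝟙 (b ≟ m)) (𝟙 (b′ <? suc m)) (𝟙 (b′ <? m))
          (ends L′ m) (count (λ q → proj₂ q <? m) L′) (count middle? L) (𝟙-at b m) e ih

-- Uniqueness of the counting functions, and type A

module FullRvac where

  open Toggle
  open Grid
  open Lia using (lia; con; goal; _:+_; _:≤_; _:≡_; _:→_)
  open Steps
  open Models
  open Count

  incomparable⇒shifted : ∀ {a b c d} → ¬ (c ≤ a × b ≤ d) → ¬ (a ≤ c × d ≤ b) → Shifted (a , b) (c , d)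
  incomparable⇒shifted {a} {b} {c} {d} p q with a <? c | b <? d
  ... | yes l | yes l′ = inj₁ (l , l′)
  ... | yes l | no l′ = contradiction (<⇒≤ l , ≮⇒≥ l′) q
  ... | no l | yes l′ = contradiction (≮⇒≥ l , <⇒≤ l′) p
  ... | no l | no l′ with m≤n⇒m<n∨m≡n (≮⇒≥ l) | m≤n⇒m<n∨m≡n (≮⇒≥ l′)
  ...   | inj₁ m | inj₁ m′ = inj₂ (m , m′)
  ...   | inj₂ refl | _ = contradiction (≤-refl , ≮⇒≥ l′) q
  ...   | inj₁ m | inj₂ refl = contradiction (<⇒≤ m , ≤-refl) p

  module _ {N : ℕ} {S₁ E₁ S₂ E₂ : ℕ → ℕ} (b₁ : Balanced N S₁ E₁) (b₂ : Balanced N S₂ E₂) where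
    private
      module B₁ = Balanced b₁
      module B₂ = Balanced b₂

    -- Suppose S₁ rises at z and S₂ does not, and let E₁ attain the value S₁ (1 + z) at b. Then (z +
    -- 1, b] is in the first ideal and hence in the second; as S₂ is flat at z, so is (z, b], which
    -- puts it back into the first ideal although E₁ b exceeds S₁ z. The degenerate intervals b = z
    -- and b = z + 1 are covered by E ≤ S. The bound n on the ends is N in general and m in type D.
    no-jump : ∀ {n} → (∀ {a b} → a < b → b ≤ n → E₁ b ≤ S₁ a → E₂ b ≤ S₂ a) →
              (∀ {a b} → a < b → b ≤ n → E₂ b ≤ S₂ a → E₁ b ≤ S₁ a) →
              ∀ z → z < n → S₁ (suc z) ≤ E₁ n → S₁ z ≡ S₂ z → S₁ (suc z) ≤ S₂ (suc z)
    no-jump {n} to from z z<n top eq with S₁ (suc z) ≤? S₂ (suc z)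
    ... | yes p = p
    ... | no jump with B₁.E.attains (n ∸ z) {z} {n} {S₁ (suc z)} (m∸n+n≡m (<⇒≤ z<n)) (≤-trans (B₁.E≤S z) (B₁.S.up z)) top
    ...   | b , z≤b , b≤n , Eb = contradiction (case z≤b) not₁
      where
      S₂-flat : S₂ (suc z) ≤ S₂ z
      S₂-flat = s≤s⁻¹ (≤-trans (≰⇒> jump) (≤-trans (B₁.S.slow z) (s≤s (≤-reflexive eq))))
      not₁ : ¬ E₁ b ≤ S₁ z
      not₁ h = jump (≤-trans (≤-reflexive (sym Eb)) (≤-trans h (≤-trans (≤-reflexive eq) (B₂.S.up z))))
      case : z ≤ b → E₁ b ≤ S₁ z
      case z≤b with m≤n⇒m<n∨m≡n z≤b
      ... | inj₂ refl = B₁.E≤S z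
      ... | inj₁ z<b with m≤n⇒m<n∨m≡n z<b
      ...   | inj₂ refl = from ≤-refl b≤n (≤-trans (B₂.E≤S (suc z)) S₂-flat)
      ...   | inj₁ z+1<b = from z<b b≤n (≤-trans (to z+1<b b≤n (≤-reflexive Eb)) S₂-flat)

  -- The ideal reveals S position by position, and in particular the number S N of intervals.
  determined : ∀ {N S₁ E₁ S₂ E₂} → Balanced N S₁ E₁ → Balanced N S₂ E₂ →
               (∀ {a b} → a < b → b ≤ N → E₁ b ≤ S₁ a → E₂ b ≤ S₂ a) →
               (∀ {a b} → a < b → b ≤ N → E₂ b ≤ S₂ a → E₁ b ≤ S₁ a) →
               ∀ z → z ≤ N → S₁ z ≡ S₂ z
  determined b₁ b₂ to from zero _ = trans (Balanced.S.zero≡ b₁) (sym (Balanced.S.zero≡ b₂))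
  determined b₁ b₂ to from (suc z) z<N with determined b₁ b₂ to from z (<⇒≤ z<N)
  ... | eq = ≤-antisym (no-jump b₁ b₂ to from z z<N (top b₁) eq) (no-jump b₂ b₁ from to z z<N (top b₂) (sym eq))
    where
    top : ∀ {S E} → Balanced _ S E → S (suc z) ≤ E _
    top b = ≤-trans (Balanced.S.increasing b z<N) (≤-reflexive (Balanced.total b))

  -- The final ideal of (S, E) is the initial ideal of (co E, co S).
  final⇔dual : ∀ {N S E} → Balanced N S E → ∀ {ρ a b} → suc (ρ + a) ≡ b →
    (suc ρ + E (b ∸ suc ρ) ≤ S (a + suc ρ) → co S b ≤ co E (a + 0)) ×
    (co S b ≤ co E (a + 0) → suc ρ + E (b ∸ suc ρ) ≤ S (a + suc ρ))
  final⇔dual {S = S} {E} bal {ρ} {a} {b} refl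
    rewrite +-identityʳ a | m+n∸m≡n ρ a | +-suc a ρ | +-comm a ρ =
    lia 6 (λ ρ a Sb Ea cS cE → cS :+ Sb :≡ con 1 :+ ρ :+ a :→ cE :+ Ea :≡ a :→ con 1 :+ ρ :+ Ea :≤ Sb :→ goal (cS :≤ cE))
      ρ a (S (suc (ρ + a))) (E a) (suc (ρ + a) ∸ S (suc (ρ + a))) (a ∸ E a)
      (m∸n+n≡m (Balanced.S.bounded bal _)) (m∸n+n≡m (Balanced.E.bounded bal a)) ,
    lia 6 (λ ρ a Sb Ea cS cE → cS :+ Sb :≡ con 1 :+ ρ :+ a :→ cE :+ Ea :≡ a :→ cS :≤ cE :→ goal (con 1 :+ ρ :+ Ea :≤ Sb))
      ρ a (S (suc (ρ + a))) (E a) (suc (ρ + a) ∸ S (suc (ρ + a))) (a ∸ E a)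
      (m∸n+n≡m (Balanced.S.bounded bal _)) (m∸n+n≡m (Balanced.E.bounded bal a))

  co-co : ∀ {F} → Step F → ∀ x → co (co F) x ≡ F x
  co-co st x = m∸[m∸n]≡n (Step.bounded st x)

  final⇔dual′ : ∀ {N S E} → Balanced N S E → ∀ {ρ a b} → suc (ρ + a) ≡ b →
    (suc ρ + co S (b ∸ suc ρ) ≤ co E (a + suc ρ) → E b ≤ S (a + 0)) ×
    (E b ≤ S (a + 0) → suc ρ + co S (b ∸ suc ρ) ≤ co E (a + suc ρ))
  final⇔dual′ {S = S} {E} bal {ρ} {a} {b} e =
    subst₂ (λ s e → (suc ρ + co S (b ∸ suc ρ) ≤ co E (a + suc ρ) → e ≤ s) × (e ≤ s → suc ρ + co S (b ∸ suc ρ) ≤ co E (a + suc ρ)))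
      (co-co (Balanced.S-step bal) (a + 0)) (co-co (Balanced.E-step bal) b) (final⇔dual (co-balanced bal) e)

  module _ {r} {P : List (Root r)} {N} (roots : FullRoots P N) where
    open FullRoots roots
    open FullIx
    open Full roots
    open Model model using (Evolution; ρ)

    dual-full : ∀ {S E} (b : Balanced N S E) → Dual model (Ideal b) (Ideal (co-balanced b))
    dual-full b = dually λ i → final⇔dual b (rank-at i)

    dual-full′ : ∀ {S E} (b : Balanced N S E) → Dual model (Ideal (co-balanced b)) (Ideal b)
    dual-full′ b = dually λ i → final⇔dual′ b (rank-at i)

    module _ {A : List (Root r)} (aA : IsAntichainIn model A) where
      open IsAntichainIn aA

      record Encoding : Set where
        field
          {S E}    : ℕ → ℕ
          bal      : Balanced N S E
          size     : S N ≡ length A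
          encodes  : Encodes model (Ideal bal) A

      encoding : Encoding
      encoding with indices model ⊆P
      ... | Q , refl = record
        { bal = bal
        ; size = trans (starts-total (shifted-starts≢ shifted) (shifted-ends≢ shifted) proper) (trans (length-map pair Q) (sym (length-map root Q)))
        ; encodes = encode λ i → to i , from i
        }
        where
        pair : FullIx N → Interval
        pair i = start i , end i
        shifted : AllPairs Shifted (map pair Q)
        shifted = AllPairs.map⁺ (AllPairs.map (λ (p , q) → incomparable⇒shifted
          (λ (u , v) → p (embed u v)) (λ (u , v) → q (embed u v))) (AllPairs.map⁻ antichain))
        proper : All (Proper N) (map pair Q)
        proper = All.map⁺ (All.tabulate (λ {i} _ → start<end i , end≤N i))
        bal : Balanced N (starts (map pair Q)) (ends (map pair Q))
        bal = balanced (shifted-starts≢ shifted) (shifted-ends≢ shifted) proper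
        inside⁺ : ∀ i → Below (map root Q) (root i) → Any (Inside (start i) (end i)) (map pair Q)
        inside⁺ i b = Any.map⁺ (Any.map (λ {j} → reflect (start<end j) (end≤N j) (start<end i) (end≤N i)) (Any.map⁻ b))
        inside⁻ : ∀ i → Any (Inside (start i) (end i)) (map pair Q) → Below (map root Q) (root i)
        inside⁻ i b = Any.map⁺ (Any.map (λ (u , v) → embed u v) (Any.map⁻ b))
        to : ∀ i → Ideal bal i 0 → ¬ Below (map root Q) (root i)
        to i x b = empty⇒ shifted (subst (λ a → ends (map pair Q) (end i) ≤ starts (map pair Q) a) (+-identityʳ (start i)) x) (inside⁺ i b)
        from : ∀ i → ¬ Below (map root Q) (root i) → Ideal bal i 0
        from i ¬b = subst (λ a → ends (map pair Q) (end i) ≤ starts (map pair Q) a) (sym (+-identityʳ (start i)))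
          (empty⇐ shifted (¬b ∘ inside⁻ i))

    -- Applies to every pair that encodes A, not just the one built from its intervals. The pair
    -- known for `Rvac P A` comes from duality, and this is how its size is read off.
    same-size : ∀ {A S E} (aA : IsAntichainIn model A) (b : Balanced N S E) → Encodes model (Ideal b) A → S N ≡ length A
    same-size {A} {S} {E} aA b e = trans (determined b (Encoding.bal enc) to from N ≤-refl) (Encoding.size enc)
      where
      enc : Encoding aA
      enc = encoding aA
      open Encoding enc using () renaming (S to S′; E to E′)
      to : ∀ {a b} → a < b → b ≤ N → E b ≤ S a → E′ b ≤ S′ a
      to {a} {b} a<b b≤N h = subst (λ a → E′ b ≤ S′ a) (+-identityʳ a)
        (proj₂ (Encodes.laws (Encoding.encodes enc) (full a<b b≤N)) (proj₁ (Encodes.laws e (full a<b b≤N)) (subst (λ a → E b ≤ S a) (sym (+-identityʳ a)) h)))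
      from : ∀ {a b} → a < b → b ≤ N → E′ b ≤ S′ a → E b ≤ S a
      from {a} {b} a<b b≤N h = subst (λ a → E b ≤ S a) (+-identityʳ a)
        (proj₂ (Encodes.laws e (full a<b b≤N)) (proj₁ (Encodes.laws (Encoding.encodes enc) (full a<b b≤N)) (subst (λ a → E′ b ≤ S′ a) (sym (+-identityʳ a)) h)))

    module _ {A : List (Root r)} (aA : IsAntichainIn model A) where
      open Encoding (encoding aA)

      full-Rvac-in : IsAntichainIn model (Rvac P A)
      full-Rvac-in = Rvac-in model (evolution bal) (dual-full bal) aA encodes

      full-involutive : Rvac P (Rvac P A) ≋ A
      full-involutive = Rvac-involutive model (evolution bal) (evolution (co-balanced bal)) (dual-full bal) (dual-full′ bal) aA encodes

      full-size : length A + length (Rvac P A) ≡ N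
      full-size = lia 6 (λ N a b s e c → s :≡ a :→ c :≡ b :→ c :+ e :≡ N :→ s :≡ e :→ goal (a :+ b :≡ N))
        N (length A) (length (Rvac P A)) (S N) (E N) (N ∸ E N) size
        (same-size full-Rvac-in (co-balanced bal) (Rvac-encodes model (evolution bal) (dual-full bal) aA encodes))
        (m∸n+n≡m (Balanced.E.bounded bal N)) (Balanced.total bal)

-- Symmetric posets: involution and parity counts

module HalfRvac where

  open Toggle
  open Grid
  open Lia using (lia; con; goal; _:+_; _:≤_; _:<_; _:≡_; _:≰_; _:→_)
  open Steps
  open Models
  open Count
  open FullRvac

  x+x≢1+y+y : ∀ x y → x + x ≢ suc (y + y)
  x+x≢1+y+y (suc x) (suc y) e = x+x≢1+y+y x y (suc-injective (trans (sym (+-suc x x)) (trans (suc-injective e) (+-suc (suc y) y))))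
  x+x≢1+y+y (suc zero) zero ()
  x+x≢1+y+y (suc (suc x)) zero ()

  -- Parity: the right-hand side is even only if exactly one of c and d equals 1.
  one-of : ∀ {x m c d} → x + x ≡ suc (m + m) + (c + d) → c ≤ 1 → d ≤ 1 → c + d ≡ 1 × x ≡ suc m
  one-of {x} {m} {zero} {zero} e _ _ = contradiction (trans e (+-identityʳ _)) (x+x≢1+y+y x m)
  one-of {x} {m} {suc zero} {suc zero} e _ _ =
    contradiction (trans e (lia 1 (λ m → goal (con 1 :+ (m :+ m) :+ con 2 :≡ con 1 :+ (con 1 :+ m :+ (con 1 :+ m)))) m)) (x+x≢1+y+y x (suc m))
  one-of {x} {m} {zero} {suc zero} e _ _ = refl ,
    lia 2 (λ x m → x :+ x :≡ con 1 :+ (m :+ m) :+ con 1 :→ goal (x :≡ con 1 :+ m)) x m e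
  one-of {x} {m} {suc zero} {zero} e _ _ = refl ,
    lia 2 (λ x m → x :+ x :≡ con 1 :+ (m :+ m) :+ con 1 :→ goal (x :≡ con 1 :+ m)) x m e
  one-of {c = suc (suc _)} e (s≤s ()) _
  one-of {c = zero} {suc (suc _)} e _ (s≤s ())
  one-of {c = suc zero} {suc (suc _)} e _ (s≤s ())

  -- Here e and j are the sizes of the completions of A and of its image, which add up to the odd
  -- number N, and c and c′ count central intervals. With `one-of` this yields both the total size
  -- and the count of central intervals.
  double-count : ∀ l l′ c c′ e N j m′ → e + c ≡ l + l → j + c′ ≡ l′ + l′ → j + e ≡ N → N ≡ suc (m′ + m′) →
                 (l + l′) + (l + l′) ≡ suc (m′ + m′) + (c + c′)
  double-count = lia 8 (λ l l′ c c′ e N j m′ → e :+ c :≡ l :+ l :→ j :+ c′ :≡ l′ :+ l′ :→ j :+ e :≡ N :→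
    N :≡ con 1 :+ (m′ :+ m′) :→ goal (l :+ l′ :+ (l :+ l′) :≡ con 1 :+ (m′ :+ m′) :+ (c :+ c′)))

  -- By symmetry an antichain has an end at m if and only if its completion has a start at m - 1,
  -- and the image has an end at m if and only if that start is absent.
  middle-count : ∀ μ μ′ e f m s₀ s₁ → e + μ + s₀ ≡ e + s₁ → f + μ′ + s₁ ≡ suc m → f + s₀ ≡ m → μ + μ′ ≡ 1
  middle-count = lia 7 (λ μ μ′ e f m s₀ s₁ → e :+ μ :+ s₀ :≡ e :+ s₁ :→ f :+ μ′ :+ s₁ :≡ con 1 :+ m :→ f :+ s₀ :≡ m :→ goal (μ :+ μ′ :≡ con 1))

  module Middle {N m : ℕ} (middle : suc N ≡ m + m) where

    middle≥1 : 1 ≤ m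
    middle≥1 = lia 2 (λ N m → con 1 :+ N :≡ m :+ m :→ goal (con 1 :≤ m)) N m middle

    m≤N : m ≤ N
    m≤N = lia 2 (λ N m → con 1 :+ N :≡ m :+ m :→ con 1 :≤ m :→ goal (m :≤ N)) N m middle middle≥1

    module _ {L : List Interval} (shifted : AllPairs Shifted L) (proper : All (HalfProper N) L) where

      closure-balanced : Balanced N (starts (closure N L)) (ends (closure N L))
      closure-balanced = balanced (shifted-starts≢ (closure-shifted N proper shifted))
        (shifted-ends≢ (closure-shifted N proper shifted)) (closure-proper N proper)

      closure-total : starts (closure N L) N ≡ length (closure N L)
      closure-total = starts-total (shifted-starts≢ (closure-shifted N proper shifted))
        (shifted-ends≢ (closure-shifted N proper shifted)) (closure-proper N proper)

      closure-sym : Symmetric N (starts (closure N L)) (ends (closure N L))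
      closure-sym x y e = trans (closure-symmetric N proper x y e) (sym closure-total)

      empty-half⇒ : ∀ {a b} → a + b ≤ N → ends (closure N L) b ≤ starts (closure N L) a → ¬ Any (Inside a b) L
      empty-half⇒ ab h any = empty⇒ (closure-shifted N proper shifted) h (inside-closure⁺ N any)

      empty-half⇐ : ∀ {a b} → a + b ≤ N → ¬ Any (Inside a b) L → ends (closure N L) b ≤ starts (closure N L) a
      empty-half⇐ ab ¬any = empty⇐ (closure-shifted N proper shifted) (¬any ∘ inside-closure⁻ N proper ab)

    step-before : ∀ {L} → All (HalfProper N) L →
                  ends (closure N L) m ≡ ends (closure N L) (m ∸ 1) + count (middle? {N} {m} middle) L
    step-before {L} proper = trans (ends-middle middle proper)
      (cong (λ k → count (λ q → proj₂ q <? k) (closure N L) + count (middle? {N} {m} middle) L)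
        (sym (trans (+-comm 1 (m ∸ 1)) (m∸n+n≡m middle≥1))))

    -- For symmetric pairs it suffices to compare the ideals on the half poset.
    module _ {S₁ E₁ S₂ E₂ : ℕ → ℕ} (b₁ : Balanced N S₁ E₁) (b₂ : Balanced N S₂ E₂)
             (sy₁ : Symmetric N S₁ E₁) (sy₂ : Symmetric N S₂ E₂)
             (to : ∀ {a b} → a < b → a + b ≤ N → E₁ b ≤ S₁ a → E₂ b ≤ S₂ a)
             (from : ∀ {a b} → a < b → a + b ≤ N → E₂ b ≤ S₂ a → E₁ b ≤ S₁ a) where

      extend : ∀ {S E S′ E′} → Symmetric N S E → Symmetric N S′ E′ →
               (∀ {a b} → a < b → a + b ≤ N → E b ≤ S a → E′ b ≤ S′ a) →
               ∀ {a b} → a < b → b ≤ N → E b ≤ S a → E′ b ≤ S′ a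
      extend {S} {E} {S′} {E′} sy sy′ f {a} {b} a<b b≤N h with a + b ≤? N
      ... | yes ab = f a<b ab h
      ... | no ¬ab = flip′ (f a′<b′ sum (flip h))
        where
        a′≡ : b + (N ∸ b) ≡ N
        a′≡ = m+[n∸m]≡n b≤N
        b′≡ : a + (N ∸ a) ≡ N
        b′≡ = m+[n∸m]≡n (≤-trans (<⇒≤ a<b) b≤N)
        a′<b′ : N ∸ b < N ∸ a
        a′<b′ = lia 5 (λ N a b a′ b′ → a :< b :→ b :+ a′ :≡ N :→ a :+ b′ :≡ N :→ goal (a′ :< b′)) N a b (N ∸ b) (N ∸ a) a<b a′≡ b′≡
        sum : (N ∸ b) + (N ∸ a) ≤ N
        sum = lia 5 (λ N a b a′ b′ → a :+ b :≰ N :→ b :+ a′ :≡ N :→ a :+ b′ :≡ N :→ goal (a′ :+ b′ :≤ N)) N a b (N ∸ b) (N ∸ a) ¬ab a′≡ b′≡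
        flip : E b ≤ S a → E (N ∸ a) ≤ S (N ∸ b)
        flip = lia 5 (λ Eb Sa Ea′ Sb′ K → Eb :+ Sb′ :≡ K :→ Ea′ :+ Sa :≡ K :→ Eb :≤ Sa :→ goal (Ea′ :≤ Sb′))
          (E b) (S a) (E (N ∸ a)) (S (N ∸ b)) (S N) (sy (N ∸ b) b (trans (+-comm (N ∸ b) b) a′≡)) (sy a (N ∸ a) b′≡)
        flip′ : E′ (N ∸ a) ≤ S′ (N ∸ b) → E′ b ≤ S′ a
        flip′ = lia 5 (λ Eb Sa Ea′ Sb′ K → Eb :+ Sb′ :≡ K :→ Ea′ :+ Sa :≡ K :→ Ea′ :≤ Sb′ :→ goal (Eb :≤ Sa))
          (E′ b) (S′ a) (E′ (N ∸ a)) (S′ (N ∸ b)) (S′ N) (sy′ (N ∸ b) b (trans (+-comm (N ∸ b) b) a′≡)) (sy′ a (N ∸ a) b′≡)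

      half-determined : ∀ z → z ≤ N → S₁ z ≡ S₂ z
      half-determined = determined b₁ b₂ (extend sy₁ sy₂ to) (extend sy₂ sy₁ from)

  module _ {r} {P : List (Root r)} {N m} (roots : HalfRoots P N m) where
    open HalfRoots roots
    open HalfIx
    open Middle {N} {m} middle
    open Half roots
    open Model model using (Evolution; ρ)

    dual-half : ∀ {S E} (b : Balanced N S E) (sy : Symmetric N S E) →
                Dual model (Ideal b sy) (Ideal (co-balanced b) (co-symmetric b sy))
    dual-half b sy = dually λ i → final⇔dual b (rank-at i)

    dual-half′ : ∀ {S E} (b : Balanced N S E) (sy : Symmetric N S E) →
                 Dual model (Ideal (co-balanced b) (co-symmetric b sy)) (Ideal b sy)
    dual-half′ b sy = dually λ i → final⇔dual′ b (rank-at i)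

    -- An antichain A that generates the same filter as a list of intervals in
    -- which colours play no role.
    record Plain (A : List (Root r)) : Set where
      field
        {L}     : List Interval
        shifted : AllPairs Shifted L
        proper  : All (HalfProper N) L
        inside⇒ : ∀ i → Below A (root i) → Any (Inside (start i) (end i)) L
        inside⇐ : ∀ i → Any (Inside (start i) (end i)) L → Below A (root i)

      S E : ℕ → ℕ
      S = starts (closure N L)
      E = ends (closure N L)

      bal : Balanced N S E
      bal = closure-balanced shifted proper

      sy : Symmetric N S E
      sy = closure-sym shifted proper

      encodes : Encodes model (Ideal bal sy) A
      encodes = encode λ i →
        (λ x b → empty-half⇒ shifted proper (sum≤N i)
          (subst (λ a → E (end i) ≤ S a) (+-identityʳ (start i)) x) (inside⇒ i b)) ,
        (λ ¬b → subst (λ a → E (end i) ≤ S a) (sym (+-identityʳ (start i)))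
          (empty-half⇐ shifted proper (sum≤N i) (¬b ∘ inside⇐ i)))

    module _ {A : List (Root r)} (aA : IsAntichainIn model A) (pA : Plain A) where
      open Plain pA

      plain-Rvac-in : IsAntichainIn model (Rvac P A)
      plain-Rvac-in = Rvac-in model (evolution bal sy) (dual-half bal sy) aA encodes

      plain-Rvac-encodes : Encodes model (Ideal (co-balanced bal) (co-symmetric bal sy)) (Rvac P A)
      plain-Rvac-encodes = Rvac-encodes model (evolution bal sy) (dual-half bal sy) aA encodes

      plain-involutive : Rvac P (Rvac P A) ≋ A
      plain-involutive = Rvac-involutive model (evolution bal sy) (evolution (co-balanced bal) (co-symmetric bal sy))
        (dual-half bal sy) (dual-half′ bal sy) aA encodes

      module _ (pB : Plain (Rvac P A)) where
        private
          module B = Plain pB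

        co-E≡S : ∀ z → z ≤ N → co E z ≡ B.S z
        co-E≡S = half-determined (co-balanced bal) B.bal (co-symmetric bal sy) B.sy to from
          where
          to : ∀ {a b} → a < b → a + b ≤ N → co S b ≤ co E a → B.E b ≤ B.S a
          to {a} {b} a<b ab h = subst (λ a → B.E b ≤ B.S a) (+-identityʳ a) (proj₂ (Encodes.laws B.encodes (half a<b ab true))
            (proj₁ (Encodes.laws plain-Rvac-encodes (half a<b ab true)) (subst (λ a → co S b ≤ co E a) (sym (+-identityʳ a)) h)))
          from : ∀ {a b} → a < b → a + b ≤ N → B.E b ≤ B.S a → co S b ≤ co E a
          from {a} {b} a<b ab h = subst (λ a → co S b ≤ co E a) (+-identityʳ a) (proj₂ (Encodes.laws plain-Rvac-encodes (half a<b ab true))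
            (proj₁ (Encodes.laws B.encodes (half a<b ab true)) (subst (λ a → B.E b ≤ B.S a) (sym (+-identityʳ a)) h)))

        -- Symmetry expresses E through S and the total, so the agreement for starts carries over to
        -- ends.
        co-S≡E : ∀ y → y ≤ N → co S y ≡ B.E y
        co-S≡E y y≤N = +-cancelʳ-≡ (co E (N ∸ y)) _ _ (begin
          co S y + co E (N ∸ y)   ≡⟨ co-symmetric bal sy (N ∸ y) y (m∸n+n≡m y≤N) ⟩
          co E N                  ≡⟨ co-E≡S N ≤-refl ⟩
          B.S N                   ≡⟨ sym (B.sy (N ∸ y) y (m∸n+n≡m y≤N)) ⟩
          B.E y + B.S (N ∸ y)     ≡⟨ cong (B.E y +_) (sym (co-E≡S (N ∸ y) (m∸n≤m N y))) ⟩
          B.E y + co E (N ∸ y)    ∎)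
          where open ≡-Reasoning

        plain-count : count (central? N) L + count (central? N) B.L ≡ 1 × length L + length B.L ≡ m
        plain-count = proj₁ counted , trans (proj₂ counted) (m+[n∸m]≡n (middle≥1))
          where
          double : (length L + length B.L) + (length L + length B.L) ≡
                   suc (m ∸ 1 + (m ∸ 1)) + (count (central? N) L + count (central? N) B.L)
          double = double-count (length L) (length B.L) (count (central? N) L) (count (central? N) B.L) (E N) N (co E N) (m ∸ 1)
            (trans (cong (_+ count (central? N) L) size-A) (closure-length N proper))
            (trans (cong (_+ count (central? N) B.L) size-B) (closure-length N B.proper))
            (m∸n+n≡m (Balanced.E.bounded bal N)) N≡
            where
            m≡ : suc (m ∸ 1) ≡ m
            m≡ = m+[n∸m]≡n (middle≥1)
            N≡ : N ≡ suc (m ∸ 1 + (m ∸ 1))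
            N≡ = suc-injective (trans middle (trans (cong₂ _+_ (sym m≡) (sym m≡)) (cong suc (+-suc (m ∸ 1) (m ∸ 1)))))
            size-A : E N ≡ length (closure N L)
            size-A = trans (sym (Balanced.total bal)) (closure-total shifted proper)
            size-B : co E N ≡ length (closure N B.L)
            size-B = trans (co-E≡S N ≤-refl) (closure-total B.shifted B.proper)
          counted : count (central? N) L + count (central? N) B.L ≡ 1 × length L + length B.L ≡ suc (m ∸ 1)
          counted = one-of double (central≤1 N shifted) (central≤1 N B.shifted)

        plain-middle : count (middle? {N} {m} middle) L + count (middle? {N} {m} middle) B.L ≡ 1
        plain-middle = middle-count (count (middle? {N} {m} middle) L) (count (middle? {N} {m} middle) B.L) (E (m ∸ 1)) (B.E (m ∸ 1)) (m ∸ 1) (S (m ∸ 1)) (S m) balance at-middle before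
          where
          e₁ : m ∸ 1 + m ≡ N
          e₁ = suc-injective (trans (cong (_+ m) (m+[n∸m]≡n (middle≥1))) (sym middle))
          balance : E (m ∸ 1) + count (middle? {N} {m} middle) L + S (m ∸ 1) ≡ E (m ∸ 1) + S m
          balance = trans (cong (_+ S (m ∸ 1)) (sym (step-before proper)))
                          (trans (sy (m ∸ 1) m e₁) (sym (sy m (m ∸ 1) (trans (+-comm m (m ∸ 1)) e₁))))
          at-middle : B.E (m ∸ 1) + count (middle? {N} {m} middle) B.L + S m ≡ suc (m ∸ 1)
          at-middle = trans (cong (_+ S m) (trans (sym (step-before B.proper)) (sym (co-S≡E m (m≤N)))))
                            (trans (m∸n+n≡m (Balanced.S.bounded bal m)) (sym (m+[n∸m]≡n (middle≥1))))
          before : B.E (m ∸ 1) + S (m ∸ 1) ≡ m ∸ 1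
          before = trans (cong (_+ S (m ∸ 1)) (sym (co-S≡E (m ∸ 1) (≤-trans (m∸n≤m m 1) (m≤N)))))
                         (m∸n+n≡m (Balanced.S.bounded bal (m ∸ 1)))

-- Lists up to equality of sets

module Sets where

  open Toggle
  open import Data.List.Membership.Propositional.Properties.WithK using (unique∧set⇒bag)
  open import Data.List.Relation.Binary.BagAndSetEquality using (∼bag⇒↭)
  open import Data.List.Relation.Binary.Permutation.Propositional.Properties using (↭-length)

  ≋-sym : ∀ {r} {X Y : List (Root r)} → X ≋ Y → Y ≋ X
  ≋-sym e x = proj₂ (e x) , proj₁ (e x)

  ≋-trans : ∀ {r} {X Y Z : List (Root r)} → X ≋ Y → Y ≋ Z → X ≋ Z
  ≋-trans e f x = proj₁ (f x) ∘ proj₁ (e x) , proj₂ (e x) ∘ proj₂ (f x)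

  ∷-≋ : ∀ {r} {x y : Root r} {X Y} → x ≡ y → X ≋ Y → (x ∷ X) ≋ (y ∷ Y)
  ∷-≋ refl e z = (λ { (here q) → here q ; (there z∈) → there (proj₁ (e z) z∈) }) , (λ { (here q) → here q ; (there z∈) → there (proj₂ (e z) z∈) })

  antichain⇒unique : ∀ {r} {X : List (Root r)} → Antichain X → Unique X
  antichain⇒unique = AllPairs.map (λ { (x≰y , _) refl → x≰y ≤ᵣ-refl })

  ≋-length : ∀ {r} {X Y : List (Root r)} → Unique X → Unique Y → X ≋ Y → length X ≡ length Y
  ≋-length uX uY e = ↭-length (∼bag⇒↭ (unique∧set⇒bag uX uY (λ {x} → mk⇔ (proj₁ (e x)) (proj₂ (e x)))))

  countIn-≋ : ∀ {r} (S : List (Root r)) {X Y} → Unique X → Unique Y → X ≋ Y → countIn S X ≡ countIn S Y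
  countIn-≋ S uX uY e = ≋-length (Unique.filter⁺ (λ x → x ∈? S) uX) (Unique.filter⁺ (λ x → x ∈? S) uY)
    (λ x → (λ x∈ → let p , q = ∈-filter⁻ (λ x → x ∈? S) x∈ in ∈-filter⁺ (λ x → x ∈? S) (proj₁ (e x) p) q) ,
           (λ x∈ → let p , q = ∈-filter⁻ (λ x → x ∈? S) x∈ in ∈-filter⁺ (λ x → x ∈? S) (proj₂ (e x) p) q))

-- Type D: duality and uniqueness for the twisted rule

module TwistedRvac where

  open Toggle
  open Grid
  open Lia using (lia; con; goal; _:+_; _:≤_; _:<_; _:≡_; _:→_)
  open Steps
  open Models
  open Twisted
  open Count
  open FullRvac
  open HalfRvac

  odd-+ : ∀ x y → odd (x + y) ≡ odd x xor odd y
  odd-+ zero y = refl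
  odd-+ (suc x) y rewrite odd-+ x y with odd x | odd y
  ... | true | true = refl
  ... | true | false = refl
  ... | false | true = refl
  ... | false | false = refl

  xor-exchange : ∀ c s s′ → c xor s ≡ (c xor (s′ xor s)) xor s′
  xor-exchange true true true = refl
  xor-exchange true true false = refl
  xor-exchange true false true = refl
  xor-exchange true false false = refl
  xor-exchange false true true = refl
  xor-exchange false true false = refl
  xor-exchange false false true = refl
  xor-exchange false false false = refl

  xor-cancel : ∀ x y → (x xor y) xor y ≡ x
  xor-cancel true true = refl
  xor-cancel true false = refl
  xor-cancel false true = refl
  xor-cancel false false = refl

  complement-≡ : ∀ v s v′ s′ b → v + s′ ≡ b → v′ + s ≡ b → v ≡ s → v′ ≡ s′
  complement-≡ = lia 5 (λ v s v′ s′ b → v :+ s′ :≡ b :→ v′ :+ s :≡ b :→ v :≡ s :→ goal (v′ :≡ s′))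

  complement-< : ∀ v s v′ s′ b → v + s′ ≡ b → v′ + s ≡ b → v < s → v′ < s′
  complement-< = lia 5 (λ v s v′ s′ b → v :+ s′ :≡ b :→ v′ :+ s :≡ b :→ v :< s :→ goal (v′ :< s′))

  -- At a tie v = s in the middle, s + s′ = m. The parities of s and s′ thus differ by that of m,
  -- and the constant c has to absorb this difference.
  twisted-dual : ∀ {m c c′ b v s v′ s′ ε} → c′ ≡ c xor odd m → v + s′ ≡ b → v′ + s ≡ b →
                 Twisted m c b v s ε → Twisted m c′ b v′ s′ ε
  twisted-dual {b = b} {v} {s} {v′} {s′} _ h h′ (strict p) = strict (complement-< v s v′ s′ b h h′ p)
  twisted-dual {b = b} {v} {s} {v′} {s′} _ h h′ (left p q) = left p (complement-≡ v s v′ s′ b h h′ q)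
  twisted-dual {m} {c} {b = b} {v} {s} {v′} {s′} refl h h′ (mid refl q e) = mid refl (complement-≡ v s v′ s′ b h h′ q)
    (trans e (trans (xor-exchange c (odd s) (odd s′))
      (cong (λ x → (c xor x) xor odd s′) (trans (sym (odd-+ s′ s)) (cong odd (trans (+-comm s′ s) (trans (cong (_+ s′) (sym q)) h)))))))

  straddling-lemma : ∀ x s y e m′ m → x + s ≡ m → y + e ≡ m′ → suc m′ ≡ m → e < s → x ≤ y
  straddling-lemma = lia 6 (λ x s y e m′ m → x :+ s :≡ m :→ y :+ e :≡ m′ :→ con 1 :+ m′ :≡ m :→ e :< s :→ goal (x :≤ y))

  straddling-lemma′ : ∀ x s y e m′ m → x + s ≡ m′ → y + e ≡ m → suc m′ ≡ m → e ≤ s → x < y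
  straddling-lemma′ = lia 6 (λ x s y e m′ m → x :+ s :≡ m′ :→ y :+ e :≡ m :→ con 1 :+ m′ :≡ m :→ e :≤ s :→ goal (x :< y))

  flip-< : ∀ e s e′ s′ K → e + s′ ≡ K → e′ + s ≡ K → e < s → e′ < s′
  flip-< = lia 5 (λ e s e′ s′ K → e :+ s′ :≡ K :→ e′ :+ s :≡ K :→ e :< s :→ goal (e′ :< s′))

  module TwistedMiddle {N m : ℕ} (middle : suc N ≡ m + m) where
    open Middle {N} {m} middle

    m-1 : suc (m ∸ 1) ≡ m
    m-1 = m+[n∸m]≡n (middle≥1)

    <m⇒≤m-1 : ∀ {a} → a < m → a ≤ m ∸ 1
    <m⇒≤m-1 = ∸-monoˡ-≤ 1

    co-straddling : ∀ {S E} → Balanced N S E → Straddling m S E → Straddling m (co E) (co S)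
    co-straddling {S} {E} b st = record
      { E≤S⁻ = straddling-lemma (co S m) (S m) (co E (m ∸ 1)) (E (m ∸ 1)) (m ∸ 1) m
                 (m∸n+n≡m (Balanced.S.bounded b m)) (m∸n+n≡m (Balanced.E.bounded b (m ∸ 1))) m-1 (Straddling.E⁻<S st)
      ; E⁻<S = straddling-lemma′ (co S (m ∸ 1)) (S (m ∸ 1)) (co E m) (E m) (m ∸ 1) m
                 (m∸n+n≡m (Balanced.S.bounded b (m ∸ 1))) (m∸n+n≡m (Balanced.E.bounded b m)) m-1 (Straddling.E≤S⁻ st)
      }

    mid-sum′ : ∀ {a} → a < m → a + m ≤ N
    mid-sum′ {a} a<m = s≤s⁻¹ (subst (suc (a + m) ≤_) (sym middle) (+-monoˡ-≤ m a<m))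

    before-sum′ : ∀ {a b} → a < b → b ≤ m → a + b ≤ N
    before-sum′ {a} a<b b≤m = ≤-trans (+-monoʳ-≤ a b≤m) (mid-sum′ (<-≤-trans a<b b≤m))

    module _ {S₁ E₁ S₂ E₂ : ℕ → ℕ} (b₁ : Balanced N S₁ E₁) (b₂ : Balanced N S₂ E₂) where
      private
        module B₁ = Balanced b₁
        module B₂ = Balanced b₂

      -- Ideals are now known with ≤ for ends up to m and with < for ends from m on. If the value S₁
      -- (1 + z) is at most E₁ m, then `no-jump` applies. Otherwise E₁ takes the value S₁ z at some
      -- b ≥ m, and the rise at z shows in the strict ideals at b.
      no-jump′ : (∀ {a b} → a < b → b ≤ m → E₁ b ≤ S₁ a → E₂ b ≤ S₂ a) →
                 (∀ {a b} → a < b → b ≤ m → E₂ b ≤ S₂ a → E₁ b ≤ S₁ a) →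
                 (∀ {a b} → a < m → m ≤ b → b ≤ N → E₁ b < S₁ a → E₂ b < S₂ a) →
                 (∀ {a b} → a < m → m ≤ b → b ≤ N → E₂ b < S₂ a → E₁ b < S₁ a) →
                 ∀ z → suc z < m → S₁ z ≡ S₂ z → S₁ (suc z) ≤ S₂ (suc z)
      no-jump′ to from to< from< z z<m eq with S₁ (suc z) ≤? S₂ (suc z) | S₁ (suc z) ≤? E₁ m
      ... | yes p | _ = p
      ... | no _ | yes top = no-jump b₁ b₂ to from z (<⇒≤ z<m) top eq
      ... | no jump | no ¬top with B₁.E.attains (N ∸ m) {m} {N} {S₁ z} (m∸n+n≡m (m≤N))
                                     (s≤s⁻¹ (≤-trans (≰⇒> ¬top) (B₁.S.slow z)))
                                     (≤-trans (B₁.S.increasing (≤-trans (n≤1+n z) (≤-trans (<⇒≤ z<m) (m≤N)))) (≤-reflexive B₁.total))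
      ...   | b , m≤b , b≤N , Eb = contradiction Eb (<⇒≢ (from< (<⇒≤ z<m) m≤b b≤N
                (<-≤-trans (to< z<m m≤b b≤N (subst (_< S₁ (suc z)) (sym Eb) rise)) S₂-flat)))
        where
        S₂-flat : S₂ (suc z) ≤ S₂ z
        S₂-flat = s≤s⁻¹ (≤-trans (≰⇒> jump) (≤-trans (B₁.S.slow z) (s≤s (≤-reflexive eq))))
        rise : S₁ z < S₁ (suc z)
        rise = ≤-<-trans (≤-trans (≤-reflexive eq) (B₂.S.up z)) (≰⇒> jump)

  module _ {r} {P : List (Root r)} {N m} (roots : HalfRoots P N m)
           (coloured : ∀ {a d ε δ} → a < m → d < m → HalfRoots.vec roots a m ε ≤ᵣ HalfRoots.vec roots d m δ → ε ≡ δ) where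
    open HalfRoots roots
    open HalfIx
    open Middle {N} {m} middle
    open TwistedMiddle {N} {m} middle
    open Half roots
    open Model model using (Evolution; ρ)

    record TwistedData : Set where
      field
        {S E}      : ℕ → ℕ
        bal        : Balanced N S E
        sy         : Symmetric N S E
        straddling : Straddling m S E
        c          : Bool

      X : HalfIx N → ℕ → Set
      X = TwistedIdeal roots bal sy straddling c coloured

      evolves : Evolution X
      evolves = twisted-evolution roots bal sy straddling c coloured

    dual-data : TwistedData → TwistedData
    dual-data d = record
      { bal = co-balanced bal
      ; sy = co-symmetric bal sy
      ; straddling = co-straddling bal straddling
      ; c = c xor odd m
      }
      where open TwistedData d

    exchange-at : ∀ {S E} → Balanced N S E → ∀ i (c c′ : Bool) → c′ ≡ c xor odd m →
      (S′ E′ : ℕ → ℕ) → E (start i) + S′ (start i) ≡ start i → E′ (end i) + S (end i) ≡ end i →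
      Twisted m c (end i) (suc (ρ i) + E (end i ∸ suc (ρ i))) (S (start i + suc (ρ i))) (colour i) →
      Twisted m c′ (end i) (E′ (end i)) (S′ (start i + 0)) (colour i)
    exchange-at {S} {E} b i c c′ c≡ S′ E′ h h′ x =
      twisted-dual {v = suc (ρ i) + E (end i ∸ suc (ρ i))} {S (start i + suc (ρ i))} {E′ (end i)} {S′ (start i + 0)} c≡
        (trans (cong₂ (λ x y → suc (ρ i) + E x + S′ y) a≡ (+-identityʳ (start i)))
          (trans (+-assoc (suc (ρ i)) _ _) (trans (cong (suc (ρ i) +_) h) (rank-at i))))
        (trans (cong (λ x → E′ (end i) + S x) b≡) h′) x
      where
      b≡ : start i + suc (ρ i) ≡ end i
      b≡ = trans (+-suc (start i) (ρ i)) (trans (cong suc (+-comm (start i) (ρ i))) (rank-at i))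
      a≡ : end i ∸ suc (ρ i) ≡ start i
      a≡ = trans (cong (_∸ suc (ρ i)) (sym b≡)) (m+n∸n≡m (start i) (suc (ρ i)))

    exchange-at⁻ : ∀ {S E} → Balanced N S E → ∀ i (c c′ : Bool) → c ≡ c′ xor odd m →
      (S′ E′ : ℕ → ℕ) → E (start i) + S′ (start i) ≡ start i → E′ (end i) + S (end i) ≡ end i →
      Twisted m c′ (end i) (E′ (end i)) (S′ (start i + 0)) (colour i) →
      Twisted m c (end i) (suc (ρ i) + E (end i ∸ suc (ρ i))) (S (start i + suc (ρ i))) (colour i)
    exchange-at⁻ {S} {E} b i c c′ c≡ S′ E′ h h′ x =
      twisted-dual {v = E′ (end i)} {S′ (start i + 0)} {suc (ρ i) + E (end i ∸ suc (ρ i))} {S (start i + suc (ρ i))} c≡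
        (trans (cong (λ x → E′ (end i) + S x) b≡) h′)
        (trans (cong₂ (λ x y → suc (ρ i) + E x + S′ y) a≡ (+-identityʳ (start i)))
          (trans (+-assoc (suc (ρ i)) _ _) (trans (cong (suc (ρ i) +_) h) (rank-at i)))) x
      where
      b≡ : start i + suc (ρ i) ≡ end i
      b≡ = trans (+-suc (start i) (ρ i)) (trans (cong suc (+-comm (start i) (ρ i))) (rank-at i))
      a≡ : end i ∸ suc (ρ i) ≡ start i
      a≡ = trans (cong (_∸ suc (ρ i)) (sym b≡)) (m+n∸n≡m (start i) (suc (ρ i)))

    module _ (d : TwistedData) where
      open TwistedData d

      dual-twisted : Dual model X (TwistedData.X (dual-data d))
      dual-twisted = dually λ i →
        exchange-at bal i c (c xor odd m) refl (co E) (co S) (m+[n∸m]≡n (Balanced.E.bounded bal _)) (m∸n+n≡m (Balanced.S.bounded bal _)) ,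
        exchange-at⁻ bal i c (c xor odd m) (sym (xor-cancel c (odd m))) (co E) (co S)
          (m+[n∸m]≡n (Balanced.E.bounded bal _)) (m∸n+n≡m (Balanced.S.bounded bal _))

      dual-twisted′ : Dual model (TwistedData.X (dual-data d)) X
      dual-twisted′ = dually λ i →
        exchange-at (co-balanced bal) i (c xor odd m) c (sym (xor-cancel c (odd m))) S E (m∸n+n≡m (Balanced.S.bounded bal _)) (m+[n∸m]≡n (Balanced.E.bounded bal _)) ,
        exchange-at⁻ (co-balanced bal) i (c xor odd m) c refl S E (m∸n+n≡m (Balanced.S.bounded bal _)) (m+[n∸m]≡n (Balanced.E.bounded bal _))

    module _ {A : List (Root r)} (d : TwistedData) (enc : Encodes model (TwistedData.X d) A) where
      open TwistedData d

      at-zero : ∀ {a b ε} → a < b → a + b ≤ N → Twisted m c b (E b) (S a) ε → ¬ Below A (vec a b ε)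
      at-zero {a} {b} {ε} a<b ab x = proj₁ (Encodes.laws enc (half a<b ab ε))
        (subst (λ a → Twisted m c b (E b) (S a) ε) (sym (+-identityʳ a)) x)

      at-zero⁻ : ∀ {a b ε} → a < b → a + b ≤ N → ¬ Below A (vec a b ε) → Twisted m c b (E b) (S a) ε
      at-zero⁻ {a} {b} {ε} a<b ab ¬b =
        subst (λ a → Twisted m c b (E b) (S a) ε) (+-identityʳ a) (proj₂ (Encodes.laws enc (half a<b ab ε)) ¬b)

      -- S climbs in unit steps from 0 to S (m - 1), which is at least E m, so a tie really occurs
      -- at some root ending in the middle.
      meets-middle : ∃ λ a → a < m × S a ≡ E m
      meets-middle with Balanced.S.attains bal (m ∸ 1) {0} {m ∸ 1} {E m} (+-identityʳ _)
                          (≤-trans (≤-reflexive (Balanced.S.zero≡ bal)) z≤n) (Straddling.E≤S⁻ straddling)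
      ... | a , _ , a≤ , e = a , ≤-trans (s≤s a≤) (≤-reflexive (m-1)) , e

      -- The two colours are told apart where S meets the value E m, so the
      -- filter is not symmetric in the colours.
      not-plain : ∀ {S′ E′} (bal′ : Balanced N S′ E′) (sy′ : Symmetric N S′ E′) → Encodes model (Ideal bal′ sy′) A → ⊥
      not-plain bal′ sy′ enc′ with meets-middle
      ... | a , a<m , e = colours′ (at-zero⁻ a<m ab (proj₁ (Encodes.laws enc′ (half a<m ab (not ε)))
                            (proj₂ (Encodes.laws enc′ (half a<m ab ε)) (at-zero a<m ab (mid refl (sym e) refl)))))
        where
        ab : a + m ≤ N
        ab = mid-sum′ a<m
        ε : Bool
        ε = c xor odd (S a)
        colours′ : ¬ Twisted m c m (E m) (S a) (not ε)
        colours′ (strict l) = <⇒≢ l (sym e)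
        colours′ (left l _) = n≮n m l
        colours′ (mid _ _ f) = not≢ f

    module _ {A : List (Root r)} where

      -- Up to the middle, E b ≤ S a says that some colour of (a, b] is in the ideal; from the
      -- middle on, E b < S a says that every colour is. So A determines both kinds of inequality,
      -- whichever twisted pair encodes it.
      transfer-≤ : (d₁ d₂ : TwistedData) → Encodes model (TwistedData.X d₁) A → Encodes model (TwistedData.X d₂) A →
                   ∀ {a b} → a < b → b ≤ m → TwistedData.E d₁ b ≤ TwistedData.S d₁ a → TwistedData.E d₂ b ≤ TwistedData.S d₂ a
      transfer-≤ d₁ d₂ e₁ e₂ {a} {b} a<b b≤m h with somewhere {m} {TwistedData.c d₁} b≤m h
      ... | ε , x = twisted⇒≤ (at-zero⁻ d₂ e₂ a<b (before-sum′ a<b b≤m) (at-zero d₁ e₁ a<b (before-sum′ a<b b≤m) x))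

      transfer-< : (d₁ d₂ : TwistedData) → Encodes model (TwistedData.X d₁) A → Encodes model (TwistedData.X d₂) A →
                   ∀ {a b} → a < m → m ≤ b → b ≤ N → TwistedData.E d₁ b < TwistedData.S d₁ a → TwistedData.E d₂ b < TwistedData.S d₂ a
      transfer-< d₁ d₂ e₁ e₂ {a} {b} a<m m≤b b≤N h with a + b ≤? N
      ... | yes ab = both⁻ {c = D₂.c} m≤b (λ ε → at-zero⁻ d₂ e₂ {ε = ε} (<-≤-trans a<m m≤b) ab
                        (at-zero d₁ e₁ (<-≤-trans a<m m≤b) ab (strict h)))
        where
        module D₂ = TwistedData d₂
      ... | no ¬ab = flip-< (D₂.E (N ∸ a)) (D₂.S (N ∸ b)) (D₂.E b) (D₂.S a) (D₂.S N) (D₂.sy a (N ∸ a) b′≡) (D₂.sy (N ∸ b) b a′≡)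
          (both⁻ {c = D₂.c} m≤b′ (λ ε → at-zero⁻ d₂ e₂ {ε = ε} a′<b′ sum (at-zero d₁ e₁ a′<b′ sum (strict
            (flip-< (D₁.E b) (D₁.S a) (D₁.E (N ∸ a)) (D₁.S (N ∸ b)) (D₁.S N) (D₁.sy (N ∸ b) b a′≡) (D₁.sy a (N ∸ a) b′≡) h)))))
        where
        module D₁ = TwistedData d₁
        module D₂ = TwistedData d₂
        a′≡ : N ∸ b + b ≡ N
        a′≡ = m∸n+n≡m b≤N
        b′≡ : a + (N ∸ a) ≡ N
        b′≡ = m+[n∸m]≡n (≤-trans (<⇒≤ a<m) (m≤N))
        m≤b′ : m ≤ N ∸ a
        m≤b′ = +-cancelˡ-≤ a m (N ∸ a) (subst (a + m ≤_) (sym b′≡) (mid-sum′ a<m))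
        a′<b′ : N ∸ b < N ∸ a
        a′<b′ = ∸-monoʳ-< (<-≤-trans a<m m≤b) b≤N
        sum : (N ∸ b) + (N ∸ a) ≤ N
        sum = ≤-trans (+-monoʳ-≤ (N ∸ b) (m≤n+o⇒m∸n≤o N a (<⇒≤ (≰⇒> ¬ab)))) (≤-reflexive a′≡)

      module _ (d₁ d₂ : TwistedData) (e₁ : Encodes model (TwistedData.X d₁) A) (e₂ : Encodes model (TwistedData.X d₂) A) where
        private
          module D₁ = TwistedData d₁
          module D₂ = TwistedData d₂

        twisted-starts : ∀ z → z < m → D₁.S z ≡ D₂.S z
        twisted-starts zero _ = trans (Balanced.S.zero≡ D₁.bal) (sym (Balanced.S.zero≡ D₂.bal))
        twisted-starts (suc z) z<m = ≤-antisym
          (no-jump′ D₁.bal D₂.bal (transfer-≤ d₁ d₂ e₁ e₂) (transfer-≤ d₂ d₁ e₂ e₁) (transfer-< d₁ d₂ e₁ e₂) (transfer-< d₂ d₁ e₂ e₁) z z<m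
            (twisted-starts z (<⇒≤ z<m)))
          (no-jump′ D₂.bal D₁.bal (transfer-≤ d₂ d₁ e₂ e₁) (transfer-≤ d₁ d₂ e₁ e₂) (transfer-< d₂ d₁ e₂ e₁) (transfer-< d₁ d₂ e₁ e₂) z z<m
            (sym (twisted-starts z (<⇒≤ z<m))))

      -- Compared at the start a < m where the first S takes the value E m: the second pair
      -- satisfies its inequality there too, and the two S agree before the middle.
      twisted-end≤ : (d₁ d₂ : TwistedData) → Encodes model (TwistedData.X d₁) A → Encodes model (TwistedData.X d₂) A →
                     TwistedData.E d₂ m ≤ TwistedData.E d₁ m
      twisted-end≤ d₁ d₂ e₁ e₂ with meets-middle d₁ e₁
      ... | a , a<m , e = ≤-trans (transfer-≤ d₁ d₂ e₁ e₂ a<m ≤-refl (≤-reflexive (sym e)))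
                            (≤-reflexive (trans (sym (twisted-starts d₁ d₂ e₁ e₂ a a<m)) e))

      -- By symmetry the total is E m + S (m - 1), and both terms have been determined.
      twisted-total : (d₁ d₂ : TwistedData) → Encodes model (TwistedData.X d₁) A → Encodes model (TwistedData.X d₂) A →
                      TwistedData.S d₁ N ≡ TwistedData.S d₂ N
      twisted-total d₁ d₂ e₁ e₂ = trans (sym (D₁.sy (m ∸ 1) m N≡)) (trans
          (cong₂ _+_ (≤-antisym (twisted-end≤ d₂ d₁ e₂ e₁) (twisted-end≤ d₁ d₂ e₁ e₂))
                     (twisted-starts d₁ d₂ e₁ e₂ (m ∸ 1) (≤-reflexive (m-1)))) (D₂.sy (m ∸ 1) m N≡))
        where
        module D₁ = TwistedData d₁
        module D₂ = TwistedData d₂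
        N≡ : m ∸ 1 + m ≡ N
        N≡ = suc-injective (trans (cong (_+ m) (m-1)) (sym middle))

-- Type D: the twisted pair of an antichain

module TwistedDecode where

  open Toggle
  open Grid
  open Lia using (lia; con; goal; _:+_; _:≤_; _:<_; _:≡_; _:→_)
  open Steps
  open Models
  open Twisted
  open Count
  open FullRvac
  open HalfRvac
  open TwistedRvac
  open import Data.List.Relation.Unary.Any using (any?)

  mirror-right : ∀ N m p p* → suc N ≡ m + m → suc p < m → p + p* ≡ N → m < p*
  mirror-right = lia 4 (λ N m p p* → con 1 :+ N :≡ m :+ m :→ con 1 :+ p :< m :→ p :+ p* :≡ N :→ goal (m :< p*))

  mirror-left⁻ : ∀ N m b a′ → suc N ≡ m + m → b < m → b + a′ ≡ N → m ≤ a′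
  mirror-left⁻ = lia 4 (λ N m b a′ → con 1 :+ N :≡ m :+ m :→ b :< m :→ b :+ a′ :≡ N :→ goal (m :≤ a′))

  mirror-beyond : ∀ N a b b′ → a + b ≤ N → a + b′ ≡ N → b ≤ b′
  mirror-beyond = lia 4 (λ N a b b′ → a :+ b :≤ N :→ a :+ b′ :≡ N :→ goal (b :≤ b′))

  mirror-anti : ∀ N p p* a b → p < a → p + p* ≡ N → a + b ≤ N → b < p*
  mirror-anti = lia 5 (λ N p p* a b → p :< a :→ p :+ p* :≡ N :→ a :+ b :≤ N :→ goal (b :< p*))

  symmetric-∷ : ∀ e u s k l → e + s ≡ l → u + k ≡ 1 → u + e + (k + s) ≡ suc l
  symmetric-∷ = lia 5 (λ e u s k l → e :+ s :≡ l :→ u :+ k :≡ con 1 :→ goal (u :+ e :+ (k :+ s) :≡ con 1 :+ l))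

  -- The special interval (p, m] of colour σ, the root of smallest start that
  -- ends in the middle, is replaced by its extension (p, N - p].
  module _ {r} {P : List (Root r)} {N m} (roots : HalfRoots P N m)
           (coloured : ∀ {a d ε δ} → a < m → d < m → HalfRoots.vec roots a m ε ≤ᵣ HalfRoots.vec roots d m δ → ε ≡ δ) where
    open HalfRoots roots
    open HalfIx
    open Middle {N} {m} middle
    open TwistedMiddle {N} {m} middle
    open Half roots

    -- Where the other intervals lie: incomparability with (p, m] makes those ending before the
    -- middle start before p and those ending beyond it start after p. One ending in the middle
    -- starts after p by the choice of p.
    Side : ℕ → Interval → Set
    Side p (a , b) = (b < m × a < p) ⊎ (m ≤ b × p < a)

    -- The filter generated by A, split into what lies above the special root and what lies above
    -- the other intervals L; an interval of L that ends in the middle has colour `not σ`.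
    record Source (A : List (Root r)) : Set where
      field
        p       : ℕ
        σ       : Bool
        p<      : suc p < m
        {L}     : List Interval
        shifted : AllPairs Shifted L
        proper  : All (HalfProper N) L
        sides   : All (Side p) L
        below⇒  : ∀ {a b ε} → a < b → a + b ≤ N → Below A (vec a b ε) →
                  (m ≤ b × a ≤ p × (b ≡ m → ε ≡ σ)) ⊎ Any (λ q → Inside a b q × (proj₂ q ≡ m → b ≡ m → ε ≡ not σ)) L
        below⇐₁ : ∀ {a b ε} → m ≤ b → a ≤ p → (b ≡ m → ε ≡ σ) → Below A (vec a b ε)
        below⇐₂ : ∀ {a b ε} → Any (λ q → Inside a b q × (proj₂ q ≡ m → b ≡ m → ε ≡ not σ)) L → Below A (vec a b ε)

    module _ {A : List (Root r)} (source : Source A) where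
      open Source source

      private
        p* : ℕ
        p* = N ∸ p

        p<m : p < m
        p<m = <-trans (n<1+n p) p<

        p+p* : p + p* ≡ N
        p+p* = m+[n∸m]≡n (≤-trans (<⇒≤ p<m) m≤N)

        m<p* : m < p*
        m<p* = mirror-right N m p p* middle p< p+p*

        L̂ M : List Interval
        L̂ = closure N L
        -- This is no antichain in general, since (p, p*] contains the intervals of L ending at or
        -- after the middle. Its starts and its ends are nevertheless distinct, and balance rests on
        -- that.
        M = (p , p*) ∷ L̂

        sides^ : All (Side p) L̂
        sides^ = all-closure N (λ {a} {b} {a′} {b′} (a<b , ab) e₁ e₂ s → s , mirrored a b a′ b′ a<b ab e₁ e₂ s) proper sides
          where
          mirrored : ∀ a b a′ b′ → a < b → a + b ≤ N → b + a′ ≡ N → a + b′ ≡ N → Side p (a , b) → Side p (a′ , b′)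
          mirrored a b a′ b′ a<b ab e₁ e₂ (inj₁ (b<m , a<p)) = inj₂
            ( ≤-trans (<⇒≤ m<p*) (<⇒≤ (mirror-anti′ a<p))
            , <-≤-trans p<m (mirror-left⁻ N m b a′ middle b<m e₁))
            where
            mirror-anti′ : a < p → p* < b′
            mirror-anti′ l = +-cancelˡ-< a p* b′ (<-≤-trans (+-monoˡ-< p* l) (≤-reflexive (trans p+p* (sym e₂))))
          mirrored a b a′ b′ a<b ab e₁ e₂ (inj₂ (m≤b , p<a)) = inj₂
            ( ≤-trans m≤b (mirror-beyond N a b b′ ab e₂)
            , <-≤-trans p<a (mirror-beyond N b a a′ (subst (_≤ N) (+-comm a b) ab) e₁))

        distinct-start : All (λ q → p ≢ proj₁ q) L̂
        distinct-start = All.map (λ { (inj₁ (_ , l)) → >⇒≢ l ; (inj₂ (_ , l)) → <⇒≢ l }) sides^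

        distinct-end : All (λ q → p* ≢ proj₂ q) L̂
        distinct-end = all-closure N (λ {a} {b} {a′} {b′} (_ , ab) e₁ e₂ s → original a b ab s , image a b b′ e₂ s) proper sides
          where
          original : ∀ a b → a + b ≤ N → Side p (a , b) → p* ≢ b
          original a b ab (inj₁ (b<m , _)) = >⇒≢ (<-trans b<m m<p*)
          original a b ab (inj₂ (_ , p<a)) = >⇒≢ (mirror-anti N p p* a b p<a p+p* ab)
          image : ∀ a b b′ → a + b′ ≡ N → Side p (a , b) → p* ≢ b′
          image a b b′ e s refl with +-cancelʳ-≡ p* a p (trans e (sym p+p*))
          image a b b′ e (inj₁ (_ , l)) refl | refl = n≮n p l
          image a b b′ e (inj₂ (_ , l)) refl | refl = n≮n p l

        shifted^ : AllPairs Shifted L̂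
        shifted^ = closure-shifted N proper shifted

        starts≢ : AllPairs (λ x y → proj₁ x ≢ proj₁ y) M
        starts≢ = distinct-start ∷ shifted-starts≢ shifted^
        ends≢ : AllPairs (λ x y → proj₂ x ≢ proj₂ y) M
        ends≢ = distinct-end ∷ shifted-ends≢ shifted^
        properM : All (Proper N) M
        properM = (<-trans p<m m<p* , m∸n≤m N p) ∷ closure-proper N proper

        S E Ŝ Ê : ℕ → ℕ
        S = starts M
        E = ends M
        Ŝ = starts L̂
        Ê = ends L̂

        bal : Balanced N S E
        bal = balanced starts≢ ends≢ properM

        bal^ : Balanced N Ŝ Ê
        bal^ = closure-balanced shifted proper

        S≡ : ∀ x → S x ≡ 𝟙 (p <? x) + Ŝ x
        S≡ x = count-∷ (λ q → proj₁ q <? x) (p , p*) L̂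

        E≡ : ∀ y → E y ≡ 𝟙 (p* <? suc y) + Ê y
        E≡ y = count-∷ (λ q → proj₂ q <? suc y) (p , p*) L̂

        S-after : ∀ {x} → p < x → S x ≡ suc (Ŝ x)
        S-after {x} l = trans (S≡ x) (cong (_+ Ŝ x) (𝟙-yes (p <? x) l))

        S-before : ∀ {x} → x ≤ p → S x ≡ Ŝ x
        S-before {x} l = trans (S≡ x) (cong (_+ Ŝ x) (𝟙-no (p <? x) (≤⇒≯ l)))

        E-before : ∀ {y} → y < p* → E y ≡ Ê y
        E-before {y} l = trans (E≡ y) (cong (_+ Ê y) (𝟙-no (p* <? suc y) (λ q → <⇒≱ l (s≤s⁻¹ q))))

        Ê≤E : ∀ y → Ê y ≤ E y
        Ê≤E y = subst (Ê y ≤_) (sym (E≡ y)) (m≤n+m (Ê y) _)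

        sy : Symmetric N S E
        sy x y e = trans (cong₂ _+_ (E≡ y) (S≡ x)) (trans
          (symmetric-∷ (Ê y) (𝟙 (p* <? suc y)) (Ŝ x) (𝟙 (p <? x)) (length L̂) (closure-symmetric N proper x y e) (𝟙-mirror N x y p p* e p+p*))
          (sym (starts-total starts≢ ends≢ properM)))

        -- By `Side` the intervals ending before the middle are those starting before p. So this
        -- number is where Ŝ stands at p: an upper bound for Ŝ up to p and a lower bound beyond.
        E⁻ : ℕ
        E⁻ = count (λ q → proj₂ q <? m) L̂

        Ŝ≤E⁻ : ∀ {a} → a ≤ p → Ŝ a ≤ E⁻
        Ŝ≤E⁻ a≤p = count-mono _ _ (All.map (λ
          { (inj₁ (b<m , _)) _ → b<m
          ; (inj₂ (_ , p<c)) c<a → contradiction (<-≤-trans c<a a≤p) (<⇒≯ p<c) }) sides^)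

        E⁻≤Ŝ : ∀ {a} → p < a → E⁻ ≤ Ŝ a
        E⁻≤Ŝ p<a = count-mono _ _ (All.map (λ
          { (inj₁ (_ , c<p)) _ → <-trans c<p p<a
          ; (inj₂ (m≤d , _)) d<m → contradiction d<m (≤⇒≯ m≤d) }) sides^)

        E⁻≤Ê : ∀ {b} → m ≤ b → E⁻ ≤ Ê b
        E⁻≤Ê m≤b = count-mono _ _ (All.map (λ _ d<m → m≤n⇒m≤1+n (<-≤-trans d<m m≤b)) sides^)

        centralᵐ : ℕ
        centralᵐ = count (middle? {N} {m} middle) L

        Êm≡ : Ê m ≡ E⁻ + centralᵐ
        Êm≡ = ends-middle {N} {m} middle proper

        central≤ : centralᵐ ≤ 1
        central≤ = count≤1 (middle? {N} {m} middle) (All⇒ shifted)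
          where
          All⇒ : ∀ {L} → AllPairs Shifted L → AllPairs (λ x y → ¬ (proj₂ x ≡ m × proj₂ y ≡ m)) L
          All⇒ [] = []
          All⇒ (s ∷ ss) = All.map (λ { (inj₁ (_ , l)) (e , f) → <⇒≢ l (trans e (sym f))
                                     ; (inj₂ (_ , l)) (e , f) → >⇒≢ l (trans e (sym f)) }) s ∷ All⇒ ss

        hasMiddle? : Dec (Any (λ q → proj₂ q ≡ m) L)
        hasMiddle? = any? (λ q → proj₂ q ≟ m) L

        Em≡ : E m ≡ Ê m
        Em≡ = E-before m<p*

        -- The colour that stays in the ideal at ties S a = E m. If a second root (q, m] of colour
        -- `not σ` exists, ties concern p < a ≤ q, where only the colour `not σ` is in the filter.
        -- Without it they concern a ≤ p, where the colour σ is in the filter.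
        lower-colour : Bool
        lower-colour with hasMiddle?
        ... | yes _ = σ
        ... | no _ = not σ

        c : Bool
        -- At a tie S a = E m the two parities cancel, and c xor odd (S a) is `lower-colour`.
        c = lower-colour xor odd (E m)

        straddles : Straddling m S E
        straddles = record
          { E≤S⁻ = ≤-trans (≤-reflexive Em≡) (≤-trans (Balanced.E≤S bal^ m) (≤-trans
              (subst (λ k → Ŝ k ≤ suc (Ŝ (m ∸ 1))) m-1 (Balanced.S.slow bal^ (m ∸ 1)))
              (≤-reflexive (sym (S-after (subst (suc p ≤_) refl (<m⇒≤m-1 p<)))))))
          ; E⁻<S = ≤-<-trans (≤-reflexive (E-before (≤-<-trans (m∸n≤m m 1) m<p*))) (≤-<-trans
              (≤-trans (Balanced.E≤S bal^ (m ∸ 1)) (Balanced.S.increasing bal^ (m∸n≤m m 1)))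
              (≤-reflexive (sym (S-after p<m))))
          }

        inside-left : ∀ {a b q} → Side p q → Inside a b q → proj₂ q < m → a < p
        inside-left (inj₁ (_ , c<p)) (a≤c , _) _ = ≤-<-trans a≤c c<p
        inside-left (inj₂ (m≤d , _)) _ d<m = contradiction d<m (≤⇒≯ m≤d)

        not-inside : ∀ {a b} → a + b ≤ N → Ê b ≤ Ŝ a → ¬ Any (Inside a b) L
        not-inside = empty-half⇒ shifted proper

        inside-none : ∀ {a b} → a + b ≤ N → ¬ Any (Inside a b) L → Ê b ≤ Ŝ a
        inside-none = empty-half⇐ shifted proper

        drop : ∀ {a b ε} → Any (λ q → Inside a b q × (proj₂ q ≡ m → b ≡ m → ε ≡ not σ)) L → Any (Inside a b) L
        drop = Any.map proj₁

        keep : ∀ {a b ε} → b ≢ m → Any (Inside a b) L → Any (λ q → Inside a b q × (proj₂ q ≡ m → b ≡ m → ε ≡ not σ)) L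
        keep b≢m = Any.map (λ i → i , λ _ e → contradiction e b≢m)

        T : ∀ {a b ε} → Set
        T {a} {b} {ε} = Twisted m c b (E b) (S a) ε

        left-sound : ∀ {a b ε} → a < b → a + b ≤ N → b < m → E b ≤ S a → ¬ Below A (vec a b ε)
        left-sound {a} {b} a<b ab b<m h bel with below⇒ a<b ab bel
        ... | inj₁ (m≤b , _) = <⇒≱ b<m m≤b
        ... | inj₂ any with find any
        ...   | q , q∈ , i , _ = not-inside ab (subst₂ _≤_ (E-before (<-trans b<m m<p*))
                  (S-before (<⇒≤ (inside-left (All.lookup sides q∈) i (≤-<-trans (proj₂ i) b<m)))) h) (drop any)

        left-complete : ∀ {a b ε} → a < b → a + b ≤ N → b < m → ¬ Below A (vec a b ε) → E b ≤ S a
        left-complete {a} {b} a<b ab b<m ¬bel = subst (_≤ S a) (sym (E-before (<-trans b<m m<p*)))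
          (≤-trans (inside-none ab (¬bel ∘ below⇐₂ ∘ keep (<⇒≢ b<m))) (subst (Ŝ a ≤_) (sym (S≡ a)) (m≤n+m (Ŝ a) _)))

        -- Beyond p the additional start raises S by one, so < for the extended list is ≤ for the
        -- completion of L. Up to p the root lies above the special one, and S a ≤ E⁻ ≤ E b makes
        -- the strict inequality fail.
        right-sound : ∀ {a b ε} → a < b → a + b ≤ N → m < b → E b < S a → ¬ Below A (vec a b ε)
        right-sound {a} {b} a<b ab m<b h bel with p <? a
        ... | no ¬p = <⇒≱ (subst (E b <_) (S-before (≮⇒≥ ¬p)) h)
                        (≤-trans (Ŝ≤E⁻ (≮⇒≥ ¬p)) (≤-trans (E⁻≤Ê (<⇒≤ m<b)) (Ê≤E b)))
        ... | yes p<a with below⇒ a<b ab bel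
        ...   | inj₁ (_ , a≤p , _) = <⇒≱ p<a a≤p
        ...   | inj₂ any = not-inside ab (s≤s⁻¹ (subst₂ _<_ (E-before (mirror-anti N p p* a b p<a p+p* ab)) (S-after p<a) h)) (drop any)

        right-complete : ∀ {a b ε} → a < b → a + b ≤ N → m < b → ¬ Below A (vec a b ε) → E b < S a
        right-complete {a} {b} a<b ab m<b ¬bel with p <? a
        ... | no ¬p = contradiction (below⇐₁ (<⇒≤ m<b) (≮⇒≥ ¬p) (λ e → contradiction e (>⇒≢ m<b))) ¬bel
        ... | yes p<a = subst₂ _<_ (sym (E-before (mirror-anti N p p* a b p<a p+p* ab))) (sym (S-after p<a))
                (s≤s (inside-none ab (¬bel ∘ below⇐₂ ∘ keep (>⇒≢ m<b))))

        Middle′ : ℕ → Bool → Set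
        Middle′ a ε = E m < S a ⊎ (E m ≡ S a × ε ≡ lower-colour)

        middle⇒ : ∀ {a ε} → Twisted m c m (E m) (S a) ε → Middle′ a ε
        middle⇒ (strict l) = inj₁ l
        middle⇒ (left l _) = contradiction l (n≮n m)
        middle⇒ (mid _ e f) = inj₂ (e , trans f (trans (cong (λ k → c xor odd k) (sym e)) (xor-cancel lower-colour (odd (E m)))))

        middle⇐ : ∀ {a ε} → Middle′ a ε → Twisted m c m (E m) (S a) ε
        middle⇐ (inj₁ l) = strict l
        middle⇐ (inj₂ (e , f)) = mid refl e (trans f (trans (sym (xor-cancel lower-colour (odd (E m)))) (cong (λ k → c xor odd k) e)))

        split : ∀ {a ε} → E m ≤ S a → ε ≡ lower-colour → Middle′ a ε
        split h e with m≤n⇒m<n∨m≡n h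
        ... | inj₁ l = inj₁ l
        ... | inj₂ q = inj₂ (q , e)

        lower-yes : Any (λ q → proj₂ q ≡ m) L → lower-colour ≡ σ
        lower-yes any with hasMiddle?
        ... | yes _ = refl
        ... | no ¬any = contradiction any ¬any

        lower-no : ¬ Any (λ q → proj₂ q ≡ m) L → lower-colour ≡ not σ
        lower-no ¬any with hasMiddle?
        ... | yes any = contradiction any ¬any
        ... | no _ = refl

        central≥1 : Any (λ q → proj₂ q ≡ m) L → 1 ≤ centralᵐ
        central≥1 = go
          where
          go : ∀ {L} → Any (λ q → proj₂ q ≡ m) L → 1 ≤ count (middle? {N} {m} middle) L
          go {q ∷ L} (here e) rewrite count-∷ (middle? {N} {m} middle) q L | 𝟙-yes (middle? {N} {m} middle q) e = s≤s z≤n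
          go {q ∷ L} (there a) rewrite count-∷ (middle? {N} {m} middle) q L = ≤-trans (go a) (m≤n+m _ (𝟙 (middle? {N} {m} middle q)))

        middle-sound : ∀ {a ε} → a < m → a + m ≤ N → Middle′ a ε → ¬ Below A (vec a m ε)
        middle-sound {a} {ε} a<m am x bel with below⇒ a<m am bel
        ... | inj₁ (_ , a≤p , e) = clash x
          where
          S≤ : S a ≤ E m
          S≤ = ≤-trans (≤-reflexive (S-before a≤p)) (≤-trans (Ŝ≤E⁻ a≤p) (≤-trans (E⁻≤Ê ≤-refl) (≤-reflexive (sym Em≡))))
          clash : ¬ Middle′ a ε
          clash (inj₁ l) = <⇒≱ l S≤
          clash (inj₂ (q , f)) = by hasMiddle?
            where
            by : Dec (Any (λ q → proj₂ q ≡ m) L) → ⊥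
            by (no ¬any) = not≢ (sym (trans (sym (e refl)) (trans f (lower-no ¬any))))
            by (yes any) = <⇒≢ (≤-<-trans (≤-trans (≤-reflexive (S-before a≤p)) (Ŝ≤E⁻ a≤p))
                  (≤-trans (≤-trans (≤-reflexive (+-comm 1 E⁻)) (+-monoʳ-≤ E⁻ (central≥1 any))) (≤-reflexive (trans (sym Êm≡) (sym Em≡))))) (sym q)
        ... | inj₂ any with find any
        ...   | q , q∈ , i , f with proj₂ q <? m
        ...     | yes d<m = clash x
          where
          a≤p : a ≤ p
          a≤p = <⇒≤ (inside-left (All.lookup sides q∈) i d<m)
          S< : S a < E m
          S< = ≤-<-trans (≤-reflexive (S-before a≤p)) (≤-trans (≰⇒> (λ h → not-inside am h (drop any))) (≤-reflexive (sym Em≡)))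
          clash : ¬ Middle′ a ε
          clash (inj₁ l) = <⇒≯ l S<
          clash (inj₂ (e , _)) = <⇒≢ S< (sym e)
        ...     | no d≮m = clash x
          where
          d≡m : proj₂ q ≡ m
          d≡m = ≤-antisym (proj₂ i) (≮⇒≥ d≮m)
          S≤ : S a ≤ E m
          S≤ = ≤-trans (≤-reflexive (S≡ a)) (≤-trans (+-monoˡ-≤ (Ŝ a) (𝟙-≤1 (p <? a)))
                 (≤-trans (≰⇒> (λ h → not-inside am h (drop any))) (≤-reflexive (sym Em≡))))
          clash : ¬ Middle′ a ε
          clash (inj₁ l) = <⇒≱ l S≤
          clash (inj₂ (_ , g)) = not≢ (trans (sym (f d≡m refl)) (trans g (lower-yes (Any.map (λ { refl → d≡m }) q∈))))

        middle-complete : ∀ {a ε} → a < m → a + m ≤ N → ¬ Below A (vec a m ε) → Middle′ a ε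
        middle-complete {a} {ε} a<m am ¬bel = by hasMiddle? (ε Bool.≟ σ) (p <? a)
          where
          none⇒ : ¬ Any (λ q → proj₂ q ≡ m) L → Ê m ≤ Ŝ a
          none⇒ ¬any = inside-none am (λ any → ¬bel (below⇐₂ (colourless any)))
            where
            colourless : Any (Inside a m) L → Any (λ q → Inside a m q × (proj₂ q ≡ m → m ≡ m → ε ≡ not σ)) L
            colourless any with find any
            ... | q , q∈ , i = Any.map (λ { refl → i , λ e _ → contradiction (Any.map (λ { refl → e }) q∈) ¬any }) q∈
          by : Dec (Any (λ q → proj₂ q ≡ m) L) → Dec (ε ≡ σ) → Dec (p < a) → Middle′ a ε
          by _ (yes e) (no ¬p) = contradiction (below⇐₁ ≤-refl (≮⇒≥ ¬p) (λ _ → e)) ¬bel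
          by (no ¬any) _ (yes p<a) = inj₁ (≤-trans (s≤s (≤-trans (≤-reflexive Em≡) (none⇒ ¬any))) (≤-reflexive (sym (S-after p<a))))
          by (no ¬any) (no e) (no ¬p) = split {a} (≤-trans (≤-reflexive Em≡) (≤-trans (none⇒ ¬any) (≤-reflexive (sym (S-before (≮⇒≥ ¬p))))))
            (trans (≢⇒≡not e) (sym (lower-no ¬any)))
          by (yes any) (no e) (no ¬p) with find any
          ... | q , q∈ , refl = contradiction (below⇐₂ (Any.map (λ { refl → (inside (All.lookup sides q∈) , ≤-refl) , λ _ _ → ≢⇒≡not e }) q∈)) ¬bel
            where
            inside : Side p q → a ≤ proj₁ q
            inside (inj₁ (l , _)) = contradiction l (n≮n m)
            inside (inj₂ (_ , l)) = ≤-trans (≮⇒≥ ¬p) (<⇒≤ l)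
          by (yes any) (yes e) (yes p<a) = split {a}
            (≤-trans (≤-reflexive (trans Em≡ Êm≡)) (≤-trans (+-mono-≤ (E⁻≤Ŝ {a} p<a) central≤)
              (≤-reflexive (trans (+-comm (Ŝ a) 1) (sym (S-after p<a))))))
            (trans e (sym (lower-yes any)))
          by (yes any) (no e) (yes p<a) = inj₁ (≤-trans (s≤s (≤-trans (≤-reflexive Em≡)
            (inside-none am (λ i → ¬bel (below⇐₂ (Any.map (λ i → i , λ _ _ → ≢⇒≡not e) i)))))) (≤-reflexive (sym (S-after p<a))))

      decoded : TwistedData roots coloured
      decoded = record { bal = bal ; sy = sy ; straddling = straddles ; c = c }

      decoded-encodes : Encodes model (TwistedData.X decoded) A
      decoded-encodes = encode λ i → laws (start<end i) (sum≤N i) (colour i)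
        where
        laws : ∀ {a b} → a < b → a + b ≤ N → ∀ ε →
               (Twisted m c b (E b) (S (a + 0)) ε → ¬ Below A (vec a b ε)) × (¬ Below A (vec a b ε) → Twisted m c b (E b) (S (a + 0)) ε)
        laws {a} {b} a<b ab ε rewrite +-identityʳ a = at (<-cmp b m)
          where
          at : Tri (b < m) (b ≡ m) (m < b) → (Twisted m c b (E b) (S a) ε → ¬ Below A (vec a b ε)) × (¬ Below A (vec a b ε) → Twisted m c b (E b) (S a) ε)
          at (tri< l _ _) = left-sound a<b ab l ∘ twisted⇒≤ , left⁺ l ∘ left-complete a<b ab l
          at (tri≈ _ refl _) = middle-sound {a} {ε} a<b ab ∘ middle⇒ {a} {ε} , middle⇐ {a} {ε} ∘ middle-complete {a} {ε} a<b ab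
          at (tri> _ _ g) = right-sound a<b ab g ∘ right⁻ g , strict ∘ right-complete a<b ab g

      decoded-total : S N + count (central? N) L ≡ suc (length L + length L)
      decoded-total = trans (cong (_+ count (central? N) L) (starts-total starts≢ ends≢ properM)) (cong suc (closure-length N proper))

-- Type D: three classes of antichains

module DRvac where

  open Toggle
  open Grid
  open Parabolic
  open Sets
  open Steps
  open Models
  open Twisted
  open Count
  open FullRvac
  open HalfRvac
  open TwistedRvac
  open TwistedDecode
  open import Data.List.Relation.Unary.Any using (any?)

  length-filter-¬ : ∀ {A : Set} {P : A → Set} (P? : Decidable P) xs →
                    length (filter (¬? ∘ P?) xs) + count P? xs ≡ length xs
  length-filter-¬ P? [] = refl
  length-filter-¬ P? (x ∷ xs) with P? x
  ... | yes _ = trans (+-suc _ _) (cong suc (length-filter-¬ P? xs))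
  ... | no _ = cong suc (length-filter-¬ P? xs)

  count-map : ∀ {A B : Set} {P : B → Set} (P? : Decidable P) (f : A → B) xs → count P? (map f xs) ≡ count (P? ∘ f) xs
  count-map P? f [] = refl
  count-map P? f (x ∷ xs) rewrite count-∷ P? (f x) (map f xs) | count-∷ (P? ∘ f) x xs = cong (𝟙 (P? (f x)) +_) (count-map P? f xs)

  count-restrict : ∀ {A : Set} {P Q R : A → Set} (P? : Decidable P) (Q? : Decidable Q) (R? : Decidable R) →
                   (∀ {x} → P x → ¬ Q x → R x) → (∀ {x} → R x → P x × ¬ Q x) →
                   ∀ xs → count P? (filter (¬? ∘ Q?) xs) ≡ count R? xs
  count-restrict P? Q? R? f g [] = refl
  count-restrict P? Q? R? f g (x ∷ xs) rewrite count-∷ R? x xs with Q? x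
  ... | yes q = trans (count-restrict P? Q? R? f g xs) (cong (_+ count R? xs) (sym (𝟙-no (R? x) (λ r → proj₂ (g r) q))))
  ... | no ¬q = trans (count-∷ P? x _) (cong₂ _+_ (≤-antisym (𝟙-mono (P? x) (R? x) (λ p → f p ¬q)) (𝟙-mono (R? x) (P? x) (proj₁ ∘ g)))
                                              (count-restrict P? Q? R? f g xs))

  count≥1 : ∀ {A : Set} {P : A → Set} (P? : Decidable P) {xs} → Any P xs → 1 ≤ count P? xs
  count≥1 P? {x ∷ xs} (here p) rewrite count-∷ P? x xs | 𝟙-yes (P? x) p = s≤s z≤n
  count≥1 P? {x ∷ xs} (there a) rewrite count-∷ P? x xs = ≤-trans (count≥1 P? a) (m≤n+m _ (𝟙 (P? x)))

  module _ {r} {P : List (Root r)} {N m} (roots : HalfRoots P N m)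
           (coloured : ∀ {a d ε δ} → a < m → d < m → HalfRoots.vec roots a m ε ≤ᵣ HalfRoots.vec roots d m δ → ε ≡ δ) where
    open HalfRoots roots
    open HalfIx
    open Middle {N} {m} middle
    open TwistedMiddle {N} {m} middle
    open Half roots
    open Model model using (ρ)

    Central : Bool → HalfIx N → Set
    Central δ i = end i ≡ m × colour i ≡ δ

    central-at? : ∀ δ → Decidable (Central δ)
    central-at? δ i = (end i ≟ m) ×-dec (colour i Bool.≟ δ)

    ≤⇒ : ∀ i {a b ε} → a < b → a + b ≤ N → root i ≤ᵣ vec a b ε →
         Inside a b (start i , end i) × (end i ≡ m → b ≡ m → colour i ≡ ε)
    ≤⇒ i a<b ab h = reflect (start<end i) (sum≤N i) a<b ab h ,
      λ e f → coloured (centre-start i e) (subst (_ <_) f a<b) (subst₂ (λ d b → vec (start i) d (colour i) ≤ᵣ vec _ b _) e f h)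
      where
      centre-start : ∀ i → end i ≡ m → start i < m
      centre-start i e = subst (start i <_) e (start<end i)

    record Exceptional (A : List (Root r)) : Set where
      field
        σ     : Bool
        α∈    : vec (m ∸ 1) m σ ∈ A
        rest  : ∀ {x} → x ∈ A → x ≢ vec (m ∸ 1) m σ → ∃ λ a → ∃ λ b → a < b × b < m × vec a b true ≡ x

    -- The roots ending in the middle come in pairs of both colours with the same start, or not at
    -- all. The list `L` keeps one of each pair, hence the correction by its count of intervals
    -- ending in m.
    record Unmixed (A : List (Root r)) : Set where
      field
        plain : Plain roots A
        size  : length A ≡ length (Plain.L plain) + count (middle? {N} {m} middle) (Plain.L plain)

    record Mixed (A : List (Root r)) : Set where
      field
        source : Source roots coloured A
        size   : length A ≡ suc (length (Source.L source))

    module Classify (Q : List (HalfIx N)) (antichain : AllPairs (λ i j → Incomparable (root i) (root j)) Q) where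

      A : List (Root r)
      A = map root Q

      pair : HalfIx N → Interval
      pair i = start i , end i

      related : ∀ {i j} → i ∈ Q → j ∈ Q → i ≡ j ⊎ Incomparable (root i) (root j)
      related = allPairs-lookup (λ (p , q) → q , p) antichain

      Qᶜ : Bool → List (HalfIx N)
      Qᶜ τ = filter (¬? ∘ central-at? τ) Q

      Qᶜ⁻ : ∀ τ {i} → i ∈ Qᶜ τ → i ∈ Q × ¬ Central τ i
      Qᶜ⁻ τ = ∈-filter⁻ (¬? ∘ central-at? τ)

      module Without (τ : Bool) where
        L : List Interval
        L = map pair (Qᶜ τ)

        proper : All (HalfProper N) L
        proper = All.map⁺ (All.tabulate (λ {i} _ → start<end i , sum≤N i))

        -- With the colour τ gone, the roots left in the middle share one colour, so incomparable
        -- roots have incomparable intervals.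
        shifted : AllPairs Shifted L
        shifted = AllPairs.map⁺ (allPairs-map∈ shift (AllPairs.filter⁺ (¬? ∘ central-at? τ) antichain))
          where
          shift : ∀ {i j} → i ∈ Qᶜ τ → j ∈ Qᶜ τ → Incomparable (root i) (root j) → Shifted (pair i) (pair j)
          shift {i} {j} i∈ j∈ (p , q) = incomparable⇒shifted
            (λ (u , v) → p (embed′ u v (λ e f → trans (other i∈ e) (sym (other j∈ f)))))
            (λ (u , v) → q (embed′ u v (λ e f → trans (other j∈ e) (sym (other i∈ f)))))
            where
            other : ∀ {k} → k ∈ Qᶜ τ → end k ≡ m → colour k ≡ not τ
            other {k} k∈ e = ≢⇒≡not (λ f → proj₂ (Qᶜ⁻ τ {k} k∈) (e , f))

        total : length L + count (central-at? τ) Q ≡ length A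
        total = trans (cong (_+ count (central-at? τ) Q) (length-map pair (Qᶜ τ)))
                  (trans (length-filter-¬ (central-at? τ) Q) (sym (length-map root Q)))

        kept : ∀ {i} → i ∈ Q → ¬ Central τ i → ∀ {P : Interval → Set} → P (pair i) → Any P L
        kept i∈ ¬c p = Any.map⁺ (Any.map (λ { refl → p }) (∈-filter⁺ (¬? ∘ central-at? τ) i∈ ¬c))

        from-kept : ∀ {P : Interval → Set} → Any P L → ∃ λ i → i ∈ Q × ¬ Central τ i × P (pair i)
        from-kept any with find (Any.map⁻ any)
        ... | i , i∈ , p = i , proj₁ (Qᶜ⁻ τ {i} i∈) , proj₂ (Qᶜ⁻ τ {i} i∈) , p

      below⁻ : ∀ {y} → Below A y → ∃ λ i → i ∈ Q × root i ≤ᵣ y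
      below⁻ b with find (Any.map⁻ b)
      ... | i , i∈ , h = i , i∈ , h

      below⁺ : ∀ {y i} → i ∈ Q → root i ≤ᵣ y → Below A y
      below⁺ i∈ h = Any.map⁺ (Any.map (λ { refl → h }) i∈)

      one-central : ∀ τ {i j} → i ∈ Q → j ∈ Q → Central τ i → Central τ j → i ≡ j
      one-central τ {i} {j} i∈ j∈ (e , f) (e′ , f′) with related i∈ j∈
      ... | inj₁ q = q
      ... | inj₂ (p , q) with ≤-total (start j) (start i)
      ...   | inj₁ l = contradiction (embed′ l (≤-reflexive (trans e (sym e′))) (λ _ _ → trans f (sym f′))) p
      ...   | inj₂ l = contradiction (embed′ l (≤-reflexive (trans e′ (sym e))) (λ _ _ → trans f′ (sym f))) q

      count-central : ∀ τ → count (central-at? τ) Q ≤ 1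
      count-central τ = count≤1 (central-at? τ) (AllPairs.map (λ {i} {j} (p , q) ((e , f) , (e′ , f′)) → clash i j p q e f e′ f′) antichain)
        where
        clash : ∀ i j → ¬ root i ≤ᵣ root j → ¬ root j ≤ᵣ root i → end i ≡ m → colour i ≡ τ → end j ≡ m → colour j ≡ τ → ⊥
        clash i j p q e f e′ f′ with ≤-total (start j) (start i)
        ... | inj₁ l = p (embed′ l (≤-reflexive (trans e (sym e′))) (λ _ _ → trans f (sym f′)))
        ... | inj₂ l = q (embed′ l (≤-reflexive (trans e′ (sym e))) (λ _ _ → trans f′ (sym f)))

      HasCentral : Bool → Set
      HasCentral τ = Any (Central τ) Q

      -- The colours are exchangeable when both central roots have the same
      -- start, or there are none.
      unmixed : (∀ {i} → i ∈ Q → end i ≡ m → ∀ δ → ∃ λ j → j ∈ Q × Central δ j × start j ≡ start i) → Unmixed A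
      unmixed partner = record
        { plain = record
          { shifted = shifted
          ; proper = proper
          ; inside⇒ = λ i b → let k , k∈ , h = below⁻ b in inside⇒ k k∈ (proj₁ (≤⇒ k (start<end i) (sum≤N i) h))
          ; inside⇐ = λ i any → let k , k∈ , _ , h = from-kept any in inside⇐ i k k∈ h
          }
        ; size = trans (sym total) (cong (length L +_) balance)
        }
        where
        open Without false
        inside⇒ : ∀ k {a b} → k ∈ Q → Inside a b (pair k) → Any (Inside a b) L
        inside⇒ k k∈ h with central-at? false k
        ... | no ¬c = kept k∈ ¬c h
        ... | yes (e , _) with partner k∈ e true
        ...   | j , j∈ , (e′ , f) , s = kept j∈ (λ (_ , g) → contradiction (trans (sym f) g) λ ())
                  (≤-trans (proj₁ h) (≤-reflexive (sym s)) , ≤-trans (≤-reflexive (trans e′ (sym e))) (proj₂ h))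
        inside⇐ : ∀ i k → k ∈ Q → Inside (start i) (end i) (pair k) → Below A (root i)
        inside⇐ i k k∈ (p , q) with end k ≟ m
        ... | no ≢m = below⁺ k∈ (embed′ p q (λ e _ → contradiction e ≢m))
        ... | yes e with partner k∈ e (colour i)
        ...   | j , j∈ , (e′ , f) , s = below⁺ j∈ (embed′ (≤-trans p (≤-reflexive (sym s)))
                  (≤-trans (≤-reflexive (trans e′ (sym e))) q) (λ _ _ → f))
        both : ∀ δ δ′ → Any (Central δ) Q → Any (Central δ′) Q
        both δ δ′ any with find any
        ... | i , i∈ , e , _ with partner i∈ e δ′
        ...   | j , j∈ , c , _ = Any.map (λ { refl → c }) j∈
        middle-count≡ : count (middle? {N} {m} middle) L ≡ count (central-at? true) Q
        middle-count≡ = trans (count-map (middle? {N} {m} middle) pair (Qᶜ false))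
          (count-restrict (λ i → end i ≟ m) (central-at? false) (central-at? true)
            (λ e ¬c → e , ≢⇒≡not (λ f → ¬c (e , f))) (λ (e , f) → e , λ (_ , g) → contradiction (trans (sym f) g) λ ()) Q)
        balance : count (central-at? false) Q ≡ count (middle? {N} {m} middle) L
        balance with any? (central-at? false) Q
        ... | yes any = trans (≤-antisym (count-central false) (count≥1 (central-at? false) any))
                (sym (trans middle-count≡ (≤-antisym (count-central true) (count≥1 (central-at? true) (both false true any)))))
        ... | no ¬any = trans (count-none (central-at? false) (All.¬Any⇒All¬ Q ¬any))
                (sym (trans middle-count≡ (count-none (central-at? true) (All.¬Any⇒All¬ Q (¬any ∘ both true false)))))

      mixed : ∀ σ {i₀} → i₀ ∈ Q → Central σ i₀ → suc (start i₀) < m →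
              (∀ {i} → i ∈ Q → Central (not σ) i → start i₀ < start i) → Mixed A
      mixed σ {i₀} i₀∈ (e₀ , f₀) p< smaller = record
        { source = record
          { p = start i₀
          ; σ = σ
          ; p< = p<
          ; shifted = shifted
          ; proper = proper
          ; sides = All.map⁺ (All.tabulate (λ {i} i∈ → side i (proj₁ (Qᶜ⁻ σ {i} i∈)) (proj₂ (Qᶜ⁻ σ {i} i∈))))
          ; below⇒ = λ a<b ab b → let i , i∈ , h = below⁻ b ; p , q = ≤⇒ i a<b ab h in below⇒ i i∈ p q
          ; below⇐₁ = λ m≤b a≤p e → below⁺ i₀∈ (embed′ a≤p (≤-trans (≤-reflexive e₀) m≤b) (λ _ f → trans f₀ (sym (e f))))
          ; below⇐₂ = λ any → let i , i∈ , ¬c , (p , q) , c = from-kept any in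
              below⁺ i∈ (embed′ p q (λ e f → trans (≢⇒≡not (λ g → ¬c (e , g))) (sym (c e f))))
          }
        ; size = trans (sym total) (trans (cong (length L +_) (≤-antisym (count-central σ)
            (count≥1 (central-at? σ) (Any.map (λ { refl → e₀ , f₀ }) i₀∈)))) (+-comm (length L) 1))
        }
        where
        open Without σ
        p≤ : ∀ {i} → i ∈ Q → ¬ Central σ i → ¬ root i ≤ᵣ root i₀ × ¬ root i₀ ≤ᵣ root i
        p≤ i∈ ¬c with related i∈ i₀∈
        ... | inj₁ refl = contradiction (e₀ , f₀) ¬c
        ... | inj₂ inc = inc
        side : ∀ i → i ∈ Q → ¬ Central σ i → Side roots coloured (start i₀) (pair i)
        side i i∈ ¬c with <-cmp (end i) m
        ... | tri≈ _ e _ = inj₂ (≤-reflexive (sym e) , smaller i∈ (e , ≢⇒≡not (λ f → ¬c (e , f))))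
        ... | tri< l ≢m _ = inj₁ (l , ≰⇒> (λ h → proj₁ (p≤ i∈ ¬c)
                (embed′ h (≤-trans (<⇒≤ l) (≤-reflexive (sym e₀))) (λ e _ → contradiction e ≢m))))
        ... | tri> _ ≢m g = inj₂ (<⇒≤ g , ≰⇒> (λ h → proj₂ (p≤ i∈ ¬c)
                (embed′ h (≤-trans (≤-reflexive e₀) (<⇒≤ g)) (λ _ e → contradiction e ≢m))))
        below⇒ : ∀ i {a b ε} → i ∈ Q → Inside a b (pair i) → (end i ≡ m → b ≡ m → colour i ≡ ε) →
          (m ≤ b × a ≤ start i₀ × (b ≡ m → ε ≡ σ)) ⊎ Any (λ q → Inside a b q × (proj₂ q ≡ m → b ≡ m → ε ≡ not σ)) L
        below⇒ i i∈ (p , q) c with central-at? σ i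
        ... | yes (e , f) = inj₁ (≤-trans (≤-reflexive (sym e)) q ,
                ≤-trans p (≤-reflexive (cong start (one-central σ i∈ i₀∈ (e , f) (e₀ , f₀)))) , λ g → trans (sym (c e g)) f)
        ... | no ¬c = inj₂ (kept i∈ ¬c ((p , q) , λ e g → trans (sym (c e g)) (≢⇒≡not (λ f → ¬c (e , f)))))

      -- Any root ending beyond the middle would lie above the simple root, and another one ending
      -- in the middle would have the same colour and be comparable to it.
      exceptional : ∀ σ {i₀} → i₀ ∈ Q → Central σ i₀ → suc (start i₀) ≡ m → ¬ HasCentral (not σ) → Exceptional A
      exceptional σ {i₀} i₀∈ (e₀ , f₀) p≡ ¬other = record { σ = σ ; α∈ = subst (_∈ A) α≡ (∈-map⁺ root i₀∈) ; rest = rest }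
        where
        s≡ : start i₀ ≡ m ∸ 1
        s≡ = cong (_∸ 1) p≡
        α≡ : root i₀ ≡ vec (m ∸ 1) m σ
        α≡ = trans (cong₂ (λ a b → vec a b (colour i₀)) s≡ e₀) (cong (vec (m ∸ 1) m) f₀)
        rest : ∀ {x} → x ∈ A → x ≢ vec (m ∸ 1) m σ → ∃ λ a → ∃ λ b → a < b × b < m × vec a b true ≡ x
        rest x∈ x≢ with ∈-map⁻ root x∈
        ... | i , i∈ , refl = start i , end i , start<end i , before , plain (<⇒≢ before)
          where
          ¬same : i ≢ i₀
          ¬same refl = x≢ α≡
          before : end i < m
          before with related i∈ i₀∈
          ... | inj₁ e = contradiction e ¬same
          ... | inj₂ (_ , q) with <-cmp (end i) m
          ...   | tri< l _ _ = l
          ...   | tri≈ _ e _ with colour i Bool.≟ σ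
          ...     | yes f = contradiction (one-central σ i∈ i₀∈ (e , f) (e₀ , f₀)) ¬same
          ...     | no ¬f = contradiction (Any.map (λ { refl → e , ≢⇒≡not ¬f }) i∈) ¬other
          before | inj₂ (_ , q) | tri> _ ≢m g = contradiction
            (embed′ (≤-trans (<m⇒≤m-1 (s≤m⇒ g)) (≤-reflexive (sym s≡))) (≤-trans (≤-reflexive e₀) (<⇒≤ g)) (λ _ e → contradiction e ≢m)) q
            where
            s≤m⇒ : m < end i → start i < m
            s≤m⇒ g = ≰⇒> (λ h → <⇒≱ (s≤s (≤-reflexive middle)) (≤-trans (s≤s (+-mono-≤ h (<⇒≤ g))) (s≤s (sum≤N i))))

      classified : Unmixed A ⊎ Mixed A ⊎ Exceptional A
      classified with any? (central-at? true) Q | any? (central-at? false) Q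
      ... | no ¬t | no ¬f = inj₁ (unmixed (λ {i} i∈ e → contradiction i∈ (none i e)))
        where
        none : ∀ i → end i ≡ m → ¬ i ∈ Q
        none i e i∈ with colour i Bool.≟ true
        ... | yes c = ¬t (Any.map (λ { refl → e , c }) i∈)
        ... | no ¬c = ¬f (Any.map (λ { refl → e , ≢⇒≡not ¬c }) i∈)
      ... | yes t | no ¬f = inj₂ (only true t ¬f)
        where
        only : ∀ σ → HasCentral σ → ¬ HasCentral (not σ) → Mixed A ⊎ Exceptional A
        only σ any ¬other with find any
        ... | i₀ , i₀∈ , c@(e , f) with m≤n⇒m<n∨m≡n (subst (start i₀ <_) e (start<end i₀))
        ...   | inj₁ l = inj₁ (mixed σ i₀∈ c l (λ i∈ c′ → contradiction (Any.map (λ { refl → c′ }) i∈) ¬other))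
        ...   | inj₂ q = inj₂ (exceptional σ i₀∈ c q ¬other)
      ... | no ¬t | yes f = inj₂ (only false f ¬t)
        where
        only : ∀ σ → HasCentral σ → ¬ HasCentral (not σ) → Mixed A ⊎ Exceptional A
        only σ any ¬other with find any
        ... | i₀ , i₀∈ , c@(e , f) with m≤n⇒m<n∨m≡n (subst (start i₀ <_) e (start<end i₀))
        ...   | inj₁ l = inj₁ (mixed σ i₀∈ c l (λ i∈ c′ → contradiction (Any.map (λ { refl → c′ }) i∈) ¬other))
        ...   | inj₂ q = inj₂ (exceptional σ i₀∈ c q ¬other)
      ... | yes t | yes f with find t | find f
      ...   | i , i∈ , ci | j , j∈ , cj with <-cmp (start i) (start j)
      -- The root of smaller start is the special one. The other starts later and still before m,
      -- whence 1 + p < m.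
      ...     | tri< l _ _ = inj₂ (inj₁ (mixed true i∈ ci (<-≤-trans (s≤s l) (subst (start j <_) (proj₁ cj) (start<end j)))
                  (λ k∈ ck → subst (λ k → start i < start k) (one-central false j∈ k∈ cj ck) l)))
      ...     | tri> _ _ l = inj₂ (inj₁ (mixed false j∈ cj (<-≤-trans (s≤s l) (subst (start i <_) (proj₁ ci) (start<end i)))
                  (λ k∈ ck → subst (λ k → start j < start k) (one-central true i∈ k∈ ci ck) l)))
      ...     | tri≈ _ s _ = inj₁ (unmixed partner)
        where
        partner : ∀ {k} → k ∈ Q → end k ≡ m → ∀ δ → ∃ λ l → l ∈ Q × Central δ l × start l ≡ start k
        partner {k} k∈ e δ with colour k Bool.≟ true
        partner {k} k∈ e true | yes c = k , k∈ , (e , c) , refl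
        partner {k} k∈ e false | yes c = j , j∈ , cj , trans (sym s) (cong start (one-central true i∈ k∈ ci (e , c)))
        partner {k} k∈ e true | no ¬c = i , i∈ , ci , trans s (cong start (one-central false j∈ k∈ cj (e , ≢⇒≡not ¬c)))
        partner {k} k∈ e false | no ¬c = k , k∈ , (e , ≢⇒≡not ¬c) , refl

    classify : ∀ {A} → IsAntichainIn model A → Unmixed A ⊎ Mixed A ⊎ Exceptional A
    classify aA with indices model (IsAntichainIn.⊆P aA)
    ... | Q , refl = Classify.classified Q (AllPairs.map⁻ (IsAntichainIn.antichain aA))

-- Type D: involution and cardinality

module DMain where

  open Toggle
  open Grid
  open Parabolic
  open Sets
  open Lia using (lia; con; goal; _:+_; _:≡_; _:→_)
  open Steps
  open Models
  open Twisted
  open Count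
  open FullRvac
  open HalfRvac
  open TwistedRvac
  open TwistedDecode
  open DRvac
  open import Data.List.Relation.Unary.Any using (tail)

  -- The extended interval (p, N - p] is its own mirror image and counts once, which makes the
  -- right-hand sides odd. By `one-of` the two sizes then add up to 1 + m, the rank of the root
  -- system.
  mixed-count : ∀ l l′ c c′ e N j m → e + c ≡ suc (l + l) → j + c′ ≡ suc (l′ + l′) → j + e ≡ N → suc N ≡ m + m →
                (suc l + suc l′) + (suc l + suc l′) ≡ suc (m + m) + (c + c′)
  mixed-count = lia 8 (λ l l′ c c′ e N j m → e :+ c :≡ con 1 :+ (l :+ l) :→ j :+ c′ :≡ con 1 :+ (l′ :+ l′) :→ j :+ e :≡ N :→ con 1 :+ N :≡ m :+ m :→
    goal (con 1 :+ l :+ (con 1 :+ l′) :+ (con 1 :+ l :+ (con 1 :+ l′)) :≡ con 1 :+ (m :+ m) :+ (c :+ c′)))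

  unmixed-count : ∀ l l′ μ μ′ m → l + l′ ≡ m → μ + μ′ ≡ 1 → l + μ + (l′ + μ′) ≡ suc m
  unmixed-count = lia 5 (λ l l′ μ μ′ m → l :+ l′ :≡ m :→ μ :+ μ′ :≡ con 1 :→ goal (l :+ μ :+ (l′ :+ μ′) :≡ con 1 :+ m))

  exceptional-count : ∀ a b l l′ m → a ≡ suc l → b ≡ suc l′ → suc (l + l′) ≡ m → a + b ≡ suc m
  exceptional-count = lia 5 (λ a b l l′ m → a :≡ con 1 :+ l :→ b :≡ con 1 :+ l′ :→ con 1 :+ (l :+ l′) :≡ m :→ goal (a :+ b :≡ con 1 :+ m))

  module _ {r} {P : List (Root r)} {N m} (roots : HalfRoots P N m)
           (coloured : ∀ {a d ε δ} → a < m → d < m → HalfRoots.vec roots a m ε ≤ᵣ HalfRoots.vec roots d m δ → ε ≡ δ) where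
    open HalfRoots roots
    open HalfIx
    open Middle {N} {m} middle
    open TwistedMiddle {N} {m} middle
    open Half roots
    open IsAntichainIn

    m-1<m : m ∸ 1 < m
    m-1<m = ≤-reflexive m-1

    simple : Bool → Root r
    simple σ = vec (m ∸ 1) m σ

    simple∈ : ∀ σ → simple σ ∈ P
    simple∈ σ = vec∈ σ m-1<m (mid-sum′ m-1<m)

    rk-simple : ∀ σ → rk (simple σ) ≡ 0
    rk-simple σ = +-cancelʳ-≡ (m ∸ 1) _ 0 (suc-injective (trans (rk-vec σ m-1<m (mid-sum′ m-1<m)) (sym m-1)))

    simple-≰ : ∀ {σ τ} → σ ≢ τ → ¬ simple σ ≤ᵣ simple τ
    simple-≰ σ≢τ h = σ≢τ (coloured m-1<m m-1<m h)

    simple≤ : ∀ i → m < end i → ∀ σ → simple σ ≤ᵣ root i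
    simple≤ i g σ = embed′ (<m⇒≤m-1 (≰⇒> (λ h → <⇒≱ (s≤s (≤-reflexive middle)) (≤-trans (s≤s (+-mono-≤ h (<⇒≤ g))) (s≤s (sum≤N i))))))
      (<⇒≤ g) (λ _ e → contradiction e (>⇒≢ g))

    P₁ : Bool → List (Root r)
    P₁ σ = parabolic (simple σ) P

    ranked₁ : ∀ σ → RankedList (P₁ σ)
    ranked₁ σ = ranked′ ranked (simple∈ σ) (rk-simple σ)

    other∈P₁ : ∀ σ → simple (not σ) ∈ P₁ σ
    other∈P₁ σ = P′⁺ ranked (simple∈ σ) (rk-simple σ) (simple∈ (not σ)) (simple-≰ (λ e → not≢ (sym e)))

    P₂ : Bool → List (Root r)
    P₂ σ = parabolic (simple (not σ)) (P₁ σ)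

    -- Removing both simple roots of the fork leaves the poset of type A.
    trunk : ∀ σ → FullRoots (P₂ σ) (m ∸ 1)
    trunk σ = record
      { ranked = ranked′ (ranked₁ σ) (other∈P₁ σ) (rk-simple (not σ))
      ; vec = λ a b → vec a b true
      ; vec∈ = λ a<b b≤ → P′⁺ (ranked₁ σ) (other∈P₁ σ) (rk-simple (not σ))
          (P′⁺ ranked (simple∈ σ) (rk-simple σ) (vec∈ true a<b (before a<b b≤)) (above a<b b≤)) (above a<b b≤)
      ; vec∈⁻ = vec∈⁻′
      ; reflect = λ a<b b≤ c<d d≤ → reflect a<b (before a<b b≤) c<d (before c<d d≤)
      ; embed = embed true
      ; rk-vec = λ a<b b≤ → rk-vec true a<b (before a<b b≤)
      }
      where
      before : ∀ {a b} → a < b → b ≤ m ∸ 1 → a + b ≤ N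
      before a<b b≤ = before-sum′ a<b (≤-trans b≤ (m∸n≤m m 1))
      above : ∀ {a b τ} → a < b → b ≤ m ∸ 1 → ¬ simple τ ≤ᵣ vec a b true
      above a<b b≤ h = <⇒≱ m-1<m (≤-trans (proj₂ (reflect m-1<m (mid-sum′ m-1<m) a<b (before a<b b≤) h)) b≤)
      vec∈⁻′ : ∀ {x} → x ∈ P₂ σ → ∃ λ (i : FullIx (m ∸ 1)) → vec (FullIx.start i) (FullIx.end i) true ≡ x
      vec∈⁻′ x∈ with P′⁻ (ranked₁ σ) (other∈P₁ σ) (rk-simple (not σ)) x∈
      ... | x∈₁ , ≰₂ with P′⁻ ranked (simple∈ σ) (rk-simple σ) x∈₁
      ...   | x∈P , ≰₁ with vec∈⁻ x∈P
      ...     | i , refl with <-cmp (end i) m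
      ...       | tri< l _ _ = full (start<end i) (<m⇒≤m-1 l) , plain (<⇒≢ l)
      ...       | tri> _ _ g = contradiction (simple≤ i g σ) ≰₁
      ...       | tri≈ _ e _ with colour i Bool.≟ σ
      ...         | yes f = contradiction (embed′ (<m⇒≤m-1 (subst (start i <_) e (start<end i))) (≤-reflexive (sym e)) (λ _ _ → sym f)) ≰₁
      ...         | no ¬f = contradiction (embed′ (<m⇒≤m-1 (subst (start i <_) e (start<end i))) (≤-reflexive (sym e)) (λ _ _ → sym (≢⇒≡not ¬f))) ≰₂

    remove⁻ : ∀ {α x : Root r} {X} → x ∈ remove α X → x ∈ X × x ≢ α
    remove⁻ {α} = ∈-filter⁻ (λ q → ¬? (q ≟ᵣ α))

    remove⁺ : ∀ {α x : Root r} {X} → x ∈ X → x ≢ α → x ∈ remove α X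
    remove⁺ {α} = ∈-filter⁺ (λ q → ¬? (q ≟ᵣ α))

    trunk-in : ∀ τ {A} → IsAntichainIn model A → (e : Exceptional roots coloured A) →
               IsAntichainIn (Full.model (trunk τ)) (remove (simple (Exceptional.σ e)) A)
    trunk-in τ {A} aA e = record
      { antichain = AllPairs.filter⁺ _ (antichain aA)
      ; ⊆P = All.tabulate (λ x∈ → in-trunk (proj₁ (remove⁻ {simple σ} {X = A} x∈)) (proj₂ (remove⁻ {simple σ} {X = A} x∈)))
      }
      where
      open Exceptional e
      in-trunk : ∀ {x} → x ∈ A → x ≢ simple σ → x ∈ P₂ τ
      in-trunk x∈ x≢ with rest x∈ x≢
      ... | a , b , a<b , b<m , refl = FullRoots.vec∈ (trunk τ) a<b (<m⇒≤m-1 b<m)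

    exceptional-of : ∀ σ {X Y} → X ≋ (simple (not σ) ∷ Y) → All (_∈ P₂ σ) Y → Exceptional roots coloured X
    exceptional-of σ X≋ Y⊆ = record { σ = not σ ; α∈ = proj₂ (X≋ _) (here refl) ; rest = λ {x} x∈ x≢ →
      let i , q = FullRoots.vec∈⁻ (trunk σ) (All.lookup Y⊆ (tail x≢ (proj₁ (X≋ x) x∈)))
      in FullIx.start i , FullIx.end i , FullIx.start<end i , ≤-<-trans (FullIx.end≤N i) m-1<m , q }

    remove-≋ : ∀ {β : Root r} {X Y} → X ≋ (β ∷ Y) → ¬ β ∈ Y → remove β X ≋ Y
    remove-≋ {β} {X} X≋ β∉ x =
      (λ x∈ → tail (proj₂ (remove⁻ {X = X} x∈)) (proj₁ (X≋ x) (proj₁ (remove⁻ {X = X} x∈)))) ,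
      (λ x∈ → remove⁺ (proj₂ (X≋ x) (there x∈)) (λ { refl → β∉ x∈ }))

    module ExceptionalRvac {A : List (Root r)} (aA : IsAntichainIn model A) (e : Exceptional roots coloured A) where
      open Exceptional e

      L L″ : List (Root r)
      L = remove (simple σ) A
      L″ = Rvac (P₂ σ) L

      aL : IsAntichainIn (Full.model (trunk σ)) L
      aL = trunk-in σ aA e

      aL″ : IsAntichainIn (Full.model (trunk σ)) L″
      aL″ = full-Rvac-in (trunk σ) aL

      A≋ : (simple σ ∷ L) ≋ A
      A≋ x = (λ { (here refl) → α∈ ; (there x∈) → proj₁ (remove⁻ {X = A} x∈) }) , from
        where
        from : x ∈ A → x ∈ (simple σ ∷ L)
        from x∈ with x ≟ᵣ simple σ
        ... | yes q = here q
        ... | no q = there (remove⁺ x∈ q)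

      -- Part (iv) removes the simple root of colour σ and passes to the poset without it; part (v),
      -- applied in that poset, restores the simple root of the other colour. What remains is
      -- rowvacuation on the trunk.
      Rvac≋ : Rvac P A ≋ (simple (not σ) ∷ L″)
      Rvac≋ = ≋-trans {X = Rvac P A} {Rvac (P₁ σ) L} {simple (not σ) ∷ L″} (Rvac-containing ranked (simple∈ σ) (rk-simple σ) model (antichain aA) (⊆P aA) α∈)
        (Rvac-avoiding (ranked₁ σ) (other∈P₁ σ) (rk-simple (not σ)) (antichain aL) (⊆P aL))

      B-in : IsAntichainIn model (Rvac P A)
      B-in = record { antichain = proj₁ valid ; ⊆P = proj₂ valid }
        where valid = Rvac-valid ranked (antichain aA) (⊆P aA)

      other∉L″ : ¬ simple (not σ) ∈ L″
      other∉L″ h = proj₂ (P′⁻ (ranked₁ σ) (other∈P₁ σ) (rk-simple (not σ)) (All.lookup (⊆P aL″) h)) ≤ᵣ-refl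

      Rvac-exceptional : Exceptional roots coloured (Rvac P A)
      Rvac-exceptional = exceptional-of σ {Rvac P A} {L″} Rvac≋ (⊆P aL″)

      unique-∷ : ∀ {x : Root r} {X} → ¬ x ∈ X → Antichain X → AllPairs _≢_ (x ∷ X)
      unique-∷ x∉ aX = All.tabulate (λ y∈ q → x∉ (subst (_∈ _) (sym q) y∈)) ∷ antichain⇒unique aX

      exceptional-size : length A + length (Rvac P A) ≡ suc m
      exceptional-size = exceptional-count (length A) (length (Rvac P A)) (length L) (length L″) m
        (≋-length (antichain⇒unique (antichain aA)) (unique-∷ (λ h → proj₂ (remove⁻ {X = A} h) refl) (antichain aL)) (≋-sym A≋))
        (≋-length (antichain⇒unique (antichain B-in)) (unique-∷ other∉L″ (antichain aL″)) Rvac≋)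
        (trans (cong suc (full-size (trunk σ) aL)) m-1)

    exceptional-involutive : ∀ {A} (aA : IsAntichainIn model A) → Exceptional roots coloured A → Rvac P (Rvac P A) ≋ A
    exceptional-involutive {A} aA e = ≋-trans {X = Rvac P (Rvac P A)} {simple (not (not σ)) ∷ B.L″} {A} B.Rvac≋
      (≋-trans {X = simple (not (not σ)) ∷ B.L″} {simple σ ∷ E.L} {A} cons E.A≋)
      where
      module E = ExceptionalRvac aA e
      module B = ExceptionalRvac E.B-in E.Rvac-exceptional
      open Exceptional e
      enc : Encoding (trunk σ) E.aL
      enc = encoding (trunk σ) E.aL
      open Encoding enc
      -- The second application arrives at the trunk with the two simple roots removed in the
      -- opposite order, which is a different list. Encodings refer to intervals only and carry
      -- over.
      R : FullRoots (P₂ (not σ)) (m ∸ 1)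
      R = trunk (not σ)
      BL≋ : B.L ≋ E.L″
      BL≋ = remove-≋ {simple (not σ)} {Rvac P A} {E.L″} E.Rvac≋ E.other∉L″
      enc″ : Encodes (Full.model (trunk σ)) (Full.Ideal (trunk σ) (co-balanced bal)) E.L″
      enc″ = Rvac-encodes _ (Full.evolution (trunk σ) bal) (dual-full (trunk σ) bal) E.aL encodes
      below-≋ : ∀ {X Y : List (Root r)} {y} → X ≋ Y → Below X y → Below Y y
      below-≋ e b with find b
      ... | x , x∈ , h = ∈⇒below (proj₁ (e x) x∈) h
      encB : Encodes (Full.model R) (Full.Ideal R (co-balanced bal)) B.L
      encB = encode λ i → (λ x b → proj₁ (Encodes.laws enc″ i) x (below-≋ {B.L} {E.L″} BL≋ b)) ,
                          (λ ¬b → proj₂ (Encodes.laws enc″ i) (¬b ∘ below-≋ {E.L″} {B.L} (≋-sym {X = B.L} {E.L″} BL≋)))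
      L≋ : B.L″ ≋ E.L
      L≋ = encodes-≋ (Full.model R) B.aL″ (trunk-in (not σ) aA e)
        (Rvac-encodes _ (Full.evolution R (co-balanced bal)) (dual-full′ R bal) B.aL encB)
        (encode (Encodes.laws encodes))
      cons : (simple (not (not σ)) ∷ B.L″) ≋ (simple σ ∷ E.L)
      cons = ∷-≋ {X = B.L″} {E.L} (cong simple (Bool.not-involutive σ)) L≋

    -- A plain filter would contain the simple root of the other colour along with α, but no element
    -- of A lies below that root.
    exceptional-not-plain : ∀ {A} → Exceptional roots coloured A → ¬ Plain roots A
    exceptional-not-plain {A} e p with find (Plain.inside⇐ p (half m-1<m (mid-sum′ m-1<m) (not σ))
                                     (Plain.inside⇒ p (half m-1<m (mid-sum′ m-1<m) σ) (∈⇒below α∈ ≤ᵣ-refl)))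
      where open Exceptional e
    ... | x , x∈ , h with x ≟ᵣ simple (Exceptional.σ e)
    ...   | yes refl = simple-≰ (λ q → not≢ (sym q)) h
    ...   | no x≢ with Exceptional.rest e x∈ x≢
    ...     | a , b , a<b , b<m , refl = <⇒≱ b<m (≤-trans (≤-reflexive (sym m-1))
              (≤-<-trans (proj₁ (reflect a<b (before-sum′ a<b (<⇒≤ b<m)) m-1<m (mid-sum′ m-1<m) h)) a<b))

    -- The simple root of colour τ starts after p, so it owes its place in the filter to the
    -- intervals L, whose colour in the middle is `not σ`. The special root of colour σ lies above
    -- some element of A, which can only be that simple root. Hence τ would be both `not σ` and σ.
    exceptional-not-source : ∀ {A} → Exceptional roots coloured A → ¬ Source roots coloured A
    exceptional-not-source {A} e s = contradiction τ≡ (λ q → not≢ (sym q))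
      where
      open Exceptional e using (α∈; rest) renaming (σ to τ)
      open Source s
      p<m : p < m
      p<m = <-trans (n<1+n p) p<
      τ≡not : τ ≡ not σ
      τ≡not with below⇒ m-1<m (mid-sum′ m-1<m) (∈⇒below α∈ ≤ᵣ-refl)
      ... | inj₁ (_ , h , _) = contradiction (<m⇒≤m-1 p<) (<⇒≱ (s≤s h))
      ... | inj₂ any with find any
      ...   | (c , d) , q∈ , (p≤ , q≤) , f = f (≤-antisym q≤ (≤-trans (≤-reflexive (sym m-1)) (≤-<-trans p≤ (proj₁ (All.lookup proper q∈))))) refl
      τ≡σ : τ ≡ σ
      τ≡σ with find (below⇐₁ {p} {m} {σ} ≤-refl ≤-refl (λ _ → refl))
      ... | x , x∈ , h with x ≟ᵣ simple τ
      ...   | yes refl = coloured m-1<m p<m h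
      ...   | no x≢ with rest x∈ x≢
      ...     | a , b , a<b , b<m , refl with below⇒ a<b (before-sum′ a<b (<⇒≤ b<m)) (∈⇒below x∈ ≤ᵣ-refl)
      ...       | inj₁ (m≤b , _) = contradiction b<m (≤⇒≯ m≤b)
      ...       | inj₂ any with find any
      ...         | (c , d) , q∈ , (a≤c , d≤b) , _ with All.lookup sides q∈
      ...           | inj₂ (m≤d , _) = contradiction (≤-<-trans d≤b b<m) (≤⇒≯ m≤d)
      ...           | inj₁ (_ , c<p) = contradiction c<p (≤⇒≯ (≤-trans
                        (proj₁ (reflect a<b (before-sum′ a<b (<⇒≤ b<m)) p<m (mid-sum′ p<m) h)) a≤c))
      τ≡ : σ ≡ not σ
      τ≡ = trans (sym τ≡σ) τ≡not

    exceptional-≋ : ∀ {A B} → A ≋ B → Exceptional roots coloured A → Exceptional roots coloured B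
    exceptional-≋ A≋B e = record { σ = σ ; α∈ = proj₁ (A≋B _) α∈ ; rest = λ x∈ → rest (proj₂ (A≋B _) x∈) }
      where open Exceptional e

    module UnmixedRvac {A : List (Root r)} (aA : IsAntichainIn model A) (u : Unmixed roots coloured A) where
      open Unmixed u renaming (plain to pA)

      -- The image is unmixed again: a mixed one admits no plain encoding, and if it were
      -- exceptional, then so would be its own image, which is A. The parity counts of both lists
      -- then apply.
      unmixed-size : length A + length (Rvac P A) ≡ suc m
      unmixed-size = by (classify roots coloured (plain-Rvac-in roots aA pA))
        where
        by : Unmixed roots coloured (Rvac P A) ⊎ Mixed roots coloured (Rvac P A) ⊎ Exceptional roots coloured (Rvac P A) →
             length A + length (Rvac P A) ≡ suc m
        by (inj₁ v) = trans (cong₂ _+_ size (Unmixed.size v))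
              (unmixed-count (length (Plain.L pA)) (length (Plain.L (Unmixed.plain v))) _ _ m
                (proj₂ (plain-count roots aA pA (Unmixed.plain v))) (plain-middle roots aA pA (Unmixed.plain v)))
        by (inj₂ (inj₁ x)) = ⊥-elim (not-plain roots coloured (decoded roots coloured (Mixed.source x))
              (decoded-encodes roots coloured (Mixed.source x))
              (co-balanced (Plain.bal pA)) (co-symmetric (Plain.bal pA) (Plain.sy pA)) (plain-Rvac-encodes roots aA pA))
        by (inj₂ (inj₂ e)) = ⊥-elim (exceptional-not-plain
              (exceptional-≋ {Rvac P (Rvac P A)} {A} (plain-involutive roots aA pA) (ExceptionalRvac.Rvac-exceptional (plain-Rvac-in roots aA pA) e)) pA)

    module MixedRvac {A : List (Root r)} (aA : IsAntichainIn model A) (x : Mixed roots coloured A) where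
      open Mixed x
      private
        d : TwistedData roots coloured
        d = decoded roots coloured source
        module D = TwistedData d
        enc : Encodes model D.X A
        enc = decoded-encodes roots coloured source
        B : List (Root r)
        B = Rvac P A
        aB : IsAntichainIn model B
        aB = Rvac-in model D.evolves (dual-twisted roots coloured d) aA enc
        encB : Encodes model (TwistedData.X (dual-data roots coloured d)) B
        encB = Rvac-encodes model D.evolves (dual-twisted roots coloured d) aA enc

      mixed-involutive : Rvac P (Rvac P A) ≋ A
      mixed-involutive = Rvac-involutive model D.evolves (TwistedData.evolves (dual-data roots coloured d))
        (dual-twisted roots coloured d) (dual-twisted′ roots coloured d) aA enc

      -- The image is mixed again, for the same reasons. Its dual pair and the pair decoded from it
      -- encode the same antichain, so their totals agree by `twisted-total`.
      mixed-size : length A + length (Rvac P A) ≡ suc m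
      mixed-size = by (classify roots coloured aB)
        where
        by : Unmixed roots coloured B ⊎ Mixed roots coloured B ⊎ Exceptional roots coloured B → length A + length B ≡ suc m
        by (inj₁ v) = ⊥-elim (not-plain roots coloured (dual-data roots coloured d) encB (Plain.bal (Unmixed.plain v)) (Plain.sy (Unmixed.plain v))
              (Plain.encodes (Unmixed.plain v)))
        by (inj₂ (inj₂ e)) = ⊥-elim (exceptional-not-source
              (exceptional-≋ {Rvac P B} {A} mixed-involutive (ExceptionalRvac.Rvac-exceptional aB e)) source)
        by (inj₂ (inj₁ y)) = trans (cong₂ _+_ size (Mixed.size y)) (proj₂ (one-of
              (mixed-count (length (Source.L source)) (length (Source.L (Mixed.source y))) (count (central? N) (Source.L source))
                (count (central? N) (Source.L (Mixed.source y))) (D.S N) N (co D.E N) m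
                (decoded-total roots coloured source)
                (trans (cong (_+ count (central? N) (Source.L (Mixed.source y)))
                         (twisted-total roots coloured (dual-data roots coloured d) (decoded roots coloured (Mixed.source y)) encB (decoded-encodes roots coloured (Mixed.source y))))
                       (decoded-total roots coloured (Mixed.source y)))
                (trans (cong (co D.E N +_) (Balanced.total D.bal)) (m∸n+n≡m (Balanced.E.bounded D.bal N))) middle)
              (central≤1 N (Source.shifted source)) (central≤1 N (Source.shifted (Mixed.source y)))))

    forked-involutive : ∀ {A} → IsAntichainIn model A → Rvac P (Rvac P A) ≋ A
    forked-involutive {A} aA = by (classify roots coloured aA)
      where
      by : Unmixed roots coloured A ⊎ Mixed roots coloured A ⊎ Exceptional roots coloured A → Rvac P (Rvac P A) ≋ A
      by (inj₁ u) = plain-involutive roots aA (Unmixed.plain u)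
      by (inj₂ (inj₁ x)) = MixedRvac.mixed-involutive aA x
      by (inj₂ (inj₂ e)) = exceptional-involutive aA e

    forked-size : ∀ {A} → IsAntichainIn model A → length A + length (Rvac P A) ≡ suc m
    forked-size {A} aA = by (classify roots coloured aA)
      where
      by : Unmixed roots coloured A ⊎ Mixed roots coloured A ⊎ Exceptional roots coloured A → length A + length (Rvac P A) ≡ suc m
      by (inj₁ u) = UnmixedRvac.unmixed-size aA u
      by (inj₂ (inj₁ x)) = MixedRvac.mixed-size aA x
      by (inj₂ (inj₂ e)) = ExceptionalRvac.exceptional-size aA e

-- Coefficient vectors and folded intervals

module Coeff where

  open Lia using (lia; goal; _:+_; _:≤_; _:<_; _:≡_; _:→_)
  open import Data.Fin using (Fin; toℕ; fromℕ<; zero; suc)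
  open import Data.Fin.Properties using (toℕ-fromℕ<; toℕ<n)
  open import Data.Vec using ([]; _∷_; tabulate; zipWith; lookup; sum)
  open import Data.Vec.Properties using (tabulate-cong; tabulate-∘; lookup∘tabulate)

  -- Coefficients are indexed by 1, …, r.
  tab : ∀ {r} → (ℕ → ℕ) → Root r
  tab f = tabulate (λ i → f (suc (toℕ i)))

  χ : ℕ → ℕ → ℕ → ℕ
  χ i j k = if (i ≤ᵇ k) ∧ (k ≤ᵇ j) then 1 else 0

  tab-cong : ∀ {r} {f g : ℕ → ℕ} → (∀ k → 1 ≤ k → k ≤ r → f k ≡ g k) → tab {r} f ≡ tab g
  tab-cong h = tabulate-cong (λ i → h _ (s≤s z≤n) (toℕ<n i))

  tab-+ : ∀ {r} (f g : ℕ → ℕ) → tab {r} f ⊕ tab g ≡ tab (λ k → f k + g k)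
  tab-+ {r} f g = go (λ i → f (suc (toℕ i))) (λ i → g (suc (toℕ i)))
    where
    go : ∀ {n} (f g : Fin n → ℕ) → zipWith _+_ (tabulate f) (tabulate g) ≡ tabulate (λ i → f i + g i)
    go {zero} f g = refl
    go {suc n} f g = cong (f zero + g zero ∷_) (go (f ∘ suc) (g ∘ suc))

  tab-2× : ∀ {r} (f : ℕ → ℕ) → 2× (tab {r} f) ≡ tab (λ k → 2 * f k)
  tab-2× f = sym (tabulate-∘ (2 *_) (λ i → f (suc (toℕ i))))

  tab-mono : ∀ {r} {f g : ℕ → ℕ} → (∀ k → 1 ≤ k → k ≤ r → f k ≤ g k) → tab {r} f ≤ᵣ tab g
  tab-mono h = Pw.tabulate⁺ (λ i → h _ (s≤s z≤n) (toℕ<n i))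

  tab-mono⁻ : ∀ {r} {f g : ℕ → ℕ} → tab {r} f ≤ᵣ tab g → ∀ k → 1 ≤ k → k ≤ r → f k ≤ g k
  tab-mono⁻ {r} {f} {g} h (suc k) _ k≤ = subst₂ _≤_ (at f) (at g) (Pw.lookup h (fromℕ< k≤))
    where
    at : ∀ f → lookup (tab {r} f) (fromℕ< k≤) ≡ f (suc k)
    at f = trans (lookup∘tabulate _ (fromℕ< k≤)) (cong (f ∘ suc) (toℕ-fromℕ< k≤))

  height-+ : ∀ {r} (x y : Root r) → height (x ⊕ y) ≡ height x + height y
  height-+ [] [] = refl
  height-+ (x ∷ xs) (y ∷ ys) rewrite height-+ xs ys =
    lia 4 (λ a b c d → goal (a :+ b :+ (c :+ d) :≡ a :+ c :+ (b :+ d))) x y (sum xs) (sum ys)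

  χ-in : ∀ {i j k} → i ≤ k → k ≤ j → χ i j k ≡ 1
  χ-in {i} {j} {k} p q with i ≤ᵇ k | ≤⇒≤ᵇ p | k ≤ᵇ j | ≤⇒≤ᵇ q
  ... | true | _ | true | _ = refl

  χ-left : ∀ {i j k} → k < i → χ i j k ≡ 0
  χ-left {i} {j} {k} k<i with i ≤ᵇ k | ≤ᵇ⇒≤ i k
  ... | true | f = contradiction (f _) (<⇒≱ k<i)
  ... | false | _ = refl

  χ-right : ∀ {i j k} → j < k → χ i j k ≡ 0
  χ-right {i} {j} {k} j<k with i ≤ᵇ k | k ≤ᵇ j | ≤ᵇ⇒≤ k j
  ... | true | true | f = contradiction (f _) (<⇒≱ j<k)
  ... | true | false | _ = refl
  ... | false | _ | _ = refl

  χ-≤1 : ∀ i j k → χ i j k ≤ 1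
  χ-≤1 i j k with (i ≤ᵇ k) ∧ (k ≤ᵇ j)
  ... | true = ≤-refl
  ... | false = z≤n

  χ⁻ : ∀ {i j k} → 1 ≤ χ i j k → i ≤ k × k ≤ j
  χ⁻ {i} {j} {k} h with i ≤? k | k ≤? j
  ... | yes p | yes q = p , q
  ... | no ¬p | _ = contradiction h (subst (λ x → ¬ 1 ≤ x) (sym (χ-left {i} {j} (≰⇒> ¬p))) λ ())
  ... | yes _ | no ¬q = contradiction h (subst (λ x → ¬ 1 ≤ x) (sym (χ-right {i} {j} (≰⇒> ¬q))) λ ())

  χ-mono : ∀ {i j i′ j′} k → i′ ≤ i → j ≤ j′ → χ i j k ≤ χ i′ j′ k
  χ-mono {i} {j} {i′} {j′} k p q with i ≤? k | k ≤? j
  ... | yes a | yes b = ≤-reflexive (trans (χ-in {i} {j} a b) (sym (χ-in (≤-trans p a) (≤-trans b q))))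
  ... | no ¬a | _ = subst (_≤ χ i′ j′ k) (sym (χ-left {i} {j} (≰⇒> ¬a))) z≤n
  ... | yes _ | no ¬b = subst (_≤ χ i′ j′ k) (sym (χ-right {i} {j} (≰⇒> ¬b))) z≤n

  height-initial : ∀ r j → j ≤ r → height (tab {r} (λ k → if k ≤ᵇ j then 1 else 0)) ≡ j
  height-initial zero zero _ = refl
  height-initial (suc r) zero _ = height-initial r zero z≤n
  height-initial (suc r) (suc j) (s≤s j≤r) = cong suc (height-initial r j j≤r)

  -- Adding the initial segment (0, a] completes the interval to (0, b], whose height is found by
  -- recursion.
  height-ind : ∀ {r a b} → a ≤ b → b ≤ r → height (ind {r} (suc a) b) + a ≡ b
  height-ind {r} {a} {b} a≤b b≤r = begin
    height (ind {r} (suc a) b) + a                            ≡⟨ cong (height (ind {r} (suc a) b) +_) (sym (height-initial r a (≤-trans a≤b b≤r))) ⟩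
    height (ind {r} (suc a) b) + height (tab {r} (below a))   ≡⟨ sym (height-+ {r} (ind (suc a) b) (tab (below a))) ⟩
    height (ind {r} (suc a) b ⊕ tab (below a))                ≡⟨ cong height (trans (tab-+ {r} (χ (suc a) b) (below a)) (tab-cong (λ k _ _ → split k))) ⟩
    height (tab {r} (below b))                                ≡⟨ height-initial r b b≤r ⟩
    b                                                         ∎
    where
    open ≡-Reasoning
    below : ℕ → ℕ → ℕ
    below j k = if k ≤ᵇ j then 1 else 0
    below-yes : ∀ {j k} → k ≤ j → below j k ≡ 1
    below-yes {j} {k} p with k ≤ᵇ j | ≤⇒≤ᵇ p
    ... | true | _ = refl
    below-no : ∀ {j k} → j < k → below j k ≡ 0
    below-no {j} {k} p with k ≤ᵇ j | ≤ᵇ⇒≤ k j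
    ... | true | f = contradiction (f _) (<⇒≱ p)
    ... | false | _ = refl
    split : ∀ k → χ (suc a) b k + below a k ≡ below b k
    split k with k ≤? a | k ≤? b
    ... | yes p | _ = trans (cong₂ _+_ (χ-left {suc a} {b} (s≤s p)) (below-yes p)) (sym (below-yes (≤-trans p a≤b)))
    ... | no ¬p | yes q = trans (cong₂ _+_ (χ-in (≰⇒> ¬p) q) (below-no (≰⇒> ¬p))) (sym (below-yes q))
    ... | no ¬p | no ¬q = trans (cong₂ _+_ (χ-right {suc a} {b} (≰⇒> ¬q)) (below-no (≰⇒> ¬p))) (sym (below-no (≰⇒> ¬q)))

  -- Σ α over a line of simple roots α₁, …, α_r followed by the mirror images
  -- of α_u, …, α₁: the root of the interval (a, b] of this line.
  module Folded (r u : ℕ) (u≤r : u ≤ r) where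

    -- Past r the line continues with α_u, α_{u-1}, ..., so an interval ending at b > r reaches back
    -- to the index u + r - b + 1. Type B has u = r, type C has u = r - 1 and type D has u = r - 2.
    turn : ℕ → ℕ
    turn b = u + r ∸ b

    fold : ℕ → ℕ → Root r
    fold a b = ind (suc a) b ⊕ ind (suc (turn b)) u

    coef : ℕ → ℕ → ℕ → ℕ
    coef a b k = χ (suc a) b k + χ (suc (turn b)) u k

    fold-tab : ∀ a b → fold a b ≡ tab (coef a b)
    fold-tab a b = tab-+ (χ (suc a) b) (χ (suc (turn b)) u)

    turn-small : ∀ {b} → b ≤ r → u ≤ turn b
    turn-small {b} b≤r = subst (_≤ turn b) (m+n∸n≡m u r) (∸-monoʳ-≤ (u + r) b≤r)

    second-empty : ∀ {b} k → b ≤ r → χ (suc (turn b)) u k ≡ 0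
    second-empty {b} k b≤r with k ≤? u
    ... | yes k≤u = χ-left {suc (turn b)} {u} (s≤s (≤-trans k≤u (turn-small b≤r)))
    ... | no k≰u = χ-right {suc (turn b)} {u} (≰⇒> k≰u)

    fold-short : ∀ a {b} → b ≤ r → fold a b ≡ ind (suc a) b
    fold-short a {b} b≤r = trans (fold-tab a b) (tab-cong (λ k _ _ → trans (cong (χ (suc a) b k +_) (second-empty k b≤r)) (+-identityʳ _)))

    coef-mono : ∀ {a b c d} k → c ≤ a → b ≤ d → coef a b k ≤ coef c d k
    coef-mono k c≤a b≤d = +-mono-≤ (χ-mono k (s≤s c≤a) b≤d) (χ-mono k (s≤s (∸-monoʳ-≤ (u + r) b≤d)) ≤-refl)

    fold-mono : ∀ {a b c d} → c ≤ a → b ≤ d → fold a b ≤ᵣ fold c d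
    fold-mono {a} {b} {c} {d} c≤a b≤d = subst₂ _≤ᵣ_ (sym (fold-tab a b)) (sym (fold-tab c d)) (tab-mono (λ k _ _ → coef-mono k c≤a b≤d))

    coef⁻ : ∀ {a b k} → 1 ≤ coef a b k → (suc a ≤ k × k ≤ b) ⊎ (suc (turn b) ≤ k × k ≤ u)
    coef⁻ {a} {b} {k} h with 1 ≤? χ (suc a) b k
    ... | yes p = inj₁ (χ⁻ p)
    ... | no ¬p = inj₂ (χ⁻ (subst (λ x → 1 ≤ x + χ (suc (turn b)) u k) (n<1⇒n≡0 (≰⇒> ¬p)) h))

    coef₂⁻ : ∀ {a b k} → 2 ≤ coef a b k → suc (turn b) ≤ k
    coef₂⁻ {a} {b} {k} h with 1 ≤? χ (suc (turn b)) u k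
    ... | yes p = proj₁ (χ⁻ {suc (turn b)} {u} p)
    ... | no ¬p = contradiction h (<⇒≱ (s≤s (≤-trans (≤-reflexive (trans (cong (χ (suc a) b k +_) (n<1⇒n≡0 (≰⇒> ¬p))) (+-identityʳ _))) (χ-≤1 (suc a) b k))))

    module _ (N : ℕ) (N≤ : N ≤ u + r) (N< : N < r + r) where

      start<r : ∀ {a b} → a < b → a + b ≤ N → a < r
      start<r {a} {b} = lia 4 (λ a b N r → N :< r :+ r :→ a :< b :→ a :+ b :≤ N :→ goal (a :< r)) a b N r N<

      reflect-start : ∀ a c d → c + d ≤ N → suc (turn d) ≤ suc a → c ≤ a
      reflect-start a c d cd h = +-cancelʳ-≤ d c a (≤-trans cd (≤-trans N≤ (m∸n≤o⇒m≤o+n (u + r) d (s≤s⁻¹ h))))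
        where
        m∸n≤o⇒m≤o+n : ∀ m n {o} → m ∸ n ≤ o → m ≤ o + n
        m∸n≤o⇒m≤o+n m n {o} h = ≤-trans (m≤n+m∸n m n) (≤-trans (+-monoʳ-≤ n h) (≤-reflexive (+-comm n o)))

      -- The start is tested at the coefficient of index a + 1. The end is tested at index b as long
      -- as b ≤ r, and otherwise at the index `suc (turn b)`, the first one where the coefficient is
      -- 2. A coefficient 1 of (c, d] may come from its returning part, which c + d ≤ N turns into a
      -- bound on c.
      fold-reflect : ∀ {a b c d} → a < b → a + b ≤ N → c < d → c + d ≤ N →
                     (∀ k → 1 ≤ k → k ≤ r → coef a b k ≤ coef c d k) → c ≤ a × b ≤ d
      fold-reflect {a} {b} {c} {d} a<b ab c<d cd h = start , end
        where
        start : c ≤ a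
        start with coef⁻ {c} {d} {suc a} (≤-trans (≤-trans (≤-reflexive (sym (χ-in {suc a} {b} ≤-refl a<b))) (m≤m+n _ _)) (h (suc a) (s≤s z≤n) (start<r a<b ab)))
        ... | inj₁ (p , _) = s≤s⁻¹ p
        ... | inj₂ (p , _) = reflect-start a c d cd p
        end : b ≤ d
        end with b ≤? r
        ... | yes b≤r with coef⁻ {c} {d} {b} (≤-trans (≤-trans (≤-reflexive (sym (χ-in {suc a} {b} a<b ≤-refl))) (m≤m+n _ _)) (h b (≤-trans (s≤s z≤n) a<b) b≤r))
        ...   | inj₁ (_ , p) = p
        ...   | inj₂ (p , q) with b ≤? d
        ...     | yes b≤d = b≤d
        ...     | no b≰d = contradiction (turn-small (≤-trans (<⇒≤ (≰⇒> b≰d)) b≤r)) (<⇒≱ (≤-trans p q))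
        end | no b≰r = +-cancelˡ-≤ (turn b) b d (≤-trans (≤-reflexive turn+b) (≤-trans (m≤n+m∸n (u + r) d)
              (≤-trans (≤-reflexive (+-comm d (turn d))) (+-monoˡ-≤ d (s≤s⁻¹ (coef₂⁻ {c} {d} two))))))
          where
          turn+b : turn b + b ≡ u + r
          turn+b = m∸n+n≡m (≤-trans (≤-trans (m≤n+m b a) ab) N≤)
          q<u : turn b < u
          q<u = +-cancelʳ-< b (turn b) u (<-≤-trans (≤-<-trans (≤-reflexive turn+b) (+-monoʳ-< u (≰⇒> b≰r))) ≤-refl)
          a≤q : a ≤ turn b
          a≤q = +-cancelʳ-≤ b a (turn b) (≤-trans ab (≤-trans N≤ (≤-reflexive (sym turn+b))))
          two : 2 ≤ coef c d (suc (turn b))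
          two = ≤-trans (≤-reflexive (sym (cong₂ _+_ (χ-in {suc a} {b} (s≤s a≤q) (≤-trans q<u (≤-trans u≤r (<⇒≤ (≰⇒> b≰r))))) (χ-in {suc (turn b)} ≤-refl q<u))))
            (h (suc (turn b)) (s≤s z≤n) (≤-trans q<u u≤r))

      fold-reflect′ : ∀ {a b c d} → a < b → a + b ≤ N → c < d → c + d ≤ N → fold a b ≤ᵣ fold c d → c ≤ a × b ≤ d
      fold-reflect′ {a} {b} {c} {d} a<b ab c<d cd h =
        fold-reflect a<b ab c<d cd (tab-mono⁻ (subst₂ _≤ᵣ_ (fold-tab a b) (fold-tab c d) h))

      fold-height : ∀ {a b} → a < b → a + b ≤ N → height (fold a b) + a ≡ b
      fold-height {a} {b} a<b ab with b ≤? r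
      ... | yes b≤r = trans (cong (λ x → height x + a) (fold-short a b≤r)) (height-ind (<⇒≤ a<b) b≤r)
      ... | no b≰r = lia 8 (λ h h₁ h₂ a b r u q → h :≡ h₁ :+ h₂ :→ h₁ :+ a :≡ r :→ h₂ :+ q :≡ u :→ q :+ b :≡ u :+ r :→ goal (h :+ a :≡ b))
          (height (fold a b)) (height (ind {r} (suc a) r)) (height (ind {r} (suc (turn b)) u)) a b r u (turn b)
          (trans (height-+ {r} (ind (suc a) b) (ind (suc (turn b)) u)) (cong (λ x → height x + height (ind {r} (suc (turn b)) u)) cut))
          (height-ind (<⇒≤ (start<r a<b ab)) ≤-refl)
          (height-ind (+-cancelʳ-≤ b (turn b) u (≤-trans (≤-reflexive turn+b) (+-monoʳ-≤ u (<⇒≤ (≰⇒> b≰r))))) u≤r)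
          turn+b
        where
        turn+b : turn b + b ≡ u + r
        turn+b = m∸n+n≡m (≤-trans (≤-trans (m≤n+m b a) ab) N≤)
        cut : ind {r} (suc a) b ≡ ind (suc a) r
        cut = tab-cong (λ k _ k≤r → split k k≤r)
          where
          split : ∀ k → k ≤ r → χ (suc a) b k ≡ χ (suc a) r k
          split k k≤r with suc a ≤? k
          ... | yes p = trans (χ-in {suc a} {b} p (≤-trans k≤r (<⇒≤ (≰⇒> b≰r)))) (sym (χ-in {suc a} {r} p k≤r))
          ... | no ¬p = trans (χ-left {suc a} {b} (≰⇒> ¬p)) (sym (χ-left {suc a} {r} (≰⇒> ¬p)))

-- Membership and uniqueness for the lists of indices

module Lists where

  open Toggle using (allPairs-map∈)
  open import Data.Product.Properties using (,-injectiveˡ; ,-injectiveʳ)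

  interval⁺ : ∀ {a b k} → a ≤ k → k ≤ b → k ∈ [ a ⋯ b ]
  interval⁺ {a} {b} {k} a≤k k≤b = subst (_∈ [ a ⋯ b ]) (m+[n∸m]≡n a≤k)
    (∈-map⁺ (a +_) (∈-upTo⁺ (∸-monoˡ-< (s≤s k≤b) a≤k)))

  interval⁻ : ∀ {a b k} → k ∈ [ a ⋯ b ] → a ≤ k × k ≤ b
  interval⁻ {a} {b} k∈ with ∈-map⁻ (a +_) k∈
  ... | i , i∈ , refl = m≤m+n a i , s≤s⁻¹ (≤-trans (≤-reflexive (sym (+-suc a i))) (m≤o∸n⇒n+m≤o (∈-upTo⁻ i∈)))
    where
    m≤o∸n⇒n+m≤o : suc i ≤ suc b ∸ a → a + suc i ≤ suc b
    m≤o∸n⇒n+m≤o h with a ≤? suc b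
    ... | yes p = ≤-trans (+-monoʳ-≤ a h) (≤-reflexive (m+[n∸m]≡n p))
    ... | no p = contradiction (subst (suc i ≤_) (m≤n⇒m∸n≡0 (<⇒≤ (≰⇒> p))) h) λ ()

  interval-unique : ∀ a b → Unique [ a ⋯ b ]
  interval-unique a b = Unique.map⁺ (+-cancelˡ-≡ a _ _) (Unique.upTo⁺ (suc b ∸ a))

  pairs⁺ : ∀ {n a b} → a < b → b < n → (suc a , suc b) ∈ pairs n
  pairs⁺ {n} {a} {b} a<b b<n = ∈-concatMap⁺ (λ i → map (i ,_) [ suc i ⋯ n ]) (Any.map (λ { refl → ∈-map⁺ (suc a ,_) (interval⁺ (s≤s a<b) b<n) })
    (interval⁺ {1} {n} {suc a} (s≤s z≤n) (<-trans a<b b<n)))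

  pairs⁻ : ∀ {n q} → q ∈ pairs n → ∃ λ a → ∃ λ b → q ≡ (suc a , suc b) × a < b × b < n
  pairs⁻ {n} q∈ with find (∈-concatMap⁻ (λ i → map (i ,_) [ suc i ⋯ n ]) {xs = [ 1 ⋯ n ]} q∈)
  ... | i , i∈ , q∈′ with ∈-map⁻ (i ,_) q∈′ | interval⁻ {1} {n} i∈
  ...   | j , j∈ , refl | s≤s _ , _ with interval⁻ {suc _} {n} j∈
  ...     | s≤s i<j , j≤n = _ , _ , refl , i<j , j≤n

  pairs-unique : ∀ n → Unique (pairs n)
  pairs-unique n = go (interval-unique 1 n)
    where
    go : ∀ {xs} → Unique xs → Unique (concatMap (λ i → map (i ,_) [ suc i ⋯ n ]) xs)
    go [] = []
    go {i ∷ xs} (i∉ ∷ u) = Unique.++⁺ (Unique.map⁺ ,-injectiveʳ (interval-unique (suc i) n)) (go u) disjoint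
      where
      disjoint : ∀ {q} → ¬ (q ∈ map (i ,_) [ suc i ⋯ n ] × q ∈ concatMap (λ i → map (i ,_) [ suc i ⋯ n ]) xs)
      disjoint (p , q) with ∈-map⁻ (i ,_) p | find (∈-concatMap⁻ (λ i → map (i ,_) [ suc i ⋯ n ]) {xs = xs} q)
      ... | _ , _ , refl | k , k∈ , q′ with ∈-map⁻ (k ,_) q′
      ...   | _ , _ , e = All.lookup i∉ k∈ (,-injectiveˡ e)

  unique-map : ∀ {A B : Set} {f : A → B} {xs} → (∀ {x y} → x ∈ xs → y ∈ xs → f x ≡ f y → x ≡ y) → Unique xs → Unique (map f xs)
  unique-map inj u = AllPairs.map⁺ (allPairs-map∈ (λ x∈ y∈ x≢y e → x≢y (inj x∈ y∈ e)) u)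

-- The positive roots of types A, B, C and D as intervals

module Roots where

  open import Defs using (A; B; C; D)
  open Toggle
  open Lists
  open Coeff
  open Models
  open Lia using (lia; con; goal; _:+_; _:≤_; _:<_; _:≡_; _:→_)

  height⇒rk : ∀ {h a b} → h + a ≡ b → a < b → suc (h ∸ 1 + a) ≡ b
  height⇒rk {zero} e a<b = contradiction e (<⇒≢ a<b)
  height⇒rk {suc h} e a<b = e

  height-positive : ∀ {h a b} → h + a ≡ b → a < b → 1 ≤ h
  height-positive {zero} e a<b = contradiction e (<⇒≢ a<b)
  height-positive {suc h} e a<b = s≤s z≤n

  simple∈⁻ : ∀ {r x} → x ∈ simpleRoots r → ∃ λ a → a < r × x ≡ ind (suc a) (suc a)
  simple∈⁻ {r} x∈ with ∈-map⁻ (λ i → ind {r} i i) x∈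
  ... | i , i∈ , refl with interval⁻ {1} {r} i∈
  ...   | s≤s {n = a} _ , a<r = a , a<r , refl

  simple∈⁺ : ∀ {r a} → a < r → ind {r} (suc a) (suc a) ∈ simpleRoots r
  simple∈⁺ {r} {a} a<r = ∈-map⁺ (λ i → ind i i) (interval⁺ {1} {r} (s≤s z≤n) a<r)

  module TypeA (r : ℕ) where

    pair≡ : ∀ {a b} → a < b → b ≤ r → height (ind {r} (suc a) b) + a ≡ b
    pair≡ a<b b≤r = height-ind (<⇒≤ a<b) b≤r

    ∈⁺ : ∀ {a b} → a < b → b ≤ r → ind {r} (suc a) b ∈ Φ⁺ A r
    ∈⁺ {a} {b} a<b b≤r = ∈-++⁺ˡ (∈-map⁺ minusRoot (pairs⁺ {suc r} a<b (s≤s b≤r)))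

    ∈⁻ : ∀ {x} → x ∈ Φ⁺ A r → ∃ λ (i : FullIx r) → ind (suc (FullIx.start i)) (FullIx.end i) ≡ x
    ∈⁻ x∈ with ∈-++⁻ (longRoots A r) x∈
    ... | inj₁ x∈′ with ∈-map⁻ minusRoot x∈′
    ...   | q , q∈ , refl with pairs⁻ {suc r} q∈
    ...     | a , b , refl , a<b , b<r = full a<b (s≤s⁻¹ b<r) , refl

    reflects : ∀ {a b c d} → a < b → b ≤ r → ind {r} (suc a) b ≤ᵣ ind (suc c) d → c ≤ a × b ≤ d
    reflects {a} {b} {c} {d} a<b b≤r h =
      s≤s⁻¹ (proj₁ (χ⁻ {suc c} {d} (≤-trans (≤-reflexive (sym (χ-in {suc a} {b} ≤-refl a<b))) (at (suc a) (s≤s z≤n) (≤-trans a<b b≤r))))) ,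
      proj₂ (χ⁻ {suc c} {d} (≤-trans (≤-reflexive (sym (χ-in {suc a} {b} a<b ≤-refl))) (at b (≤-trans (s≤s z≤n) a<b) b≤r)))
      where
      at : ∀ k → 1 ≤ k → k ≤ r → χ (suc a) b k ≤ χ (suc c) d k
      at = tab-mono⁻ h

    unique : Unique (Φ⁺ A r)
    unique = Unique.++⁺ (unique-map inj (pairs-unique (suc r))) [] λ ()
      where
      open import Data.List.Relation.Unary.AllPairs using ([])
      inj : ∀ {x y} → x ∈ pairs (suc r) → y ∈ pairs (suc r) → minusRoot {r} x ≡ minusRoot y → x ≡ y
      inj x∈ y∈ e with pairs⁻ {suc r} x∈ | pairs⁻ {suc r} y∈
      ... | a , b , refl , a<b , b<r | c , d , refl , c<d , d<r
        with reflects {a} {b} {c} {d} a<b (s≤s⁻¹ b<r) (subst (ind {r} (suc a) b ≤ᵣ_) e ≤ᵣ-refl) | reflects {c} {d} {a} {b} c<d (s≤s⁻¹ d<r) (subst (_≤ᵣ ind {r} (suc a) b) e ≤ᵣ-refl)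
      ...   | p , q | p′ , q′ = cong₂ (λ a b → suc a , suc b) (≤-antisym p′ p) (≤-antisym q q′)

    ranked : RankedList (Φ⁺ A r)
    ranked = record { unique = unique ; positive = positive }
      where
      positive : ∀ {x} → x ∈ Φ⁺ A r → 1 ≤ height x
      positive x∈ with ∈⁻ x∈
      ... | full a<b b≤r , refl = height-positive (pair≡ a<b b≤r) a<b

    roots : FullRoots (Φ⁺ A r) r
    roots = record
      { ranked = ranked
      ; vec = λ a b → ind (suc a) b
      ; vec∈ = ∈⁺
      ; vec∈⁻ = ∈⁻
      ; reflect = λ a<b b≤ _ _ → reflects a<b b≤
      ; embed = λ c≤a b≤d → tab-mono (λ k _ _ → χ-mono k (s≤s c≤a) b≤d)
      ; rk-vec = λ a<b b≤ → height⇒rk (pair≡ a<b b≤) a<b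
      }

  values : ∀ {x₁ x₂ x₃ y₁ v₁ v₂ v₃ w₁} → x₁ ≡ v₁ → x₂ ≡ v₂ → x₃ ≡ v₃ → y₁ ≡ w₁ →
           v₁ + (2 * v₂ + v₃) ≡ w₁ + v₂ → x₁ + (2 * x₂ + x₃) ≡ y₁ + x₂
  values refl refl refl refl e = e

  -- ε_{a+1} + ε_{c+1} in terms of the folded line, for b = u + r - c.
  plus-coef : ∀ {a b c u r} → a ≤ c → c ≤ u → u ≤ r → r ≤ b → ∀ k → k ≤ r →
              χ (suc a) c k + (2 * χ (suc c) u k + χ (suc u) r k) ≡ χ (suc a) b k + χ (suc c) u k
  plus-coef {a} {b} {c} {u} {r} a≤c c≤u u≤r r≤b k k≤r with k ≤? a | k ≤? c | k ≤? u
  ... | yes p | _ | _ = values (χ-left {suc a} {c} (s≤s p)) (χ-left {suc c} {u} (s≤s (≤-trans p a≤c)))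
        (χ-left {suc u} {r} (s≤s (≤-trans p (≤-trans a≤c c≤u)))) (χ-left {suc a} {b} (s≤s p)) refl
  ... | no p | yes q | _ = values (χ-in {suc a} {c} (≰⇒> p) q) (χ-left {suc c} {u} (s≤s q))
        (χ-left {suc u} {r} (s≤s (≤-trans q c≤u))) (χ-in {suc a} {b} (≰⇒> p) (≤-trans k≤r r≤b)) refl
  ... | no p | no q | yes s = values (χ-right {suc a} {c} (≰⇒> q)) (χ-in {suc c} {u} (≰⇒> q) s)
        (χ-left {suc u} {r} (s≤s s)) (χ-in {suc a} {b} (≰⇒> p) (≤-trans k≤r r≤b)) refl
  ... | no p | no q | no s = values (χ-right {suc a} {c} (≰⇒> q)) (χ-right {suc c} {u} (≰⇒> s))
        (χ-in {suc u} {r} (≰⇒> s) k≤r) (χ-in {suc a} {b} (≰⇒> p) (≤-trans k≤r r≤b)) refl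

  module Plus (r u : ℕ) (u≤r : u ≤ r) where
    open Folded r u u≤r

    turn-turn : ∀ {c} → c ≤ u + r → turn (turn c) ≡ c
    turn-turn = m∸[m∸n]≡n

    turn-large : ∀ {c} → c ≤ u → r ≤ turn c
    turn-large {c} c≤u = ≤-trans (≤-reflexive (sym (m+n∸m≡n c r))) (∸-monoˡ-≤ c (+-monoˡ-≤ r c≤u))

    fold-plus : ∀ {a c} → a ≤ c → c ≤ u →
                ind (suc a) c ⊕ (2× (ind (suc c) u) ⊕ ind (suc u) r) ≡ fold a (turn c)
    fold-plus {a} {c} a≤c c≤u = begin
      ind (suc a) c ⊕ (2× (ind (suc c) u) ⊕ ind (suc u) r)
        ≡⟨ cong (λ v → ind (suc a) c ⊕ (v ⊕ ind (suc u) r)) (tab-2× (χ (suc c) u)) ⟩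
      ind (suc a) c ⊕ (tab (λ k → 2 * χ (suc c) u k) ⊕ ind (suc u) r)
        ≡⟨ cong (ind (suc a) c ⊕_) (tab-+ (λ k → 2 * χ (suc c) u k) (χ (suc u) r)) ⟩
      ind (suc a) c ⊕ tab (λ k → 2 * χ (suc c) u k + χ (suc u) r k)
        ≡⟨ tab-+ (χ (suc a) c) (λ k → 2 * χ (suc c) u k + χ (suc u) r k) ⟩
      tab (λ k → χ (suc a) c k + (2 * χ (suc c) u k + χ (suc u) r k))
        ≡⟨ tab-cong (λ k _ k≤r → plus-coef a≤c c≤u u≤r (turn-large c≤u) k k≤r) ⟩
      tab (λ k → χ (suc a) (turn c) k + χ (suc c) u k)
        ≡⟨ tab-cong (λ k _ _ → cong (λ d → χ (suc a) (turn c) k + χ (suc d) u k) (sym (turn-turn (≤-trans c≤u (m≤m+n u r))))) ⟩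
      tab (coef a (turn c))
        ≡⟨ sym (fold-tab a (turn c)) ⟩
      fold a (turn c) ∎
      where open ≡-Reasoning

  ind-empty : ∀ {r i j} → j < i → ∀ (x : Root r) → x ⊕ ind i j ≡ x
  ind-empty {r} {i} {j} j<i x = trans (cong (x ⊕_) (tab-cong {g = λ _ → 0} (λ k _ _ → zero-at k))) (⊕-0 x)
    where
    open import Data.Vec using ([]; _∷_)
    zero-at : ∀ k → χ i j k ≡ 0
    zero-at k with k <? i
    ... | yes p = χ-left {i} {j} p
    ... | no p = χ-right {i} {j} (<-≤-trans j<i (≮⇒≥ p))
    ⊕-0 : ∀ {r} (x : Root r) → x ⊕ tab (λ _ → 0) ≡ x
    ⊕-0 [] = refl
    ⊕-0 (x ∷ xs) = cong₂ _∷_ (+-identityʳ x) (⊕-0 xs)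

  0⊕ : ∀ {r} a (x : Root r) → ind (suc a) a ⊕ x ≡ x
  0⊕ {r} a x = trans (⊕-comm (ind (suc a) a) x) (ind-empty {r} {suc a} {a} ≤-refl x)
    where
    open import Data.Vec using ([]; _∷_)
    ⊕-comm : ∀ {r} (x y : Root r) → x ⊕ y ≡ y ⊕ x
    ⊕-comm [] [] = refl
    ⊕-comm (x ∷ xs) (y ∷ ys) = cong₂ _∷_ (+-comm x y) (⊕-comm xs ys)

  turned-sum : ∀ a c t N M → a < c → t + c ≡ M → M ≡ suc N → a + t ≤ N
  turned-sum = lia 5 (λ a c t N M → a :< c :→ t :+ c :≡ M :→ M :≡ con 1 :+ N :→ goal (a :+ t :≤ N))

  turned-sum′ : ∀ a c t N → a ≤ c → t + c ≡ N → a + t ≤ N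
  turned-sum′ = lia 4 (λ a c t N → a :≤ c :→ t :+ c :≡ N :→ goal (a :+ t :≤ N))

  before-turn : ∀ a b c N M → a + b ≤ N → c + b ≡ M → M ≡ suc N → a < c
  before-turn = lia 5 (λ a b c N M → a :+ b :≤ N :→ c :+ b :≡ M :→ M :≡ con 1 :+ N :→ goal (a :< c))

  before-turn′ : ∀ a b c N → a + b ≤ N → c + b ≡ N → a ≤ c
  before-turn′ = lia 4 (λ a b c N → a :+ b :≤ N :→ c :+ b :≡ N :→ goal (a :≤ c))

  turn-below : ∀ b c u r → c + b ≡ u + r → r < b → c < u
  turn-below = lia 4 (λ b c u r → c :+ b :≡ u :+ r :→ r :< b :→ goal (c :< u))

  turn-below′ : ∀ b c u r → c + b ≡ u + r → r ≤ b → c ≤ u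
  turn-below′ = lia 4 (λ b c u r → c :+ b :≡ u :+ r :→ r :≤ b :→ goal (c :≤ u))

  module _ {r u : ℕ} (u≤r : u ≤ r) (N : ℕ) (N≤ : N ≤ u + r) (N< : N < r + r) where
    open Folded r u u≤r

    fold-injective : ∀ {a b c d} → a < b → a + b ≤ N → c < d → c + d ≤ N → fold a b ≡ fold c d → a ≡ c × b ≡ d
    fold-injective {a} {b} {c} {d} a<b ab c<d cd e = ≤-antisym (proj₁ back) (proj₁ forth) , ≤-antisym (proj₂ forth) (proj₂ back)
      where
      forth : c ≤ a × b ≤ d
      forth = fold-reflect′ N N≤ N< a<b ab c<d cd (subst (fold a b ≤ᵣ_) e ≤ᵣ-refl)
      back : a ≤ c × d ≤ b
      back = fold-reflect′ N N≤ N< c<d cd a<b ab (subst (_≤ᵣ fold a b) e ≤ᵣ-refl)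

  module TypeB (r N : ℕ) (middle : suc N ≡ r + r) where
    private
      N≤ : N ≤ r + r
      N≤ = ≤-trans (n≤1+n N) (≤-reflexive middle)
      N< : N < r + r
      N< = ≤-reflexive middle
    open Folded r r ≤-refl
    open Plus r r ≤-refl

    inj : ∀ {a b c d} → a < b → a + b ≤ N → c < d → c + d ≤ N → fold a b ≡ fold c d → a ≡ c × b ≡ d
    inj = fold-injective ≤-refl N N≤ N<

    plusB : ℕ × ℕ → Root r
    plusB (i , j) = ind i (j ∸ 1) ⊕ 2× (ind j r)

    plusB≡ : ∀ {a c} → a < c → c < r → plusB (suc a , suc c) ≡ fold a (turn c)
    plusB≡ {a} {c} a<c c<r = trans (cong (ind (suc a) c ⊕_) (sym (ind-empty {r} {suc r} {r} ≤-refl (2× (ind (suc c) r))))) (fold-plus (<⇒≤ a<c) (<⇒≤ c<r))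

    -- The families in which the roots are listed: ε_i - ε_j, ε_i and ε_i + ε_j. The short roots are
    -- the intervals ending in the middle.
    data Kind : ℕ → ℕ → Set where
      minus : ∀ {a b} → a < b → b < r → Kind a b
      short : ∀ {a} → a < r → Kind a r
      plus  : ∀ {a c} → a < c → c < r → Kind a (turn c)

    Kind-valid : ∀ {a b} → Kind a b → a < b × a + b ≤ N
    Kind-valid {a} {b} (minus a<b b<r) = a<b , s≤s⁻¹ (≤-trans (+-mono-≤ (<-trans a<b b<r) (<⇒≤ b<r)) (≤-reflexive (sym middle)))
    Kind-valid {a} (short a<r) = a<r , s≤s⁻¹ (≤-trans (+-monoˡ-≤ r a<r) (≤-reflexive (sym middle)))
    Kind-valid {a} (plus {c = c} a<c c<r) = <-≤-trans (<-trans a<c c<r) (turn-large (<⇒≤ c<r)) ,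
      turned-sum a c (turn c) N (r + r) a<c (m∸n+n≡m (≤-trans (<⇒≤ c<r) (m≤m+n r r))) (sym middle)

    kind : ∀ {a b} → a < b → a + b ≤ N → Kind a b
    kind {a} {b} a<b ab with <-cmp b r
    ... | tri< l _ _ = minus a<b l
    ... | tri≈ _ refl _ = short a<b
    ... | tri> _ _ g = subst (Kind a) (turn-turn b≤) (plus (before-turn a b (turn b) N (r + r) ab (m∸n+n≡m b≤) (sym middle)) (turn-below b (turn b) r r (m∸n+n≡m b≤) g))
      where
      b≤ : b ≤ r + r
      b≤ = ≤-trans (m≤n+m b a) (≤-trans ab N≤)

    short∈ : ∀ {a} → a < r → fold a r ∈ shortRoots B r
    short∈ {a} a<r = subst (_∈ shortRoots B r) (sym (fold-short a ≤-refl)) (∈-map⁺ (λ i → ind i r) (interval⁺ {1} {r} (s≤s z≤n) a<r))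

    long∈ : ∀ {a b} → Kind a b → b ≢ r → fold a b ∈ longRoots B r
    long∈ {a} (minus a<b b<r) _ = subst (_∈ longRoots B r) (sym (fold-short a (<⇒≤ b<r))) (∈-++⁺ˡ (∈-map⁺ minusRoot (pairs⁺ {r} a<b b<r)))
    long∈ (short _) b≢r = contradiction refl b≢r
    long∈ (plus a<c c<r) _ = subst (_∈ longRoots B r) (plusB≡ a<c c<r) (∈-++⁺ʳ (map minusRoot (pairs r)) (∈-map⁺ _ (pairs⁺ {r} a<c c<r)))

    short∈⁻ : ∀ {x} → x ∈ shortRoots B r → ∃ λ a → a < r × fold a r ≡ x
    short∈⁻ x∈ with ∈-map⁻ (λ i → ind {r} i r) x∈
    ... | i , i∈ , refl with interval⁻ {1} {r} i∈
    ...   | s≤s {n = a} _ , a<r = a , a<r , fold-short a ≤-refl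

    long∈⁻ : ∀ {x} → x ∈ longRoots B r → ∃ λ a → ∃ λ b → Kind a b × b ≢ r × fold a b ≡ x
    long∈⁻ x∈ with ∈-++⁻ (map minusRoot (pairs r)) x∈
    ... | inj₁ x∈′ with ∈-map⁻ minusRoot x∈′
    ...   | q , q∈ , refl with pairs⁻ {r} q∈
    ...     | a , b , refl , a<b , b<r = a , b , minus a<b b<r , <⇒≢ b<r , fold-short a (<⇒≤ b<r)
    long∈⁻ x∈ | inj₂ x∈′ with ∈-map⁻ plusB x∈′
    ... | q , q∈ , refl with pairs⁻ {r} q∈
    ...   | a , c , refl , a<c , c<r = a , turn c , plus a<c c<r , >⇒≢ (m<n+o⇒m<n∸o c<r) , sym (plusB≡ a<c c<r)
      where
      m<n+o⇒m<n∸o : c < r → r < turn c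
      m<n+o⇒m<n∸o c<r = +-cancelʳ-< c r (turn c) (<-≤-trans (+-monoʳ-< r c<r) (≤-reflexive (sym (m∸n+n≡m (≤-trans (<⇒≤ c<r) (m≤m+n r r))))))

    ∈⁺ : ∀ {a b} → a < b → a + b ≤ N → fold a b ∈ Φ⁺ B r
    ∈⁺ {a} {b} a<b ab with b ≟ r
    ... | yes refl = ∈-++⁺ʳ (longRoots B r) (short∈ a<b)
    ... | no b≢r = ∈-++⁺ˡ (long∈ (kind a<b ab) b≢r)

    ∈⁻ : ∀ {x} → x ∈ Φ⁺ B r → ∃ λ (i : HalfIx N) → fold (HalfIx.start i) (HalfIx.end i) ≡ x
    ∈⁻ x∈ with ∈-++⁻ (longRoots B r) x∈
    ... | inj₁ x∈′ with long∈⁻ x∈′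
    ...   | a , b , k , _ , e = half (proj₁ (Kind-valid k)) (proj₂ (Kind-valid k)) true , e
    ∈⁻ x∈ | inj₂ x∈′ with short∈⁻ x∈′
    ... | a , a<r , e = half (proj₁ (Kind-valid (short a<r))) (proj₂ (Kind-valid (short a<r))) true , e

    valid : ∀ {a b c d} → Kind a b → Kind c d → fold a b ≡ fold c d → a ≡ c × b ≡ d
    valid k l = inj (proj₁ (Kind-valid k)) (proj₂ (Kind-valid k)) (proj₁ (Kind-valid l)) (proj₂ (Kind-valid l))

    unique : Unique (Φ⁺ B r)
    unique = Unique.++⁺ (Unique.++⁺ (unique-map minus-inj (pairs-unique r)) (unique-map plus-inj (pairs-unique r)) minus-plus)
      (unique-map short-inj (interval-unique 1 r)) long-short
      where
      minus-inj : ∀ {x y} → x ∈ pairs r → y ∈ pairs r → minusRoot {r} x ≡ minusRoot y → x ≡ y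
      minus-inj x∈ y∈ e with pairs⁻ {r} x∈ | pairs⁻ {r} y∈
      ... | a , b , refl , a<b , b<r | c , d , refl , c<d , d<r = cong₂ (λ a b → suc a , suc b) (proj₁ same) (proj₂ same)
        where
        same : a ≡ c × b ≡ d
        same = valid (minus a<b b<r) (minus c<d d<r) (trans (fold-short a (<⇒≤ b<r)) (trans e (sym (fold-short c (<⇒≤ d<r)))))
      plus-inj : ∀ {x y} → x ∈ pairs r → y ∈ pairs r → plusB x ≡ plusB y → x ≡ y
      plus-inj x∈ y∈ e with pairs⁻ {r} x∈ | pairs⁻ {r} y∈
      ... | a , c , refl , a<c , c<r | a′ , c′ , refl , a′<c′ , c′<r = cong₂ (λ a b → suc a , suc b) (proj₁ same)
            (trans (sym (turn-turn (≤-trans (<⇒≤ c<r) (m≤m+n r r)))) (trans (cong turn (proj₂ same)) (turn-turn (≤-trans (<⇒≤ c′<r) (m≤m+n r r)))))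
        where
        same : a ≡ a′ × turn c ≡ turn c′
        same = valid (plus a<c c<r) (plus a′<c′ c′<r) (trans (sym (plusB≡ a<c c<r)) (trans e (plusB≡ a′<c′ c′<r)))
      short-inj : ∀ {x y} → x ∈ [ 1 ⋯ r ] → y ∈ [ 1 ⋯ r ] → ind {r} x r ≡ ind y r → x ≡ y
      short-inj x∈ y∈ e with interval⁻ {1} {r} x∈ | interval⁻ {1} {r} y∈
      ... | s≤s {n = a} _ , a<r | s≤s {n = c} _ , c<r = cong suc (proj₁ (valid (short a<r) (short c<r)
            (trans (fold-short a ≤-refl) (trans e (sym (fold-short c ≤-refl))))))
      minus-plus : ∀ {x} → ¬ (x ∈ map minusRoot (pairs r) × x ∈ map plusB (pairs r))
      minus-plus (p , q) with ∈-map⁻ minusRoot p | ∈-map⁻ plusB q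
      ... | x , x∈ , e | y , y∈ , e′ with pairs⁻ {r} x∈ | pairs⁻ {r} y∈
      ...   | a , b , refl , a<b , b<r | a′ , c , refl , a′<c , c<r = <⇒≱ b<r (≤-trans (turn-large (<⇒≤ c<r)) (≤-reflexive (sym (proj₂ same))))
        where
        same : a ≡ a′ × b ≡ turn c
        same = valid (minus a<b b<r) (plus a′<c c<r) (trans (fold-short a (<⇒≤ b<r)) (trans (sym e) (trans e′ (plusB≡ a′<c c<r))))
      long-short : ∀ {x} → ¬ (x ∈ longRoots B r × x ∈ shortRoots B r)
      long-short (p , q) with long∈⁻ p | short∈⁻ q
      ... | a , b , k , b≢r , e | c , c<r , e′ = b≢r (proj₂ (valid k (short c<r) (trans e (sym e′))))

    roots : HalfRoots (Φ⁺ B r) N r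
    roots = record
      { middle = middle
      ; ranked = record { unique = unique ; positive = positive }
      ; vec = λ a b _ → fold a b
      ; vec∈ = λ _ → ∈⁺
      ; vec∈⁻ = ∈⁻
      ; reflect = fold-reflect′ N N≤ N<
      ; embed = λ _ → fold-mono
      ; plain = λ _ → refl
      ; rk-vec = λ _ a<b ab → height⇒rk (fold-height N N≤ N< a<b ab) a<b
      ; colours = inj₂ refl
      }
      where
      positive : ∀ {x} → x ∈ Φ⁺ B r → 1 ≤ height x
      positive x∈ with ∈⁻ x∈
      ... | half a<b ab _ , refl = height-positive (fold-height N N≤ N< a<b ab) a<b

  module TypeC (r N : ℕ) (1≤r : 1 ≤ r) (middle : suc N ≡ r + r) where
    private
      u : ℕ
      u = r ∸ 1
      suc-u : suc u ≡ r
      suc-u = m+[n∸m]≡n 1≤r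
      u≤r : u ≤ r
      u≤r = m∸n≤m r 1
      N≡ : u + r ≡ N
      N≡ = suc-injective (trans (cong (_+ r) suc-u) (sym middle))
      N≤ : N ≤ u + r
      N≤ = ≤-reflexive (sym N≡)
      N< : N < r + r
      N< = ≤-reflexive middle
    open Folded r u u≤r
    open Plus r u u≤r

    inj : ∀ {a b c d} → a < b → a + b ≤ N → c < d → c + d ≤ N → fold a b ≡ fold c d → a ≡ c × b ≡ d
    inj = fold-injective u≤r N N≤ N<

    plusC : ℕ × ℕ → Root r
    plusC (i , j) = ind i (j ∸ 1) ⊕ (2× (ind j u) ⊕ ind r r)

    longC : ℕ → Root r
    longC i = 2× (ind i u) ⊕ ind r r

    plusC≡ : ∀ {a c} → a ≤ c → c ≤ u → plusC (suc a , suc c) ≡ fold a (turn c)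
    plusC≡ {a} {c} a≤c c≤u = trans (cong (λ k → ind (suc a) c ⊕ (2× (ind (suc c) u) ⊕ ind k r)) (sym suc-u)) (fold-plus a≤c c≤u)

    longC≡ : ∀ {a} → a ≤ u → longC (suc a) ≡ fold a (turn a)
    longC≡ {a} a≤u = trans (sym (0⊕ a (longC (suc a)))) (plusC≡ ≤-refl a≤u)

    -- Since u + r = N, `turn a` is N - a: the long roots 2ε_i are the central intervals.
    data Kind : ℕ → ℕ → Set where
      minus : ∀ {a b} → a < b → b < r → Kind a b
      long  : ∀ {a} → a ≤ u → Kind a (turn a)
      plus  : ∀ {a c} → a < c → c ≤ u → Kind a (turn c)

    turn-sum : ∀ {c} → c ≤ u → turn c + c ≡ N
    turn-sum c≤u = trans (m∸n+n≡m (≤-trans c≤u (m≤m+n u r))) N≡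

    Kind-valid : ∀ {a b} → Kind a b → a < b × a + b ≤ N
    Kind-valid (minus a<b b<r) = a<b , s≤s⁻¹ (≤-trans (+-mono-≤ (<-trans a<b b<r) (<⇒≤ b<r)) (≤-reflexive (sym middle)))
    Kind-valid {a} (long a≤u) = ≤-trans (s≤s a≤u) (≤-trans (≤-reflexive suc-u) (turn-large a≤u)) ,
      turned-sum′ a a (turn a) N ≤-refl (turn-sum a≤u)
    Kind-valid {a} (plus {c = c} a<c c≤u) = ≤-trans (<-≤-trans a<c c≤u) (≤-trans u≤r (turn-large c≤u)) ,
      turned-sum′ a c (turn c) N (<⇒≤ a<c) (turn-sum c≤u)

    kind : ∀ {a b} → a < b → a + b ≤ N → Kind a b
    kind {a} {b} a<b ab with b <? r
    ... | yes l = minus a<b l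
    ... | no b≮r = by (m≤n⇒m<n∨m≡n (before-turn′ a b (turn b) N ab (trans turn+b N≡)))
      where
      b≤ : b ≤ u + r
      b≤ = ≤-trans (m≤n+m b a) (≤-trans ab N≤)
      turn+b : turn b + b ≡ u + r
      turn+b = m∸n+n≡m b≤
      c≤u : turn b ≤ u
      c≤u = turn-below′ b (turn b) u r turn+b (≮⇒≥ b≮r)
      by : a < turn b ⊎ a ≡ turn b → Kind a b
      by (inj₁ l) = subst (Kind a) (turn-turn b≤) (plus l c≤u)
      by (inj₂ e) = subst (Kind a) (trans (cong turn e) (turn-turn b≤)) (long (≤-trans (≤-reflexive e) c≤u))

    valid : ∀ {a b c d} → Kind a b → Kind c d → fold a b ≡ fold c d → a ≡ c × b ≡ d
    valid k l = inj (proj₁ (Kind-valid k)) (proj₂ (Kind-valid k)) (proj₁ (Kind-valid l)) (proj₂ (Kind-valid l))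

    long∈ : ∀ {a} → a ≤ u → fold a (turn a) ∈ longRoots C r
    long∈ {a} a≤u = subst (_∈ longRoots C r) (longC≡ a≤u)
      (∈-map⁺ longC (interval⁺ {1} {r} (s≤s z≤n) (≤-trans (s≤s a≤u) (≤-reflexive suc-u))))

    long∈⁻ : ∀ {x} → x ∈ longRoots C r → ∃ λ a → a ≤ u × fold a (turn a) ≡ x
    long∈⁻ x∈ with ∈-map⁻ longC x∈
    ... | i , i∈ , refl with interval⁻ {1} {r} i∈
    ...   | s≤s {n = a} _ , a<r = a , ∸-monoˡ-≤ 1 a<r , sym (longC≡ (∸-monoˡ-≤ 1 a<r))

    minus∈ : ∀ {a b} → a < b → b < r → fold a b ∈ shortRoots C r
    minus∈ {a} a<b b<r = subst (_∈ shortRoots C r) (sym (fold-short a (<⇒≤ b<r))) (∈-++⁺ˡ (∈-map⁺ minusRoot (pairs⁺ {r} a<b b<r)))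

    plus∈ : ∀ {a c} → a < c → c ≤ u → fold a (turn c) ∈ shortRoots C r
    plus∈ {a} {c} a<c c≤u = subst (_∈ shortRoots C r) (plusC≡ (<⇒≤ a<c) c≤u)
      (∈-++⁺ʳ (map minusRoot (pairs r)) (∈-map⁺ plusC (pairs⁺ {r} a<c (≤-trans (s≤s c≤u) (≤-reflexive suc-u)))))

    short∈⁻ : ∀ {x} → x ∈ shortRoots C r → ∃ λ a → ∃ λ b → Kind a b × a + b ≢ N × fold a b ≡ x
    short∈⁻ x∈ with ∈-++⁻ (map minusRoot (pairs r)) x∈
    ... | inj₁ x∈′ with ∈-map⁻ minusRoot x∈′
    ...   | q , q∈ , refl with pairs⁻ {r} q∈
    ...     | a , b , refl , a<b , b<r = a , b , minus a<b b<r ,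
      <⇒≢ (s≤s⁻¹ (≤-trans (+-mono-≤-< (<-trans a<b b<r) b<r) (≤-reflexive (sym middle)))) , fold-short a (<⇒≤ b<r)
    short∈⁻ x∈ | inj₂ x∈′ with ∈-map⁻ plusC x∈′
    ... | q , q∈ , refl with pairs⁻ {r} q∈
    ...   | a , c , refl , a<c , c<r = a , turn c , plus a<c c≤u ,
      <⇒≢ (<-≤-trans (+-monoˡ-< (turn c) a<c) (≤-reflexive (trans (+-comm c (turn c)) (turn-sum c≤u)))) , sym (plusC≡ (<⇒≤ a<c) c≤u)
      where
      c≤u : c ≤ u
      c≤u = ∸-monoˡ-≤ 1 c<r

    ∈⁺ : ∀ {a b} → a < b → a + b ≤ N → fold a b ∈ Φ⁺ C r
    ∈⁺ {a} {b} a<b ab = by (kind a<b ab)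
      where
      by : ∀ {a b} → Kind a b → fold a b ∈ Φ⁺ C r
      by (minus a<b b<r) = ∈-++⁺ʳ (longRoots C r) (minus∈ a<b b<r)
      by (long a≤u) = ∈-++⁺ˡ (long∈ a≤u)
      by (plus a<c c≤u) = ∈-++⁺ʳ (longRoots C r) (plus∈ a<c c≤u)

    ∈⁻ : ∀ {x} → x ∈ Φ⁺ C r → ∃ λ (i : HalfIx N) → fold (HalfIx.start i) (HalfIx.end i) ≡ x
    ∈⁻ x∈ with ∈-++⁻ (longRoots C r) x∈
    ... | inj₁ x∈′ with long∈⁻ x∈′
    ...   | a , a≤u , e = half (proj₁ (Kind-valid (long a≤u))) (proj₂ (Kind-valid (long a≤u))) true , e
    ∈⁻ x∈ | inj₂ x∈′ with short∈⁻ x∈′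
    ... | a , b , k , _ , e = half (proj₁ (Kind-valid k)) (proj₂ (Kind-valid k)) true , e

    turn-injective : ∀ {c d} → c ≤ u → d ≤ u → turn c ≡ turn d → c ≡ d
    turn-injective c≤u d≤u e = trans (sym (turn-turn (≤-trans c≤u (m≤m+n u r)))) (trans (cong turn e) (turn-turn (≤-trans d≤u (m≤m+n u r))))

    unique : Unique (Φ⁺ C r)
    unique = Unique.++⁺ (unique-map long-inj (interval-unique 1 r))
      (Unique.++⁺ (unique-map minus-inj (pairs-unique r)) (unique-map plus-inj (pairs-unique r)) minus-plus) long-short
      where
      long-inj : ∀ {x y} → x ∈ [ 1 ⋯ r ] → y ∈ [ 1 ⋯ r ] → longC x ≡ longC y → x ≡ y
      long-inj x∈ y∈ e with interval⁻ {1} {r} x∈ | interval⁻ {1} {r} y∈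
      ... | s≤s {n = a} _ , a<r | s≤s {n = c} _ , c<r = cong suc (proj₁ same)
        where
        same : a ≡ c × turn a ≡ turn c
        same = valid (long (∸-monoˡ-≤ 1 a<r)) (long (∸-monoˡ-≤ 1 c<r)) (trans (sym (longC≡ (∸-monoˡ-≤ 1 a<r))) (trans e (longC≡ (∸-monoˡ-≤ 1 c<r))))
      minus-inj : ∀ {x y} → x ∈ pairs r → y ∈ pairs r → minusRoot {r} x ≡ minusRoot y → x ≡ y
      minus-inj x∈ y∈ e with pairs⁻ {r} x∈ | pairs⁻ {r} y∈
      ... | a , b , refl , a<b , b<r | c , d , refl , c<d , d<r = cong₂ (λ a b → suc a , suc b) (proj₁ same) (proj₂ same)
        where
        same : a ≡ c × b ≡ d
        same = valid (minus a<b b<r) (minus c<d d<r) (trans (fold-short a (<⇒≤ b<r)) (trans e (sym (fold-short c (<⇒≤ d<r)))))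
      plus-inj : ∀ {x y} → x ∈ pairs r → y ∈ pairs r → plusC x ≡ plusC y → x ≡ y
      plus-inj x∈ y∈ e with pairs⁻ {r} x∈ | pairs⁻ {r} y∈
      ... | a , c , refl , a<c , c<r | a′ , c′ , refl , a′<c′ , c′<r = cong₂ (λ a b → suc a , suc b) (proj₁ same)
            (turn-injective (∸-monoˡ-≤ 1 c<r) (∸-monoˡ-≤ 1 c′<r) (proj₂ same))
        where
        same : a ≡ a′ × turn c ≡ turn c′
        same = valid (plus a<c (∸-monoˡ-≤ 1 c<r)) (plus a′<c′ (∸-monoˡ-≤ 1 c′<r))
          (trans (sym (plusC≡ (<⇒≤ a<c) (∸-monoˡ-≤ 1 c<r))) (trans e (plusC≡ (<⇒≤ a′<c′) (∸-monoˡ-≤ 1 c′<r))))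
      minus-plus : ∀ {x} → ¬ (x ∈ map minusRoot (pairs r) × x ∈ map plusC (pairs r))
      minus-plus (p , q) with ∈-map⁻ minusRoot p | ∈-map⁻ plusC q
      ... | x , x∈ , e | y , y∈ , e′ with pairs⁻ {r} x∈ | pairs⁻ {r} y∈
      ...   | a , b , refl , a<b , b<r | a′ , c , refl , a′<c , c<r = <⇒≱ b<r (≤-trans (turn-large (∸-monoˡ-≤ 1 c<r)) (≤-reflexive (sym (proj₂ same))))
        where
        same : a ≡ a′ × b ≡ turn c
        same = valid (minus a<b b<r) (plus a′<c (∸-monoˡ-≤ 1 c<r))
          (trans (fold-short a (<⇒≤ b<r)) (trans (sym e) (trans e′ (plusC≡ (<⇒≤ a′<c) (∸-monoˡ-≤ 1 c<r)))))
      long-short : ∀ {x} → ¬ (x ∈ longRoots C r × x ∈ shortRoots C r)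
      long-short (p , q) with long∈⁻ p | short∈⁻ q
      ... | c , c≤u , e′ | a , b , k , ≢N , e = ≢N (trans (cong₂ _+_ (proj₁ same) (proj₂ same)) (trans (+-comm c (turn c)) (turn-sum c≤u)))
        where
        same : a ≡ c × b ≡ turn c
        same = valid k (long c≤u) (trans e (sym e′))

    roots : HalfRoots (Φ⁺ C r) N r
    roots = record
      { middle = middle
      ; ranked = record { unique = unique ; positive = positive }
      ; vec = λ a b _ → fold a b
      ; vec∈ = λ _ → ∈⁺
      ; vec∈⁻ = ∈⁻
      ; reflect = fold-reflect′ N N≤ N<
      ; embed = λ _ → fold-mono
      ; plain = λ _ → refl
      ; rk-vec = λ _ a<b ab → height⇒rk (fold-height N N≤ N< a<b ab) a<b
      ; colours = inj₂ refl
      }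
      where
      positive : ∀ {x} → x ∈ Φ⁺ C r → 1 ≤ height x
      positive x∈ with ∈⁻ x∈
      ... | half a<b ab _ , refl = height-positive (fold-height N N≤ N< a<b ab) a<b

  module TypeD (r N : ℕ) (2≤r : 2 ≤ r) (middle : suc N ≡ (r ∸ 1) + (r ∸ 1)) where
    private
      m u : ℕ
      m = r ∸ 1
      u = r ∸ 2
      suc-m : suc m ≡ r
      suc-m = m+[n∸m]≡n (≤-trans (s≤s z≤n) 2≤r)
      suc-u : suc u ≡ m
      suc-u = suc-injective (trans (m+[n∸m]≡n 2≤r) (sym suc-m))
      u<m : u < m
      u<m = ≤-reflexive suc-u
      m<r : m < r
      m<r = ≤-reflexive suc-m
      u≤r : u ≤ r
      u≤r = m∸n≤m r 2
      N≡ : u + r ≡ suc N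
      N≡ = trans (cong (u +_) (sym suc-m)) (trans (+-suc u m) (trans (cong (_+ m) suc-u) (sym middle)))
      N≤ : N ≤ u + r
      N≤ = ≤-trans (n≤1+n N) (≤-reflexive (sym N≡))
      N< : N < r + r
      N< = ≤-trans (≤-reflexive middle) (+-mono-≤ (<⇒≤ m<r) (<⇒≤ m<r))
    open Folded r u u≤r
    open Plus r u u≤r

    -- The diagram automorphism exchanging the last two simple roots.
    swap-ends : ℕ → ℕ
    swap-ends k with k ≟ m | k ≟ r
    ... | yes _ | _ = r
    ... | no _ | yes _ = m
    ... | no _ | no _ = k

    swap-m : swap-ends m ≡ r
    swap-m with m ≟ m
    ... | yes _ = refl
    ... | no ¬e = contradiction refl ¬e

    swap-r : swap-ends r ≡ m
    swap-r with r ≟ m | r ≟ r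
    ... | yes e | _ = contradiction e (>⇒≢ m<r)
    ... | no _ | yes _ = refl
    ... | no _ | no ¬e = contradiction refl ¬e

    swap-small : ∀ {k} → k < m → swap-ends k ≡ k
    swap-small {k} k<m with k ≟ m | k ≟ r
    ... | yes e | _ = contradiction e (<⇒≢ k<m)
    ... | no _ | yes e = contradiction e (<⇒≢ (<-trans k<m m<r))
    ... | no _ | no _ = refl

    data Position : ℕ → Set where
      small  : ∀ {k} → k < m → Position k
      at-m   : Position m
      at-r   : Position r

    position : ∀ {k} → k ≤ r → Position k
    position {k} k≤r with <-cmp k m
    ... | tri< l _ _ = small l
    ... | tri≈ _ refl _ = at-m
    ... | tri> _ _ g = subst Position (sym (≤-antisym k≤r (≤-trans (≤-reflexive (sym suc-m)) g))) at-r

    -- The root ε_{a+1} + ε_r, which avoids the simple root of index r - 1 and is the second colour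
    -- of (a, m].
    fork : ℕ → Root r
    fork a = ind (suc a) u ⊕ ind r r

    -- For m ≤ a the interval (a, m] is empty, and `fold` gives the zero vector, whereas `fork a`
    -- would still contain α_r and violate `embed`, which quantifies over all a and b.
    vecD : ℕ → ℕ → Bool → Root r
    vecD a b true = fold a b
    vecD a b false with b ≟ m | a <? m
    ... | yes _ | yes _ = fork a
    ... | yes _ | no _  = fold a b
    ... | no _  | _     = fold a b

    vecD-fork : ∀ {a} → a < m → vecD a m false ≡ fork a
    vecD-fork {a} a<m with m ≟ m | a <? m
    ... | yes _ | yes _ = refl
    ... | yes _ | no ¬l = contradiction a<m ¬l
    ... | no ¬e | _ = contradiction refl ¬e

    vecD-plain : ∀ a {b} → b ≢ m → vecD a b false ≡ fold a b
    vecD-plain a {b} b≢m with b ≟ m | a <? m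
    ... | yes e | _ = contradiction e b≢m
    ... | no _ | yes _ = refl
    ... | no _ | no _ = refl

    vecD-late : ∀ {a} → m ≤ a → vecD a m false ≡ fold a m
    vecD-late {a} m≤a with m ≟ m | a <? m
    ... | yes _ | yes l = contradiction l (≤⇒≯ m≤a)
    ... | yes _ | no _ = refl
    ... | no _ | _ = refl

    fork-tab : ∀ {a} → a < m → fork a ≡ tab (λ k → coef a m (swap-ends k))
    fork-tab {a} a<m = trans (tab-+ (χ (suc a) u) (χ r r)) (tab-cong (λ k _ k≤r → by k (position k≤r)))
      where
      at : ∀ k → coef a m k ≡ χ (suc a) m k
      at k = trans (cong (χ (suc a) m k +_) (second-empty k (<⇒≤ m<r))) (+-identityʳ _)
      by : ∀ k → Position k → χ (suc a) u k + χ r r k ≡ coef a m (swap-ends k)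
      by k (small k<m) = trans (cong₂ _+_ (same (suc a ≤? k)) (χ-left {r} {r} (<-trans k<m m<r)))
          (trans (+-identityʳ _) (sym (trans (at (swap-ends k)) (cong (χ (suc a) m) (swap-small k<m)))))
        where
        k≤u : k ≤ u
        k≤u = s≤s⁻¹ (≤-trans k<m (≤-reflexive (sym suc-u)))
        same : Dec (suc a ≤ k) → χ (suc a) u k ≡ χ (suc a) m k
        same (yes p) = trans (χ-in {suc a} {u} p k≤u) (sym (χ-in {suc a} {m} p (<⇒≤ k<m)))
        same (no ¬p) = trans (χ-left {suc a} {u} (≰⇒> ¬p)) (sym (χ-left {suc a} {m} (≰⇒> ¬p)))
      by _ at-m = trans (cong₂ _+_ (χ-right {suc a} {u} u<m) (χ-left {r} {r} m<r))
          (sym (trans (at (swap-ends m)) (trans (cong (χ (suc a) m) swap-m) (χ-right {suc a} {m} m<r))))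
      by _ at-r = trans (cong₂ _+_ (χ-right {suc a} {u} (<-trans u<m m<r)) (χ-in {r} {r} ≤-refl ≤-refl))
          (sym (trans (at (swap-ends r)) (trans (cong (χ (suc a) m) swap-r) (χ-in {suc a} {m} a<m ≤-refl))))

    coef-swap : ∀ {a b} → a < b → a + b ≤ N → b ≢ m → ∀ k → k ≤ r → coef a b k ≡ coef a b (swap-ends k)
    coef-swap {a} {b} a<b ab b≢m k k≤r = by k (position k≤r)
      where
      ends : coef a b m ≡ coef a b r
      ends = cong₂ _+_ first (trans (χ-right {suc (turn b)} {u} u<m) (sym (χ-right {suc (turn b)} {u} (<-trans u<m m<r))))
        where
        first : χ (suc a) b m ≡ χ (suc a) b r
        first with <-cmp b m
        ... | tri< l _ _ = trans (χ-right {suc a} {b} l) (sym (χ-right {suc a} {b} (<-trans l m<r)))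
        ... | tri≈ _ e _ = contradiction e b≢m
        ... | tri> _ _ g = trans (χ-in {suc a} {b} a<m (<⇒≤ g)) (sym (χ-in {suc a} {b} (≤-trans a<m (<⇒≤ m<r)) (≤-trans (≤-reflexive (sym suc-m)) g)))
          where
          a<m : a < m
          a<m = ≰⇒> (λ h → <⇒≱ (s≤s (≤-reflexive middle)) (≤-trans (s≤s (+-mono-≤ h (<⇒≤ g))) (s≤s ab)))
      by : ∀ k → Position k → coef a b k ≡ coef a b (swap-ends k)
      by k (small k<m) = cong (coef a b) (sym (swap-small k<m))
      by _ at-m = trans ends (cong (coef a b) (sym swap-m))
      by _ at-r = trans (sym ends) (cong (coef a b) (sym swap-r))

    -- The automorphism fixes the roots that do not end in m and exchanges the colours of those that
    -- do. The colour false thus inherits its order from `fold`, up to a permutation of coordinates.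
    false-tab : ∀ {a b} → a < b → a + b ≤ N → vecD a b false ≡ tab (λ k → coef a b (swap-ends k))
    false-tab {a} {b} a<b ab = by (b ≟ m)
      where
      by : Dec (b ≡ m) → vecD a b false ≡ tab (λ k → coef a b (swap-ends k))
      by (yes refl) = trans (vecD-fork a<b) (fork-tab a<b)
      by (no b≢m) = trans (vecD-plain a b≢m) (trans (fold-tab a b) (tab-cong (λ k _ k≤r → coef-swap a<b ab b≢m k k≤r)))

    plainD : ∀ {a b ε δ} → b ≢ m → vecD a b ε ≡ vecD a b δ
    plainD {ε = true} {true} _ = refl
    plainD {ε = false} {false} _ = refl
    plainD {a} {ε = true} {false} b≢m = sym (vecD-plain a b≢m)
    plainD {a} {ε = false} {true} b≢m = vecD-plain a b≢m

    swap-swap : ∀ k → k ≤ r → swap-ends (swap-ends k) ≡ k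
    swap-swap k k≤r = by k (position k≤r)
      where
      by : ∀ k → Position k → swap-ends (swap-ends k) ≡ k
      by k (small k<m) = trans (cong swap-ends (swap-small k<m)) (swap-small k<m)
      by _ at-m = trans (cong swap-ends swap-m) swap-r
      by _ at-r = trans (cong swap-ends swap-r) swap-m

    swap-range : ∀ k → 1 ≤ k → k ≤ r → 1 ≤ swap-ends k × swap-ends k ≤ r
    swap-range k 1≤k k≤r = by k 1≤k (position k≤r)
      where
      by : ∀ k → 1 ≤ k → Position k → 1 ≤ swap-ends k × swap-ends k ≤ r
      by k h (small k<m) = subst (λ k → 1 ≤ k × k ≤ r) (sym (swap-small k<m)) (h , <⇒≤ (<-trans k<m m<r))
      by _ h at-m = subst (λ k → 1 ≤ k × k ≤ r) (sym swap-m) (≤-trans (s≤s z≤n) 2≤r , ≤-refl)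
      by _ h at-r = subst (λ k → 1 ≤ k × k ≤ r) (sym swap-r) (≤-trans (s≤s z≤n) (≤-reflexive suc-u) , <⇒≤ m<r)

    reflect-false : ∀ {a b c d} → a < b → a + b ≤ N → c < d → c + d ≤ N → vecD a b false ≤ᵣ vecD c d false → c ≤ a × b ≤ d
    reflect-false {a} {b} {c} {d} a<b ab c<d cd h = fold-reflect N N≤ N< a<b ab c<d cd (λ k 1≤k k≤r →
      subst (λ j → coef a b j ≤ coef c d j) (swap-swap k k≤r)
        (tab-mono⁻ {f = λ k → coef a b (swap-ends k)} {g = λ k → coef c d (swap-ends k)} (subst₂ _≤ᵣ_ (false-tab a<b ab) (false-tab c<d cd) h) (swap-ends k) (proj₁ (swap-range k 1≤k k≤r)) (proj₂ (swap-range k 1≤k k≤r))))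

    coef-mid : ∀ {a k} → m < k → coef a m k ≡ 0
    coef-mid {a} {k} m<k = cong₂ _+_ (χ-right {suc a} {m} m<k) (second-empty k (<⇒≤ m<r))

    -- Among the roots ending in m, the colour true has coefficients 1 and 0 at the last two simple
    -- roots, and the colour false has 0 and 1.
    coloured : ∀ {a d ε δ} → a < m → d < m → vecD a m ε ≤ᵣ vecD d m δ → ε ≡ δ
    coloured {ε = true} {true} _ _ _ = refl
    coloured {ε = false} {false} _ _ _ = refl
    coloured {a} {d} {true} {false} a<m d<m h = contradiction
      (≤-trans (≤-reflexive (sym (χ-in {suc a} {m} a<m ≤-refl))) (≤-trans (m≤m+n (χ (suc a) m m) (χ (suc (turn m)) u m))
        (tab-mono⁻ {f = coef a m} {g = λ k → coef d m (swap-ends k)} (subst₂ _≤ᵣ_ (fold-tab a m) (trans (vecD-fork d<m) (fork-tab d<m)) h) m (≤-trans (s≤s z≤n) a<m) (<⇒≤ m<r))))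
      (subst (λ k → ¬ 1 ≤ coef d m k) (sym swap-m) (subst (λ x → ¬ 1 ≤ x) (sym (coef-mid {d} m<r)) λ ()))
    coloured {a} {d} {false} {true} a<m d<m h = contradiction
      (≤-trans (≤-trans (≤-reflexive (sym (χ-in {suc a} {m} a<m ≤-refl))) (m≤m+n (χ (suc a) m m) (χ (suc (turn m)) u m)))
        (subst (λ k → coef a m k ≤ coef d m r) swap-r
          (tab-mono⁻ {f = λ k → coef a m (swap-ends k)} {g = coef d m} (subst₂ _≤ᵣ_ (trans (vecD-fork a<m) (fork-tab a<m)) (fold-tab d m) h) r (≤-trans (s≤s z≤n) 2≤r) ≤-refl)))
      (subst (λ x → ¬ 1 ≤ x) (sym (coef-mid {d} m<r)) λ ())

    middle-start : ∀ {a} → a + m ≤ N → a < m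
    middle-start {a} h = ≰⇒> (λ m≤a → <⇒≱ (≤-reflexive middle) (≤-trans (+-monoˡ-≤ m m≤a) h))

    reflectD : ∀ {a b ε c d δ} → a < b → a + b ≤ N → c < d → c + d ≤ N → vecD a b ε ≤ᵣ vecD c d δ → c ≤ a × b ≤ d
    reflectD {ε = true} {δ = true} = fold-reflect′ N N≤ N<
    reflectD {ε = false} {δ = false} = reflect-false
    reflectD {a} {b} {true} {c} {d} {false} a<b ab c<d cd h = by (d ≟ m) (b ≟ m)
      where
      by : Dec (d ≡ m) → Dec (b ≡ m) → c ≤ a × b ≤ d
      by (no d≢m) _ = fold-reflect′ N N≤ N< a<b ab c<d cd (subst (fold a b ≤ᵣ_) (vecD-plain c d≢m) h)
      by (yes refl) (no b≢m) = reflect-false a<b ab c<d cd (subst (_≤ᵣ vecD c m false) (sym (vecD-plain a b≢m)) h)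
      by (yes refl) (yes refl) = contradiction (coloured {ε = true} {false} a<b c<d h) λ ()
    reflectD {a} {b} {false} {c} {d} {true} a<b ab c<d cd h = by (b ≟ m) (d ≟ m)
      where
      by : Dec (b ≡ m) → Dec (d ≡ m) → c ≤ a × b ≤ d
      by (no b≢m) _ = fold-reflect′ N N≤ N< a<b ab c<d cd (subst (_≤ᵣ fold c d) (vecD-plain a b≢m) h)
      by (yes refl) (no d≢m) = reflect-false a<b ab c<d cd (subst (vecD a m false ≤ᵣ_) (sym (vecD-plain c d≢m)) h)
      by (yes refl) (yes refl) = contradiction (coloured {ε = false} {true} a<b c<d h) λ ()

    fork-mono : ∀ {a c} → c ≤ a → fork a ≤ᵣ fork c
    fork-mono {a} {c} c≤a = subst₂ _≤ᵣ_ (sym (tab-+ (χ (suc a) u) (χ r r))) (sym (tab-+ (χ (suc c) u) (χ r r)))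
      (tab-mono {f = λ k → χ (suc a) u k + χ r r k} {g = λ k → χ (suc c) u k + χ r r k}
        (λ k _ _ → +-monoˡ-≤ (χ r r k) (χ-mono {suc a} {u} {suc c} {u} k (s≤s c≤a) ≤-refl)))

    fork≤fold : ∀ {a c d} → a < m → c ≤ a → m < d → fork a ≤ᵣ fold c d
    fork≤fold {a} {c} {d} a<m c≤a m<d = subst₂ _≤ᵣ_ (sym (tab-+ (χ (suc a) u) (χ r r))) (sym (fold-tab c d))
        (tab-mono {f = λ k → χ (suc a) u k + χ r r k} {g = coef c d}
          (λ k _ k≤r → ≤-trans (by k (position k≤r)) (m≤m+n (χ (suc c) d k) (χ (suc (turn d)) u k))))
      where
      r≤d : r ≤ d
      r≤d = ≤-trans (≤-reflexive (sym suc-m)) m<d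
      by : ∀ k → Position k → χ (suc a) u k + χ r r k ≤ χ (suc c) d k
      by k (small k<m) = ≤-trans (≤-reflexive (trans (cong (χ (suc a) u k +_) (χ-left {r} {r} (<-trans k<m m<r))) (+-identityʳ _)))
        (χ-mono {suc a} {u} {suc c} {d} k (s≤s c≤a) (<⇒≤ (<-trans u<m m<d)))
      by _ at-m = subst (_≤ χ (suc c) d m) (sym (cong₂ _+_ (χ-right {suc a} {u} u<m) (χ-left {r} {r} m<r))) z≤n
      by _ at-r = ≤-reflexive (trans (cong₂ _+_ (χ-right {suc a} {u} (<-trans u<m m<r)) (χ-in {r} {r} ≤-refl ≤-refl))
        (sym (χ-in {suc c} {d} (≤-trans (s≤s c≤a) (≤-trans a<m (<⇒≤ m<r))) r≤d)))

    fold≤fork : ∀ {a b c} → c ≤ a → b < m → fold a b ≤ᵣ fork c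
    fold≤fork {a} {b} {c} c≤a b<m = subst₂ _≤ᵣ_ (sym (fold-short a (<⇒≤ (<-trans b<m m<r)))) (sym (tab-+ (χ (suc c) u) (χ r r)))
      (tab-mono {f = χ (suc a) b} {g = λ k → χ (suc c) u k + χ r r k} (λ k _ _ →
        ≤-trans (χ-mono {suc a} {b} {suc c} {u} k (s≤s c≤a) (s≤s⁻¹ (≤-trans b<m (≤-reflexive (sym suc-u))))) (m≤m+n (χ (suc c) u k) (χ r r k))))

    late-zero : ∀ {a} (x : ℕ → ℕ) → m ≤ a → fold a m ≤ᵣ tab x
    late-zero {a} x m≤a = subst (_≤ᵣ tab x) (sym (fold-tab a m)) (tab-mono {f = coef a m} {g = x} (λ k _ _ → ≤-trans (≤-reflexive (zero-at k)) z≤n))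
      where
      zero-at : ∀ k → coef a m k ≡ 0
      zero-at k = cong₂ _+_ (first (suc a ≤? k)) (second-empty k (<⇒≤ m<r))
        where
        first : Dec (suc a ≤ k) → χ (suc a) m k ≡ 0
        first (yes p) = χ-right {suc a} {m} (≤-trans (s≤s m≤a) p)
        first (no ¬p) = χ-left {suc a} {m} (≰⇒> ¬p)

    embedD : ∀ {a b c d} ε → c ≤ a → b ≤ d → vecD a b ε ≤ᵣ vecD c d ε
    embedD true = fold-mono
    embedD {a} {b} {c} {d} false c≤a b≤d = by (b ≟ m) (d ≟ m) (a <? m) (c <? m)
      where
      by : Dec (b ≡ m) → Dec (d ≡ m) → Dec (a < m) → Dec (c < m) → vecD a b false ≤ᵣ vecD c d false
      by (no b≢m) (no d≢m) _ _ = subst₂ _≤ᵣ_ (sym (vecD-plain a b≢m)) (sym (vecD-plain c d≢m)) (fold-mono c≤a b≤d)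
      by (no b≢m) (yes refl) _ (yes c<m) = subst₂ _≤ᵣ_ (sym (vecD-plain a b≢m)) (sym (vecD-fork c<m)) (fold≤fork c≤a (≤∧≢⇒< b≤d b≢m))
      by (no b≢m) (yes refl) _ (no c≮m) = subst₂ _≤ᵣ_ (sym (vecD-plain a b≢m)) (sym (vecD-late (≮⇒≥ c≮m))) (fold-mono c≤a b≤d)
      by (yes refl) (no d≢m) (yes a<m) _ = subst₂ _≤ᵣ_ (sym (vecD-fork a<m)) (sym (vecD-plain c d≢m)) (fork≤fold a<m c≤a (≤∧≢⇒< b≤d (d≢m ∘ sym)))
      by (yes refl) (no d≢m) (no a≮m) _ = subst₂ _≤ᵣ_ (sym (vecD-late (≮⇒≥ a≮m))) (sym (vecD-plain c d≢m)) (fold-mono c≤a b≤d)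
      by (yes refl) (yes refl) (yes a<m) _ = subst₂ _≤ᵣ_ (sym (vecD-fork a<m)) (sym (vecD-fork (≤-<-trans c≤a a<m))) (fork-mono c≤a)
      by (yes refl) (yes refl) (no a≮m) (yes c<m) = subst₂ _≤ᵣ_ (sym (vecD-late (≮⇒≥ a≮m))) (sym (vecD-fork c<m))
        (subst (fold a m ≤ᵣ_) (sym (tab-+ (χ (suc c) u) (χ r r))) (late-zero (λ k → χ (suc c) u k + χ r r k) (≮⇒≥ a≮m)))
      by (yes refl) (yes refl) (no a≮m) (no c≮m) = subst₂ _≤ᵣ_ (sym (vecD-late (≮⇒≥ a≮m))) (sym (vecD-late (≮⇒≥ c≮m))) (fold-mono c≤a b≤d)

    fork-height : ∀ {a} → a < m → height (fork a) + a ≡ m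
    fork-height {a} a<m = one-more (height (fork a)) (height (ind {r} (suc a) u)) (height (ind {r} r r)) a u m r
        (height-+ {r} (ind (suc a) u) (ind r r)) (height-ind (s≤s⁻¹ (≤-trans a<m (≤-reflexive (sym suc-u)))) u≤r)
        (trans (cong (λ k → height (ind {r} k r) + m) (sym suc-m)) (height-ind (<⇒≤ m<r) ≤-refl)) suc-u suc-m
      where
      one-more : ∀ h h₁ h₂ a u m r → h ≡ h₁ + h₂ → h₁ + a ≡ u → h₂ + m ≡ r → suc u ≡ m → suc m ≡ r → h + a ≡ m
      one-more = lia 7 (λ h h₁ h₂ a u m r → h :≡ h₁ :+ h₂ :→ h₁ :+ a :≡ u :→ h₂ :+ m :≡ r :→ con 1 :+ u :≡ m :→ con 1 :+ m :≡ r :→ goal (h :+ a :≡ m))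

    heightD : ∀ {a b} ε → a < b → a + b ≤ N → height (vecD a b ε) + a ≡ b
    heightD true a<b ab = fold-height N N≤ N< a<b ab
    heightD {a} {b} false a<b ab = by (b ≟ m)
      where
      by : Dec (b ≡ m) → height (vecD a b false) + a ≡ b
      by (yes refl) = trans (cong (λ v → height v + a) (vecD-fork a<b)) (fork-height a<b)
      by (no b≢m) = trans (cong (λ v → height v + a) (vecD-plain a b≢m)) (fold-height N N≤ N< a<b ab)

    plusD : ℕ × ℕ → Root r
    plusD (i , j) = ind i (j ∸ 1) ⊕ (2× (ind j u) ⊕ ind m r)

    plusD≡ : ∀ {a c} → a ≤ c → c ≤ u → plusD (suc a , suc c) ≡ fold a (turn c)
    plusD≡ {a} {c} a≤c c≤u = trans (cong (λ k → ind (suc a) c ⊕ (2× (ind (suc c) u) ⊕ ind k r)) (sym suc-u)) (fold-plus a≤c c≤u)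

    data Kind : ℕ → ℕ → Bool → Set where
      minus : ∀ {a b} → a < b → b < r → Kind a b true
      plus  : ∀ {a c} → a < c → c ≤ u → Kind a (turn c) true
      upper : ∀ {a} → a < m → Kind a m false

    turn-sum : ∀ {c} → c ≤ u → turn c + c ≡ suc N
    turn-sum c≤u = trans (m∸n+n≡m (≤-trans c≤u (m≤m+n u r))) N≡

    mid-sum : ∀ {a b} → a < b → b ≤ m → a + b ≤ N
    mid-sum a<b b≤m = s≤s⁻¹ (≤-trans (+-mono-≤ (<-≤-trans a<b b≤m) b≤m) (≤-reflexive (sym middle)))

    Kind-valid : ∀ {a b ε} → Kind a b ε → a < b × a + b ≤ N
    Kind-valid (minus a<b b<r) = a<b , mid-sum a<b (s≤s⁻¹ (≤-trans b<r (≤-reflexive (sym suc-m))))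
    Kind-valid {a} (plus {c = c} a<c c≤u) = ≤-trans (<-≤-trans a<c c≤u) (≤-trans u≤r (turn-large c≤u)) ,
      turned-sum a c (turn c) N (suc N) a<c (turn-sum c≤u) refl
    Kind-valid (upper a<m) = a<m , mid-sum a<m ≤-refl

    kind : ∀ {a b} → a < b → a + b ≤ N → Kind a b true
    kind {a} {b} a<b ab with b <? r
    ... | yes l = minus a<b l
    ... | no b≮r = subst (λ b → Kind a b true) (turn-turn b≤)
        (plus (before-turn a b (turn b) N (suc N) ab (trans turn+b N≡) refl) (turn-below′ b (turn b) u r turn+b (≮⇒≥ b≮r)))
      where
      b≤ : b ≤ u + r
      b≤ = ≤-trans (m≤n+m b a) (≤-trans ab N≤)
      turn+b : turn b + b ≡ u + r
      turn+b = m∸n+n≡m b≤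

    valid : ∀ {a b ε c d δ} → Kind a b ε → Kind c d δ → vecD a b ε ≡ vecD c d δ → a ≡ c × b ≡ d
    valid {a} {b} {ε} {c} {d} {δ} k l e = ≤-antisym (proj₁ back) (proj₁ forth) , ≤-antisym (proj₂ forth) (proj₂ back)
      where
      forth : c ≤ a × b ≤ d
      forth = reflectD {ε = ε} {δ = δ} (proj₁ (Kind-valid k)) (proj₂ (Kind-valid k)) (proj₁ (Kind-valid l)) (proj₂ (Kind-valid l)) (subst (vecD a b ε ≤ᵣ_) e ≤ᵣ-refl)
      back : a ≤ c × d ≤ b
      back = reflectD {ε = δ} {δ = ε} (proj₁ (Kind-valid l)) (proj₂ (Kind-valid l)) (proj₁ (Kind-valid k)) (proj₂ (Kind-valid k)) (subst (_≤ᵣ vecD a b ε) e ≤ᵣ-refl)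

    forkD : ℕ → Root r
    forkD i = ind i u ⊕ ind r r

    minuses pluses uppers : List (Root r)
    minuses = map minusRoot (pairs r)
    pluses = map plusD (pairs m)
    uppers = map forkD [ 1 ⋯ m ]

    kind∈ : ∀ {a b ε} → Kind a b ε → vecD a b ε ∈ Φ⁺ D r
    kind∈ (minus {a} a<b b<r) = ∈-++⁺ˡ (∈-++⁺ˡ (subst (_∈ minuses) (sym (fold-short a (<⇒≤ b<r))) (∈-map⁺ minusRoot (pairs⁺ {r} a<b b<r))))
    kind∈ (plus {a} {c} a<c c≤u) = ∈-++⁺ˡ (∈-++⁺ʳ minuses (∈-++⁺ˡ (subst (_∈ pluses) (plusD≡ (<⇒≤ a<c) c≤u)
      (∈-map⁺ plusD (pairs⁺ {m} a<c (≤-trans (s≤s c≤u) (≤-reflexive suc-u)))))))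
    kind∈ (upper {a} a<m) = ∈-++⁺ˡ (∈-++⁺ʳ minuses (∈-++⁺ʳ pluses (subst (_∈ uppers) (sym (vecD-fork a<m))
      (∈-map⁺ forkD (interval⁺ {1} {m} (s≤s z≤n) a<m)))))

    minus⁻ : ∀ {x} → x ∈ minuses → ∃ λ a → ∃ λ b → ∃ λ (l : a < b) → ∃ λ (l′ : b < r) → fold a b ≡ x
    minus⁻ x∈ with ∈-map⁻ minusRoot x∈
    ... | q , q∈ , refl with pairs⁻ {r} q∈
    ...   | a , b , refl , a<b , b<r = a , b , a<b , b<r , fold-short a (<⇒≤ b<r)

    plus⁻ : ∀ {x} → x ∈ pluses → ∃ λ a → ∃ λ c → ∃ λ (l : a < c) → ∃ λ (l′ : c ≤ u) → fold a (turn c) ≡ x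
    plus⁻ x∈ with ∈-map⁻ plusD x∈
    ... | q , q∈ , refl with pairs⁻ {m} q∈
    ...   | a , c , refl , a<c , c<m = a , c , a<c , c≤u , sym (plusD≡ (<⇒≤ a<c) c≤u)
      where
      c≤u : c ≤ u
      c≤u = s≤s⁻¹ (≤-trans c<m (≤-reflexive (sym suc-u)))

    upper⁻ : ∀ {x} → x ∈ uppers → ∃ λ a → ∃ λ (l : a < m) → vecD a m false ≡ x
    upper⁻ x∈ with ∈-map⁻ forkD x∈
    ... | i , i∈ , refl with interval⁻ {1} {m} i∈
    ...   | s≤s {n = a} _ , a<m = a , a<m , vecD-fork a<m

    kind⁻ : ∀ {x} → x ∈ Φ⁺ D r → ∃ λ a → ∃ λ b → ∃ λ ε → Kind a b ε × vecD a b ε ≡ x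
    kind⁻ x∈ with ∈-++⁻ (longRoots D r) x∈
    ... | inj₁ x∈′ with ∈-++⁻ minuses x∈′
    ...   | inj₁ p = let a , b , l , l′ , e = minus⁻ p in a , b , true , minus l l′ , e
    ...   | inj₂ q with ∈-++⁻ pluses q
    ...     | inj₁ p = let a , c , l , l′ , e = plus⁻ p in a , turn c , true , plus l l′ , e
    ...     | inj₂ p = let a , l , e = upper⁻ p in a , m , false , upper l , e

    ∈⁺ : ∀ {a b} ε → a < b → a + b ≤ N → vecD a b ε ∈ Φ⁺ D r
    ∈⁺ true a<b ab = kind∈ (kind a<b ab)
    ∈⁺ {a} {b} false a<b ab = by (b ≟ m)
      where
      by : Dec (b ≡ m) → vecD a b false ∈ Φ⁺ D r
      by (yes refl) = kind∈ (upper a<b)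
      by (no b≢m) = subst (_∈ Φ⁺ D r) (sym (vecD-plain a b≢m)) (kind∈ (kind a<b ab))

    unique : Unique (Φ⁺ D r)
    unique = Unique.++⁺ (Unique.++⁺ (unique-map minus-inj (pairs-unique r))
        (Unique.++⁺ (unique-map plus-inj (pairs-unique m)) (unique-map upper-inj (interval-unique 1 m)) plus-upper) minus-rest) [] λ ()
      where
      open import Data.List.Relation.Unary.AllPairs using ([])
      below-m : ∀ {c} → c ≤ u → m < turn c
      below-m c≤u = <-≤-trans m<r (turn-large c≤u)
      minus-inj : ∀ {x y} → x ∈ pairs r → y ∈ pairs r → minusRoot {r} x ≡ minusRoot y → x ≡ y
      minus-inj x∈ y∈ e with pairs⁻ {r} x∈ | pairs⁻ {r} y∈
      ... | a , b , refl , a<b , b<r | c , d , refl , c<d , d<r = cong₂ (λ a b → suc a , suc b) (proj₁ same) (proj₂ same)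
        where
        same : a ≡ c × b ≡ d
        same = valid (minus a<b b<r) (minus c<d d<r) (trans (fold-short a (<⇒≤ b<r)) (trans e (sym (fold-short c (<⇒≤ d<r)))))
      plus-inj : ∀ {x y} → x ∈ pairs m → y ∈ pairs m → plusD x ≡ plusD y → x ≡ y
      plus-inj x∈ y∈ e with pairs⁻ {m} x∈ | pairs⁻ {m} y∈
      ... | a , c , refl , a<c , c<m | a′ , c′ , refl , a′<c′ , c′<m = cong₂ (λ a b → suc a , suc b) (proj₁ same)
            (trans (sym (turn-turn (≤-trans c≤u (m≤m+n u r)))) (trans (cong turn (proj₂ same)) (turn-turn (≤-trans c′≤u (m≤m+n u r)))))
        where
        c≤u : c ≤ u
        c≤u = s≤s⁻¹ (≤-trans c<m (≤-reflexive (sym suc-u)))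
        c′≤u : c′ ≤ u
        c′≤u = s≤s⁻¹ (≤-trans c′<m (≤-reflexive (sym suc-u)))
        same : a ≡ a′ × turn c ≡ turn c′
        same = valid (plus a<c c≤u) (plus a′<c′ c′≤u) (trans (sym (plusD≡ (<⇒≤ a<c) c≤u)) (trans e (plusD≡ (<⇒≤ a′<c′) c′≤u)))
      upper-inj : ∀ {x y} → x ∈ [ 1 ⋯ m ] → y ∈ [ 1 ⋯ m ] → forkD x ≡ forkD y → x ≡ y
      upper-inj x∈ y∈ e with interval⁻ {1} {m} x∈ | interval⁻ {1} {m} y∈
      ... | s≤s {n = a} _ , a<m | s≤s {n = c} _ , c<m = cong suc (proj₁ same)
        where
        same : a ≡ c × m ≡ m
        same = valid (upper a<m) (upper c<m) (trans (vecD-fork a<m) (trans e (sym (vecD-fork c<m))))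
      plus-upper : ∀ {x} → ¬ (x ∈ pluses × x ∈ uppers)
      plus-upper (p , q) with plus⁻ p | upper⁻ q
      ... | a , c , a<c , c≤u , e | a′ , a′<m , e′ = <⇒≢ (below-m c≤u) (sym (proj₂ same))
        where
        same : a ≡ a′ × turn c ≡ m
        same = valid (plus a<c c≤u) (upper a′<m) (trans e (sym e′))
      minus-rest : ∀ {x} → ¬ (x ∈ minuses × x ∈ pluses ++ uppers)
      minus-rest (p , q) with minus⁻ p | ∈-++⁻ pluses q
      ... | a , b , a<b , b<r , e | inj₁ q′ with plus⁻ q′
      ...   | a′ , c , a′<c , c≤u , e′ = <⇒≱ b<r (≤-trans (turn-large c≤u) (≤-reflexive (sym (proj₂ same))))
        where
        same : a ≡ a′ × b ≡ turn c
        same = valid (minus a<b b<r) (plus a′<c c≤u) (trans e (sym e′))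
      minus-rest (p , q) | a , b , a<b , b<r , e | inj₂ q′ with upper⁻ q′
      ... | a′ , a′<m , e′ = contradiction (coloured {ε = true} {false} a<m a′<m (subst (fold a m ≤ᵣ_) (trans (subst (λ b → fold a b ≡ _) (proj₂ same) e) (sym e′)) ≤ᵣ-refl)) λ ()
        where
        same : a ≡ a′ × b ≡ m
        same = valid (minus a<b b<r) (upper a′<m) (trans e (sym e′))
        a<m : a < m
        a<m = ≤-trans (s≤s (≤-reflexive (proj₁ same))) a′<m

    roots : HalfRoots (Φ⁺ D r) N m
    roots = record
      { middle = middle
      ; ranked = record { unique = unique ; positive = positive }
      ; vec = vecD
      ; vec∈ = ∈⁺
      ; vec∈⁻ = λ x∈ → let a , b , ε , k , e = kind⁻ x∈ in half (proj₁ (Kind-valid k)) (proj₂ (Kind-valid k)) ε , e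
      ; reflect = λ {a} {b} {ε} {c} {d} {δ} → reflectD {a} {b} {ε} {c} {d} {δ}
      ; embed = embedD
      ; plain = λ {a} {b} {ε} {δ} → plainD {a} {b} {ε} {δ}
      ; rk-vec = λ ε a<b ab → height⇒rk (heightD ε a<b ab) a<b
      ; colours = inj₁ coloured
      }
      where
      positive : ∀ {x} → x ∈ Φ⁺ D r → 1 ≤ height x
      positive x∈ with kind⁻ x∈
      ... | a , b , ε , k , refl = height-positive (heightD ε (proj₁ (Kind-valid k)) (proj₂ (Kind-valid k))) (proj₁ (Kind-valid k))

-- Types B and C: involution, cardinality and root lengths

module Colourless where

  open Toggle
  open Grid
  open Models
  open FullRvac
  open HalfRvac
  open Count

  𝟙-cong : ∀ {P Q : Set} (p : Dec P) (q : Dec Q) → (P → Q) → (Q → P) → 𝟙 p ≡ 𝟙 q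
  𝟙-cong p q f g = ≤-antisym (𝟙-mono p q f) (𝟙-mono q p g)

  module _ {r} {P : List (Root r)} {N m} (roots : HalfRoots P N m)
           (colourless : ∀ {a b ε δ} → HalfRoots.vec roots a b ε ≡ HalfRoots.vec roots a b δ) where
    open HalfRoots roots
    open HalfIx
    open Half roots

    pair : HalfIx N → Interval
    pair i = start i , end i

    recolour : ∀ {a b c d ε δ} → c ≤ a → b ≤ d → vec a b ε ≤ᵣ vec c d δ
    recolour {a} {b} {c} {d} {ε} {δ} c≤a b≤d = subst (_≤ᵣ vec c d δ) colourless (embed δ c≤a b≤d)

    plain-of : ∀ {A} → IsAntichainIn model A → ∀ Q → map root Q ≡ A → Plain roots A
    plain-of {A} aA Q e = record
      { L = map pair Q
      ; shifted = AllPairs.map⁺ (AllPairs.map (λ (p , q) → incomparable⇒shifted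
          (λ (u , v) → p (recolour u v)) (λ (u , v) → q (recolour u v)))
          (AllPairs.map⁻ {f = root} {xs = Q} (subst Antichain (sym e) (IsAntichainIn.antichain aA))))
      ; proper = All.map⁺ (All.tabulate (λ {i} _ → start<end i , sum≤N i))
      ; inside⇒ = λ i b → Any.map⁺ (Any.map (λ {j} → reflect {ε = colour j} {δ = colour i} (start<end j) (sum≤N j) (start<end i) (sum≤N i))
          (Any.map⁻ {f = root} {xs = Q} (subst (λ X → Below X (root i)) (sym e) b)))
      ; inside⇐ = λ i b → subst (λ X → Below X (root i)) e (Any.map⁺ (Any.map (λ (u , v) → recolour u v) (Any.map⁻ {f = pair} {xs = Q} b)))
      }

    -- Root length becomes a property of intervals: the short roots of type B end in the middle, and
    -- the long roots of type C are central.
    countIn-pairs : ∀ (S : List (Root r)) {p : Interval → Set} (p? : Decidable p) →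
      (∀ i → root i ∈ S → p (pair i)) → (∀ i → p (pair i) → root i ∈ S) →
      ∀ Q → countIn S (map root Q) ≡ count p? (map pair Q)
    countIn-pairs S p? to from [] = refl
    countIn-pairs S p? to from (i ∷ Q) = trans (count-∷ (_∈? S) (root i) (map root Q))
      (trans (cong₂ _+_ (𝟙-cong (root i ∈? S) (p? (pair i)) (to i) (from i)) (countIn-pairs S p? to from Q))
        (sym (count-∷ p? (pair i) (map pair Q))))

    module _ {A} (aA : IsAntichainIn model A) where
      private
        Q Q′ : List (HalfIx N)
        Q = proj₁ (indices model (IsAntichainIn.⊆P aA))
        e : map root Q ≡ A
        e = proj₂ (indices model (IsAntichainIn.⊆P aA))
        pA : Plain roots A
        pA = plain-of aA Q e
        aB : IsAntichainIn model (Rvac P A)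
        aB = plain-Rvac-in roots aA pA
        Q′ = proj₁ (indices model (IsAntichainIn.⊆P aB))
        e′ : map root Q′ ≡ Rvac P A
        e′ = proj₂ (indices model (IsAntichainIn.⊆P aB))
        pB : Plain roots (Rvac P A)
        pB = plain-of aB Q′ e′

      colourless-involutive : Rvac P (Rvac P A) ≋ A
      colourless-involutive = plain-involutive roots aA pA

      colourless-size : length A + length (Rvac P A) ≡ m
      colourless-size = trans (cong₂ _+_ (lengths Q e) (lengths Q′ e′)) (proj₂ (plain-count roots aA pA pB))
        where
        lengths : ∀ Q {X} → map root Q ≡ X → length X ≡ length (map pair Q)
        lengths Q e = trans (cong length (sym e)) (trans (length-map root Q) (sym (length-map pair Q)))

      module _ (S : List (Root r)) where

        transfer : ∀ {p : Interval → Set} (p? : Decidable p) →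
          (∀ i → root i ∈ S → p (pair i)) → (∀ i → p (pair i) → root i ∈ S) →
          count p? (map pair Q) + count p? (map pair Q′) ≡ 1 → countIn S A + countIn S (Rvac P A) ≡ 1
        transfer p? to from h = trans (cong₂ _+_
          (trans (cong (countIn S) (sym e)) (countIn-pairs S p? to from Q))
          (trans (cong (countIn S) (sym e′)) (countIn-pairs S p? to from Q′))) h

        colourless-central : (∀ i → root i ∈ S → start i + end i ≡ N) → (∀ i → start i + end i ≡ N → root i ∈ S) →
                             countIn S A + countIn S (Rvac P A) ≡ 1
        colourless-central to from = transfer (central? N) to from (proj₁ (plain-count roots aA pA pB))

        colourless-middle : (∀ i → root i ∈ S → end i ≡ m) → (∀ i → end i ≡ m → root i ∈ S) →
                            countIn S A + countIn S (Rvac P A) ≡ 1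
        colourless-middle to from = transfer (middle? {N} {m} middle) to from (plain-middle roots aA pA pB)

-- Assembling the statements for one poset

module Conclude where

  open Toggle
  open Grid
  open Parabolic
  open Levels
  open Models
  open FullRvac
  open Sets
  open Count
  open Roots
  open Lists
  open Lia using (lia; con; goal; _:+_; _:≡_; _:→_)

  countIn-∷ : ∀ {r} (S : List (Root r)) x X → countIn S (x ∷ X) ≡ 𝟙 (x ∈? S) + countIn S X
  countIn-∷ S = count-∷ (_∈? S)

  countIn-++ : ∀ {r} (S X Y : List (Root r)) → countIn S (X ++ Y) ≡ countIn S X + countIn S Y
  countIn-++ S X Y = trans (cong length (filter-++ (_∈? S) X Y)) (length-++ (filter (_∈? S) X))

  simple-unique : ∀ r → Unique (simpleRoots r)
  simple-unique r = unique-map inj (interval-unique 1 r)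
    where
    inj : ∀ {x y} → x ∈ [ 1 ⋯ r ] → y ∈ [ 1 ⋯ r ] → ind {r} x x ≡ ind y y → x ≡ y
    inj x∈ y∈ e with interval⁻ {1} {r} x∈ | interval⁻ {1} {r} y∈
    ... | s≤s {n = a} _ , a<r | s≤s {n = c} _ , c<r = ≤-antisym (s≤s (proj₁ (TypeA.reflects r {c} {suc c} {a} {suc a} ≤-refl c<r (subst (_≤ᵣ ind {r} (suc a) (suc a)) e ≤ᵣ-refl))))
       (s≤s (proj₁ (TypeA.reflects r {a} {suc a} {c} {suc c} ≤-refl a<r (subst (ind {r} (suc a) (suc a) ≤ᵣ_) e ≤ᵣ-refl))))

  unique-++⇒disjoint : ∀ {r} (X : List (Root r)) {Y x} → Unique (X ++ Y) → x ∈ X → ¬ x ∈ Y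
  unique-++⇒disjoint (_ ∷ X) (x∉ ∷ u) (here refl) y∈ = All.lookup x∉ (∈-++⁺ʳ X y∈) refl
  unique-++⇒disjoint (_ ∷ X) (_ ∷ u) (there x∈) y∈ = unique-++⇒disjoint X u x∈ y∈

  countIn-split : ∀ {r} (S T : List (Root r)) {X} → Unique (S ++ T) → All (_∈ S ++ T) X → countIn S X + countIn T X ≡ length X
  countIn-split S T {[]} u [] = refl
  countIn-split S T {x ∷ X} u (x∈ ∷ X⊆) = trans (cong₂ _+_ (countIn-∷ S x X) (countIn-∷ T x X))
    (by (𝟙 (x ∈? S)) (𝟙 (x ∈? T)) (countIn S X) (countIn T X) (length X) (one (∈-++⁻ S x∈)) (countIn-split S T u X⊆))
    where
    one : x ∈ S ⊎ x ∈ T → 𝟙 (x ∈? S) + 𝟙 (x ∈? T) ≡ 1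
    one (inj₁ x∈S) = cong₂ _+_ (𝟙-yes (x ∈? S) x∈S) (𝟙-no (x ∈? T) (unique-++⇒disjoint S u x∈S))
    one (inj₂ x∈T) = cong₂ _+_ (𝟙-no (x ∈? S) (λ x∈S → unique-++⇒disjoint S u x∈S x∈T)) (𝟙-yes (x ∈? T) x∈T)
    by : ∀ a b c d l → a + b ≡ 1 → c + d ≡ l → a + c + (b + d) ≡ suc l
    by = lia 5 (λ a b c d l → a :+ b :≡ con 1 :→ c :+ d :≡ l :→ goal (a :+ c :+ (b :+ d) :≡ con 1 :+ l))

  Conclusion : ∀ {r} → List (Root r) → List (Root r) → ℕ → Set
  Conclusion {r} long short h = (A : List (Root r)) → IsAntichain P A →
        (Rvac P (Rvac P A) ≋ A)
        × (length A + length (Rvac P A) ≡ r)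
        × ((countIn long (A ++ Rvac P A) ≡ countIn long (simpleRoots r))
           × (countIn short (A ++ Rvac P A) ≡ countIn short (simpleRoots r)))
        × (∀ i → i ≤ h ∸ 1 → A ≋ level P i → Rvac P A ≋ level P (h ∸ 1 ∸ i))
        × (∀ α → α ∈ simpleRoots r → α ∈ A → Rvac P A ≋ Rvac (parabolic α P) (remove α A))
        × (∀ α → α ∈ simpleRoots r → All (_∈ parabolic α P) A → Rvac P A ≋ (α ∷ Rvac (parabolic α P) A))
    where
    P : List (Root r)
    P = long ++ short

  module _ {r} (long short : List (Root r)) (model : Model (long ++ short))
           (lower : ∀ i → 1 ≤ Model.ρ model i → ∃ λ j → Model._⋖_ model j i)
           (N : ℕ) (1≤N : 1 ≤ N)
           (upper : ∀ i → suc (Model.ρ model i) < N → ∃ λ j → Model._⋖_ model i j)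
           (low : ∀ i → suc (Model.ρ model i) ≤ N) (top : Model.Ix model) (top-rank : suc (Model.ρ model top) ≡ N)
           (simple⇒ : ∀ {a} → a < r → ∃ λ i → Model.root model i ≡ ind (suc a) (suc a) × Model.ρ model i ≡ 0)
           (⇒simple : ∀ i → Model.ρ model i ≡ 0 → Model.root model i ∈ simpleRoots r)
           (involutive : ∀ {A} → IsAntichainIn model A → Rvac (long ++ short) (Rvac (long ++ short) A) ≋ A)
           (size : ∀ {A} → IsAntichainIn model A → length A + length (Rvac (long ++ short) A) ≡ r)
           (k : ℕ) (constant : (∀ {A} → IsAntichainIn model A → countIn long A + countIn long (Rvac (long ++ short) A) ≡ k)
                             ⊎ (∀ {A} → IsAntichainIn model A → countIn short A + countIn short (Rvac (long ++ short) A) ≡ k))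
           (h : ℕ) (h≡ : h ∸ 1 ≡ N) where
    private
      P : List (Root r)
      P = long ++ short
    open Model model

    rank≡ : suc (rank P) ≡ N
    rank≡ = ≤-antisym (≤-trans (s≤s (rank-≤ bound)) (≤-reflexive (m+[n∸m]≡n 1≤N)))
      (≤-trans (≤-reflexive (sym top-rank)) (s≤s (rk≤rank (root∈ top))))
      where
      bound : ∀ {x} → x ∈ P → rk x ≤ N ∸ 1
      bound x∈ with index x∈
      ... | i , refl = ∸-monoˡ-≤ 1 (low i)

    simple∈P : ∀ {α} → α ∈ simpleRoots r → α ∈ P × rk α ≡ 0
    simple∈P α∈ with simple∈⁻ α∈
    ... | a , a<r , refl = let i , e , z = simple⇒ a<r in subst (λ α → α ∈ P × rk α ≡ 0) e (root∈ i , z)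

    lowest≋simple : level P 0 ≋ simpleRoots r
    lowest≋simple x = to , λ x∈ → level-∈⁺ (proj₁ (simple∈P x∈)) (proj₂ (simple∈P x∈))
      where
      to : x ∈ level P 0 → x ∈ simpleRoots r
      to x∈ with level-∈⁻ x∈
      ... | x∈P , z with index x∈P
      ...   | i , refl = ⇒simple i z

    antichain-in : ∀ {A} → IsAntichain P A → IsAntichainIn model A
    antichain-in (A⊆ , a) = record { antichain = a ; ⊆P = A⊆ }

    Rvac-at-level : ∀ {A} → IsAntichain P A → ∀ i → i ≤ N → A ≋ level P i → Rvac P A ≋ level P (N ∸ i)
    Rvac-at-level {A} (A⊆ , a) i i≤N e = subst (λ n → Rvac P A ≋ level P (n ∸ i)) rank≡
      (Rvac-level model lower (λ j l → upper j (≤-trans (s≤s l) (≤-reflexive rank≡))) i (≤-trans i≤N (≤-reflexive (sym rank≡))) a A⊆ e)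

    -- The empty antichain is the level N = h - 1, just beyond the top, and part (iii) exchanges it
    -- with level 0.
    Rvac-[] : Rvac P [] ≋ simpleRoots r
    Rvac-[] = ≋-trans {X = Rvac P []} {level P 0} (subst (λ n → Rvac P [] ≋ level P n) (n∸n≡0 N)
      (Rvac-at-level ([] , []) N ≤-refl (subst ([] ≋_) (sym (level-empty {P = P} (≤-reflexive rank≡))) (λ _ → id , id)))) lowest≋simple

    private
      empty : IsAntichainIn model []
      empty = antichain-in ([] , [])

    Rvac-valid′ : ∀ {A} → IsAntichainIn model A → Antichain (Rvac P A) × All (_∈ P) (Rvac P A)
    Rvac-valid′ aA = let v = Rvac-valid ranked (IsAntichainIn.antichain aA) (IsAntichainIn.⊆P aA) in v

    countIn-Rvac-[] : ∀ S → countIn S (Rvac P []) ≡ countIn S (simpleRoots r)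
    countIn-Rvac-[] S = countIn-≋ S (antichain⇒unique (proj₁ (Rvac-valid′ empty))) (simple-unique r) Rvac-[]

    split : ∀ {A} → IsAntichainIn model A → countIn long (A ++ Rvac P A) + countIn short (A ++ Rvac P A) ≡ r
    split {A} aA = trans (countIn-split long short unique (All.++⁺ (IsAntichainIn.⊆P aA) (proj₂ (Rvac-valid′ aA))))
      (trans (length-++ A) (size aA))

    -- Long and short roots together always number r, so constancy of one count entails that of the
    -- other; evaluation at the empty antichain identifies the constants. In types A and D the count
    -- of short roots is constantly 0.
    same-counts : ∀ {A} → IsAntichainIn model A →
      countIn long (A ++ Rvac P A) ≡ countIn long (Rvac P []) × countIn short (A ++ Rvac P A) ≡ countIn short (Rvac P [])
    same-counts {A} aA = by constant
      where
      by : (∀ {A} → IsAntichainIn model A → countIn long A + countIn long (Rvac P A) ≡ k)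
         ⊎ (∀ {A} → IsAntichainIn model A → countIn short A + countIn short (Rvac P A) ≡ k) →
         countIn long (A ++ Rvac P A) ≡ countIn long (Rvac P []) × countIn short (A ++ Rvac P A) ≡ countIn short (Rvac P [])
      by (inj₁ c) = e , +-cancelˡ-≡ (countIn long (A ++ Rvac P A)) _ _ (trans (split aA) (trans (sym (split empty)) (cong (_+ countIn short (Rvac P [])) (sym e))))
        where
        e : countIn long (A ++ Rvac P A) ≡ countIn long (Rvac P [])
        e = trans (countIn-++ long A (Rvac P A)) (trans (c aA) (sym (c empty)))
      by (inj₂ c) = +-cancelʳ-≡ (countIn short (A ++ Rvac P A)) _ _ (trans (split aA) (trans (sym (split empty)) (cong (countIn long (Rvac P []) +_) (sym e)))) , e
        where
        e : countIn short (A ++ Rvac P A) ≡ countIn short (Rvac P [])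
        e = trans (countIn-++ short A (Rvac P A)) (trans (c aA) (sym (c empty)))

    conclusion : Conclusion long short h
    conclusion A aA =
      involutive (antichain-in aA) ,
      size (antichain-in aA) ,
      (trans (proj₁ (same-counts (antichain-in aA))) (countIn-Rvac-[] long) ,
       trans (proj₂ (same-counts (antichain-in aA))) (countIn-Rvac-[] short)) ,
      subst (λ n → ∀ i → i ≤ n → A ≋ level P i → Rvac P A ≋ level P (n ∸ i)) (sym h≡) (Rvac-at-level aA) ,
      (λ α α∈ → Rvac-containing ranked (proj₁ (simple∈P α∈)) (proj₂ (simple∈P α∈)) model (proj₂ aA) (proj₁ aA)) ,
      (λ α α∈ → Rvac-avoiding ranked (proj₁ (simple∈P α∈)) (proj₂ (simple∈P α∈)) (proj₂ aA))

-- The four types and the theorem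

open import Defs using (A; B; C; D)
open Toggle
open Grid
open Models
open FullRvac
open DMain
open Colourless
open Conclude
open Coeff
open Roots
open Lia using (lia; con; goal; _:+_; _:≤_; _:<_; _:≡_; _:→_)

half-sum : ∀ a m N → suc N ≡ m + m → a + suc a ≤ N → suc a ≤ m
half-sum = lia 3 (λ a m N → con 1 :+ N :≡ m :+ m :→ a :+ (con 1 :+ a) :≤ N :→ goal (con 1 :+ a :≤ m))

half-sum⁻ : ∀ a m N → suc N ≡ m + m → a < m → a + suc a ≤ N
half-sum⁻ = lia 3 (λ a m N → con 1 :+ N :≡ m :+ m :→ a :< m :→ goal (a :+ (con 1 :+ a) :≤ N))

no-short : ∀ {r} (X Y : List (Root r)) → countIn [] X + countIn [] Y ≡ 0
no-short X Y = cong₂ _+_ (none X) (none Y)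
  where
  none : ∀ X → countIn [] X ≡ 0
  none X = cong length (filter-none (_∈? []) {X} (All.tabulate (λ _ ())))

module HalfShape {r} (long short : List (Root r)) {N m} (roots : HalfRoots (long ++ short) N m) where
  open HalfRoots roots
  open HalfIx
  open Half roots
  open Model model using (ρ)

  1≤N : 2 ≤ m → 1 ≤ N
  1≤N 2≤m = s≤s⁻¹ (≤-trans 2≤m (≤-trans (m≤m+n m m) (≤-reflexive (sym middle))))

  low : ∀ i → suc (ρ i) ≤ N
  low i = ≤-trans (s≤s (m≤m+n (ρ i) (start i))) (≤-trans (≤-reflexive (rank-at i)) (≤-trans (m≤n+m (end i) (start i)) (sum≤N i)))

  module _ (2≤m : 2 ≤ m) where

    top : HalfIx N
    top = half (1≤N 2≤m) ≤-refl true

    top-rank : suc (ρ top) ≡ N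
    top-rank = trans (cong suc (sym (+-identityʳ (ρ top)))) (rank-at top)

  rank-zero : ∀ {a ε} (ok : a + suc a ≤ N) → ρ (half ≤-refl ok ε) ≡ 0
  rank-zero {a} {ε} ok = +-cancelʳ-≡ a _ 0 (suc-injective (rank-at (half ≤-refl ok ε)))

  shortest : ∀ i → ρ i ≡ 0 → suc (start i) ≡ end i
  shortest i z = trans (cong (λ ρ → suc (ρ + start i)) (sym z)) (rank-at i)

  short-sum : ∀ i → suc (start i) ≡ end i → suc (start i) ≤ m
  short-sum i e = half-sum (start i) m N middle (subst (λ b → start i + b ≤ N) (sym e) (sum≤N i))

  conclude : 2 ≤ m →
    (∀ {a} → a < r → ∃ λ i → root i ≡ ind (suc a) (suc a) × ρ i ≡ 0) → (∀ i → ρ i ≡ 0 → root i ∈ simpleRoots r) →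
    (∀ {A} → IsAntichainIn model A → Rvac (long ++ short) (Rvac (long ++ short) A) ≋ A) →
    (∀ {A} → IsAntichainIn model A → length A + length (Rvac (long ++ short) A) ≡ r) →
    (k : ℕ) → (∀ {A} → IsAntichainIn model A → countIn long A + countIn long (Rvac (long ++ short) A) ≡ k)
            ⊎ (∀ {A} → IsAntichainIn model A → countIn short A + countIn short (Rvac (long ++ short) A) ≡ k) →
    (h : ℕ) → h ∸ 1 ≡ N → Conclusion long short h
  conclude 2≤m s⇒ ⇒s inv size k c h h≡ = conclusion long short model lower N (1≤N 2≤m) upper low (top 2≤m) (top-rank 2≤m) s⇒ ⇒s inv size k c h h≡

module A-case (r : ℕ) (1≤r : 1 ≤ r) where
  open TypeA r
  open Full roots
  open FullIx
  open Model model using (ρ)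

  ρ-zero : ∀ i → suc (start i) ≡ end i → ρ i ≡ 0
  ρ-zero i e = +-cancelʳ-≡ (start i) (ρ i) 0 (suc-injective (trans (rank-at i) (sym e)))

  low : ∀ i → suc (ρ i) ≤ r
  low i = ≤-trans (s≤s (m≤m+n (ρ i) (start i))) (≤-trans (≤-reflexive (rank-at i)) (end≤N i))

  top-rank : suc (ρ (full 1≤r ≤-refl)) ≡ r
  top-rank = trans (cong suc (sym (+-identityʳ _))) (rank-at (full 1≤r ≤-refl))

  ⇒simple : ∀ i → ρ i ≡ 0 → root i ∈ simpleRoots r
  ⇒simple i z = subst (λ b → ind (suc (start i)) b ∈ simpleRoots r) e (simple∈⁺ (≤-trans (≤-reflexive e) (end≤N i)))
    where
    e : suc (start i) ≡ end i
    e = trans (cong (λ ρ → suc (ρ + start i)) (sym z)) (rank-at i)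

  result : Conclusion (longRoots A r) (shortRoots A r) (coxeter A r)
  result = conclusion (longRoots A r) (shortRoots A r) model lower r 1≤r upper low (full 1≤r ≤-refl) top-rank
    (λ a<r → full ≤-refl a<r , refl , ρ-zero (full ≤-refl a<r) refl) ⇒simple
    (full-involutive roots) (full-size roots) 0 (inj₂ (λ {X} _ → no-short X (Rvac (Φ⁺ A r) X))) (suc r) refl

module B-case (r N : ℕ) (2≤r : 2 ≤ r) (middle : suc N ≡ r + r) where
  open TypeB r N middle
  open Folded r r ≤-refl
  open Half roots
  open HalfIx
  open HalfShape (longRoots B r) (shortRoots B r) roots
  open Model model using (ρ)

  ⇒simple : ∀ i → ρ i ≡ 0 → root i ∈ simpleRoots r
  ⇒simple i z = subst (λ b → fold (start i) b ∈ simpleRoots r) (shortest i z)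
    (subst (_∈ simpleRoots r) (sym (fold-short (start i) a<r)) (simple∈⁺ a<r))
    where
    a<r : start i < r
    a<r = short-sum i (shortest i z)

  short⇒ : ∀ i → root i ∈ shortRoots B r → end i ≡ r
  short⇒ i x∈ with short∈⁻ x∈
  ... | c , c<r , e = sym (proj₂ (inj (proj₁ (Kind-valid (short c<r))) (proj₂ (Kind-valid (short c<r))) (start<end i) (sum≤N i) e))

  short⇐ : ∀ i → end i ≡ r → root i ∈ shortRoots B r
  short⇐ i e = subst (λ b → fold (start i) b ∈ shortRoots B r) (sym e) (short∈ (<-≤-trans (start<end i) (≤-reflexive e)))

  result : (h : ℕ) → h ∸ 1 ≡ N → Conclusion (longRoots B r) (shortRoots B r) h
  result = conclude 2≤r
    (λ {a} a<r → half ≤-refl (half-sum⁻ a r N middle a<r) true , fold-short a a<r , rank-zero {a} {true} (half-sum⁻ a r N middle a<r)) ⇒simple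
    (colourless-involutive roots refl) (colourless-size roots refl) 1
    (inj₂ (λ aA → colourless-middle roots refl aA (shortRoots B r) short⇒ short⇐))

module C-case (r N : ℕ) (2≤r : 2 ≤ r) (middle : suc N ≡ r + r) where
  private
    1≤r : 1 ≤ r
    1≤r = <⇒≤ 2≤r
  open TypeC r N 1≤r middle
  open Folded r (r ∸ 1) (m∸n≤m r 1)
  open Half roots
  open HalfIx
  open HalfShape (longRoots C r) (shortRoots C r) roots
  open Model model using (ρ)

  ⇒simple : ∀ i → ρ i ≡ 0 → root i ∈ simpleRoots r
  ⇒simple i z = subst (λ b → fold (start i) b ∈ simpleRoots r) (shortest i z)
    (subst (_∈ simpleRoots r) (sym (fold-short (start i) a<r)) (simple∈⁺ a<r))
    where
    a<r : start i < r
    a<r = short-sum i (shortest i z)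

  long⇒ : ∀ i → root i ∈ longRoots C r → start i + end i ≡ N
  long⇒ i x∈ with long∈⁻ x∈
  ... | c , c≤u , e = trans (cong₂ _+_ (sym (proj₁ same)) (sym (proj₂ same))) (trans (+-comm c (turn c)) (turn-sum c≤u))
    where
    same : c ≡ start i × turn c ≡ end i
    same = inj (proj₁ (Kind-valid (long c≤u))) (proj₂ (Kind-valid (long c≤u))) (start<end i) (sum≤N i) e

  long⇐ : ∀ i → start i + end i ≡ N → root i ∈ longRoots C r
  long⇐ i e = subst (λ b → fold (start i) b ∈ longRoots C r)
    (+-cancelʳ-≡ (start i) _ _ (trans (turn-sum a≤u) (trans (sym e) (+-comm (start i) (end i))))) (long∈ a≤u)
    where
    below : ∀ a b r N → a < b → a + b ≡ N → suc N ≡ r + r → suc a ≤ r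
    below = lia 4 (λ a b r N → a :< b :→ a :+ b :≡ N :→ con 1 :+ N :≡ r :+ r :→ goal (con 1 :+ a :≤ r))
    a≤u : start i ≤ r ∸ 1
    a≤u = ∸-monoˡ-≤ 1 (below (start i) (end i) r N (start<end i) e middle)

  result : (h : ℕ) → h ∸ 1 ≡ N → Conclusion (longRoots C r) (shortRoots C r) h
  result = conclude 2≤r
    (λ {a} a<r → half ≤-refl (half-sum⁻ a r N middle a<r) true , fold-short a a<r , rank-zero {a} {true} (half-sum⁻ a r N middle a<r)) ⇒simple
    (colourless-involutive roots refl) (colourless-size roots refl) 1
    (inj₁ (λ aA → colourless-central roots refl aA (longRoots C r) long⇒ long⇐))

module D-case (r N : ℕ) (4≤r : 4 ≤ r) (middle : suc N ≡ (r ∸ 1) + (r ∸ 1)) where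
  private
    2≤r : 2 ≤ r
    2≤r = ≤-trans (s≤s (s≤s z≤n)) 4≤r
    m : ℕ
    m = r ∸ 1
    suc-m : suc m ≡ r
    suc-m = m+[n∸m]≡n (<⇒≤ 2≤r)
    m≤r : m ≤ r
    m≤r = m∸n≤m r 1
    suc-u : suc (r ∸ 2) ≡ m
    suc-u = suc-injective (trans (m+[n∸m]≡n 2≤r) (sym suc-m))
  open TypeD r N 2≤r middle
  open Folded r (r ∸ 2) (m∸n≤m r 2)
  open Half roots
  open HalfIx
  open HalfShape (longRoots D r) (shortRoots D r) roots
  open Model model using (ρ)

  -- For a = m - 1 the first summand of `fork a` is the empty interval, which leaves the last simple
  -- root α_r.
  fork-end : ∀ {a} → suc a ≡ m → vecD a m false ≡ ind (suc m) (suc m)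
  fork-end {a} e = trans (vecD-fork (≤-reflexive e)) (trans (cong (_⊕ ind r r) (cong (λ k → ind k (r ∸ 2)) (trans e (sym suc-u))))
    (trans (0⊕ (r ∸ 2) (ind r r)) (cong₂ ind (sym suc-m) (sym suc-m))))

  simple⇒ : ∀ {a} → a < r → ∃ λ i → root i ≡ ind (suc a) (suc a) × ρ i ≡ 0
  simple⇒ {a} a<r = by (m≤n⇒m<n∨m≡n (s≤s⁻¹ (≤-trans a<r (≤-reflexive (sym suc-m)))))
    where
    by : a < m ⊎ a ≡ m → ∃ λ i → root i ≡ ind (suc a) (suc a) × ρ i ≡ 0
    by (inj₁ a<m) = half ≤-refl (half-sum⁻ a m N middle a<m) true , fold-short a (≤-trans a<m m≤r) , rank-zero {a} {true} (half-sum⁻ a m N middle a<m)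
    by (inj₂ e) = half ≤-refl ok false , trans (cong (λ b → vecD (r ∸ 2) b false) suc-u) (trans (fork-end suc-u) (cong (λ k → ind (suc k) (suc k)) (sym e))) , rank-zero {r ∸ 2} {false} ok
      where
      ok : r ∸ 2 + suc (r ∸ 2) ≤ N
      ok = half-sum⁻ (r ∸ 2) m N middle (≤-reflexive suc-u)

  vec-simple : ∀ {a} ε → suc a ≤ m → vecD a (suc a) ε ∈ simpleRoots r
  vec-simple {a} true a<m = subst (_∈ simpleRoots r) (sym (fold-short a (≤-trans a<m m≤r))) (simple∈⁺ (≤-trans a<m m≤r))
  vec-simple {a} false a<m = by (suc a ≟ m)
    where
    by : Dec (suc a ≡ m) → vecD a (suc a) false ∈ simpleRoots r
    by (no ≢m) = subst (_∈ simpleRoots r) (sym (vecD-plain a ≢m)) (vec-simple true a<m)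
    by (yes e) = subst (_∈ simpleRoots r) (sym (trans (cong (λ b → vecD a b false) e) (fork-end e))) (simple∈⁺ (≤-reflexive suc-m))

  ⇒simple : ∀ i → ρ i ≡ 0 → root i ∈ simpleRoots r
  ⇒simple i z = subst (λ b → vecD (start i) b (colour i) ∈ simpleRoots r) (shortest i z)
    (vec-simple (colour i) (short-sum i (shortest i z)))

  result : (h : ℕ) → h ∸ 1 ≡ N → Conclusion (longRoots D r) (shortRoots D r) h
  result = conclude (s≤s⁻¹ (≤-trans (s≤s (s≤s (s≤s z≤n))) (≤-trans 4≤r (≤-reflexive (sym suc-m))))) simple⇒ ⇒simple
    (forked-involutive roots coloured) (λ aA → trans (forked-size roots coloured aA) suc-m) 0
    (inj₂ (λ {X} _ → no-short X (Rvac (Φ⁺ D r) X)))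

double-middle : ∀ r → 2 ≤ r → suc (2 * r ∸ 1) ≡ r + r
double-middle r 2≤r = trans (m+[n∸m]≡n (≤-trans (<⇒≤ 2≤r) (m≤m+n r (r + 0)))) (cong (r +_) (+-identityʳ r))

fork-middle : ∀ r → 4 ≤ r → suc (2 * r ∸ 2 ∸ 1) ≡ (r ∸ 1) + (r ∸ 1)
fork-middle (suc zero) (s≤s ())
fork-middle (suc (suc r)) _ rewrite +-identityʳ r | +-suc r (suc r) | +-suc r r = refl

theorem1p4 : (t : ClassicalType) (r : ℕ) → minRank t ≤ r →
    (A : List (Root r)) → IsAntichain (Φ⁺ t r) A →
      (Rvac (Φ⁺ t r) (Rvac (Φ⁺ t r) A) ≋ A)
      × (length A + length (Rvac (Φ⁺ t r) A) ≡ r)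
      × ((countIn (longRoots t r) (A ++ Rvac (Φ⁺ t r) A)
            ≡ countIn (longRoots t r) (simpleRoots r))
         × (countIn (shortRoots t r) (A ++ Rvac (Φ⁺ t r) A)
            ≡ countIn (shortRoots t r) (simpleRoots r)))
      × (∀ i → i ≤ coxeter t r ∸ 1 → A ≋ level (Φ⁺ t r) i →
           Rvac (Φ⁺ t r) A ≋ level (Φ⁺ t r) (coxeter t r ∸ 1 ∸ i))
      × (∀ α → α ∈ simpleRoots r → α ∈ A →
           Rvac (Φ⁺ t r) A ≋ Rvac (parabolic α (Φ⁺ t r)) (remove α A))
      × (∀ α → α ∈ simpleRoots r → All (_∈ parabolic α (Φ⁺ t r)) A →
           Rvac (Φ⁺ t r) A ≋ (α ∷ Rvac (parabolic α (Φ⁺ t r)) A))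
theorem1p4 A r 1≤r = A-case.result r 1≤r
theorem1p4 B r 2≤r = B-case.result r (coxeter B r ∸ 1) 2≤r (double-middle r 2≤r) (coxeter B r) refl
theorem1p4 C r 2≤r = C-case.result r (coxeter C r ∸ 1) 2≤r (double-middle r 2≤r) (coxeter C r) refl
theorem1p4 D r 4≤r = D-case.result r (coxeter D r ∸ 1) 4≤r (fork-middle r 4≤r) (coxeter D r) refl
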